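{- Let $p$ be an odd prime, and let $n>0$ and $r$ be integers with $p-1\nmid n$ and $p\nmid r$. Then for every $b\in\{1,\ldots,\mathrm{ord}_p(pn)\}$, $$\frac{(-r)^nF_p(pn,r)+(-1)^{(b-1)n}\prod_{1\le k\le b'n_*,\ p\nmid k}k}{n_*!}\equiv n_*(pB_{\varphi(p^b)}-p+1)-p^bn_*H_{n_*}+n(r^{p-1}-1)-pn\sum_{1<k<p-n_*}\binom{n_*+k}{n_*}\frac{B_k}{kr^k}\pmod{p^{b+1}},$$ where $b'=(p^b-1)/(p-1)$.
   Context: $C_p(n,r)=\sum_{k\equiv r\,(\mathrm{mod}\ p)}\binom nk(-1)^k$ and $F_p(n,r)=(-p)^{ -\lfloor (n-1)/(p-1)\rfloor}C_p(n,r)+[\![n=0]\!]$ for $n\in\mathbb{N}$, $r\in\mathbb{Z}$. $n_*$ is the smallest positive residue of $n$ modulo $p-1$. $H_r=\sum_{0<k\le r}1/k$. $B_k$ are Bernoulli numbers ($x/(e^x-1)=\sum_kB_kx^k/k!$), $\varphi$ is Euler's totient function, and $\mathrm{ord}_p$ is the $p$-adic order. Congruences between rationals modulo $p^{b+1}$ mean the difference divided by $p^{b+1}$ is a $p$-adic integer. -}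

module Defs where

open import Data.Nat as ℕ using (ℕ; zero; suc; _∸_)
open import Data.Nat.Divisibility as ℕD using (_∣?_; divides)
open import Data.Nat.Combinatorics using (_C_)
open import Data.Nat using (_!)
open import Data.Nat.GCD using (gcd)
open import Data.Nat.DivMod using (_/_; _%_)
open import Data.Integer as ℤ using (ℤ; +_; -[1+_]; ∣_∣)
open import Data.Rational as ℚ using (ℚ; mkℚ; 0ℚ; 1ℚ; 1/_)
open ℚ.ℚ using (denominatorℕ)
open import Data.Bool using (if_then_else_)
open import Relation.Nullary using (¬_; Dec; yes; no; does)

-- Total natural division / remainder (divisor 0 gives 0 / m); only used with nonzero divisors
divT : ℕ → ℕ → ℕ
divT m zero = 0
divT m (suc d) = m / suc d

modT : ℕ → ℕ → ℕ
modT m zero = m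
modT m (suc d) = m % suc d

ℕ→ℚ : ℕ → ℚ
ℕ→ℚ n = ℤ.+ n ℚ./ 1

ℤ→ℚ : ℤ → ℚ
ℤ→ℚ z = z ℚ./ 1

infixr 8 _^ℚ_
_^ℚ_ : ℚ → ℕ → ℚ
x ^ℚ zero = 1ℚ
x ^ℚ suc k = x ℚ.* (x ^ℚ k)

-- Total inverse (1/0 := 0); only used on nonzero arguments
inv : ℚ → ℚ
inv (mkℚ (+ zero) _ _) = 0ℚ
inv q@(mkℚ (+ suc n) _ _) = 1/ q
inv q@(mkℚ -[1+ n ] _ _) = 1/ q

sumFrom : ℕ → ℕ → (ℕ → ℚ) → ℚ
sumFrom a zero f = 0ℚ
sumFrom a (suc m) f = f a ℚ.+ sumFrom (suc a) m f

sumRange : ℕ → ℕ → (ℕ → ℚ) → ℚ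
sumRange a b f = sumFrom a (suc b ∸ a) f

prodUpTo : ℕ → (ℕ → ℕ) → ℕ
prodUpTo zero g = 1
prodUpTo (suc m) g = prodUpTo m g ℕ.* g (suc m)

Cp : ℕ → ℕ → ℤ → ℚ
Cp p n r = sumRange 0 n (λ k →
  if does (p ∣? ∣ + k ℤ.- r ∣)
  then ℕ→ℚ (n C k) ℚ.* ((ℚ.- 1ℚ) ^ℚ k)
  else 0ℚ)

-- F_p(n,r) = (-p)^{-⌊(n-1)/(p-1)⌋} C_p(n,r) + [n=0]   (for p ≥ 3)
-- For n = 0 the exponent ⌊-1/(p-1)⌋ equals -1.
Fp : ℕ → ℕ → ℤ → ℚ
Fp p zero r = (ℚ.- ℕ→ℚ p) ℚ.* Cp p zero r ℚ.+ 1ℚ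
Fp p (suc m) r = inv ((ℚ.- ℕ→ℚ p) ^ℚ divT m (p ∸ 1)) ℚ.* Cp p (suc m) r

nStar : ℕ → ℕ → ℕ
nStar p n with modT n (p ∸ 1)
... | zero = p ∸ 1
... | suc k = suc k

ordAux : ℕ → ℕ → ℕ → ℕ
ordAux zero p m = 0
ordAux (suc f) p m with p ∣? m
... | yes (divides q _) = suc (ordAux f p q)
... | no _ = 0

-- ord_p(m) for m > 0 and p ≥ 2
ord : ℕ → ℕ → ℕ
ord p m = ordAux m p m

φ : ℕ → ℕ
φ m = count m
  where
  count : ℕ → ℕ
  count zero = 0
  count (suc k) = (if does (gcd (suc k) m ℕ.≟ 1) then 1 else 0) ℕ.+ count k

H : ℕ → ℚ
H r = sumRange 1 r (λ k → inv (ℕ→ℚ k))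

-- Bernoulli numbers (x/(e^x-1) convention, B₁ = -1/2) via
-- B₀ = 1,  Σ_{j=0}^{m} binom(m+1,j) B_j = 0  for m ≥ 1.
-- bernList m = B_m ∷ B_{m-1} ∷ ... ∷ B_0
open import Data.List using (List; []; _∷_; length)

lookupRev : List ℚ → ℕ → ℚ
lookupRev xs j = go xs (length xs ∸ suc j)
  where
  go : List ℚ → ℕ → ℚ
  go [] _ = 0ℚ
  go (y ∷ ys) zero = y
  go (y ∷ ys) (suc i) = go ys i

bernList : ℕ → List ℚ
bernList zero = 1ℚ ∷ []
bernList (suc m) = next ∷ bs
  where
  bs : List ℚ
  bs = bernList m
  next : ℚ
  next = ℚ.- (inv (ℕ→ℚ (suc (suc m))) ℚ.*
           sumRange 0 m (λ j → ℕ→ℚ (suc (suc m) C j) ℚ.* lookupRev bs j))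

B : ℕ → ℚ
B m = lookupRev (bernList m) m

IsPAdicInt : ℕ → ℚ → Set
IsPAdicInt p x = ¬ (p ℕD.∣ denominatorℕ x)

CongModPow : ℕ → ℕ → ℚ → ℚ → Set
CongModPow p e x y = IsPAdicInt p ((x ℚ.- y) ℚ.* inv (ℕ→ℚ (p ℕ.^ e)))

prodCoprimeTo : ℕ → ℕ → ℕ
prodCoprimeTo p m = prodUpTo m (λ k → if does (p ∣? k) then 1 else k)

{-# OPTIONS --safe #-}
{-
With δ = 1 - x, x the backward shift, C_p(N, r) is δ^N applied to the indicator of pℤ.  On
p-periodic functions with sum zero δ^(p-1) acts as -p U, where U^p = 1 + p T, so the increments
of F_p(N, r) in N along multiples of p are p-adically proportional to the step.  Comparing n
with a multiple of a large power of p by means of one reference step reduces the claim to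
N = p s, s = n_*, and to N = p^B s with B large.

For these N, and modulo a high power of p, the indicator of a residue class prime to p is a
combination of powers k^(a p^K), and δ^N of a power is N! times a Stirling number, a coefficient
of 1 / ((1 - x)(1 - 2x)⋯(1 - Nx)).  Evaluated modulo p^B, this gives a product of integers
prime to p, as in the Gross–Koblitz formula; evaluated modulo p² when N = p s, it gives the
sum of the B_k / (k r^k) by Newton's identities.  Finally p B_φ(p^b) - p + 1 is congruent to 1 plus
the product of the units up to p^b, because the sum of their φ(p^b)-th powers determines the
φ(p^b)-th power of their product.
-}
module Submission where

-- The obstacle is division. At N = s + e(p-1) the Fleck quotient is C_p(N, r) over (-p)^e, and e
-- grows with N, so a congruence for C_p loses p^e of its modulus. The expansion of the residue
-- indicator therefore has a free parameter K: its modulus p^(K+1) can be raised at will, at the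
-- price of Stirling numbers with a larger first index, which the generating function treats
-- uniformly. The factor N! then supplies p^e exactly, times a unit.
--
-- Accuracy is spread unevenly. At N = p^B s the series is known modulo p^B, so B is taken large. At
-- N = ps accuracy p^2 is enough, because there a difference of quotients is multiplied by a step
-- divisible by p^(b-1). Both evaluations rest on one fact: (1 - x)...(1 - (p-1)x) is 1 - x^(p-1)
-- modulo p, so the series is close to a negative power of 1 - x^(p-1) and the exponents sort
-- themselves by their class modulo p - 1.
--
-- Oddness of p enters through p | p(p-1)/2, which removes second-order terms, and through the
-- evenness of p - 1, which removes signs.

-- Binomial coefficients, congruences with explicit quotients, and truncated binomial expansions in
-- a commutative ring.

module GenericAlgebra where

  open import Algebra.Bundles using (CommutativeRing)
  open import Algebra.Solver.Ring.AlmostCommutativeRing using (_-Raw-AlmostCommutative⟶_; fromCommutativeRing)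
  import Algebra.Solver.Ring as RS
  import Algebra.Properties.CommutativeSemiring.Exp as Exp
  import Relation.Binary.Reasoning.Setoid as SetoidReasoning
  open import Data.Nat as ℕ using (ℕ; zero; suc)
  import Data.Nat.Properties as ℕP
  open import Data.Integer as ℤ using (ℤ; +_)
  import Data.Integer.Properties as ℤP
  import Level
  open import Data.Maybe using (Maybe; just; nothing)
  open import Data.Product using (_,_; ∃)
  open import Data.Sum using (inj₁; inj₂)
  open import Relation.Nullary using (yes; no)
  open import Relation.Binary.PropositionalEquality as ≡ using (_≡_; _≢_)
  open import Data.Nat.Primality using (Prime; euclidsLemma)
  open import Data.Nat.Divisibility using (_∣_; divides; ∣⇒≤)
  open import Data.Nat.Combinatorics using (_C_; nCk≡nC[n∸k]; nCn≡1; nCk+nC[k+1]≡[n+1]C[k+1]; k>n⇒nCk≡0)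
  import Data.Nat.Solver as NatSolver
  open import Data.Empty using (⊥-elim)
  module NS = NatSolver.+-*-Solver
  open import Data.Nat.Tactic.RingSolver public using () renaming (solve-∀ to ℕ-solve-∀)

  ℤsum : ℕ → (ℕ → ℤ) → ℤ
  ℤsum zero f = + 0
  ℤsum (suc n) f = ℤsum n f ℤ.+ f n

  -- The number n(n-1)/2, in the recursive form in which it arises both as the second-order
  -- coefficient of (1 + z)^n and as 0 + 1 + ... + (n-1).
  tri : ℕ → ℕ
  tri zero = 0
  tri (suc n) = n ℕ.+ tri n

  -- Pascal's rule as a definition, convenient for induction; `bin≡C` returns to the coefficients of
  -- the theorem.
  bin : ℕ → ℕ → ℕ
  bin n zero = 1
  bin zero (suc k) = 0
  bin (suc n) (suc k) = bin n k ℕ.+ bin n (suc k)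

  bin-0 : ∀ n → bin n 0 ≡ 1
  bin-0 zero = ≡.refl
  bin-0 (suc n) = ≡.refl

  bin-> : ∀ n k → n ℕ.< k → bin n k ≡ 0
  bin-> zero (suc k) _ = ≡.refl
  bin-> (suc n) (suc k) (ℕ.s≤s n<k) = ≡.cong₂ ℕ._+_ (bin-> n k n<k) (bin-> n (suc k) (ℕP.m<n⇒m<1+n n<k))

  bin-n : ∀ n → bin n n ≡ 1
  bin-n zero = ≡.refl
  bin-n (suc n) = ≡.cong₂ ℕ._+_ (bin-n n) (bin-> n (suc n) ℕP.≤-refl)

  bin-absorb : ∀ n k → suc k ℕ.* bin (suc n) (suc k) ≡ suc n ℕ.* bin n k
  bin-absorb zero zero = ≡.refl
  bin-absorb zero (suc k) = ℕP.*-zeroʳ (suc (suc k))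
  bin-absorb (suc n) zero = ≡.trans (ℕP.+-identityʳ _) (≡.cong suc (≡.trans (≡.trans (≡.sym (ℕP.+-identityʳ _)) (bin-absorb n 0)) ((≡.cong (suc n ℕ.*_) (bin-0 n)))))
  bin-absorb (suc n) (suc k) = begin
    suc (suc k) ℕ.* (a ℕ.+ b)  ≡⟨ NS.solve 3 (λ K a b → (NS.con 2 :+ K) :* (a :+ b) := (NS.con 1 :+ K) :* a :+ ((NS.con 2 :+ K) :* b :+ a)) ≡.refl k a b ⟩
    suc k ℕ.* a ℕ.+ (suc (suc k) ℕ.* b ℕ.+ a) ≡⟨ ≡.cong₂ (λ u v → u ℕ.+ (v ℕ.+ a)) (bin-absorb n k) (bin-absorb n (suc k)) ⟩
    suc n ℕ.* bin n k ℕ.+ (suc n ℕ.* bin n (suc k) ℕ.+ a) ≡⟨ NS.solve 3 (λ N x y → (NS.con 1 :+ N) :* x :+ ((NS.con 1 :+ N) :* y :+ (x :+ y)) := (NS.con 2 :+ N) :* (x :+ y)) ≡.refl n (bin n k) (bin n (suc k)) ⟩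
    suc (suc n) ℕ.* a ∎
    where
    open ≡.≡-Reasoning
    open NS using (_:+_; _:*_; _:=_)
    a = bin (suc n) (suc k)
    b = bin (suc n) (suc (suc k))

  bin≡C : ∀ n k → bin n k ≡ n C k
  bin≡C n zero = ≡.sym (≡.trans (nCk≡nC[n∸k] {0} {n} ℕ.z≤n) (nCn≡1 n))
  bin≡C zero (suc k) = ≡.sym (k>n⇒nCk≡0 {0} {suc k} (ℕ.z<s))
  bin≡C (suc n) (suc k) = ≡.trans (≡.cong₂ ℕ._+_ (bin≡C n k) (bin≡C n (suc k))) (nCk+nC[k+1]≡[n+1]C[k+1] n k)

  -- By absorption k times the coefficient is p times another one, and p does not divide k.
  prime∣bin : ∀ {p} → Prime p → ∀ k → 0 ℕ.< k → k ℕ.< p → p ∣ bin p k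
  prime∣bin {suc p} pr (suc k) _ k<p with euclidsLemma (suc k) (bin (suc p) (suc k)) pr (divides (bin p k) (≡.trans (bin-absorb p k) (ℕP.*-comm (suc p) (bin p k))))
  ... | inj₁ p∣k = ⊥-elim (ℕP.<⇒≱ k<p (∣⇒≤ p∣k))
  ... | inj₂ p∣b = p∣b


  module Gen {c ℓ} (R : CommutativeRing c ℓ)
             (mor : CommutativeRing.rawRing ℤP.+-*-commutativeRing -Raw-AlmostCommutative⟶ fromCommutativeRing R) where
    open CommutativeRing R public
    open _-Raw-AlmostCommutative⟶_ mor public using () renaming
      (⟦_⟧ to ι; +-homo to ι+; *-homo to ι*; -‿homo to ι-; 0-homo to ι0; 1-homo to ι1)
    open Exp commutativeSemiring public

    private
      dec : ∀ a b → Maybe (ι a ≈ ι b)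
      dec a b with a ℤ.≟ b
      ... | yes a≡b = just (reflexive (≡.cong ι a≡b))
      ... | no _ = nothing
    module Sol = RS (CommutativeRing.rawRing ℤP.+-*-commutativeRing) (fromCommutativeRing R) mor dec
    open Sol public using (solve; _:=_; _:+_; _:*_; :-_; _:-_; con; _:^_)
    open SetoidReasoning setoid public

    ιℕ : ℕ → Carrier
    ιℕ n = ι (+ n)

    ι-cong : ∀ {a b} → a ≡ b → ι a ≈ ι b
    ι-cong a≡b = reflexive (≡.cong ι a≡b)

    ιℕ+ : ∀ a b → ιℕ (a ℕ.+ b) ≈ ιℕ a + ιℕ b
    ιℕ+ a b = ι+ (+ a) (+ b)

    ιℕ* : ∀ a b → ιℕ (a ℕ.* b) ≈ ιℕ a * ιℕ b
    ιℕ* a b = trans (ι-cong (ℤP.pos-* a b)) (ι* (+ a) (+ b))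

    ιℕ-suc : ∀ a → ιℕ (suc a) ≈ 1# + ιℕ a
    ιℕ-suc a = trans (ιℕ+ 1 a) (+-congʳ ι1)

    ιℕ^ : ∀ a n → ιℕ (a ℕ.^ n) ≈ ιℕ a ^ n
    ιℕ^ a zero = ι1
    ιℕ^ a (suc n) = trans (ιℕ* a (a ℕ.^ n)) (*-congˡ (ιℕ^ a n))

    infix 4 _≡_mod_
    -- The quotient is data: it can be acted on, scaled or substituted, which is how a congruence
    -- between operators becomes one between values, or one between rationals.
    record _≡_mod_ (x y m : Carrier) : Set (c Level.⊔ ℓ) where
      constructor by
      field
        quo : Carrier
        eq : x ≈ y + m * quo

    open _≡_mod_ public

    meq : ∀ {x y m} → x ≈ y → x ≡ y mod m
    meq {x} {y} {m} x≈y = by 0# (trans x≈y (trans (sym (+-identityʳ y)) (+-congˡ (sym (zeroʳ m)))))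

    mrefl : ∀ {x m} → x ≡ x mod m
    mrefl = meq refl

    msym : ∀ {x y m} → x ≡ y mod m → y ≡ x mod m
    msym {x} {y} {m} (by q e) = by (- q) (sym (trans (+-congʳ e)
      (solve 3 (λ y m q → (y :+ m :* q) :+ m :* (:- q) := y) refl y m q)))

    mtrans : ∀ {x y z m} → x ≡ y mod m → y ≡ z mod m → x ≡ z mod m
    mtrans {x} {y} {z} {m} (by q e) (by q′ e′) = by (q′ + q) (trans e (trans (+-congʳ e′)
      (solve 4 (λ z m q q′ → z :+ m :* q′ :+ m :* q := z :+ m :* (q′ :+ q)) refl z m q q′)))

    m+ : ∀ {x y x′ y′ m} → x ≡ y mod m → x′ ≡ y′ mod m → x + x′ ≡ y + y′ mod m
    m+ {x} {y} {x′} {y′} {m} (by q e) (by q′ e′) = by (q + q′) (trans (+-cong e e′)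
      (solve 5 (λ y y′ m q q′ → (y :+ m :* q) :+ (y′ :+ m :* q′) := (y :+ y′) :+ m :* (q :+ q′)) refl y y′ m q q′))

    m* : ∀ {x y x′ y′ m} → x ≡ y mod m → x′ ≡ y′ mod m → x * x′ ≡ y * y′ mod m
    m* {x} {y} {x′} {y′} {m} (by q e) (by q′ e′) = by (q * y′ + y * q′ + m * q * q′) (trans (*-cong e e′)
      (solve 5 (λ y y′ m q q′ → (y :+ m :* q) :* (y′ :+ m :* q′) := (y :* y′) :+ m :* (q :* y′ :+ y :* q′ :+ m :* q :* q′)) refl y y′ m q q′))

    mneg : ∀ {x y m} → x ≡ y mod m → - x ≡ - y mod m
    mneg {x} {y} {m} (by q e) = by (- q) (trans (-‿cong e)
      (solve 3 (λ y m q → :- (y :+ m :* q) := (:- y) :+ m :* (:- q)) refl y m q))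

    m- : ∀ {x y x′ y′ m} → x ≡ y mod m → x′ ≡ y′ mod m → x - x′ ≡ y - y′ mod m
    m- c₁ c₂ = m+ c₁ (mneg c₂)

    m*ˡ : ∀ {x y m} z → x ≡ y mod m → z * x ≡ z * y mod m
    m*ˡ z = m* mrefl

    m*ʳ : ∀ {x y m} z → x ≡ y mod m → x * z ≡ y * z mod m
    m*ʳ z c₁ = m* c₁ mrefl

    m+ˡ : ∀ {x y m} z → x ≡ y mod m → z + x ≡ z + y mod m
    m+ˡ z = m+ mrefl

    m+ʳ : ∀ {x y m} z → x ≡ y mod m → x + z ≡ y + z mod m
    m+ʳ z c₁ = m+ c₁ mrefl

    mpow : ∀ {x y m} n → x ≡ y mod m → x ^ n ≡ y ^ n mod m
    mpow zero _ = mrefl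
    mpow (suc n) c₁ = m* c₁ (mpow n c₁)

    m≈ : ∀ {x x′ y y′ m} → x ≈ x′ → y ≈ y′ → x′ ≡ y′ mod m → x ≡ y mod m
    m≈ e e′ (by q f) = by q (trans e (trans f (+-congʳ (sym e′))))

    m≈m : ∀ {x y m m′} → m ≈ m′ → x ≡ y mod m → x ≡ y mod m′
    m≈m e (by q f) = by q (trans f (+-congˡ (*-congʳ e)))

    mscale : ∀ {x y m} z → x ≡ y mod m → z * x ≡ z * y mod (z * m)
    mscale {x} {y} {m} z (by q e) = by q (trans (*-congˡ e)
      (solve 4 (λ z y m q → z :* (y :+ m :* q) := z :* y :+ (z :* m) :* q) refl z y m q))

    mdrop : ∀ {x y} m k → x ≡ y mod (m * k) → x ≡ y mod m
    mdrop m k (by q e) = by (k * q) (trans e (+-congˡ (*-assoc m k q)))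

    -- A factor that vanishes modulo w raises the modulus by w. Precision is gained this way
    -- throughout: next to a small factor a coarse congruence suffices.
    mmul : ∀ {x y m} z w → x ≡ y mod m → z ≡ 0# mod w → z * x ≡ z * y mod (w * m)
    mmul {x} {y} {m} z w (by q e) (by k f) = by (k * q) (trans (*-cong (trans f (+-identityˡ _)) e) (trans
      (solve 5 (λ w k y m q → (w :* k) :* (y :+ m :* q) := (w :* k) :* y :+ (w :* m) :* (k :* q)) refl w k y m q)
       (+-congʳ (*-congʳ (sym (trans f (+-identityˡ _)))))))

    m0* : ∀ {x m} z → x ≡ 0# mod m → z * x ≡ 0# mod m
    m0* z c₁ = mtrans (m*ˡ z c₁) (meq (zeroʳ z))

    m*0 : ∀ {x m} z → x ≡ 0# mod m → x * z ≡ 0# mod m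
    m*0 z c₁ = mtrans (m*ʳ z c₁) (meq (zeroˡ z))

    m00 : ∀ {x y m k} → x ≡ 0# mod m → y ≡ 0# mod k → x * y ≡ 0# mod (m * k)
    m00 {x} {y} {m} {k} c₁ c₂ = mtrans (mmul x m c₂ c₁) (meq (zeroʳ x))

    m+0 : ∀ {x m} z → x ≡ 0# mod m → z + x ≡ z mod m
    m+0 z x≡0 = mtrans (m+ˡ z x≡0) (meq (+-identityʳ z))

    mcoarse : ∀ {x y m n} → m ≡ 0# mod n → x ≡ y mod m → x ≡ y mod n
    mcoarse {y = y} m≡0 (by q e) = mtrans (meq e) (mtrans (m+ˡ y (m*0 q m≡0)) (meq (+-identityʳ y)))

    mdiff : ∀ {x y m} → x - y ≡ 0# mod m → x ≡ y mod m
    mdiff {x} {y} {m} (by q e) = by q (trans (solve 2 (λ x y → x := y :+ (x :- y)) refl x y) (+-congˡ (trans e (+-identityˡ _))))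

    mdiff⁻ : ∀ {x y m} → x ≡ y mod m → x - y ≡ 0# mod m
    mdiff⁻ {x} {y} {m} (by q e) = by q (trans (+-congʳ e) (trans (solve 2 (λ y z → (y :+ z) :- y := z) refl y (m * q)) (sym (+-identityˡ _))))

    module _ (m : Carrier) where
      m^-weaken : ∀ {x y} i j → i ℕ.≤ j → x ≡ y mod (m ^ j) → x ≡ y mod (m ^ i)
      m^-weaken i j i≤j c₁ = mdrop (m ^ i) (m ^ (j ℕ.∸ i))
        (m≈m (trans (^-congʳ m (≡.sym (ℕP.m+[n∸m]≡n i≤j))) (^-homo-* m i (j ℕ.∸ i))) c₁)

      m^1 : ∀ {x y} → x ≡ y mod (m ^ 1) → x ≡ y mod m
      m^1 = m≈m (*-identityʳ m)

      m^1⁻ : ∀ {x y} → x ≡ y mod m → x ≡ y mod (m ^ 1)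
      m^1⁻ = m≈m (sym (*-identityʳ m))

      m^0≤ : ∀ i j → i ℕ.≤ j → m ^ j ≡ 0# mod (m ^ i)
      m^0≤ i j i≤j = by (m ^ (j ℕ.∸ i)) (trans
        (trans (^-congʳ m (≡.sym (ℕP.m+[n∸m]≡n i≤j))) (^-homo-* m i (j ℕ.∸ i))) (sym (+-identityˡ _)))

      m^00 : ∀ {x y} i j → x ≡ 0# mod (m ^ i) → y ≡ 0# mod (m ^ j) → x * y ≡ 0# mod (m ^ (i ℕ.+ j))
      m^00 i j c₁ c₂ = m≈m (sym (^-homo-* m i j)) (m00 c₁ c₂)

      m^mul : ∀ {x y} i j z → z ≡ 0# mod (m ^ i) → x ≡ y mod (m ^ j) → z * x ≡ z * y mod (m ^ (i ℕ.+ j))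
      m^mul i j z c₁ c₂ = m≈m (sym (^-homo-* m i j)) (mmul z (m ^ i) c₂ c₁)

    sum : ℕ → (ℕ → Carrier) → Carrier
    sum zero f = 0#
    sum (suc n) f = sum n f + f n

    sum-cong : ∀ n {f g} → (∀ k → k ℕ.< n → f k ≈ g k) → sum n f ≈ sum n g
    sum-cong zero h = refl
    sum-cong (suc n) h = +-cong (sum-cong n (λ k k<n → h k (ℕP.m<n⇒m<1+n k<n))) (h n ℕP.≤-refl)

    sum-mod : ∀ n {f g m} → (∀ k → k ℕ.< n → f k ≡ g k mod m) → sum n f ≡ sum n g mod m
    sum-mod zero h = mrefl
    sum-mod (suc n) h = m+ (sum-mod n (λ k k<n → h k (ℕP.m<n⇒m<1+n k<n))) (h n ℕP.≤-refl)

    sum-0 : ∀ n {f} → (∀ k → k ℕ.< n → f k ≈ 0#) → sum n f ≈ 0#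
    sum-0 zero h = refl
    sum-0 (suc n) h = trans (+-cong (sum-0 n (λ k k<n → h k (ℕP.m<n⇒m<1+n k<n))) (h n ℕP.≤-refl)) (+-identityˡ 0#)

    sum-0m : ∀ n {f m} → (∀ k → k ℕ.< n → f k ≡ 0# mod m) → sum n f ≡ 0# mod m
    sum-0m n h = mtrans (sum-mod n h) (meq (sum-0 n (λ _ _ → refl)))

    sum-+ : ∀ n f g → sum n (λ k → f k + g k) ≈ sum n f + sum n g
    sum-+ zero f g = sym (+-identityˡ 0#)
    sum-+ (suc n) f g = trans (+-congʳ (sum-+ n f g))
      (solve 4 (λ a b c d → (a :+ b) :+ (c :+ d) := (a :+ c) :+ (b :+ d)) refl (sum n f) (sum n g) (f n) (g n))

    sum-* : ∀ n z f → sum n (λ k → z * f k) ≈ z * sum n f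
    sum-* zero z f = sym (zeroʳ z)
    sum-* (suc n) z f = trans (+-congʳ (sum-* n z f)) (sym (distribˡ z _ _))

    sum-neg : ∀ n f → sum n (λ k → - f k) ≈ - sum n f
    sum-neg zero f = trans (sym ι0) (trans (ι- (+ 0)) (-‿cong ι0))
    sum-neg (suc n) f = trans (+-congʳ (sum-neg n f)) (solve 2 (λ a b → (:- a) :+ (:- b) := :- (a :+ b)) refl _ _)

    sum-first : ∀ n f → sum (suc n) f ≈ f 0 + sum n (λ k → f (suc k))
    sum-first zero f = +-comm 0# (f 0)
    sum-first (suc n) f = trans (+-congʳ (sum-first n f)) (+-assoc _ _ _)

    sum-split : ∀ m n f → sum (m ℕ.+ n) f ≈ sum m f + sum n (λ k → f (m ℕ.+ k))
    sum-split zero n f = sym (+-identityˡ _)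
    sum-split (suc m) n f = trans (sum-first (m ℕ.+ n) f) (trans (+-congˡ (sum-split m n (λ k → f (suc k))))
      (trans (sym (+-assoc _ _ _)) (+-congʳ (sym (sum-first m f)))))

    sum-single : ∀ n f k → k ℕ.< n → (∀ i → i ℕ.< n → i ≢ k → f i ≈ 0#) → sum n f ≈ f k
    sum-single (suc n) f k k<n h with k ℕ.≟ n
    ... | yes ≡.refl = trans (+-congʳ (sum-0 n (λ i i<n → h i (ℕP.m<n⇒m<1+n i<n) (ℕP.<⇒≢ i<n)))) (+-identityˡ _)
    ... | no k≢n = trans (+-cong (sum-single n f k (ℕP.≤∧≢⇒< (ℕP.≤-pred k<n) k≢n) (λ i i<n → h i (ℕP.m<n⇒m<1+n i<n)))
                                 (h n ℕP.≤-refl (λ n≡k → k≢n (≡.sym n≡k)))) (+-identityʳ _)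

    sum-ι : ∀ n (f : ℕ → ℤ) → sum n (λ k → ι (f k)) ≈ ι (ℤsum n f)
    sum-ι zero f = sym ι0
    sum-ι (suc n) f = trans (+-congʳ (sum-ι n f)) (sym (ι+ _ _))

    -- In the solver `con (+ 1)` evaluates to the image of the integer 1, which is only provably
    -- equal to `1#`; a zeroth power evaluates to `1#` itself.
    𝟙 : ∀ {n} → Sol.Polynomial n
    𝟙 = con (+ 0) :^ 0

    1^ : ∀ n → 1# ^ n ≈ 1#
    1^ zero = refl
    1^ (suc n) = trans (*-identityˡ _) (1^ n)

    0^ : ∀ n .{{_ : ℕ.NonZero n}} → 0# ^ n ≈ 0#
    0^ (suc n) = zeroˡ _

    -- An exact identity with an unspecified cofactor w: only the factor z^2 of the remainder is
    -- ever used.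
    pow-taylor₁ : ∀ k x z → ∃ λ w → (x + z) ^ suc k ≈ x ^ suc k + ιℕ (suc k) * x ^ k * z + z * z * w
    pow-taylor₁ zero x z = 0# , trans (solve 2 (λ x z → (x :+ z) :* 𝟙 := x :* 𝟙 :+ con (+ 1) :* 𝟙 :* z :+ z :* z :* con (+ 0)) refl x z)
      (+-congˡ (*-congˡ ι0))
    pow-taylor₁ (suc k) x z with pow-taylor₁ k x z
    ... | w , e = ιℕ (suc k) * x ^ k + (x + z) * w , trans (*-congˡ e) (trans
      (solve 5 (λ x z X S w → (x :+ z) :* (x :* X :+ S :* X :* z :+ z :* z :* w) :=
                  x :* (x :* X) :+ (𝟙 :+ S) :* (x :* X) :* z :+ z :* z :* (S :* X :+ (x :+ z) :* w)) refl x z (x ^ k) (ιℕ (suc k)) w)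
      (+-congʳ (+-congˡ (*-congʳ (*-congʳ (sym (ιℕ-suc (suc k))))))))

    pow-taylor₂ : ∀ k z → ∃ λ w → (1# + z) ^ k ≈ 1# + ιℕ k * z + ιℕ (tri k) * (z * z) + z * z * z * w
    pow-taylor₂ zero z = 0# , trans (solve 1 (λ z → 𝟙 := 𝟙 :+ con (+ 0) :* z :+ con (+ 0) :* (z :* z) :+ z :* z :* z :* con (+ 0)) refl z) (+-congˡ (*-congˡ ι0))
    pow-taylor₂ (suc k) z with pow-taylor₂ k z
    ... | w , e = ιℕ (tri k) + w + z * w , trans (*-congˡ e) (trans
      (solve 4 (λ z S T w → (𝟙 :+ z) :* (𝟙 :+ S :* z :+ T :* (z :* z) :+ z :* z :* z :* w) :=
                  𝟙 :+ (𝟙 :+ S) :* z :+ (S :+ T) :* (z :* z) :+ z :* z :* z :* (T :+ w :+ z :* w)) refl z (ιℕ k) (ιℕ (tri k)) w)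
      (+-congʳ (+-cong (+-congˡ (*-congʳ (sym (ιℕ-suc k)))) (*-congʳ (sym (ιℕ+ k (tri k)))))))

    pow-taylor₂′ : ∀ k y x → ∃ λ w → (y + x) ^ suc (suc k) ≈ y ^ suc (suc k) + ιℕ (suc (suc k)) * y ^ suc k * x + ιℕ (tri (suc (suc k))) * y ^ k * (x * x) + x * x * x * w
    pow-taylor₂′ zero y x = 0# , trans (solve 2 (λ y x → (y :+ x) :* ((y :+ x) :* 𝟙) := y :* (y :* 𝟙) :+ con (+ 2) :* (y :* 𝟙) :* x :+ con (+ 1) :* 𝟙 :* (x :* x) :+ x :* x :* x :* con (+ 0)) refl y x)
      (+-congˡ (*-congˡ ι0))
    pow-taylor₂′ (suc k) y x with pow-taylor₂′ k y x
    ... | w , e = ιℕ (tri (suc (suc k))) * y ^ k + (y + x) * w , trans (*-congˡ e) (trans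
      (solve 6 (λ y x Y S T w → (y :+ x) :* (y :* (y :* Y) :+ S :* (y :* Y) :* x :+ T :* Y :* (x :* x) :+ x :* x :* x :* w) :=
          y :* (y :* (y :* Y)) :+ (𝟙 :+ S) :* (y :* (y :* Y)) :* x :+ (S :+ T) :* (y :* Y) :* (x :* x) :+ x :* x :* x :* (T :* Y :+ (y :+ x) :* w))
        refl y x (y ^ k) (ιℕ (suc (suc k))) (ιℕ (tri (suc (suc k)))) w)
      (+-congʳ (+-cong (+-congˡ (*-congʳ (*-congʳ (sym (ιℕ-suc (suc (suc k))))))) (*-congʳ (*-congʳ (sym (ιℕ+ (suc (suc k)) (tri (suc (suc k))))))))))

    sum-blocks : ∀ n m f → sum (n ℕ.* m) f ≈ sum n (λ i → sum m (λ j → f (i ℕ.* m ℕ.+ j)))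
    sum-blocks zero m f = refl
    sum-blocks (suc n) m f = trans (reflexive (≡.cong (λ k → sum k f) (ℕP.+-comm m (n ℕ.* m)))) (trans (sum-split (n ℕ.* m) m f) (+-congʳ (sum-blocks n m f)))

    sum-const : ∀ n z → sum n (λ _ → z) ≈ ιℕ n * z
    sum-const zero z = sym (trans (*-congʳ ι0) (zeroˡ z))
    sum-const (suc n) z = trans (+-congʳ (sum-const n z)) (trans (solve 2 (λ n z → n :* z :+ z := (𝟙 :+ n) :* z) refl (ιℕ n) z) (*-congʳ (sym (ιℕ-suc n))))

    sum-id : ∀ n → sum n ιℕ ≈ ιℕ (tri n)
    sum-id zero = sym ι0
    sum-id (suc n) = trans (+-congʳ (sum-id n)) (trans (+-comm (ιℕ (tri n)) (ιℕ n)) (sym (ιℕ+ n (tri n))))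

    -- The linear term of the expansion has the factor n from the exponent, the remainder the square
    -- of the modulus; each gains at least one power of n.
    pow-lift : ∀ n {x y} i → x ≡ y mod (ιℕ n ^ suc i) → x ^ n ≡ y ^ n mod (ιℕ n ^ suc (suc i))
    pow-lift zero i _ = mrefl
    pow-lift (suc k) {x} {y} i (by q e) with pow-taylor₁ k y (ιℕ (suc k) ^ suc i * q)
    ... | w , f = by (y ^ k * q + ιℕ (suc k) ^ i * (q * q * w)) (trans (^-congˡ (suc k) e) (trans f
      (solve 6 (λ N Y A M q w → A :+ N :* Y :* (N :* M :* q) :+ (N :* M :* q) :* (N :* M :* q) :* w :=
                  A :+ (N :* (N :* M)) :* (Y :* q :+ M :* (q :* q :* w))) refl
             (ιℕ (suc k)) (y ^ k) (y ^ suc k) (ιℕ (suc k) ^ i) q w)))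

    pow-lifts : ∀ n {x y} i j → x ≡ y mod (ιℕ n ^ suc i) → x ^ (n ℕ.^ j) ≡ y ^ (n ℕ.^ j) mod (ιℕ n ^ suc (i ℕ.+ j))
    pow-lifts n i zero c₁ = m≈m (^-congʳ (ιℕ n) (≡.cong suc (≡.sym (ℕP.+-identityʳ i)))) (mpow 1 c₁)
    pow-lifts n {x} {y} i (suc j) c₁ = m≈m (^-congʳ (ιℕ n) (≡.cong suc (≡.sym (ℕP.+-suc i j))))
      (m≈ (sym (exp x)) (sym (exp y)) (pow-lift n (i ℕ.+ j) (pow-lifts n i j c₁)))
      where exp : ∀ x → (x ^ (n ℕ.^ j)) ^ n ≈ x ^ (n ℕ.* n ℕ.^ j)
            exp x = trans (^-assocʳ x (n ℕ.^ j) n) (^-congʳ x (ℕP.*-comm (n ℕ.^ j) n))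

    binomial : ∀ n z → (1# + z) ^ n ≈ sum (suc n) (λ k → ιℕ (bin n k) * z ^ k)
    binomial zero z = sym (trans (+-identityˡ _) (trans (*-congʳ ι1) (*-identityˡ 1#)))
    binomial (suc n) z = sym (begin
      sum (suc (suc n)) (λ k → ιℕ (bin (suc n) k) * z ^ k)
        ≈⟨ sum-first (suc n) _ ⟩
      ιℕ 1 * 1# + sum (suc n) (λ k → ιℕ (bin n k ℕ.+ bin n (suc k)) * z ^ suc k)
        ≈⟨ +-congˡ (sum-cong (suc n) (λ k _ → trans (*-congʳ (ιℕ+ (bin n k) (bin n (suc k))))
            (solve 4 (λ a b z Z → (a :+ b) :* (z :* Z) := z :* (a :* Z) :+ b :* (z :* Z)) refl _ _ z (z ^ k)))) ⟩
      ιℕ 1 * 1# + sum (suc n) (λ k → z * (ιℕ (bin n k) * z ^ k) + ιℕ (bin n (suc k)) * z ^ suc k)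
        ≈⟨ +-congˡ (sum-+ (suc n) _ _) ⟩
      ιℕ 1 * 1# + (sum (suc n) (λ k → z * (ιℕ (bin n k) * z ^ k)) + sum (suc n) (λ k → ιℕ (bin n (suc k)) * z ^ suc k))
        ≈⟨ +-congˡ (+-cong (sum-* (suc n) z _) (trans (+-congˡ (trans (*-congʳ (ι-cong (≡.cong +_ (bin-> n (suc n) ℕP.≤-refl)))) (trans (*-congʳ ι0) (zeroˡ _)))) (+-identityʳ _))) ⟩
      ιℕ 1 * 1# + (z * sum (suc n) (λ k → ιℕ (bin n k) * z ^ k) + sum n (λ k → ιℕ (bin n (suc k)) * z ^ suc k))
        ≈⟨ solve 3 (λ a b c → a :+ (b :+ c) := b :+ (a :+ c)) refl _ _ _ ⟩
      z * sum (suc n) (λ k → ιℕ (bin n k) * z ^ k) + (ιℕ 1 * 1# + sum n (λ k → ιℕ (bin n (suc k)) * z ^ suc k))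
        ≈⟨ +-congˡ (trans (+-congʳ (*-congʳ (ι-cong (≡.cong +_ (≡.sym (bin-0 n)))))) (sym (sum-first n _))) ⟩
      z * sum (suc n) (λ k → ιℕ (bin n k) * z ^ k) + sum (suc n) (λ k → ιℕ (bin n k) * z ^ k)
        ≈⟨ solve 2 (λ z a → z :* a :+ a := (𝟙 :+ z) :* a) refl z _ ⟩
      (1# + z) * sum (suc n) (λ k → ιℕ (bin n k) * z ^ k)
        ≈⟨ *-congˡ (binomial n z) ⟨
      (1# + z) * (1# + z) ^ n ∎)

    freshman : ∀ {d} → Prime (suc d) → ∀ z → (1# + z) ^ suc d ≡ 1# + z ^ suc d mod ιℕ (suc d)
    freshman {p′} pr z = mtrans (meq (trans (binomial (suc p′) z) (+-congʳ (sum-first p′ _))))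
       (m≈ refl (+-cong (trans (sym (*-identityʳ 1#)) (*-congʳ (sym ι1)))
                        (trans (sym (*-identityˡ _)) (*-congʳ (trans (sym ι1) (ι-cong (≡.cong +_ (≡.sym (bin-n (suc p′)))))))))
         (m+ (mtrans (m+ˡ _ (sum-0m p′ (λ k k<p′ → mdiv (prime∣bin pr (suc k) (ℕ.z<s) (ℕ.s≤s k<p′)) (z ^ suc k)))) (meq (+-identityʳ _))) mrefl))
      where
      mdiv : ∀ {n a} → n ∣ a → ∀ y → ιℕ a * y ≡ 0# mod ιℕ n
      mdiv {n} (divides q ≡.refl) y = by (ιℕ q * y) (trans (*-congʳ (ιℕ* q n)) (trans
        (solve 3 (λ q n y → q :* n :* y := n :* (q :* y)) refl (ιℕ q) (ιℕ n) y) (sym (+-identityˡ _))))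

    neg-square : ∀ h x → (- x) ^ (h ℕ.+ h) ≈ x ^ (h ℕ.+ h)
    neg-square h x = begin
      (- x) ^ (h ℕ.+ h)       ≈⟨ ^-homo-* (- x) h h ⟩
      (- x) ^ h * (- x) ^ h   ≈⟨ ^-distrib-* (- x) (- x) h ⟨
      ((- x) * (- x)) ^ h     ≈⟨ ^-congˡ h (solve 1 (λ x → (:- x) :* (:- x) := x :* x) refl x) ⟩
      (x * x) ^ h             ≈⟨ ^-distrib-* x x h ⟩
      x ^ h * x ^ h           ≈⟨ ^-homo-* x h h ⟨
      x ^ (h ℕ.+ h) ∎

    module _ (n h : ℕ) (odd : tri n ≡ n ℕ.* h) where
      private N = ιℕ n

      -- In the inductive step, with z = N^(c+1) T, the term n(n-1)/2 z^2 must vanish modulo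
      -- N^(c+3). For c = 0 the square gives only N^2, and the missing factor comes from `odd`.
      one-plus-pow : ∀ T c → (1# + N * T) ^ (n ℕ.^ c) ≡ 1# + N ^ suc c * T mod (N ^ suc (suc c))
      one-plus-pow T zero = meq (trans (*-identityʳ _) (+-congˡ (*-congʳ (sym (*-identityʳ N)))))
      one-plus-pow T (suc c) with pow-taylor₂ n (N ^ suc c * T)
      ... | w , e = m≈ (trans (^-congʳ _ (ℕP.*-comm n (n ℕ.^ c))) (sym (^-assocʳ _ (n ℕ.^ c) n))) refl
          (mtrans (pow-lift n (suc c) (one-plus-pow T c))
            (by (N ^ c * (ιℕ h * (T * T)) + N ^ c * N ^ c * (T * T * T * w)) (trans e (trans (+-congʳ (+-congˡ (*-congʳ (trans (ι-cong (≡.cong +_ odd)) (ιℕ* n h)))))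
              (solve 5 (λ N C T H w → 𝟙 :+ N :* (N :* C :* T) :+ (N :* H) :* ((N :* C :* T) :* (N :* C :* T)) :+ (N :* C :* T) :* (N :* C :* T) :* (N :* C :* T) :* w :=
                 (𝟙 :+ N :* (N :* C) :* T) :+ N :* (N :* (N :* C)) :* (C :* (H :* (T :* T)) :+ C :* C :* (T :* T :* T :* w))) refl N (N ^ c) T (ιℕ h) w)))))

      one-plus-pow* : ∀ T c m → (1# + N * T) ^ (n ℕ.^ c ℕ.* m) ≡ 1# + ιℕ m * (N ^ suc c * T) mod (N ^ suc (suc c))
      one-plus-pow* T c zero = m≈ (^-congʳ _ (ℕP.*-zeroʳ (n ℕ.^ c))) (trans (+-congˡ (trans (*-congʳ ι0) (zeroˡ _))) (+-identityʳ _)) mrefl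
      one-plus-pow* T c (suc m) with pow-taylor₁ m 1# (N ^ suc c * T)
      ... | w , e = m≈ (sym (^-assocʳ _ (n ℕ.^ c) (suc m))) refl (mtrans (mpow (suc m) (one-plus-pow T c))
          (by (N ^ c * (T * T * w)) (trans e (trans (+-congʳ (+-cong (1^ (suc m)) (*-congʳ (trans (*-congˡ (1^ m)) (*-identityʳ _)))))
            (solve 5 (λ N C T S w → 𝟙 :+ S :* (N :* C :* T) :+ (N :* C :* T) :* (N :* C :* T) :* w :=
               (𝟙 :+ S :* (N :* C :* T)) :+ N :* (N :* C) :* (C :* (T :* T :* w))) refl N (N ^ c) T (ιℕ (suc m)) w)))))

open import Data.Bool using (if_then_else_)
open import Data.Nat as ℕ using (ℕ; zero; suc)
import Data.Nat.Properties as ℕP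
import Data.Nat.Divisibility as ℕD
open import Data.Nat.Divisibility using (_∣?_)
open import Data.Nat.Primality using (Prime)
import Data.Integer.Properties as ℤP
open import Data.Integer.Tactic.RingSolver using (solve-∀)
open import Data.Product using (_,_; ∃; proj₁; proj₂)
open import Data.Sum using (inj₁; inj₂)
open import Relation.Nullary using (does; yes; no; Dec; ¬_; contradiction)
open import Relation.Binary.PropositionalEquality hiding (J)

-- The polynomial ring of the backward shift and its value at x = 1.

module ShiftOperators where

  open GenericAlgebra
  open import Algebra.Bundles using (CommutativeRing)
  open import Algebra.Solver.Ring.AlmostCommutativeRing using (_-Raw-AlmostCommutative⟶_; fromCommutativeRing; -raw-almostCommutative⟶)
  open import Data.Integer using (ℤ; +_; -[1+_]; _+_; _*_; -_; _-_; 0ℤ; 1ℤ)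
  open import Level using (0ℓ)

  module Z = Gen ℤP.+-*-commutativeRing (-raw-almostCommutative⟶ (fromCommutativeRing ℤP.+-*-commutativeRing))

  -- ℤ[x], written as expressions, acting on functions ℤ → ℤ with x as the backward shift.
  infixl 6 _⊕_
  infixl 7 _⊗_
  data Op : Set where
    cst : ℤ → Op
    𝕏 : Op
    _⊕_ _⊗_ : Op → Op → Op

  act : Op → (ℤ → ℤ) → ℤ → ℤ
  act (cst z) f i = z * f i
  act 𝕏 f i = f (i - 1ℤ)
  act (a ⊕ b) f i = act a f i + act b f i
  act (a ⊗ b) f i = act a (act b f) i

  act-cong : ∀ o {f g} → (∀ i → f i ≡ g i) → ∀ i → act o f i ≡ act o g i
  act-cong (cst z) h i = cong (z *_) (h i)
  act-cong 𝕏 h i = h (i - 1ℤ)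
  act-cong (a ⊕ b) h i = cong₂ _+_ (act-cong a h i) (act-cong b h i)
  act-cong (a ⊗ b) h i = act-cong a (act-cong b h) i

  act-+ : ∀ o f g i → act o (λ j → f j + g j) i ≡ act o f i + act o g i
  act-+ (cst z) f g i = ℤP.*-distribˡ-+ z (f i) (g i)
  act-+ 𝕏 f g i = refl
  act-+ (a ⊕ b) f g i = trans (cong₂ _+_ (act-+ a f g i) (act-+ b f g i)) (lem (act a f i) _ _ _)
    where lem : ∀ x y z w → (x + y) + (z + w) ≡ (x + z) + (y + w)
          lem = solve-∀
  act-+ (a ⊗ b) f g i = trans (act-cong a (act-+ b f g) i) (act-+ a (act b f) (act b g) i)

  act-* : ∀ o z f i → act o (λ j → z * f j) i ≡ z * act o f i
  act-* (cst w) z f i = lem w z (f i)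
    where lem : ∀ w z x → w * (z * x) ≡ z * (w * x)
          lem = solve-∀
  act-* 𝕏 z f i = refl
  act-* (a ⊕ b) z f i = trans (cong₂ _+_ (act-* a z f i) (act-* b z f i)) (sym (ℤP.*-distribˡ-+ z (act a f i) (act b f i)))
  act-* (a ⊗ b) z f i = trans (act-cong a (act-* b z f) i) (act-* a z (act b f) i)

  act-shift : ∀ o f c i → act o (λ j → f (j - c)) i ≡ act o f (i - c)
  act-shift (cst z) f c i = refl
  act-shift 𝕏 f c i = cong f (lem i c)
    where lem : ∀ i c → (i - 1ℤ) - c ≡ (i - c) - 1ℤ
          lem = solve-∀
  act-shift (a ⊕ b) f c i = cong₂ _+_ (act-shift a f c i) (act-shift b f c i)
  act-shift (a ⊗ b) f c i = trans (act-cong a (act-shift b f c) i) (act-shift a (act b f) c i)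

  -- Every operator is built from constants and a single shift, and all operators commute with
  -- these; hence composition can serve as a commutative multiplication.
  act-comm : ∀ o o′ f i → act o (act o′ f) i ≡ act o′ (act o f) i
  act-comm (cst z) o′ f i = sym (act-* o′ z f i)
  act-comm 𝕏 o′ f i = sym (act-shift o′ f 1ℤ i)
  act-comm (a ⊕ b) o′ f i = trans (cong₂ _+_ (act-comm a o′ f i) (act-comm b o′ f i)) (sym (act-+ o′ (act a f) (act b f) i))
  act-comm (a ⊗ b) o′ f i = trans (act-cong a (act-comm b o′ f) i) (act-comm a o′ (act b f) i)

  infix 4 _≋_
  -- Operators are equal when their actions are, so identities may be proved by evaluating on
  -- functions and no normal form of polynomials is needed.
  record _≋_ (o o′ : Op) : Set where
    constructor ≋-by
    field at : ∀ f i → act o f i ≡ act o′ f i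
  open _≋_ public

  𝒪 : CommutativeRing 0ℓ 0ℓ
  𝒪 = record
    { Carrier = Op ; _≈_ = _≋_ ; _+_ = _⊕_ ; _*_ = _⊗_ ; -_ = λ o → cst -[1+ 0 ] ⊗ o ; 0# = cst 0ℤ ; 1# = cst 1ℤ
    ; isCommutativeRing = record
      { isRing = record
        { +-isAbelianGroup = record
          { isGroup = record
            { isMonoid = record
              { isSemigroup = record
                { isMagma = record
                  { isEquivalence = record
                    { refl = ≋-by λ _ _ → refl
                    ; sym = λ e → ≋-by λ f i → sym (at e f i)
                    ; trans = λ e e′ → ≋-by λ f i → trans (at e f i) (at e′ f i) }
                  ; ∙-cong = λ e e′ → ≋-by λ f i → cong₂ _+_ (at e f i) (at e′ f i) }
                ; assoc = λ a b c → ≋-by λ f i → ℤP.+-assoc (act a f i) _ _ }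
              ; identity = (λ a → ≋-by λ f i → ℤP.+-identityˡ _) , (λ a → ≋-by λ f i → ℤP.+-identityʳ _) }
            ; inverse = (λ a → ≋-by λ f i → trans (cong (_+ act a f i) (ℤP.-1*i≡-i (act a f i))) (ℤP.+-inverseˡ (act a f i)))
                      , (λ a → ≋-by λ f i → trans (cong (λ z → act a f i + z) (ℤP.-1*i≡-i (act a f i))) (ℤP.+-inverseʳ (act a f i)))
            ; ⁻¹-cong = λ e → ≋-by λ f i → cong (-[1+ 0 ] *_) (at e f i) }
          ; comm = λ a b → ≋-by λ f i → ℤP.+-comm (act a f i) _ }
        ; *-cong = λ {a} {a′} {b} {b′} e e′ → ≋-by λ f i → trans (at e (act b f) i) (act-cong a′ (at e′ f) i)
        ; *-assoc = λ a b c → ≋-by λ f i → refl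
        ; *-identity = (λ a → ≋-by λ f i → ℤP.*-identityˡ _) , (λ a → ≋-by λ f i → act-cong a (λ j → ℤP.*-identityˡ (f j)) i)
        ; distrib = (λ a b c → ≋-by λ f i → act-+ a (act b f) (act c f) i) , (λ a b c → ≋-by λ f i → refl) }
      ; *-comm = λ a b → ≋-by λ f i → act-comm a b f i } }

  cst-hom : CommutativeRing.rawRing ℤP.+-*-commutativeRing -Raw-AlmostCommutative⟶ fromCommutativeRing 𝒪
  cst-hom = record
    { ⟦_⟧ = cst
    ; +-homo = λ x y → ≋-by λ f i → ℤP.*-distribʳ-+ (f i) x y
    ; *-homo = λ x y → ≋-by λ f i → ℤP.*-assoc x y (f i)
    ; -‿homo = λ x → ≋-by λ f i → lem x (f i)
    ; 0-homo = ≋-by λ _ _ → refl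
    ; 1-homo = ≋-by λ _ _ → refl }
    where lem : ∀ x y → - x * y ≡ -[1+ 0 ] * (x * y)
          lem = solve-∀

  module P = Gen 𝒪 cst-hom

  act-0 : ∀ o {f} → (∀ i → f i ≡ 0ℤ) → ∀ i → act o f i ≡ 0ℤ
  act-0 o {f} h i = trans (act-cong o {g = λ j → 0ℤ * f j} h i) (act-* o 0ℤ f i)

  act-pow : ∀ o m n f i → act (o P.^ (m ℕ.+ n)) f i ≡ act (o P.^ m) (act (o P.^ n) f) i
  act-pow o m n f i = at (P.^-homo-* o m n) f i

  act-mod : ∀ o {f g m} → (∀ i → f i Z.≡ g i mod m) → ∀ i → act o f i Z.≡ act o g i mod m
  act-mod o {f} {g} {m} h i = Z.by (act o (λ j → Z.quo (h j)) i)
    (trans (act-cong o (λ j → Z.eq (h j)) i) (trans (act-+ o g _ i) (cong (λ z → act o g i + z) (act-* o m _ i))))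

  cst^ : ∀ a n → cst a P.^ n ≋ cst (a Z.^ n)
  cst^ a zero = P.refl
  cst^ a (suc n) = P.trans (P.*-congˡ (cst^ a n)) (P.sym (P.ι* a (a Z.^ n)))

  mod-act : ∀ {o o′ z} → o P.≡ o′ mod cst z → ∀ f i → act o f i Z.≡ act o′ f i mod z
  mod-act (P.by q e) f i = Z.by (act q f i) (at e f i)

  mod-act^ : ∀ {o o′} z n → o P.≡ o′ mod (cst z P.^ n) → ∀ f i → act o f i Z.≡ act o′ f i mod (z Z.^ n)
  mod-act^ z n c = mod-act (P.m≈m (cst^ z n) c)

  act-neg : ∀ o f i → act (P.- o) f i ≡ - act o f i
  act-neg o f i = ℤP.-1*i≡-i (act o f i)

  -- The value of the polynomial at x = 1, which is the scalar by which the operator acts on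
  -- constant functions.
  ε : Op → ℤ
  ε (cst z) = z
  ε 𝕏 = 1ℤ
  ε (a ⊕ b) = ε a + ε b
  ε (a ⊗ b) = ε a * ε b

  act-const : ∀ o z i → act o (λ _ → z) i ≡ ε o * z
  act-const (cst w) z i = refl
  act-const 𝕏 z i = sym (ℤP.*-identityˡ z)
  act-const (a ⊕ b) z i = trans (cong₂ _+_ (act-const a z i) (act-const b z i)) (sym (ℤP.*-distribʳ-+ z (ε a) (ε b)))
  act-const (a ⊗ b) z i = trans (act-cong a (act-const b z) i) (trans (act-const a (ε b * z) i) (sym (ℤP.*-assoc (ε a) (ε b) z)))

  -- `ε` is defined on expressions, but it is recovered from the action on the constant 1 and so
  -- respects `_≋_`.
  ε-cong : ∀ {o o′} → o ≋ o′ → ε o ≡ ε o′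
  ε-cong {o} {o′} e = trans (sym (ℤP.*-identityʳ (ε o))) (trans (sym (act-const o 1ℤ 0ℤ)) (trans (at e _ 0ℤ) (trans (act-const o′ 1ℤ 0ℤ) (ℤP.*-identityʳ (ε o′)))))

  δ : Op
  δ = P.1# P.- 𝕏

  -- Division by 1 - x with the value at 1 as remainder, by recursion on the expression.
  divide-δ : ∀ o → ∃ λ q → o ≋ cst (ε o) ⊕ (δ ⊗ q)
  divide-δ (cst z) = P.0# , P.sym (P.trans (P.+-congˡ (P.zeroʳ δ)) (P.+-identityʳ _))
  divide-δ 𝕏 = P.- P.1# , P.solve 1 (λ x → x P.:= P.con 1ℤ P.:+ (P.𝟙 P.:- x) P.:* (P.:- P.𝟙)) P.refl 𝕏
  divide-δ (a ⊕ b) with divide-δ a | divide-δ b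
  ... | q , e | r , f = q ⊕ r , P.trans (P.+-cong e f) (P.trans
    (P.solve 5 (λ a b d q r → (a P.:+ d P.:* q) P.:+ (b P.:+ d P.:* r) P.:= (a P.:+ b) P.:+ d P.:* (q P.:+ r)) P.refl (cst (ε a)) (cst (ε b)) δ q r)
    (P.+-congʳ (P.sym (P.ι+ (ε a) (ε b)))))
  divide-δ (a ⊗ b) with divide-δ a | divide-δ b
  ... | q , e | r , f = (q ⊗ cst (ε b)) ⊕ ((cst (ε a) ⊗ r) ⊕ (δ ⊗ (q ⊗ r))) , P.trans (P.*-cong e f) (P.trans
    (P.solve 5 (λ a b d q r → (a P.:+ d P.:* q) P.:* (b P.:+ d P.:* r) P.:= (a P.:* b) P.:+ d P.:* (q P.:* b P.:+ (a P.:* r P.:+ d P.:* (q P.:* r)))) P.refl (cst (ε a)) (cst (ε b)) δ q r)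
    (P.+-congʳ (P.sym (P.ι* (ε a) (ε b)))))

-- Fleck quotients as iterates of the operator `U` on p-periodic functions.

module FleckQuotients where

  open GenericAlgebra
  open ShiftOperators
  open import Data.Nat.Primality using (¬prime[1])
  open import Data.Integer using (ℤ; +_; -[1+_]; _+_; _*_; -_; _-_; 0ℤ; 1ℤ; ∣_∣)
  import Data.Integer.Divisibility.Signed as ℤS

  ∣⇒mod : ∀ {n x} → n ℕD.∣ ∣ x ∣ → x Z.≡ 0ℤ mod (+ n)
  ∣⇒mod {n} {x} n∣x with ℤS.∣ᵤ⇒∣ {+ n} {x} n∣x
  ... | ℤS.divides q e = Z.by q (trans e (trans (ℤP.*-comm q (+ n)) (sym (ℤP.+-identityˡ _))))

  mod⇒∣ : ∀ {n x} → x Z.≡ 0ℤ mod (+ n) → n ℕD.∣ ∣ x ∣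
  mod⇒∣ {n} {x} (Z.by q e) = ℤS.∣⇒∣ᵤ {+ n} {x} (ℤS.divides q (trans e (trans (ℤP.+-identityˡ _) (ℤP.*-comm (+ n) q))))

  if-yes : ∀ {a p} {A : Set a} {B : Set p} (D : Dec B) {x y : A} → B → (if does D then x else y) ≡ x
  if-yes (yes _) _ = refl
  if-yes (no ¬b) b = contradiction b ¬b

  if-no : ∀ {a p} {A : Set a} {B : Set p} (D : Dec B) {x y : A} → ¬ B → (if does D then x else y) ≡ y
  if-no (yes b) ¬b = contradiction b ¬b
  if-no (no _) _ = refl

  module Fleck (d h : ℕ) (pr : Prime (suc d)) (d≡h+h : d ≡ h ℕ.+ h) where
    p = suc d
    𝕡 = + p

    tri-odd : tri p ≡ p ℕ.* h
    tri-odd = trans (cong (λ x → tri (suc x)) d≡h+h) (trans (lem h) (cong (λ x → suc x ℕ.* h) (sym d≡h+h)))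
      where
      open NS using (_:+_; _:*_; _:=_)
      lem : ∀ h → tri (suc (h ℕ.+ h)) ≡ suc (h ℕ.+ h) ℕ.* h
      lem zero = refl
      lem (suc h) rewrite ℕP.+-suc h h = trans (cong (λ x → suc (suc (h ℕ.+ h)) ℕ.+ (suc (h ℕ.+ h) ℕ.+ x)) (lem h))
        (NS.solve 1 (λ h → (NS.con 2 :+ (h :+ h)) :+ ((NS.con 1 :+ (h :+ h)) :+ (NS.con 1 :+ (h :+ h)) :* h)
                         := (NS.con 3 :+ (h :+ h)) :* (NS.con 1 :+ h)) refl h)

    c₀ : ℤ → ℤ
    c₀ r = if does (p ∣? ∣ r ∣) then 1ℤ else 0ℤ

    c₀-yes : ∀ r → r Z.≡ 0ℤ mod 𝕡 → c₀ r ≡ 1ℤ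
    c₀-yes r m = if-yes (p ∣? ∣ r ∣) (mod⇒∣ m)

    c₀-no : ∀ r → ¬ (r Z.≡ 0ℤ mod 𝕡) → c₀ r ≡ 0ℤ
    c₀-no r m = if-no (p ∣? ∣ r ∣) (λ p∣r → m (∣⇒mod p∣r))

    Periodic : (ℤ → ℤ) → Set
    Periodic f = ∀ i → f (i - 𝕡) ≡ f i

    c₀-periodic : Periodic c₀
    c₀-periodic i = case (p ∣? ∣ i ∣)
      where
      p≡0 : 𝕡 Z.≡ 0ℤ mod 𝕡
      p≡0 = Z.by 1ℤ (sym (trans (ℤP.+-identityˡ _) (ℤP.*-identityʳ 𝕡)))
      lem : ∀ i p → i ≡ (i - p) + p
      lem = solve-∀
      case : Dec (p ℕD.∣ ∣ i ∣) → c₀ (i - 𝕡) ≡ c₀ i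
      case (yes ∣) = trans (c₀-yes (i - 𝕡) (Z.m- {i} (∣⇒mod {x = i} ∣) p≡0)) (sym (c₀-yes i (∣⇒mod ∣)))
      case (no ∤) = trans (c₀-no (i - 𝕡) (λ m → ∤ (mod⇒∣ (Z.m≈ (lem i 𝕡) refl (Z.m+ m p≡0))))) (sym (c₀-no i (λ m → ∤ (mod⇒∣ m))))

    act-periodic : ∀ o {f} → Periodic f → Periodic (act o f)
    act-periodic o {f} per i = trans (sym (act-shift o f 𝕡 i)) (act-cong o per i)

    act-𝕏^ : ∀ n f i → act (𝕏 P.^ n) f i ≡ f (i - + n)
    act-𝕏^ zero f i = trans (ℤP.*-identityˡ _) (cong f (sym (ℤP.+-identityʳ i)))
    act-𝕏^ (suc n) f i = trans (act-𝕏^ n f (i - 1ℤ)) (cong f (trans (lem i (+ n)) (cong (λ z → i - z) (sym (ℤP.pos-+ 1 n)))))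
      where lem : ∀ i n → (i - 1ℤ) - n ≡ i - (1ℤ + n)
            lem = solve-∀

    1-𝕏^p : Op
    1-𝕏^p = P.1# P.- 𝕏 P.^ p

    1-𝕏^p-kills : ∀ {f} → Periodic f → ∀ i → act 1-𝕏^p f i ≡ 0ℤ
    1-𝕏^p-kills {f} per i = trans (cong₂ _+_ (ℤP.*-identityˡ (f i)) (trans (act-neg (𝕏 P.^ p) f i) (cong -_ (trans (act-𝕏^ p f i) (per i))))) (ℤP.+-inverseʳ (f i))

    private
      abstract
        -- The binomial expansion of (1 - x)^p modulo p; evenness of p - 1 turns (-x)^p into -x^p.
        -- The quotient is used only through its equation, hence `abstract`.
        δ^p-mod : δ P.^ p P.≡ 1-𝕏^p mod cst 𝕡
        δ^p-mod = P.m≈ P.refl (P.+-congˡ (P.trans (P.solve 2 (λ x y → :- (x P.:* y) P.:= (:- x) P.:* y) P.refl 𝕏 (𝕏 P.^ d)) (P.sym (P.*-congˡ X))))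
          (P.m≈ P.refl (P.+-congˡ (P.*-congˡ P.refl)) (P.freshman pr (P.- 𝕏)))
          where
          open P using (:-_)
          X : (P.- 𝕏) P.^ d P.≈ 𝕏 P.^ d
          X = P.trans (P.^-congʳ (P.- 𝕏) d≡h+h) (P.trans (P.neg-square h 𝕏) (P.^-congʳ 𝕏 (sym d≡h+h)))

      g : Op
      g = P.quo δ^p-mod

      cancel-p : ∀ {x} → 𝕡 * x ≡ 0ℤ → x ≡ 0ℤ
      cancel-p {x} e = ℤP.*-cancelˡ-≡ 𝕡 x 0ℤ (trans e (sym (ℤP.*-zeroʳ 𝕡)))

      ε𝕏^ : ∀ n → ε (𝕏 P.^ n) ≡ 1ℤ
      ε𝕏^ zero = refl
      ε𝕏^ (suc n) = trans (ℤP.*-identityˡ _) (ε𝕏^ n)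

      -- At x = 1 both (1 - x)^p and 1 - x^p vanish, so p g(1) = 0; therefore g is a multiple of 1 -
      -- x.
      εg : ε g ≡ 0ℤ
      εg = cancel-p (trans (lem (ε (𝕏 P.^ p)) (𝕡 * ε g) (trans (sym (ε-cong (P.eq δ^p-mod))) (ℤP.*-zeroˡ (ε (δ P.^ d)))))
        (cong (λ z → z - 1ℤ) (ε𝕏^ p)))
        where lem : ∀ x y → (1ℤ + -[1+ 0 ] * x) + y ≡ 0ℤ → y ≡ x - 1ℤ
              lem x y e = trans (lem2 x y) (trans (cong (_+ (x - 1ℤ)) e) (ℤP.+-identityˡ _))
                where lem2 : ∀ x y → y ≡ ((1ℤ + -[1+ 0 ] * x) + y) + (x - 1ℤ)
                      lem2 = solve-∀

      A : Op
      A = proj₁ (divide-δ g)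

      δ^p : δ P.^ p ≋ 1-𝕏^p ⊕ (cst 𝕡 ⊗ (δ ⊗ A))
      δ^p = P.trans (P.eq δ^p-mod) (P.+-congˡ (P.*-congˡ (P.trans (proj₂ (divide-δ g)) (P.trans (P.+-congʳ (P.ι-cong εg)) (P.+-identityˡ _)))))

      act-δ-id : ∀ i → act δ (λ j → j) i ≡ 1ℤ
      act-δ-id = lem
        where lem : ∀ i → 1ℤ * i + -[1+ 0 ] * (i - 1ℤ) ≡ 1ℤ
              lem = solve-∀

      act-δ-const : ∀ f i → (∀ j → f j ≡ 1ℤ) → act δ f i ≡ 0ℤ
      act-δ-const f i h = trans (act-cong δ h i) (act-const δ 1ℤ i)

      δ-kills-id : ∀ n → 0 ℕ.< n → ∀ i → act (δ P.^ suc n) (λ j → j) i ≡ 0ℤ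
      δ-kills-id (suc n) _ i = trans (cong (λ m → act (δ P.^ m) (λ j → j) i) (ℕP.+-comm 2 n))
        (trans (act-pow δ n 2 (λ j → j) i) (act-0 (δ P.^ n) (λ j → act-δ-const _ j (λ k → trans (act-cong δ (λ l → ℤP.*-identityˡ l) k) (act-δ-id k))) i))

    0<d : 0 ℕ.< d
    0<d = prime-pos pr
      where prime-pos : ∀ {d} → Prime (suc d) → 0 ℕ.< d
            prime-pos {suc d} _ = ℕ.z<s
            prime-pos {zero} pr = contradiction pr ¬prime[1]

    private
      -- Evaluation on the identity function, whose first difference is the constant 1: δ^p
      -- annihilates it, 1 - x^p sends it to p, and pδA sends it to p A(1).
      εA : ε A ≡ -[1+ 0 ]
      εA = ℤP.*-cancelˡ-≡ 𝕡 (ε A) -[1+ 0 ] (lem 𝕡 (ε A) (trans (sym lhs) (trans (sym (at δ^p (λ j → j) 0ℤ)) (δ-kills-id d 0<d 0ℤ))))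
        where
        lem : ∀ p a → p + p * a ≡ 0ℤ → p * a ≡ p * -[1+ 0 ]
        lem p a e = trans (lem₁ p a) (trans (cong (_+ (p * -[1+ 0 ])) e) (ℤP.+-identityˡ _))
          where lem₁ : ∀ p a → p * a ≡ (p + p * a) + (p * -[1+ 0 ])
                lem₁ = solve-∀
        lhs : act (1-𝕏^p ⊕ (cst 𝕡 ⊗ (δ ⊗ A))) (λ j → j) 0ℤ ≡ 𝕡 + 𝕡 * ε A
        lhs = cong₂ (λ x y → x + 𝕡 * y)
          (trans (cong₂ _+_ (ℤP.*-identityˡ 0ℤ) (trans (act-neg (𝕏 P.^ p) _ 0ℤ) (cong -_ (act-𝕏^ p (λ j → j) 0ℤ)))) refl)
          (trans (act-comm δ A (λ j → j) 0ℤ) (trans (act-cong A act-δ-id 0ℤ) (trans (act-const A 1ℤ 0ℤ) (ℤP.*-identityʳ (ε A)))))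

    -- The sign makes the value at x = 1 equal to 1. Then U = 1 + δQ, and (δQ)^p is a multiple of p
    -- modulo 1 - x^p.
    U : Op
    U = P.- A

    private
      Q : Op
      Q = proj₁ (divide-δ U)

      U≋ : U ≋ P.1# ⊕ (δ ⊗ Q)
      U≋ = P.trans (proj₂ (divide-δ U)) (P.+-congʳ (P.ι-cong (cong (-[1+ 0 ] *_) εA)))

      abstract
        U^p-mod : U P.^ p P.≡ P.1# ⊕ ((δ ⊗ Q) P.^ p) mod cst 𝕡
        U^p-mod = P.m≈ (P.^-congˡ p U≋) P.refl (P.freshman pr (δ ⊗ Q))

    T : Op
    T = (g ⊗ (Q P.^ p)) ⊕ P.quo U^p-mod

    U^p : U P.^ p P.≡ P.1# ⊕ (cst 𝕡 ⊗ T) mod 1-𝕏^p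
    U^p = P.by (Q P.^ p) (P.trans (P.eq U^p-mod) (P.trans (P.+-congʳ (P.+-congˡ (P.trans (P.^-distrib-* δ Q p) (P.*-congʳ (P.eq δ^p-mod)))))
      (P.solve 5 (λ m p g q w → (𝟙 :+ (m :+ p :* g) :* q) :+ p :* w := (𝟙 :+ p :* (g :* q :+ w)) :+ m :* q) P.refl 1-𝕏^p (cst 𝕡) g (Q P.^ p) (P.quo U^p-mod))))
      where open P using (𝟙; _:+_; _:*_; _:=_)

    kill-mod : ∀ {o o′ f} → Periodic f → o P.≡ o′ mod 1-𝕏^p → ∀ i → act o f i ≡ act o′ f i
    kill-mod {o} {o′} {f} per (P.by q e) i = trans (at e f i) (trans (cong (λ z → act o′ f i + z) (1-𝕏^p-kills (act-periodic q per) i)) (ℤP.+-identityʳ _))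

    U-taylor : ∀ {f} → Periodic f → ∀ c m i →
      act (U P.^ (p ℕ.* (p ℕ.^ c ℕ.* m))) f i Z.≡ f i + + m * (𝕡 Z.^ suc c * act T f i) mod (𝕡 Z.^ suc (suc c))
    U-taylor {f} per c m i = Z.m≈
      (trans (sym (at (P.^-assocʳ U p (p ℕ.^ c ℕ.* m)) f i)) (kill-mod per (P.mpow (p ℕ.^ c ℕ.* m) U^p) i))
      (cong₂ _+_ (sym (ℤP.*-identityˡ (f i))) (cong (+ m *_) (sym (at (cst^ 𝕡 (suc c)) (act T f) i))))
      (mod-act^ 𝕡 (suc (suc c)) (P.one-plus-pow* p h tri-odd T c m) f i)

    δ^p-periodic : ∀ {f} → Periodic f → ∀ i → act (δ P.^ p) f i ≡ 𝕡 * act A (act δ f) i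
    δ^p-periodic {f} per i = trans (at δ^p f i) (trans (cong₂ _+_ (1-𝕏^p-kills per i) (cong (𝕡 *_) (act-comm δ A f i))) (ℤP.+-identityˡ _))

    -- C_p(N, r) as a function of r: δ^N sums the values c₀(r - k) with the signed binomial
    -- coefficients.
    cc : ℕ → ℤ → ℤ
    cc N = act (δ P.^ N) c₀

    cc-periodic : ∀ N → Periodic (cc N)
    cc-periodic N = act-periodic (δ P.^ N) c₀-periodic

    -- On periodic functions δ^p = pAδ consumes p factors δ and returns one. The factor returned is
    -- the reason for a step of p - 1 and for the positive index.
    cc-step : ∀ N i → cc (suc N ℕ.+ d) i ≡ - 𝕡 * act U (cc (suc N)) i
    cc-step N i = trans (cong (λ m → act (δ P.^ m) c₀ i) (sym (ℕP.+-suc N d))) (trans (act-pow δ N p c₀ i)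
      (trans (act-cong (δ P.^ N) (δ^p-periodic c₀-periodic) i) (trans (act-* (δ P.^ N) 𝕡 _ i)
      (trans (cong (𝕡 *_) (trans (act-comm (δ P.^ N) A (act δ c₀) i) (act-cong A (act-comm (δ P.^ N) δ c₀) i)))
      (trans (lem 𝕡 _) (cong (- 𝕡 *_) (sym (act-neg A (cc (suc N)) i))))))))
      where lem : ∀ p a → p * a ≡ - p * - a
            lem = solve-∀

    module _ (s′ : ℕ) where
      s = suc s′

      -- The Fleck quotient at s + e(p-1), obtained without division; `cc≡F` gives the relation to
      -- C_p.
      F : ℕ → ℤ → ℤ
      F e = act (U P.^ e) (cc s)

      F-periodic : ∀ e → Periodic (F e)
      F-periodic e = act-periodic (U P.^ e) (cc-periodic s)

      cc≡F : ∀ e i → cc (s ℕ.+ e ℕ.* d) i ≡ (- 𝕡) Z.^ e * F e i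
      cc≡F zero i = trans (cong (λ m → cc m i) (ℕP.+-identityʳ s)) (trans (sym (ℤP.*-identityˡ (cc s i))) (sym (ℤP.*-identityˡ _)))
      cc≡F (suc e) i = trans (cong (λ m → cc m i) (trans (cong (s ℕ.+_) (ℕP.+-comm d (e ℕ.* d))) (sym (ℕP.+-assoc s (e ℕ.* d) d))))
        (trans (cc-step (s′ ℕ.+ e ℕ.* d) i) (trans (cong (- 𝕡 *_) (trans (act-cong U (cc≡F e) i) (act-* U ((- 𝕡) Z.^ e) (F e) i)))
          (sym (ℤP.*-assoc (- 𝕡) ((- 𝕡) Z.^ e) (F (suc e) i)))))

      F-taylor : ∀ e c m i → F (e ℕ.+ p ℕ.* (p ℕ.^ c ℕ.* m)) i Z.≡ F e i + + m * (𝕡 Z.^ suc c * act T (F e) i) mod (𝕡 Z.^ suc (suc c))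
      F-taylor e c m i = Z.m≈ (trans (cong (λ k → act (U P.^ k) (cc s) i) (ℕP.+-comm e _)) (act-pow U (p ℕ.* (p ℕ.^ c ℕ.* m)) e (cc s) i)) refl (U-taylor (F-periodic e) c m i)

      F-mod-p : ∀ e q i → F (e ℕ.+ p ℕ.* q) i Z.≡ F e i mod 𝕡
      F-mod-p e q i = Z.mtrans (Z.m^1 𝕡 (Z.m^-weaken 𝕡 1 2 (ℕ.z<s)
          (Z.m≈ (cong (λ k → F (e ℕ.+ p ℕ.* k) i) (sym (ℕP.*-identityˡ q))) refl (F-taylor e 0 q i))))
        (Z.by (+ q * act T (F e) i) (lem (F e i) (+ q) 𝕡 (act T (F e) i)))
        where lem : ∀ f q p t → f + q * (p * 1ℤ * t) ≡ f + p * (q * t)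
              lem = solve-∀

      -- The operator T, whose mod-p action would be awkward to compute, is eliminated
      -- between a step of length q and a reference step of length q′ ≡ s.
      F-compare : ∀ e e′ c m q′ → let q = p ℕ.^ c ℕ.* m in e ℕ.+ p ℕ.* q ≡ e′ ℕ.+ p ℕ.* q′ → + q′ Z.≡ + s mod 𝕡 → ∀ r →
        + s * (F (e ℕ.+ p ℕ.* q) r - F e r) Z.≡ + q * (F (e ℕ.+ p ℕ.* q) r - F e′ r) mod (𝕡 Z.^ suc (suc c))
      F-compare e e′ c m q′ eq q′≡s r = Z.mtrans (Z.m*ˡ (+ s) left) (Z.mtrans middle (Z.msym right))
        where
        q = p ℕ.^ c ℕ.* m
        F₁ = F (e ℕ.+ p ℕ.* q)
        t = act T (F e) r
        t′ = act T (F e′) r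
        F₁≡ : ∀ i → F₁ i ≡ F (e′ ℕ.+ p ℕ.* q′) i
        F₁≡ i = cong (λ k → F k i) eq
        t≡t′ : t Z.≡ t′ mod 𝕡
        t≡t′ = act-mod T (λ i → Z.mtrans (Z.msym (F-mod-p e q i)) (Z.m≈ (F₁≡ i) refl (F-mod-p e′ q′ i))) r
        left : F₁ r - F e r Z.≡ + m * (𝕡 Z.^ suc c * t) mod (𝕡 Z.^ suc (suc c))
        left = Z.mtrans (Z.m+ʳ (- F e r) (F-taylor e c m r)) (Z.meq (lem (F e r) _))
          where lem : ∀ a b → (a + b) - a ≡ b
                lem = solve-∀
        right₀ : F₁ r - F e′ r Z.≡ + q′ * (𝕡 * t′) mod (𝕡 Z.^ 2)
        right₀ = Z.mtrans (Z.m+ʳ (- F e′ r) (Z.m≈ (trans (F₁≡ r) (cong (λ k → F (e′ ℕ.+ p ℕ.* k) r) (sym (ℕP.*-identityˡ q′)))) refl (F-taylor e′ 0 q′ r))) (Z.meq (lem (F e′ r) (+ q′) 𝕡 t′))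
          where lem : ∀ a q p t → (a + q * (p * 1ℤ * t)) - a ≡ q * (p * t)
                lem = solve-∀
        q≡ : + q ≡ 𝕡 Z.^ c * + m
        q≡ = trans (Z.ιℕ* (p ℕ.^ c) m) (cong (_* + m) (Z.ιℕ^ p c))
        q≡0 : + q Z.≡ 0ℤ mod (𝕡 Z.^ c)
        q≡0 = Z.by (+ m) (trans q≡ (sym (ℤP.+-identityˡ _)))
        up : ∀ {x y} → x Z.≡ y mod (𝕡 Z.^ 2) → + q * x Z.≡ + q * y mod (𝕡 Z.^ suc (suc c))
        up e = Z.m≈m (cong (𝕡 Z.^_) (ℕP.+-comm c 2)) (Z.m^mul 𝕡 c 2 (+ q) q≡0 e)
        right : + q * (F₁ r - F e′ r) Z.≡ + q * (+ q′ * (𝕡 * t′)) mod (𝕡 Z.^ suc (suc c))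
        right = up right₀
        middle : + s * (+ m * (𝕡 Z.^ suc c * t)) Z.≡ + q * (+ q′ * (𝕡 * t′)) mod (𝕡 Z.^ suc (suc c))
        middle = Z.m≈ (trans (lem (+ s) (+ m) 𝕡 (𝕡 Z.^ c) t) (cong (λ z → z * (𝕡 * (+ s * t))) (sym q≡))) (cong (+ q *_) (lem₂ (+ q′) 𝕡 t′))
          (up (Z.m≈m (cong (𝕡 *_) (sym (ℤP.*-identityʳ 𝕡))) (Z.mscale 𝕡 (Z.m* (Z.msym q′≡s) t≡t′))))
          where
          lem : ∀ s m p c t → s * (m * (p * c * t)) ≡ (c * m) * (p * (s * t))
          lem = solve-∀
          lem₂ : ∀ q p t → q * (p * t) ≡ p * (q * t)
          lem₂ = solve-∀

-- Finite differences of powers, the series of Stirling numbers, and its denominator.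

module StirlingSeries where

  open GenericAlgebra
  open ShiftOperators
  open FleckQuotients using (if-yes; if-no)
  open import Data.Nat using (_!)
  open import Data.Nat.DivMod using (_/_; _%_; m<n⇒m%n≡m; m<n⇒m/n≡0; [m+n]%n≡m%n; [m+kn]%n≡m%n; m*n%n≡0; m*n/n≡m; +-distrib-/-∣ˡ; n/n≡1; m≡m%n+[m/n]*n)
  open import Data.Nat.Divisibility using (∣-refl)
  open import Data.Integer using (ℤ; +_; -[1+_]; _+_; _*_; -_; _-_; 0ℤ; 1ℤ)

  -- D N g = Σ_k (-1)^k (N choose k) g k.
  D : ℕ → (ℕ → ℤ) → ℤ
  D zero g = g 0
  D (suc N) g = D N g - D N (λ k → g (suc k))

  D-cong : ∀ N {f g} → (∀ k → f k ≡ g k) → D N f ≡ D N g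
  D-cong zero h = h 0
  D-cong (suc N) h = cong₂ _-_ (D-cong N h) (D-cong N (λ k → h (suc k)))

  D-+ : ∀ N f g → D N (λ k → f k + g k) ≡ D N f + D N g
  D-+ zero f g = refl
  D-+ (suc N) f g = trans (cong₂ _-_ (D-+ N f g) (D-+ N (λ k → f (suc k)) (λ k → g (suc k)))) (lem (D N f) (D N g) (D N (λ k → f (suc k))) (D N (λ k → g (suc k))))
    where lem : ∀ a b c d → (a + b) - (c + d) ≡ (a - c) + (b - d)
          lem = solve-∀

  D-* : ∀ N z f → D N (λ k → z * f k) ≡ z * D N f
  D-* zero z f = refl
  D-* (suc N) z f = trans (cong₂ _-_ (D-* N z f) (D-* N z (λ k → f (suc k)))) (lem z (D N f) (D N (λ k → f (suc k))))
    where lem : ∀ z a b → z * a - z * b ≡ z * (a - b)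
          lem = solve-∀

  D-mod : ∀ N {f g m} → (∀ k → f k Z.≡ g k mod m) → D N f Z.≡ D N g mod m
  D-mod zero h = h 0
  D-mod (suc N) h = Z.m- (D-mod N h) (D-mod N (λ k → h (suc k)))

  D-sum : ∀ N n (f : ℕ → ℕ → ℤ) → D N (λ k → Z.sum n (λ i → f i k)) ≡ Z.sum n (λ i → D N (f i))
  D-sum N zero f = D-0 N
    where D-0 : ∀ N → D N (λ _ → 0ℤ) ≡ 0ℤ
          D-0 zero = refl
          D-0 (suc N) = cong₂ _-_ (D-0 N) (D-0 N)
  D-sum N (suc n) f = trans (D-+ N _ (f n)) (cong (_+ D N (f n)) (D-sum N n f))

  D-δ^ : ∀ N f i → act (δ P.^ N) f i ≡ D N (λ k → f (i - + k))
  D-δ^ zero f i = trans (ℤP.*-identityˡ (f i)) (cong f (sym (ℤP.+-identityʳ i)))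
  D-δ^ (suc N) f i = trans (act-comm δ (δ P.^ N) f i) (trans (D-δ^ N (act δ f) i) (trans (D-cong N (λ k → trans (lem (f (i - + k)) (f (i - + k - 1ℤ))) (cong (λ z → f (i - + k) + -[1+ 0 ] * f z) (shift i k))))
    (trans (D-+ N (λ k → f (i - + k)) (λ k → -[1+ 0 ] * f (i - + suc k))) (cong (λ z → D N (λ k → f (i - + k)) + z) (trans (D-* N -[1+ 0 ] (λ k → f (i - + suc k))) (ℤP.-1*i≡-i (D N (λ k → f (i - + suc k)))))))))
    where
    lem : ∀ a b → 1ℤ * a + -[1+ 0 ] * b ≡ a + -[1+ 0 ] * b
    lem = solve-∀
    shift : ∀ i k → i - + k - 1ℤ ≡ i - + suc k
    shift i k = trans (lem₂ i (+ k)) (cong (λ z → i - z) (sym (ℤP.pos-+ 1 k)))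
      where lem₂ : ∀ i k → i - k - 1ℤ ≡ i - (1ℤ + k)
            lem₂ = solve-∀

  -- Absorption, k binom(N+1, k) = (N+1) binom(N, k-1), with the shifted sum that results rewritten
  -- as D N g - D (N+1) g.
  D-mul : ∀ N g → D (suc N) (λ k → + k * g k) ≡ + suc N * (D (suc N) g - D N g)
  D-mul zero g = lem (g 0) (g 1)
    where lem : ∀ a b → 0ℤ * a - 1ℤ * b ≡ 1ℤ * (a - b - a)
          lem = solve-∀
  D-mul (suc N) g = trans (cong₂ _-_ (D-mul N g) (trans (D-cong (suc N) (λ k → trans (cong (_* g (suc k)) (ℤP.pos-+ 1 k)) (dist (+ k) (g (suc k)))))
        (trans (D-+ (suc N) (λ k → + k * g⁺ k) g⁺) (cong (_+ D (suc N) g⁺) (D-mul N g⁺)))))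
    (trans (lem (+ suc N) (D N g) (D N g⁺) (D N (λ k → g⁺ (suc k)))) (cong (_* (D (suc (suc N)) g - D (suc N) g)) (sym (ℤP.pos-+ 1 (suc N)))))
    where
    g⁺ : ℕ → ℤ
    g⁺ k = g (suc k)
    dist : ∀ k x → (1ℤ + k) * x ≡ k * x + x
    dist = solve-∀
    lem : ∀ n a b c → n * ((a - b) - a) - (n * ((b - c) - b) + (b - c)) ≡ (1ℤ + n) * (((a - b) - (b - c)) - (a - b))
    lem = solve-∀

  -- The complete homogeneous sum of degree i in 1, ..., N, which is the Stirling number of the
  -- second kind S(N+i, N).
  hs : ℕ → ℕ → ℤ
  hs zero zero = 1ℤ
  hs zero (suc i) = 0ℤ
  hs (suc N) zero = 1ℤ
  hs (suc N) (suc i) = + suc N * hs (suc N) i + hs N (suc i)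

  hs-0 : ∀ N → hs N 0 ≡ 1ℤ
  hs-0 zero = refl
  hs-0 (suc N) = refl

  sf : ℕ → ℤ
  sf zero = 1ℤ
  sf (suc N) = - (+ suc N) * sf N

  sf≡ : ∀ N → sf N ≡ (- 1ℤ) Z.^ N * + (N !)
  sf≡ zero = refl
  sf≡ (suc N) = trans (cong (- (+ suc N) *_) (sf≡ N)) (trans (lem (+ suc N) ((- 1ℤ) Z.^ N) (+ (N !))) (cong ((- 1ℤ) Z.^ suc N *_) (sym (ℤP.pos-* (suc N) (N !)))))
    where lem : ∀ n e f → - n * (e * f) ≡ (- 1ℤ * e) * (n * f)
          lem = solve-∀

  D-pow-< : ∀ N L → L ℕ.< N → D N (λ k → (+ k) Z.^ L) ≡ 0ℤ
  D-pow-< (suc N) zero _ = trans (cong₂ _-_ (D-cong N {g = λ _ → 1ℤ} (λ _ → refl)) (D-cong N {g = λ _ → 1ℤ} (λ _ → refl))) (ℤP.+-inverseʳ (D N (λ _ → 1ℤ)))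
  D-pow-< (suc N) (suc L) (ℕ.s≤s L<N) = trans (D-mul N (λ k → (+ k) Z.^ L))
    (trans (cong (+ suc N *_) (cong₂ _-_ (D-pow-< (suc N) L (ℕP.m<n⇒m<1+n L<N)) (D-pow-< N L L<N))) (ℤP.*-zeroʳ (+ suc N)))

  -- By `D-mul` the left side obeys the recursion of `hs`, each increase of N contributing one
  -- factor -N to `sf`.
  D-pow : ∀ N i → D N (λ k → (+ k) Z.^ (N ℕ.+ i)) ≡ sf N * hs N i
  D-pow zero zero = refl
  D-pow zero (suc i) = trans (ℤP.*-zeroˡ (0ℤ Z.^ i)) (sym (ℤP.*-zeroʳ 1ℤ))
  D-pow (suc N) zero = trans (D-mul N (λ k → (+ k) Z.^ (N ℕ.+ 0)))
    (trans (cong (+ suc N *_) (cong₂ _-_ (D-pow-< (suc N) (N ℕ.+ 0) (ℕP.≤-reflexive (cong suc (ℕP.+-identityʳ N)))) (trans (D-pow N 0) (cong (sf N *_) (hs-0 N)))))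
    (lem (+ suc N) (sf N)))
    where lem : ∀ n f → n * (0ℤ - f * 1ℤ) ≡ (- n * f) * 1ℤ
          lem = solve-∀
  D-pow (suc N) (suc i) = trans (D-mul N (λ k → (+ k) Z.^ (N ℕ.+ suc i)))
    (trans (cong (+ suc N *_) (cong₂ _-_ (trans (D-cong (suc N) (λ k → cong ((+ k) Z.^_) (ℕP.+-suc N i))) (D-pow (suc N) i)) (D-pow N (suc i))))
    (lem (+ suc N) (sf N) (hs (suc N) i) (hs N (suc i))))
    where lem : ∀ n f a b → n * ((- n * f) * a - f * b) ≡ (- n * f) * (n * a + b)
          lem = solve-∀

  -- Extension by zero makes a formal power series a function on ℤ, on which the shift acts as
  -- multiplication by x.
  ext : (ℕ → ℤ) → ℤ → ℤ
  ext g (+ i) = g i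
  ext g -[1+ _ ] = 0ℤ

  Causal : (ℤ → ℤ) → Set
  Causal f = ∀ n → f -[1+ n ] ≡ 0ℤ

  ext-causal : ∀ g → Causal (ext g)
  ext-causal g n = refl

  act-causal : ∀ o {f} → Causal f → Causal (act o f)
  act-causal (cst z) h n = trans (cong (z *_) (h n)) (ℤP.*-zeroʳ z)
  act-causal 𝕏 h n = h (suc (n ℕ.+ 0))
  act-causal (a ⊕ b) h n = cong₂ _+_ (act-causal a h n) (act-causal b h n)
  act-causal (a ⊗ b) h n = act-causal a (act-causal b h) n

  act-𝕏^-ext-< : ∀ n g i → i ℕ.< n → act (𝕏 P.^ n) (ext g) (+ i) ≡ 0ℤ
  act-𝕏^-ext-< (suc n) g zero _ = act-causal (𝕏 P.^ n) (ext-causal g) 0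
  act-𝕏^-ext-< (suc n) g (suc i) (ℕ.s≤s i<n) = act-𝕏^-ext-< n g i i<n

  act-𝕏^-ext : ∀ n g i → act (𝕏 P.^ n) (ext g) (+ (n ℕ.+ i)) ≡ g i
  act-𝕏^-ext zero g i = ℤP.*-identityˡ (g i)
  act-𝕏^-ext (suc n) g i = act-𝕏^-ext n g i

  private
    causal-ext : ∀ {f} → Causal f → ∀ i → f i ≡ ext (λ n → f (+ n)) i
    causal-ext h (+ n) = refl
    causal-ext h -[1+ n ] = h n

  linear : ℤ → ℕ → Op
  linear w e = P.1# P.- (cst w ⊗ 𝕏 P.^ e)

  -- 1 - w x^(e+1) is invertible on power series: modulo m the coefficient at n is w times the one
  -- at n - e - 1, and the descent ends at negative indices.
  unipotent : ∀ w e {f m} → Causal f → (∀ i → act (linear w (suc e)) f i Z.≡ 0ℤ mod m) → ∀ i → f i Z.≡ 0ℤ mod m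
  unipotent w e {f} {m} causal h -[1+ n ] = Z.meq (causal n)
  unipotent w e {f} {m} causal h (+ n) = go (suc n) n ℕP.≤-refl
    where
    step : ∀ i → f i Z.≡ w * act (𝕏 P.^ suc e) f i mod m
    step i = Z.mdiff (Z.m≈ (trans (lem (f i) _) (cong (λ z → 1ℤ * f i + z) (sym (act-neg (cst w ⊗ 𝕏 P.^ suc e) f i)))) refl (h i))
      where lem : ∀ a b → a - b ≡ 1ℤ * a + - b
            lem = solve-∀
    rest : ∀ i → act (𝕏 P.^ suc e) f i Z.≡ 0ℤ mod m → f i Z.≡ 0ℤ mod m
    rest i c = Z.mtrans (step i) (Z.m0* w c)
    go : ∀ N n → n ℕ.< N → f (+ n) Z.≡ 0ℤ mod m
    go (suc N) n (ℕ.s≤s n≤N) with n ℕP.<? suc e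
    ... | yes n<e = rest (+ n) (Z.meq (trans (act-cong (𝕏 P.^ suc e) (causal-ext causal) (+ n)) (act-𝕏^-ext-< (suc e) _ n n<e)))
    ... | no n≮e = rest (+ n) (Z.m≈ (trans (act-cong (𝕏 P.^ suc e) (causal-ext causal) (+ n))
          (trans (cong (λ k → act (𝕏 P.^ suc e) (ext (λ n → f (+ n))) (+ k)) (sym n≡)) (act-𝕏^-ext (suc e) _ (n ℕ.∸ suc e))))
          refl (go N (n ℕ.∸ suc e) (ℕP.<-≤-trans (ℕP.≤-trans (ℕP.m<n+m (n ℕ.∸ suc e) (ℕ.z<s)) (ℕP.≤-reflexive n≡)) n≤N)))
      where n≡ : suc e ℕ.+ (n ℕ.∸ suc e) ≡ n
            n≡ = ℕP.m+[n∸m]≡n (ℕP.≮⇒≥ n≮e)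

  unipotent^ : ∀ w e M {f m} → Causal f → (∀ i → act (linear w (suc e) P.^ M) f i Z.≡ 0ℤ mod m) → ∀ i → f i Z.≡ 0ℤ mod m
  unipotent^ w e zero {f} causal h i = Z.m≈ (sym (ℤP.*-identityˡ (f i))) refl (h i)
  unipotent^ w e (suc M) causal h = unipotent^ w e M causal (unipotent w e (act-causal (linear w (suc e) P.^ M) causal) h)

  -- The product of 1 - jx over c < j ≤ c + m; for c = 0 it is the denominator of the Stirling
  -- series.
  blk : ℕ → ℕ → Op
  blk c zero = P.1#
  blk c (suc m) = linear (+ (c ℕ.+ suc m)) 1 ⊗ blk c m

  QQ : ℕ → Op
  QQ = blk 0

  QQ-unipotent : ∀ N {f m} → Causal f → (∀ i → act (QQ N) f i Z.≡ 0ℤ mod m) → ∀ i → f i Z.≡ 0ℤ mod m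
  QQ-unipotent zero {f} causal h i = Z.m≈ (sym (ℤP.*-identityˡ (f i))) refl (h i)
  QQ-unipotent (suc N) causal h = QQ-unipotent N causal (unipotent (+ suc N) 0 (act-causal (QQ N) causal) h)

  δ₀ : ℤ → ℤ
  δ₀ = ext (hs 0)

  linear-hs : ∀ N i → act (linear (+ suc N) 1) (ext (hs (suc N))) i ≡ ext (hs N) i
  linear-hs N (+ zero) = trans (lem (+ suc N)) (sym (hs-0 N))
    where lem : ∀ n → 1ℤ * 1ℤ + -[1+ 0 ] * (n * 0ℤ) ≡ 1ℤ
          lem = solve-∀
  linear-hs N (+ suc i) = trans (cong (λ z → 1ℤ * hs (suc N) (suc i) + -[1+ 0 ] * (+ suc N * z)) (ℤP.*-identityˡ (hs (suc N) i))) (lem (+ suc N) (hs (suc N) i) (hs N (suc i)))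
    where lem : ∀ n a b → 1ℤ * (n * a + b) + -[1+ 0 ] * (n * a) ≡ b
          lem = solve-∀
  linear-hs N -[1+ n ] = lem (+ suc N)
    where lem : ∀ n → 1ℤ * 0ℤ + -[1+ 0 ] * (n * 0ℤ) ≡ 0ℤ
          lem = solve-∀

  QQ-hs : ∀ N i → act (QQ N) (ext (hs N)) i ≡ δ₀ i
  QQ-hs zero i = ℤP.*-identityˡ (δ₀ i)
  QQ-hs (suc N) i = trans (act-comm (linear (+ suc N) 1) (QQ N) (ext (hs (suc N))) i) (trans (act-cong (QQ N) (linear-hs N) i) (QQ-hs N i))

  blk-+ : ∀ c m n → blk c (m ℕ.+ n) ≋ blk c m ⊗ blk (c ℕ.+ m) n
  blk-+ c m zero = P.trans (P.reflexive (cong (blk c) (ℕP.+-identityʳ m))) (P.sym (P.*-identityʳ (blk c m)))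
  blk-+ c m (suc n) = P.trans (P.reflexive (cong (blk c) (ℕP.+-suc m n))) (P.trans
    (P.*-cong (P.reflexive (cong (λ k → linear (+ k) 1) (trans (cong (c ℕ.+_) (sym (ℕP.+-suc m n))) (sym (ℕP.+-assoc c m (suc n)))))) (blk-+ c m n))
    (P.solve 3 (λ a b c → a P.:* (b P.:* c) P.:= b P.:* (a P.:* c)) P.refl (linear (+ ((c ℕ.+ m) ℕ.+ suc n)) 1) (blk c m) (blk (c ℕ.+ m) n)))

  -- The derivative of - blk c m in c at c = 0.
  SS : ℕ → Op
  SS zero = P.0#
  SS (suc m) = (𝕏 ⊗ QQ m) ⊕ (linear (+ suc m) 1 ⊗ SS m)

  blk-taylor : ∀ c m → blk c m P.≡ QQ m P.- (cst (+ c) ⊗ SS m) mod (cst (+ c) ⊗ cst (+ c))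
  blk-taylor c zero = P.meq (P.solve 1 (λ c → 𝟙 := 𝟙 :- c :* con 0ℤ) P.refl (cst (+ c)))
    where open P using (𝟙; con; _:*_; _:-_; _:=_)
  blk-taylor c (suc m) = P.mtrans (P.m*ˡ (linear (+ (c ℕ.+ suc m)) 1) (blk-taylor c m)) (P.by (𝕏 ⊗ SS m) (P.trans
    (P.*-congʳ (P.+-congˡ (P.-‿cong (P.*-cong (P.ιℕ+ c (suc m)) (P.*-identityʳ 𝕏)))))
    (P.trans (P.solve 5 (λ c n x q s → (𝟙 :- (c :+ n) :* x) :* (q :- c :* s) := ((𝟙 :- n :* x) :* q :- c :* (x :* q :+ (𝟙 :- n :* x) :* s)) :+ (c :* c) :* (x :* s))
        P.refl (cst (+ c)) (cst (+ suc m)) 𝕏 (QQ m) (SS m))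
      (P.+-congʳ (P.+-cong (P.*-congʳ lin) (P.-‿cong (P.*-congˡ (P.+-congˡ (P.*-congʳ lin)))))))))
    where
    open P using (𝟙; con; _:*_; _:-_; _:+_; _:=_)
    lin : P.1# P.- (cst (+ suc m) ⊗ 𝕏) P.≈ linear (+ suc m) 1
    lin = P.+-congˡ (P.-‿cong (P.*-congˡ (P.sym (P.*-identityʳ 𝕏))))

  -- The product up to (n+1)c is cut into blocks starting at 0, c, ..., nc. Each is the first block
  -- displaced by ic, so the linear terms add up to c times 0 + 1 + ... + n.
  blocks-taylor : ∀ c n → QQ (suc n ℕ.* c) P.≡ QQ c P.^ suc n P.- (cst (+ tri (suc n)) ⊗ (cst (+ c) ⊗ (SS c ⊗ QQ c P.^ n))) mod (cst (+ c) ⊗ cst (+ c))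
  blocks-taylor c zero = P.meq (P.trans (P.reflexive (cong QQ (ℕP.+-identityʳ c))) (P.solve 2 (λ q c → q := q :* 𝟙 :- con 0ℤ :* c) P.refl (QQ c) _))
    where open P using (𝟙; con; _:*_; _:-_; _:=_)
  blocks-taylor c (suc n) = P.m≈ (P.trans (P.reflexive (cong QQ (ℕP.+-comm c (suc n ℕ.* c)))) (blk-+ 0 (suc n ℕ.* c) c)) P.refl
    (P.mtrans (P.m* (blocks-taylor c n) (P.mtrans (P.mdrop (cst (+ c) ⊗ cst (+ c)) (cst (+ suc n) ⊗ cst (+ suc n)) (P.m≈m sq (blk-taylor (suc n ℕ.* c) c)))
        (P.meq (P.+-congˡ (P.-‿cong (P.*-congʳ (P.ιℕ* (suc n) c)))))))
      (P.by (cst (+ tri (suc n)) ⊗ (cst (+ suc n) ⊗ (SS c ⊗ (SS c ⊗ QQ c P.^ n))))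
        (P.trans (P.solve 6 (λ q Q t c s n → (q :* Q :- t :* (c :* (s :* Q))) :* (q :- (n :* c) :* s)
          := (q :* (q :* Q) :- (n :+ t) :* (c :* (s :* (q :* Q)))) :+ (c :* c) :* (t :* (n :* (s :* (s :* Q))))) P.refl
           (QQ c) (QQ c P.^ n) (cst (+ tri (suc n))) (cst (+ c)) (SS c) (cst (+ suc n)))
         (P.+-cong (P.+-congˡ (P.-‿cong (P.*-congʳ (P.sym (P.ιℕ+ (suc n) (tri (suc n))))))) (P.*-congˡ P.refl)))))
    where
    open P using (𝟙; con; _:*_; _:-_; _:+_; _:=_)
    sq : cst (+ (suc n ℕ.* c)) ⊗ cst (+ (suc n ℕ.* c)) P.≈ (cst (+ c) ⊗ cst (+ c)) ⊗ (cst (+ suc n) ⊗ cst (+ suc n))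
    sq = P.trans (P.*-cong (P.ιℕ* (suc n) c) (P.ιℕ* (suc n) c)) (P.solve 2 (λ n c → (n :* c) :* (n :* c) := (c :* c) :* (n :* n)) P.refl (cst (+ suc n)) (cst (+ c)))

  -- The derivation x d/dx applied to `QQ m`, by the product rule.
  θQ : ℕ → Op
  θQ zero = P.0#
  θQ (suc m) = (linear (+ suc m) 1 ⊗ θQ m) P.- (cst (+ suc m) ⊗ (𝕏 ⊗ QQ m))

  -- `SS m` is the sum over j of x times the product without 1 - jx. Writing 1 = (1 - jx) + jx turns
  -- each summand into x `QQ m` plus the matching term of -x `θQ m`.
  SS-euler : ∀ m → SS m ≋ cst (+ m) ⊗ (𝕏 ⊗ QQ m) P.- 𝕏 ⊗ θQ m
  SS-euler zero = P.solve 1 (λ x → con 0ℤ := con 0ℤ :* (x :* 𝟙) :- x :* con 0ℤ) P.refl 𝕏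
    where open P using (𝟙; con; _:*_; _:-_; _:+_; _:=_)
  SS-euler (suc m) = P.trans (P.+-congˡ (P.*-congˡ (P.trans (SS-euler m) (P.+-congʳ (P.*-congʳ m≈)))))
    (P.solve 4 (λ x j Q t → x :* Q :+ (𝟙 :- j :* (x :* 𝟙)) :* ((j :- 𝟙) :* (x :* Q) :- x :* t)
        := j :* (x :* ((𝟙 :- j :* (x :* 𝟙)) :* Q)) :- x :* ((𝟙 :- j :* (x :* 𝟙)) :* t :- j :* (x :* Q))) P.refl 𝕏 (cst (+ suc m)) (QQ m) (θQ m))
    where
    open P using (𝟙; con; _:*_; _:-_; _:+_; _:=_)
    m≈ : cst (+ m) P.≈ cst (+ suc m) P.- P.1#
    m≈ = P.trans (P.solve 1 (λ m → m := (𝟙 :+ m) :- 𝟙) P.refl (cst (+ m))) (P.+-congʳ (P.sym (P.ιℕ-suc m)))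

  -- The coefficient of x^k in `QQ m`, up to sign an elementary symmetric function of 1, ..., m.
  q : ℕ → ℕ → ℤ
  q zero zero = 1ℤ
  q zero (suc k) = 0ℤ
  q (suc m) zero = 1ℤ
  q (suc m) (suc k) = q m (suc k) - + suc m * q m k

  q-0 : ∀ m → q m 0 ≡ 1ℤ
  q-0 zero = refl
  q-0 (suc m) = refl

  q-> : ∀ m k → m ℕ.< k → q m k ≡ 0ℤ
  q-> zero (suc k) _ = refl
  q-> (suc m) (suc k) (ℕ.s≤s m<k) = trans (cong₂ (λ a b → a - + suc m * b) (q-> m (suc k) (ℕP.m<n⇒m<1+n m<k)) (q-> m k m<k)) (lem (+ suc m))
    where lem : ∀ a → 0ℤ - a * 0ℤ ≡ 0ℤ
          lem = solve-∀

  q-top : ∀ m → q m m ≡ sf m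
  q-top zero = refl
  q-top (suc m) = trans (cong₂ (λ a b → a - + suc m * b) (q-> m (suc m) ℕP.≤-refl) (q-top m)) (lem (+ suc m) (sf m))
    where lem : ∀ a b → 0ℤ - a * b ≡ - a * b
          lem = solve-∀

  poly : ℕ → (ℕ → ℤ) → Op
  poly m a = P.sum (suc m) (λ k → cst (a k) ⊗ 𝕏 P.^ k)

  poly-linear : ∀ j m a b → a (suc m) ≡ 0ℤ → b 0 ≡ a 0 → (∀ k → b (suc k) ≡ a (suc k) - j * a k) → linear j 1 ⊗ poly m a ≋ poly (suc m) b
  poly-linear j m a b top b₀ bₛ = P.sym (P.trans (P.sum-first (suc m) _) (P.trans
    (P.+-cong (P.*-congʳ (P.ι-cong b₀)) (P.trans (P.sum-cong (suc m) (λ k _ → P.trans (P.*-congʳ (P.trans (P.ι-cong (bₛ k)) (P.trans (P.ι+ (a (suc k)) (- (j * a k))) (P.+-congˡ (P.trans (P.ι- (j * a k)) (P.-‿cong (P.ι* j (a k))))))))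
         (P.solve 5 (λ A j B x X → (A :- j :* B) :* (x :* X) := A :* (x :* X) :+ (:- (j :* x)) :* (B :* X)) P.refl (cst (a (suc k))) (cst j) (cst (a k)) 𝕏 (𝕏 P.^ k))))
       (P.trans (P.sum-+ (suc m) _ _) (P.+-cong (P.trans (P.+-congˡ (P.trans (P.*-congʳ (P.ι-cong top)) (P.zeroˡ _))) (P.+-identityʳ _)) (P.sum-* (suc m) _ _)))))
    (P.trans (P.sym (P.+-assoc _ _ _)) (P.trans (P.+-congʳ (P.sym (P.sum-first m _)))
      (P.solve 3 (λ s j x → s :+ (:- (j :* x)) :* s := (𝟙 :- j :* (x :* 𝟙)) :* s) P.refl (poly m a) (cst j) 𝕏)))))
    where open P using (𝟙; con; _:*_; _:-_; :-_; _:+_; _:=_)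

  QQ-poly : ∀ m → QQ m ≋ poly m (q m)
  QQ-poly zero = P.solve 0 (𝟙 := con 0ℤ :+ con 1ℤ :* 𝟙) P.refl
    where open P using (𝟙; con; _:*_; _:+_; _:=_)
  QQ-poly (suc m) = P.trans (P.*-congˡ (QQ-poly m)) (poly-linear (+ suc m) m (q m) (q (suc m)) (q-> m (suc m) ℕP.≤-refl) (sym (q-0 m)) (λ k → refl))

  θQ-poly : ∀ m → θQ m ≋ poly m (λ k → + k * q m k)
  θQ-poly zero = P.solve 0 (con 0ℤ := con 0ℤ :+ con 0ℤ :* 𝟙) P.refl
    where open P using (𝟙; con; _:*_; _:+_; _:=_)
  θQ-poly (suc m) = P.trans (P.+-cong (P.trans (P.*-congˡ (θQ-poly m)) (poly-linear (+ suc m) m (λ k → + k * q m k) b (trans (cong (+ suc m *_) (q-> m (suc m) ℕP.≤-refl)) (ℤP.*-zeroʳ (+ suc m))) refl (λ _ → refl)))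
                                   (P.-‿cong (P.*-congˡ (P.*-congˡ (QQ-poly m)))))
    (P.trans (P.+-congˡ shifted) (P.trans (P.sym (P.sum-+ (suc (suc m)) _ _)) (P.sum-cong (suc (suc m)) coeff)))
    where
    open P using (𝟙; con; _:*_; _:-_; :-_; _:+_; _:=_)
    b b′ : ℕ → ℤ
    b zero = 0ℤ * q m 0
    b (suc k) = + suc k * q m (suc k) - + suc m * (+ k * q m k)
    b′ zero = 0ℤ
    b′ (suc k) = - (+ suc m * q m k)
    shifted : P.- (cst (+ suc m) ⊗ (𝕏 ⊗ poly m (q m))) P.≈ poly (suc m) b′
    shifted = P.sym (P.trans (P.sum-first (suc m) _) (P.trans (P.+-cong (P.trans (P.*-congʳ P.refl) (P.zeroˡ _)) (P.trans (P.sum-cong (suc m) (λ k _ → P.trans (P.*-congʳ (P.trans (P.ι- (+ suc m * q m k)) (P.-‿cong (P.ι* (+ suc m) (q m k)))))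
        (P.solve 4 (λ j Q x X → (:- (j :* Q)) :* (x :* X) := (:- (j :* x)) :* (Q :* X)) P.refl (cst (+ suc m)) (cst (q m k)) 𝕏 (𝕏 P.^ k)))) (P.sum-* (suc m) _ _)))
        (P.solve 3 (λ j x s → con 0ℤ :+ (:- (j :* x)) :* s := :- (j :* (x :* s))) P.refl (cst (+ suc m)) 𝕏 (poly m (q m)))))
    coeff : ∀ k → k ℕ.< suc (suc m) → cst (b k) ⊗ 𝕏 P.^ k ⊕ cst (b′ k) ⊗ 𝕏 P.^ k P.≈ cst (+ k * q (suc m) k) ⊗ 𝕏 P.^ k
    coeff zero _ = P.trans (P.sym (P.distribʳ (𝕏 P.^ 0) (cst (b 0)) (cst (b′ 0)))) (P.*-congʳ (P.trans (P.sym (P.ι+ (b 0) (b′ 0))) (P.ι-cong (lem (q m 0)))))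
      where lem : ∀ x → 0ℤ * x + 0ℤ ≡ 0ℤ * 1ℤ
            lem = solve-∀
    coeff (suc k) _ = P.trans (P.sym (P.distribʳ (𝕏 P.^ suc k) (cst (b (suc k))) (cst (b′ (suc k))))) (P.*-congʳ (P.trans (P.sym (P.ι+ (b (suc k)) (b′ (suc k))))
        (P.ι-cong (trans (cong (λ z → (z * q m (suc k) - + suc m * (+ k * q m k)) - + suc m * q m k) (ℤP.pos-+ 1 k)) (trans (lem (+ k) (+ suc m) (q m (suc k)) (q m k)) (cong (λ z → z * (q m (suc k) - + suc m * q m k)) (sym (ℤP.pos-+ 1 k))))))))
      where lem : ∀ k m a b → ((1ℤ + k) * a - m * (k * b)) + - (m * b) ≡ (1ℤ + k) * (a - m * b)
            lem = solve-∀

  -- w m j k is the coefficient of x^k in QQ m / (1 - jx).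
  w : ℕ → ℤ → ℕ → ℤ
  w m j zero = 1ℤ
  w m j (suc k) = q m (suc k) + j * w m j k

  private
    w-suc : ∀ m j k → w (suc m) j (suc k) ≡ w m j (suc k) - + suc m * w m j k
    w-suc m j zero = trans (cong (λ z → q m 1 - + suc m * z + j * 1ℤ) (q-0 m)) (lem (q m 1) (+ suc m) j)
      where lem : ∀ a m j → a - m * 1ℤ + j * 1ℤ ≡ a + j * 1ℤ - m * 1ℤ
            lem = solve-∀
    w-suc m j (suc k) = trans (cong (λ z → q (suc m) (suc (suc k)) + j * z) (w-suc m j k)) (lem (q m (suc (suc k))) (+ suc m) (q m (suc k)) j (w m j (suc k)) (w m j k))
      where lem : ∀ a m b j c e → (a - m * b) + j * (c - m * e) ≡ (a + j * c) - m * (b + j * e)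
            lem = solve-∀
    w-top : ∀ m k → w (suc m) (+ suc m) k ≡ q m k
    w-top m zero = sym (q-0 m)
    w-top m (suc k) = trans (cong (λ z → q m (suc k) - + suc m * q m k + + suc m * z) (w-top m k)) (lem (q m (suc k)) (+ suc m) (q m k))
      where lem : ∀ a m b → a - m * b + m * b ≡ a
            lem = solve-∀

  -- Coefficient of x^(k+1) in θQ = - Σ jx QQ/(1 - jx). The induction on m works because a new
  -- factor multiplies all old summands and adds one summand of its own.
  newton : ∀ m k → + suc k * q m (suc k) ≡ - Z.sum m (λ j → + suc j * w m (+ suc j) k)
  newton zero k = ℤP.*-zeroʳ (+ suc k)
  newton (suc m) zero = trans (lem (q m 1) (+ suc m) (q m 0)) (trans (cong₂ (λ x y → x - + suc m * y) (newton m 0) (q-0 m)) (lem₂ (Z.sum m (λ j → + suc j * 1ℤ)) (+ suc m)))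
    where lem : ∀ a m b → 1ℤ * (a - m * b) ≡ 1ℤ * a - m * b
          lem = solve-∀
          lem₂ : ∀ s m → - s - m * 1ℤ ≡ - (s + m * 1ℤ)
          lem₂ = solve-∀
  newton (suc m) (suc k) = trans (trans (cong (_* (q m (suc (suc k)) - M * q m (suc k))) (ℤP.pos-+ 1 (suc k))) (lem (+ suc k) (q m (suc (suc k))) M (q m (suc k))))
    (trans (cong₂ (λ x y → x - M * y - M * q m (suc k)) (trans (cong (_* q m (suc (suc k))) (sym (ℤP.pos-+ 1 (suc k)))) (newton m (suc k))) (newton m k))
    (trans (lem₂ (Z.sum m (λ j → + suc j * w m (+ suc j) (suc k))) M (Z.sum m (λ j → + suc j * w m (+ suc j) k)) (q m (suc k)))
     (cong -_ (sym (cong₂ _+_ (trans (Z.sum-cong m (λ j _ → trans (cong (+ suc j *_) (w-suc m (+ suc j) k)) (lem₃ (+ suc j) (w m (+ suc j) (suc k)) M (w m (+ suc j) k))))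
         (trans (Z.sum-+ m (λ j → + suc j * w m (+ suc j) (suc k)) (λ j → - M * (+ suc j * w m (+ suc j) k))) (cong (λ z → Z.sum m (λ j → + suc j * w m (+ suc j) (suc k)) + z) (Z.sum-* m (- M) (λ j → + suc j * w m (+ suc j) k)))))
        (cong (M *_) (w-top m (suc k))))))))
    where
    M = + suc m
    lem : ∀ k a m b → (1ℤ + k) * (a - m * b) ≡ (1ℤ + k) * a - m * (k * b) - m * b
    lem = solve-∀
    lem₂ : ∀ a m b c → - a - m * - b - m * c ≡ - ((a + - m * b) + m * c)
    lem₂ = solve-∀
    lem₃ : ∀ j a m b → j * (a - m * b) ≡ j * a + - m * (j * b)
    lem₃ = solve-∀

  -- The coefficient of y^τ in (1 - y)^(-M).
  hc : ℕ → ℕ → ℕ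
  hc zero zero = 1
  hc zero (suc τ) = 0
  hc (suc M) zero = 1
  hc (suc M) (suc τ) = hc M (suc τ) ℕ.+ hc (suc M) τ

  hc-0 : ∀ M → hc M 0 ≡ 1
  hc-0 zero = refl
  hc-0 (suc M) = refl

  hc-! : ∀ M τ → hc (suc M) τ ℕ.* (M ! ℕ.* τ !) ≡ (M ℕ.+ τ) !
  hc-! M zero = trans (ℕP.+-identityʳ _) (trans (ℕP.*-identityʳ (M !)) (cong _! (sym (ℕP.+-identityʳ M))))
  hc-! zero (suc τ) = trans (lem (hc 1 τ) (suc τ) (τ !)) (cong (suc τ ℕ.*_) (hc-! 0 τ))
    where lem : ∀ a b c → a ℕ.* (1 ℕ.* (b ℕ.* c)) ≡ b ℕ.* (a ℕ.* (1 ℕ.* c))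
          lem = ℕ-solve-∀
  hc-! (suc M) (suc τ) = trans (lem (hc (suc M) (suc τ)) (hc (suc (suc M)) τ) (suc M) (suc τ) (M !) (τ !))
    (trans (cong₂ (λ x y → suc M ℕ.* x ℕ.+ suc τ ℕ.* y) (hc-! M (suc τ)) (trans (hc-! (suc M) τ) (cong _! (sym (ℕP.+-suc M τ)))))
     (trans (sym (ℕP.*-distribʳ-+ ((M ℕ.+ suc τ) !) (suc M) (suc τ))) refl))
    where lem : ∀ a b m t M T → (a ℕ.+ b) ℕ.* ((m ℕ.* M) ℕ.* (t ℕ.* T)) ≡ m ℕ.* (a ℕ.* (M ℕ.* (t ℕ.* T))) ℕ.+ t ℕ.* (b ℕ.* ((m ℕ.* M) ℕ.* T))
          lem = ℕ-solve-∀

  rf : ℕ → ℕ → ℕ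
  rf zero τ = 1
  rf (suc M) τ = (suc M ℕ.+ τ) ℕ.* rf M τ

  rf-! : ∀ M τ → rf M τ ℕ.* τ ! ≡ (M ℕ.+ τ) !
  rf-! zero τ = ℕP.+-identityʳ (τ !)
  rf-! (suc M) τ = trans (ℕP.*-assoc (suc M ℕ.+ τ) (rf M τ) (τ !)) (cong ((suc M ℕ.+ τ) ℕ.*_) (rf-! M τ))

  -- M! times the coefficient is the polynomial (τ+1)...(τ+M), so for M < p its residue modulo p
  -- depends on τ modulo p only.
  hc-rf : ∀ M τ → hc (suc M) τ ℕ.* M ! ≡ rf M τ
  hc-rf M τ = ℕP.*-cancelʳ-≡ (hc (suc M) τ ℕ.* M !) (rf M τ) (τ !) {{τ ℕP.!≢0}}
    (trans (ℕP.*-assoc (hc (suc M) τ) (M !) (τ !)) (trans (hc-! M τ) (sym (rf-! M τ))))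

  rf-mod : ∀ M {τ τ′ m} → + τ Z.≡ + τ′ mod m → + rf M τ Z.≡ + rf M τ′ mod m
  rf-mod zero c = Z.mrefl
  rf-mod (suc M) {τ} {τ′} c = Z.m≈ (Z.ιℕ* (suc M ℕ.+ τ) (rf M τ)) (Z.ιℕ* (suc M ℕ.+ τ′) (rf M τ′))
    (Z.m* (Z.m≈ (Z.ιℕ+ (suc M) τ) (Z.ιℕ+ (suc M) τ′) (Z.m+ˡ (+ suc M) c)) (rf-mod M c))

  module Spread (d′ : ℕ) where
    private d = suc d′

    -- The coefficient of x^i in (1 - x^d)^(-M).
    Hn : ℕ → ℕ → ℤ
    Hn M i = if does (i % d ℕ.≟ 0) then + hc M (i / d) else 0ℤ

    H : ℕ → ℤ → ℤ
    H M = ext (Hn M)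

    R : Op
    R = linear 1ℤ d

    Hn-multiple : ∀ M τ → Hn M (τ ℕ.* d) ≡ + hc M τ
    Hn-multiple M τ = trans (if-yes (τ ℕ.* d % d ℕ.≟ 0) (m*n%n≡0 τ d)) (cong (λ t → + hc M t) (m*n/n≡m τ d))

    Hn-other : ∀ M k τ → 0 ℕ.< k → k ℕ.< d → Hn M (k ℕ.+ τ ℕ.* d) ≡ 0ℤ
    Hn-other M k τ 0<k k<d = if-no ((k ℕ.+ τ ℕ.* d) % d ℕ.≟ 0)
      (λ e → ℕP.<⇒≢ 0<k (sym (trans (sym (m<n⇒m%n≡m k<d)) (trans (sym ([m+kn]%n≡m%n k τ d)) e))))

    private
      Hn-< : ∀ M i → i ℕ.< d → Hn (suc M) i ≡ Hn M i
      Hn-< M i i<d = cong (λ z → if does (i % d ℕ.≟ 0) then + z else 0ℤ)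
        (trans (cong (hc (suc M)) (m<n⇒m/n≡0 i<d)) (trans (sym (hc-0 M)) (cong (hc M) (sym (m<n⇒m/n≡0 i<d)))))

      Hn-step : ∀ M i → Hn (suc M) (d ℕ.+ i) ≡ Hn M (d ℕ.+ i) + Hn (suc M) i
      Hn-step M i = go (i % d ℕ.≟ 0)
        where
        %≡ : (d ℕ.+ i) % d ≡ i % d
        %≡ = trans (cong (λ z → z % d) (ℕP.+-comm d i)) ([m+n]%n≡m%n i d)
        /≡ : (d ℕ.+ i) / d ≡ suc (i / d)
        /≡ = trans (+-distrib-/-∣ˡ {d} i {d} ∣-refl) (cong (λ z → z ℕ.+ i / d) (n/n≡1 d))
        go : Dec (i % d ≡ 0) → Hn (suc M) (d ℕ.+ i) ≡ Hn M (d ℕ.+ i) + Hn (suc M) i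
        go (yes e) = trans (if-yes ((d ℕ.+ i) % d ℕ.≟ 0) (trans %≡ e)) (trans (trans (cong (λ t → + hc (suc M) t) /≡) (ℤP.pos-+ (hc M (suc (i / d))) (hc (suc M) (i / d))))
          (sym (cong₂ _+_ (trans (if-yes ((d ℕ.+ i) % d ℕ.≟ 0) (trans %≡ e)) (cong (λ t → + hc M t) /≡)) (if-yes (i % d ℕ.≟ 0) e))))
        go (no ¬e) = trans (if-no ((d ℕ.+ i) % d ℕ.≟ 0) (λ e → ¬e (trans (sym %≡) e)))
          (sym (cong₂ _+_ (if-no ((d ℕ.+ i) % d ℕ.≟ 0) (λ e → ¬e (trans (sym %≡) e))) (if-no (i % d ℕ.≟ 0) ¬e)))

    R-H : ∀ M i → act R (H (suc M)) i ≡ H M i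
    R-H M -[1+ n ] = act-causal R {H (suc M)} (ext-causal (Hn (suc M))) n
    R-H M (+ i) with i ℕP.<? d
    ... | yes i<d = trans (cong (λ z → 1ℤ * Hn (suc M) i + -[1+ 0 ] * (1ℤ * z)) (act-𝕏^-ext-< d (Hn (suc M)) i i<d))
                      (trans (lem (Hn (suc M) i)) (Hn-< M i i<d))
      where lem : ∀ a → 1ℤ * a + -[1+ 0 ] * (1ℤ * 0ℤ) ≡ a
            lem = solve-∀
    ... | no i≮d = subst (λ i → act R (H (suc M)) (+ i) ≡ H M (+ i)) (ℕP.m+[n∸m]≡n (ℕP.≮⇒≥ i≮d))
          (trans (cong₂ (λ y z → 1ℤ * y + -[1+ 0 ] * (1ℤ * z)) (Hn-step M i′) (act-𝕏^-ext d (Hn (suc M)) i′)) (lem (Hn M (d ℕ.+ i′)) (Hn (suc M) i′)))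
      where i′ = i ℕ.∸ d
            lem : ∀ a b → 1ℤ * (a + b) + -[1+ 0 ] * (1ℤ * b) ≡ a
            lem = solve-∀

    R^-H : ∀ k M i → act (R P.^ k) (H (k ℕ.+ M)) i ≡ H M i
    R^-H zero M i = ℤP.*-identityˡ (H M i)
    R^-H (suc k) M i = trans (act-comm R (R P.^ k) (H (suc (k ℕ.+ M))) i) (trans (act-cong (R P.^ k) (R-H (k ℕ.+ M)) i) (R^-H k M i))

    H-0 : ∀ i → H 0 i ≡ δ₀ i
    H-0 -[1+ n ] = refl
    H-0 (+ zero) = refl
    H-0 (+ suc i) = go (suc i % d ℕ.≟ 0)
      where
      go : Dec (suc i % d ≡ 0) → Hn 0 (suc i) ≡ 0ℤ
      go (no ¬e) = if-no (suc i % d ℕ.≟ 0) ¬e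
      go (yes e) = trans (if-yes (suc i % d ℕ.≟ 0) e) (cong +_ (hc-pos (suc i / d) (λ z → contradiction (trans (m≡m%n+[m/n]*n (suc i) d) (cong₂ (λ a b → a ℕ.+ b ℕ.* d) e z)) λ ())))
        where hc-pos : ∀ t → t ≢ 0 → hc 0 t ≡ 0
              hc-pos zero t≢0 = contradiction refl t≢0
              hc-pos (suc t) _ = refl

-- Power sums, cancellation modulo p^n, and the coefficients of (1 - x)...(1 - (p-1)x).

module PrimeUnits where

  open GenericAlgebra
  open ShiftOperators
  open FleckQuotients
  open StirlingSeries
  open import Data.Nat using (_!)
  open import Data.Nat.Primality using (euclidsLemma; prime⇒irreducible)
  open import Data.Nat.DivMod using (_/_; _%_; m≡m%n+[m/n]*n; m%n<n)
  open import Data.Nat.Induction using (<-rec)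
  open import Data.Integer using (ℤ; +_; _+_; _*_; -_; _-_; 0ℤ; 1ℤ; ∣_∣)

  psum : ℕ → ℕ → ℤ
  psum k m = Z.sum m (λ j → (+ j) Z.^ k)

  -- Telescoping of (j+1)^(k+1) - j^(k+1) over j < m.
  psum-rec : ∀ k m → Z.sum (suc k) (λ i → + bin (suc k) i * psum i m) ≡ (+ m) Z.^ suc k
  psum-rec k zero = trans (Z.sum-0 (suc k) (λ i _ → ℤP.*-zeroʳ (+ bin (suc k) i))) (sym (ℤP.*-zeroˡ (0ℤ Z.^ k)))
  psum-rec k (suc m) = begin
    Z.sum (suc k) (λ i → + bin (suc k) i * (psum i m + (+ m) Z.^ i))
      ≡⟨ Z.sum-cong (suc k) (λ i _ → ℤP.*-distribˡ-+ (+ bin (suc k) i) (psum i m) ((+ m) Z.^ i)) ⟩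
    Z.sum (suc k) (λ i → + bin (suc k) i * psum i m + + bin (suc k) i * (+ m) Z.^ i)
      ≡⟨ Z.sum-+ (suc k) _ _ ⟩
    Z.sum (suc k) (λ i → + bin (suc k) i * psum i m) + Z.sum (suc k) (λ i → + bin (suc k) i * (+ m) Z.^ i)
      ≡⟨ cong (_+ X) (psum-rec k m) ⟩
    (+ m) Z.^ suc k + X
      ≡⟨ lem ((+ m) Z.^ suc k) X ⟩
    X + 1ℤ * (+ m) Z.^ suc k
      ≡⟨ cong (λ z → X + + z * (+ m) Z.^ suc k) (sym (bin-n (suc k))) ⟩
    X + + bin (suc k) (suc k) * (+ m) Z.^ suc k
      ≡⟨ Z.binomial (suc k) (+ m) ⟨
    (1ℤ + + m) Z.^ suc k
      ≡⟨ cong (Z._^ suc k) (ℤP.pos-+ 1 m) ⟨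
    (+ suc m) Z.^ suc k ∎
    where
    open ≡-Reasoning
    X = Z.sum (suc k) (λ i → + bin (suc k) i * (+ m) Z.^ i)
    lem : ∀ a b → a + b ≡ b + 1ℤ * a
    lem = solve-∀

  prime-odd : ∀ d′ → Prime (suc (suc d′)) → suc (suc d′) ≢ 2 → ∃ λ h → suc d′ ≡ h ℕ.+ h
  prime-odd d′ pr p≢2 = go (suc d′ % 2) (m%n<n (suc d′) 2) (m≡m%n+[m/n]*n (suc d′) 2)
    where
    k = suc d′ / 2
    2k : k ℕ.* 2 ≡ k ℕ.+ k
    2k = trans (ℕP.*-comm k 2) (cong (k ℕ.+_) (ℕP.+-identityʳ k))
    go : ∀ m → m ℕ.< 2 → suc d′ ≡ m ℕ.+ k ℕ.* 2 → ∃ λ h → suc d′ ≡ h ℕ.+ h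
    go zero _ e = k , trans e 2k
    go (suc zero) _ e with prime⇒irreducible pr (ℕD.divides (suc k) (cong suc e))
    ... | inj₂ e′ = contradiction (sym e′) p≢2
    go (suc (suc m)) (ℕ.s≤s (ℕ.s≤s ())) _

  module Units (d : ℕ) (pr : Prime (suc d)) where
    private
      p = suc d
      𝕡 = + p

    unit-cancel₁ : ∀ u x → ¬ (p ℕD.∣ ∣ u ∣) → u * x Z.≡ 0ℤ mod 𝕡 → x Z.≡ 0ℤ mod 𝕡
    unit-cancel₁ u x p∤u c with euclidsLemma ∣ u ∣ ∣ x ∣ pr (subst (p ℕD.∣_) (ℤP.abs-* u x) (mod⇒∣ {p} {u * x} c))
    ... | inj₁ p∣u = contradiction p∣u p∤u
    ... | inj₂ p∣x = ∣⇒mod {p} {x} p∣x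

    unit-cancel : ∀ n u x → ¬ (p ℕD.∣ ∣ u ∣) → u * x Z.≡ 0ℤ mod (𝕡 Z.^ n) → x Z.≡ 0ℤ mod (𝕡 Z.^ n)
    unit-cancel zero u x _ _ = Z.by x (sym (trans (ℤP.+-identityˡ (1ℤ * x)) (ℤP.*-identityˡ x)))
    unit-cancel (suc n) u x p∤u (Z.by q e) with unit-cancel₁ u x p∤u (Z.by (𝕡 Z.^ n * q) (trans e (cong (λ z → 0ℤ + z) (ℤP.*-assoc 𝕡 (𝕡 Z.^ n) q))))
    ... | Z.by x′ f = Z.m≈ (trans f (ℤP.+-identityˡ (𝕡 * x′))) (sym (ℤP.*-zeroʳ 𝕡))
        (Z.mscale 𝕡 (unit-cancel n u x′ p∤u (Z.by q (ℤP.*-cancelˡ-≡ 𝕡 (u * x′) (0ℤ + 𝕡 Z.^ n * q)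
          (trans (lem 𝕡 u x′) (trans (cong (u *_) (sym f)) (trans e (lem₂ 𝕡 (𝕡 Z.^ n) q))))))))
      where
      lem : ∀ p u x → p * (u * x) ≡ u * (0ℤ + p * x)
      lem = solve-∀
      lem₂ : ∀ p c q → 0ℤ + p * c * q ≡ p * (0ℤ + c * q)
      lem₂ = solve-∀

    unit-cancel≡ : ∀ n u x y → ¬ (p ℕD.∣ ∣ u ∣) → u * x Z.≡ u * y mod (𝕡 Z.^ n) → x Z.≡ y mod (𝕡 Z.^ n)
    unit-cancel≡ n u x y p∤u c = Z.mdiff (unit-cancel n u (x - y) p∤u (Z.m≈ (lem u x y) refl (Z.mdiff⁻ c)))
      where lem : ∀ u x y → u * (x - y) ≡ u * x - u * y
            lem = solve-∀

    p^-cancel : ∀ e j x → 𝕡 Z.^ e * x Z.≡ 0ℤ mod (𝕡 Z.^ (e ℕ.+ j)) → x Z.≡ 0ℤ mod (𝕡 Z.^ j)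
    p^-cancel zero j x c = Z.m≈ (sym (ℤP.*-identityˡ x)) refl c
    p^-cancel (suc e) j x (Z.by q f) = p^-cancel e j x (Z.by q (ℤP.*-cancelˡ-≡ 𝕡 (𝕡 Z.^ e * x) (0ℤ + 𝕡 Z.^ (e ℕ.+ j) * q)
      (trans (sym (ℤP.*-assoc 𝕡 (𝕡 Z.^ e) x)) (trans f (lem 𝕡 (𝕡 Z.^ (e ℕ.+ j)) q)))))
      where lem : ∀ p c q → 0ℤ + p * c * q ≡ p * (0ℤ + c * q)
            lem = solve-∀

    p^-cancel≡ : ∀ e j x y → 𝕡 Z.^ e * x Z.≡ 𝕡 Z.^ e * y mod (𝕡 Z.^ (e ℕ.+ j)) → x Z.≡ y mod (𝕡 Z.^ j)
    p^-cancel≡ e j x y c = Z.mdiff (p^-cancel e j (x - y) (Z.m≈ (lem (𝕡 Z.^ e) x y) refl (Z.mdiff⁻ c)))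
      where lem : ∀ u x y → u * (x - y) ≡ u * x - u * y
            lem = solve-∀

    small-unit : ∀ k → 0 ℕ.< k → k ℕ.< p → ¬ (p ℕD.∣ k)
    small-unit (suc k) _ k<p p∣k = ℕP.<⇒≱ k<p (ℕD.∣⇒≤ p∣k)

    *-unit : ∀ {a b} → ¬ (p ℕD.∣ a) → ¬ (p ℕD.∣ b) → ¬ (p ℕD.∣ a ℕ.* b)
    *-unit {a} {b} p∤a p∤b p∣ab with euclidsLemma a b pr p∣ab
    ... | inj₁ x = p∤a x
    ... | inj₂ x = p∤b x

    !-unit : ∀ k → k ℕ.< p → ¬ (p ℕD.∣ k !)
    !-unit zero _ p∣1 = small-unit 1 (ℕ.z<s) (1<p pr) p∣1
      where 1<p : ∀ {d} → Prime (suc d) → 1 ℕ.< suc d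
            1<p {suc d} _ = ℕ.s≤s (ℕ.z<s)
            1<p {zero} pr = contradiction pr Data.Nat.Primality.¬prime[1]
    !-unit (suc k) k<p = *-unit {suc k} {k !} (small-unit (suc k) (ℕ.z<s) k<p) (!-unit k (ℕP.<-trans ℕP.≤-refl k<p))

    -- In `psum-rec` all lower sums vanish by induction, and the coefficient k + 1 of the last one
    -- is less than p.
    psum-mod-p : ∀ {m} → + m Z.≡ 0ℤ mod 𝕡 → ∀ k → k ℕ.< d → psum k m Z.≡ 0ℤ mod 𝕡
    psum-mod-p {m} m≡0 = <-rec (λ k → k ℕ.< d → psum k m Z.≡ 0ℤ mod 𝕡) step
      where
      step : ∀ k → (∀ {i} → i ℕ.< k → i ℕ.< d → psum i m Z.≡ 0ℤ mod 𝕡) → k ℕ.< d → psum k m Z.≡ 0ℤ mod 𝕡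
      step k ih k<d = unit-cancel₁ (+ bin (suc k) k) (psum k m) unit
        (Z.m≈ (lem (Z.sum k (λ i → + bin (suc k) i * psum i m)) (+ bin (suc k) k * psum k m)) refl
          (Z.m- {x = Z.sum (suc k) (λ i → + bin (suc k) i * psum i m)} {y = 0ℤ} (Z.m≈ (psum-rec k m) refl (Z.m*0 ((+ m) Z.^ k) m≡0))
                (Z.sum-0m k (λ i i<k → Z.m0* (+ bin (suc k) i) (ih i<k (ℕP.<-trans i<k k<d))))))
        where
        lem : ∀ a b → b ≡ (a + b) - a
        lem = solve-∀
        bin-k : ∀ k → bin (suc k) k ≡ suc k
        bin-k zero = refl
        bin-k (suc k) = trans (cong₂ ℕ._+_ (bin-k k) (bin-n (suc k))) (ℕP.+-comm (suc k) 1)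
        unit : ¬ (p ℕD.∣ bin (suc k) k)
        unit = subst (λ z → ¬ (p ℕD.∣ z)) (sym (bin-k k)) (small-unit (suc k) (ℕ.z<s) (ℕ.s≤s k<d))

    fermat : ∀ j → (+ j) Z.^ p Z.≡ + j mod 𝕡
    fermat zero = Z.meq (ℤP.*-zeroˡ (0ℤ Z.^ d))
    fermat (suc j) = Z.m≈ (cong (Z._^ p) (ℤP.pos-+ 1 j)) (ℤP.pos-+ 1 j) (Z.mtrans (Z.freshman pr (+ j)) (Z.m+ˡ 1ℤ (fermat j)))

    fermat′ : ∀ j → ¬ (p ℕD.∣ j) → (+ j) Z.^ d Z.≡ 1ℤ mod 𝕡
    fermat′ j p∤j = Z.mdiff (unit-cancel₁ (+ j) ((+ j) Z.^ d - 1ℤ) p∤j (Z.m≈ (lem (+ j) ((+ j) Z.^ d)) refl (Z.mdiff⁻ (fermat j))))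
      where lem : ∀ j x → j * (x - 1ℤ) ≡ j * x - j
            lem = solve-∀

  module Coeffs (d : ℕ) (pr : Prime (suc d)) where
    open Units d pr
    private
      p = suc d
      𝕡 = + p

    𝕡≡0 : 𝕡 Z.≡ 0ℤ mod 𝕡
    𝕡≡0 = Z.by 1ℤ (sym (trans (ℤP.+-identityˡ (𝕡 * 1ℤ)) (ℤP.*-identityʳ 𝕡)))

    psum⁺ : ℕ → ℤ
    psum⁺ a = Z.sum d (λ j → (+ suc j) Z.^ a)

    psum⁺≡ : ∀ a → psum⁺ (suc a) ≡ psum (suc a) p
    psum⁺≡ a = sym (trans (Z.sum-first d (λ j → (+ j) Z.^ suc a)) (trans (cong (_+ psum⁺ (suc a)) (ℤP.*-zeroˡ (0ℤ Z.^ a))) (ℤP.+-identityˡ (psum⁺ (suc a)))))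

    psum⁺-mod-p : ∀ a → suc a ℕ.< d → psum⁺ (suc a) Z.≡ 0ℤ mod 𝕡
    psum⁺-mod-p a a<d = Z.m≈ (psum⁺≡ a) refl (psum-mod-p {p} 𝕡≡0 (suc a) a<d)

    private
      -- The right sides of Newton's identities with an extra weight j^a. Unfolding `w` once raises
      -- a, lowers k, and splits off a coefficient times a power sum.
      W : ℕ → ℕ → ℤ
      W a k = Z.sum d (λ j → (+ suc j) Z.^ a * w d (+ suc j) k)

      W-0 : ∀ a → W a 0 ≡ psum⁺ a
      W-0 a = Z.sum-cong d (λ j _ → ℤP.*-identityʳ ((+ suc j) Z.^ a))

      W-suc : ∀ a k → W a (suc k) ≡ q d (suc k) * psum⁺ a + W (suc a) k
      W-suc a k = trans (Z.sum-cong d (λ j _ → lem ((+ suc j) Z.^ a) (q d (suc k)) (+ suc j) (w d (+ suc j) k)))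
        (trans (Z.sum-+ d (λ j → q d (suc k) * (+ suc j) Z.^ a) (λ j → (+ suc j) Z.^ suc a * w d (+ suc j) k))
          (cong (_+ W (suc a) k) (Z.sum-* d (q d (suc k)) (λ j → (+ suc j) Z.^ a))))
        where lem : ∀ A q j w → A * (q + j * w) ≡ q * A + (j * A) * w
              lem = solve-∀

      newton-W : ∀ k → + suc k * q d (suc k) ≡ - W 1 k
      newton-W k = trans (newton d k) (cong -_ (Z.sum-cong d (λ j _ → cong (_* w d (+ suc j) k) (sym (ℤP.*-identityʳ (+ suc j))))))

      W-mod-p : ∀ a k → suc a ℕ.+ k ℕ.≤ d → W (suc a) k Z.≡ psum⁺ (suc a ℕ.+ k) mod 𝕡
      W-mod-p a zero _ = Z.meq (trans (W-0 (suc a)) (cong psum⁺ (sym (ℕP.+-identityʳ (suc a)))))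
      W-mod-p a (suc k) le = Z.m≈ (W-suc (suc a) k) (trans (cong psum⁺ (ℕP.+-suc (suc a) k)) (sym (ℤP.+-identityˡ (psum⁺ (suc (suc a) ℕ.+ k)))))
        (Z.m+ (Z.m0* (q d (suc k)) (psum⁺-mod-p a (ℕP.≤-trans (ℕ.s≤s (ℕ.s≤s (ℕP.m≤m+n a k))) le′))) (W-mod-p (suc a) k le′))
        where le′ : suc (suc a) ℕ.+ k ℕ.≤ d
              le′ = ℕP.≤-trans (ℕP.≤-reflexive (sym (ℕP.+-suc (suc a) k))) le

    -- Newton's identity expresses the coefficient by power sums with exponents below p - 1.
    -- Together with `q-top-mod-p` this says that `QQ d` is 1 - x^(p-1) modulo p.
    q-mod-p : ∀ k → suc k ℕ.< d → q d (suc k) Z.≡ 0ℤ mod 𝕡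
    q-mod-p k k<d = unit-cancel₁ (+ suc k) (q d (suc k)) (small-unit (suc k) (ℕ.z<s) (ℕP.m<n⇒m<1+n k<d))
      (Z.m≈ (newton-W k) refl (Z.mneg {y = 0ℤ} (Z.mtrans (W-mod-p 0 k (ℕP.<⇒≤ k<d)) (psum⁺-mod-p k k<d))))

    -- Here the power sum that remains has exponent p - 1, and by Fermat it counts the p - 1 units.
    q-top-mod-p : 0 ℕ.< d → q d d Z.≡ - 1ℤ mod 𝕡
    q-top-mod-p 0<d = top d refl 0<d
      where
      sum-one : ∀ n → Z.sum n (λ _ → 1ℤ) ≡ + n
      sum-one zero = refl
      sum-one (suc n) = trans (cong (_+ 1ℤ) (sum-one n)) (trans (ℤP.+-comm (+ n) 1ℤ) (sym (ℤP.pos-+ 1 n)))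
      top : ∀ k → k ≡ d → 0 ℕ.< k → q d k Z.≡ - 1ℤ mod 𝕡
      top (suc k) e _ = Z.mdiff (unit-cancel₁ (+ suc k) (q d (suc k) - - 1ℤ) (small-unit (suc k) (ℕ.z<s) (ℕ.s≤s (ℕP.≤-reflexive e)))
        (Z.m≈ (trans (lem (+ suc k) (q d (suc k))) (cong (λ z → z + + suc k) (newton-W k))) (sym (ℤP.+-inverseˡ (+ suc k)))
          (Z.m+ʳ (+ suc k) (Z.mneg (Z.mtrans (W-mod-p 0 k (ℕP.≤-reflexive e)) (Z.mtrans
            (Z.sum-mod d (λ j j<d → Z.m≈ (cong ((+ suc j) Z.^_) e) refl (fermat′ (suc j) (small-unit (suc j) (ℕ.z<s) (ℕ.s≤s j<d)))))
            (Z.meq (trans (sum-one d) (cong +_ (sym e))))))))))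
        where lem : ∀ a b → a * (b - - 1ℤ) ≡ a * b + a
              lem = solve-∀

    private
      W-mod-p² : ∀ a k → suc a ℕ.+ k ℕ.< d → W (suc a) k Z.≡ psum⁺ (suc a ℕ.+ k) mod (𝕡 Z.^ 2)
      W-mod-p² a zero _ = Z.meq (trans (W-0 (suc a)) (cong psum⁺ (sym (ℕP.+-identityʳ (suc a)))))
      W-mod-p² a (suc k) le = Z.m≈ (W-suc (suc a) k) (trans (cong psum⁺ (ℕP.+-suc (suc a) k)) (sym (ℤP.+-identityˡ (psum⁺ (suc (suc a) ℕ.+ k)))))
        (Z.m+ (Z.m^00 𝕡 1 1 (Z.m^1⁻ 𝕡 (q-mod-p k (ℕP.≤-trans (ℕ.s≤s (ℕ.s≤s (ℕP.m≤n+m k (suc a)))) le′))) (Z.m^1⁻ 𝕡 (psum⁺-mod-p a (ℕP.≤-trans (ℕ.s≤s (ℕ.s≤s (ℕP.m≤m+n a k))) (ℕP.<⇒≤ le′))))) (W-mod-p² (suc a) k le′))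
        where le′ : suc (suc a) ℕ.+ k ℕ.< d
              le′ = ℕP.≤-trans (ℕP.≤-reflexive (cong suc (sym (ℕP.+-suc (suc a) k)))) le

    -- What is dropped from Newton's identity are products of a coefficient and a power sum, both
    -- divisible by p.
    q-mod-p² : ∀ k → suc k ℕ.< d → + suc k * q d (suc k) Z.≡ - psum (suc k) p mod (𝕡 Z.^ 2)
    q-mod-p² k k<d = Z.m≈ (newton-W k) (cong -_ (sym (psum⁺≡ k))) (Z.mneg (W-mod-p² 0 k k<d))

-- The localisation of ℤ at p inside ℚ, and its link with `CongModPow`.

module Localisation where

  open import Defs
  open GenericAlgebra
  open ShiftOperators using (module Z)
  open PrimeUnits using (module Units)
  open import Algebra.Bundles using (CommutativeRing)
  open import Algebra.Solver.Ring.AlmostCommutativeRing using (_-Raw-AlmostCommutative⟶_; fromCommutativeRing)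
  import Data.Nat.Coprimality as Cop
  open import Data.Integer as ℤ using (ℤ; +_; -[1+_]; ∣_∣)
  open import Data.Rational as ℚ using (ℚ; mkℚ; 0ℚ; 1ℚ; _+_; _*_; -_; _-_)
  open import Data.Rational.Unnormalised as ℚᵘ using (mkℚᵘ; *≡*)
  import Data.Rational.Unnormalised.Properties as ℚᵘP
  import Data.Rational.Properties as ℚP
  open import Level using (0ℓ)

  private
    toᵘ : ∀ z → ℚ.toℚᵘ (ℤ→ℚ z) ℚᵘ.≃ mkℚᵘ z 0
    toᵘ z = ℚP.toℚᵘ-fromℚᵘ (mkℚᵘ z 0)

  ℤ→ℚ-+ : ∀ x y → ℤ→ℚ (x ℤ.+ y) ≡ ℤ→ℚ x + ℤ→ℚ y
  ℤ→ℚ-+ x y = ℚP.toℚᵘ-injective (ℚᵘP.≃-trans (toᵘ (x ℤ.+ y)) (ℚᵘP.≃-sym (ℚᵘP.≃-trans (ℚP.toℚᵘ-homo-+ (ℤ→ℚ x) (ℤ→ℚ y))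
    (ℚᵘP.≃-trans (ℚᵘP.+-cong (toᵘ x) (toᵘ y)) (*≡* (cong (ℤ._* + 1) (cong₂ ℤ._+_ (ℤP.*-identityʳ x) (ℤP.*-identityʳ y))))))))

  ℤ→ℚ-* : ∀ x y → ℤ→ℚ (x ℤ.* y) ≡ ℤ→ℚ x * ℤ→ℚ y
  ℤ→ℚ-* x y = ℚP.toℚᵘ-injective (ℚᵘP.≃-trans (toᵘ (x ℤ.* y)) (ℚᵘP.≃-sym (ℚᵘP.≃-trans (ℚP.toℚᵘ-homo-* (ℤ→ℚ x) (ℤ→ℚ y))
    (ℚᵘP.*-cong (toᵘ x) (toᵘ y)))))

  ℤ→ℚ-neg : ∀ x → ℤ→ℚ (ℤ.- x) ≡ - ℤ→ℚ x
  ℤ→ℚ-neg x = ℚP.toℚᵘ-injective (ℚᵘP.≃-trans (toᵘ (ℤ.- x)) (ℚᵘP.≃-sym (ℚᵘP.≃-trans (ℚP.toℚᵘ-homo‿- (ℤ→ℚ x)) (ℚᵘP.-‿cong (toᵘ x)))))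

  ℤ→ℚ-injective : ∀ {x y} → ℤ→ℚ x ≡ ℤ→ℚ y → x ≡ y
  ℤ→ℚ-injective {x} {y} e with ℚᵘP.≃-trans (ℚᵘP.≃-sym (toᵘ x)) (ℚᵘP.≃-trans (ℚᵘP.≃-reflexive (cong ℚ.toℚᵘ e)) (toᵘ y))
  ... | *≡* e′ = trans (sym (ℤP.*-identityʳ x)) (trans e′ (ℤP.*-identityʳ y))

  ℚ-hom : CommutativeRing.rawRing ℤP.+-*-commutativeRing -Raw-AlmostCommutative⟶ fromCommutativeRing ℚP.+-*-commutativeRing
  ℚ-hom = record { ⟦_⟧ = ℤ→ℚ ; +-homo = ℤ→ℚ-+ ; *-homo = ℤ→ℚ-* ; -‿homo = ℤ→ℚ-neg ; 0-homo = refl ; 1-homo = refl }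

  module Q = Gen ℚP.+-*-commutativeRing ℚ-hom

  inv-* : ∀ x → x ≢ 0ℚ → inv x * x ≡ 1ℚ
  inv-* x@(mkℚ (+ zero) _ _) x≢0 = contradiction (ℚP.↥p≡0⇒p≡0 x refl) x≢0
  inv-* x@(mkℚ (+ suc n) _ _) _ = ℚP.*-inverseˡ x
  inv-* x@(mkℚ -[1+ n ] _ _) _ = ℚP.*-inverseˡ x

  1≢0 : 1ℚ ≢ 0ℚ
  1≢0 ()

  ℤ→ℚ-≢0 : ∀ z → z ≢ + 0 → ℤ→ℚ z ≢ 0ℚ
  ℤ→ℚ-≢0 z z≢0 e = z≢0 (ℤ→ℚ-injective {z} {+ 0} e)

  ℤ→ℚ-^ : ∀ z n → ℤ→ℚ z ^ℚ n ≡ ℤ→ℚ (z Z.^ n)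
  ℤ→ℚ-^ z zero = refl
  ℤ→ℚ-^ z (suc n) = trans (cong (ℤ→ℚ z *_) (ℤ→ℚ-^ z n)) (sym (ℤ→ℚ-* z (z Z.^ n)))

  module Local (d : ℕ) (pr : Prime (suc d)) where
    open Units d pr
    private
      p = suc d

    -- A rational together with some fraction for it, not necessarily reduced, whose denominator is
    -- prime to p; the ring operations then need no gcd.
    record ℤ₍ₚ₎ : Set where
      no-eta-equality
      field
        val : ℚ
        num : ℤ
        den : ℕ
        den-unit : ¬ (p ℕD.∣ den)
        val-eq : val * ℤ→ℚ (+ den) ≡ ℤ→ℚ num
    open ℤ₍ₚ₎ public

    1-unit : ¬ (p ℕD.∣ 1)
    1-unit = !-unit 0 (ℕ.z<s)

    infixl 6 _⊹_
    infixl 7 _∙_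
    _⊹_ _∙_ : ℤ₍ₚ₎ → ℤ₍ₚ₎ → ℤ₍ₚ₎
    val (x ⊹ y) = val x + val y
    num (x ⊹ y) = num x ℤ.* + den y ℤ.+ num y ℤ.* + den x
    den (x ⊹ y) = den x ℕ.* den y
    den-unit (x ⊹ y) = *-unit (den-unit x) (den-unit y)
    val-eq (x ⊹ y) = trans (cong ((val x + val y) *_) (trans (cong ℤ→ℚ (ℤP.pos-* (den x) (den y))) (ℤ→ℚ-* (+ den x) (+ den y))))
      (trans (Q.solve 4 (λ x y m n → (x Q.:+ y) Q.:* (m Q.:* n) Q.:= (x Q.:* m) Q.:* n Q.:+ (y Q.:* n) Q.:* m) refl (val x) (val y) (ℤ→ℚ (+ den x)) (ℤ→ℚ (+ den y)))
      (trans (cong₂ (λ u v → u * ℤ→ℚ (+ den y) + v * ℤ→ℚ (+ den x)) (val-eq x) (val-eq y))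
        (sym (trans (ℤ→ℚ-+ (num x ℤ.* + den y) (num y ℤ.* + den x)) (cong₂ _+_ (ℤ→ℚ-* (num x) (+ den y)) (ℤ→ℚ-* (num y) (+ den x)))))))
    val (x ∙ y) = val x * val y
    num (x ∙ y) = num x ℤ.* num y
    den (x ∙ y) = den x ℕ.* den y
    den-unit (x ∙ y) = *-unit (den-unit x) (den-unit y)
    val-eq (x ∙ y) = trans (cong ((val x * val y) *_) (trans (cong ℤ→ℚ (ℤP.pos-* (den x) (den y))) (ℤ→ℚ-* (+ den x) (+ den y))))
      (trans (Q.solve 4 (λ x y m n → (x Q.:* y) Q.:* (m Q.:* n) Q.:= (x Q.:* m) Q.:* (y Q.:* n)) refl (val x) (val y) (ℤ→ℚ (+ den x)) (ℤ→ℚ (+ den y)))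
      (trans (cong₂ _*_ (val-eq x) (val-eq y)) (sym (ℤ→ℚ-* (num x) (num y)))))

    ⊖_ : ℤ₍ₚ₎ → ℤ₍ₚ₎
    val (⊖ x) = - val x
    num (⊖ x) = ℤ.- num x
    den (⊖ x) = den x
    den-unit (⊖ x) = den-unit x
    val-eq (⊖ x) = trans (Q.solve 2 (λ x m → (Q.:- x) Q.:* m Q.:= Q.:- (x Q.:* m)) refl (val x) (ℤ→ℚ (+ den x))) (trans (cong -_ (val-eq x)) (sym (ℤ→ℚ-neg (num x))))

    int : ℤ → ℤ₍ₚ₎
    val (int z) = ℤ→ℚ z
    num (int z) = z
    den (int z) = 1
    den-unit (int z) = 1-unit
    val-eq (int z) = ℚP.*-identityʳ (ℤ→ℚ z)

    infix 4 _≐_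
    record _≐_ (x y : ℤ₍ₚ₎) : Set where
      constructor ≐-by
      field val≡ : val x ≡ val y
    open _≐_ public

    ring : CommutativeRing 0ℓ 0ℓ
    ring = record
      { Carrier = ℤ₍ₚ₎ ; _≈_ = _≐_ ; _+_ = _⊹_ ; _*_ = _∙_ ; -_ = ⊖_ ; 0# = int (+ 0) ; 1# = int (+ 1)
      ; isCommutativeRing = record
        { isRing = record
          { +-isAbelianGroup = record
            { isGroup = record
              { isMonoid = record
                { isSemigroup = record
                  { isMagma = record
                    { isEquivalence = record
                      { refl = ≐-by refl
                      ; sym = λ e → ≐-by (sym (val≡ e))
                      ; trans = λ e f → ≐-by (trans (val≡ e) (val≡ f)) }
                    ; ∙-cong = λ e f → ≐-by (cong₂ _+_ (val≡ e) (val≡ f)) }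
                  ; assoc = λ x y z → ≐-by (ℚP.+-assoc (val x) (val y) (val z)) }
                ; identity = (λ x → ≐-by (ℚP.+-identityˡ (val x))) , (λ x → ≐-by (ℚP.+-identityʳ (val x))) }
              ; inverse = (λ x → ≐-by (ℚP.+-inverseˡ (val x))) , (λ x → ≐-by (ℚP.+-inverseʳ (val x)))
              ; ⁻¹-cong = λ e → ≐-by (cong -_ (val≡ e)) }
            ; comm = λ x y → ≐-by (ℚP.+-comm (val x) (val y)) }
          ; *-cong = λ e f → ≐-by (cong₂ _*_ (val≡ e) (val≡ f))
          ; *-assoc = λ x y z → ≐-by (ℚP.*-assoc (val x) (val y) (val z))
          ; *-identity = (λ x → ≐-by (ℚP.*-identityˡ (val x))) , (λ x → ≐-by (ℚP.*-identityʳ (val x)))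
          ; distrib = (λ x y z → ≐-by (ℚP.*-distribˡ-+ (val x) (val y) (val z))) , (λ x y z → ≐-by (ℚP.*-distribʳ-+ (val x) (val y) (val z))) }
        ; *-comm = λ x y → ≐-by (ℚP.*-comm (val x) (val y)) } }

    int-hom : CommutativeRing.rawRing ℤP.+-*-commutativeRing -Raw-AlmostCommutative⟶ fromCommutativeRing ring
    int-hom = record { ⟦_⟧ = int ; +-homo = λ x y → ≐-by (ℤ→ℚ-+ x y) ; *-homo = λ x y → ≐-by (ℤ→ℚ-* x y) ; -‿homo = λ x → ≐-by (ℤ→ℚ-neg x)
                     ; 0-homo = ≐-by refl ; 1-homo = ≐-by refl }

    module L = Gen ring int-hom

    val-^ : ∀ x n → val (x L.^ n) ≡ val x ^ℚ n
    val-^ x zero = refl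
    val-^ x (suc n) = cong (val x *_) (val-^ x n)

    int-^ : ∀ z n → int z L.^ n ≐ int (z Z.^ n)
    int-^ z n = ≐-by (trans (val-^ (int z) n) (ℤ→ℚ-^ z n))

    int-mod : ∀ {x y m} → x Z.≡ y mod m → int x L.≡ int y mod int m
    int-mod {x} {y} {m} (Z.by r e) = L.by (int r) (L.trans (L.ι-cong e) (L.trans (L.ι+ y (m ℤ.* r)) (L.+-congˡ (L.ι* m r))))

    int-mod^ : ∀ n {x y} → x Z.≡ y mod ((+ p) Z.^ n) → int x L.≡ int y mod (int (+ p) L.^ n)
    int-mod^ n c = L.m≈m (L.sym (int-^ (+ p) n)) (int-mod c)

    inverse : (z : ℤ) → ¬ (p ℕD.∣ ∣ z ∣) → ℤ₍ₚ₎
    val (inverse z u) = inv (ℤ→ℚ z)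
    num (inverse z u) = ℤ.sign z ℤ.◃ 1
    den (inverse z u) = ∣ z ∣
    den-unit (inverse z u) = u
    val-eq (inverse z u) = lem z u
      where
      lem : ∀ z → ¬ (p ℕD.∣ ∣ z ∣) → inv (ℤ→ℚ z) * ℤ→ℚ (+ ∣ z ∣) ≡ ℤ→ℚ (ℤ.sign z ℤ.◃ 1)
      lem (+ zero) u = contradiction (p ℕD.∣0) u
      lem z@(+ suc n) u = inv-* (ℤ→ℚ z) (ℤ→ℚ-≢0 z λ ())
      lem z@(-[1+ n ]) u = trans (cong (inv (ℤ→ℚ z) *_) (ℤ→ℚ-neg z)) (trans (sym (ℚP.neg-distribʳ-* (inv (ℤ→ℚ z)) (ℤ→ℚ z))) (cong -_ (inv-* (ℤ→ℚ z) (ℤ→ℚ-≢0 z λ ()))))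

    inverse-* : ∀ z u → inverse z u ∙ int z ≐ int (+ 1)
    inverse-* z u = ≐-by (inv-* (ℤ→ℚ z) (ℤ→ℚ-≢0 z (λ z≡0 → u (subst (λ z → p ℕD.∣ ∣ z ∣) (sym z≡0) (p ℕD.∣0)))))

    unit-cancel-L : ∀ {x y m} z → ¬ (p ℕD.∣ ∣ z ∣) → int z ∙ x L.≡ int z ∙ y mod m → x L.≡ y mod m
    unit-cancel-L {x} {y} z u c = L.m≈ (e x) (e y) (L.m*ˡ (inverse z u) c)
      where e : ∀ x → x L.≈ inverse z u ∙ (int z ∙ x)
            e x = L.sym (L.trans (L.sym (L.*-assoc (inverse z u) (int z) x)) (L.trans (L.*-congʳ (inverse-* z u)) (L.*-identityˡ x)))

    -- The reduced denominator is coprime to the numerator and so divides every denominator of the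
    -- same number.
    integral : ∀ (x : ℤ₍ₚ₎) → IsPAdicInt p (val x)
    integral x = go (val x) (num x) (den x) (den-unit x) (val-eq x)
     where
     go : ∀ v a m → ¬ (p ℕD.∣ m) → v * ℤ→ℚ (+ m) ≡ ℤ→ℚ a → IsPAdicInt p v
     go v@(mkℚ n d-1 cop) a m mu ex p∣d = mu (ℕD.∣-trans p∣d d∣m)
      where
      eqᵘ : n ℤ.* + m ≡ a ℤ.* + suc d-1
      eqᵘ with ℚᵘP.≃-trans (ℚᵘP.≃-sym (ℚᵘP.*-cong (ℚᵘP.≃-refl {mkℚᵘ n d-1}) (toᵘ (+ m)))) (ℚᵘP.≃-trans (ℚᵘP.≃-sym (ℚP.toℚᵘ-homo-* v (ℤ→ℚ (+ m)))) (ℚᵘP.≃-trans (ℚᵘP.≃-reflexive (cong ℚ.toℚᵘ ex)) (toᵘ a)))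
      ... | *≡* e = trans (sym (ℤP.*-identityʳ (n ℤ.* + m))) (trans e (cong (a ℤ.*_) (cong +_ (trans (ℕP.*-identityʳ (suc d-1)) refl))))
      d∣nm : suc d-1 ℕD.∣ ∣ n ∣ ℕ.* m
      d∣nm = ℕD.divides ∣ a ∣ (trans (sym (ℤP.abs-* n (+ m))) (trans (cong ∣_∣ eqᵘ) (ℤP.abs-* a (+ suc d-1))))
      d∣m : suc d-1 ℕD.∣ m
      d∣m = Cop.coprime-divisor (Cop.sym (Cop.recompute cop)) d∣nm

    -- The quotient carried by the congruence is exactly the rational whose integrality `CongModPow`
    -- demands.
    congruence : ∀ {x y} e → x L.≡ y mod (int (+ p) L.^ e) → CongModPow p e (val x) (val y)
    congruence {x} {y} e (L.by r eq) = subst (IsPAdicInt p) (sym value) (integral r)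
      where
      P = ℤ→ℚ ((+ p) Z.^ e)
      P≡ : ℕ→ℚ (p ℕ.^ e) ≡ P
      P≡ = cong ℤ→ℚ (Z.ιℕ^ p e)
      valP : val (int (+ p) L.^ e) ≡ P
      valP = val≡ (int-^ (+ p) e)
      invP : inv P * P ≡ 1ℚ
      invP = inv-* P (λ e₀ → ℤ→ℚ-≢0 (+ (p ℕ.^ e)) (λ z → contradiction (ℤP.+-injective z) (ℕ.≢-nonZero⁻¹ (p ℕ.^ e) {{ℕP.m^n≢0 p e}})) (trans P≡ e₀))
      value : (val x - val y) * inv (ℕ→ℚ (p ℕ.^ e)) ≡ val r
      value = trans (cong₂ (λ a b → (a - val y) * inv b) (trans (val≡ eq) (cong (λ z → val y + z * val r) valP)) P≡)
        (trans (Q.solve 4 (λ y P r i → ((y Q.:+ P Q.:* r) Q.:- y) Q.:* i Q.:= (i Q.:* P) Q.:* r) refl (val y) P (val r) (inv P))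
          (trans (cong (_* val r) invP) (ℚP.*-identityˡ (val r))))

-- Bernoulli numbers as leading terms of power sums.

module BernoulliNumbers where

  open import Defs
  open GenericAlgebra
  open ShiftOperators using (module Z)
  open PrimeUnits
  open Localisation
  open import Data.Nat using (_!; _∸_)
  open import Data.Nat.Combinatorics using (_C_)
  open import Data.Nat.Induction using (<-rec)
  open import Data.Integer as ℤ using (ℤ; +_; ∣_∣)
  open import Data.List using (_∷_; length)
  open import Data.Rational as ℚ using (ℚ; 0ℚ; 1ℚ; _+_; _*_; -_; _-_)
  import Data.Rational.Properties as ℚP

  sumFrom≡ : ∀ a n f → sumFrom a n f ≡ Q.sum n (λ k → f (a ℕ.+ k))
  sumFrom≡ a zero f = refl
  sumFrom≡ a (suc n) f = trans (cong₂ _+_ (cong f (sym (ℕP.+-identityʳ a))) (trans (sumFrom≡ (suc a) n f) (Q.sum-cong n (λ k _ → cong f (sym (ℕP.+-suc a k))))))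
    (sym (Q.sum-first n (λ k → f (a ℕ.+ k))))

  private
    lookup-tail : ∀ y ys j → j ℕ.< length ys → lookupRev (y ∷ ys) j ≡ lookupRev ys j
    lookup-tail y ys j j< with length ys ∸ j | length ys ∸ suc j | ℕP.suc-pred (length ys ∸ j) {{ℕ.>-nonZero (ℕP.m<n⇒0<n∸m j<)}} | ℕP.pred[m∸n]≡m∸[1+n] (length ys) j
    ... | suc k | .k | _ | refl = refl

    lookup-head : ∀ y ys → lookupRev (y ∷ ys) (length ys) ≡ y
    lookup-head y ys with length ys ∸ length ys | ℕP.n∸n≡0 (length ys)
    ... | .0 | refl = refl

    length-bern : ∀ m → length (bernList m) ≡ suc m
    length-bern zero = refl
    length-bern (suc m) = cong suc (length-bern m)

    lookup-bern : ∀ m j → j ℕ.≤ m → lookupRev (bernList m) j ≡ B j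
    lookup-bern zero zero _ = refl
    lookup-bern (suc m) j j≤ = go (j ℕ.≟ suc m)
      where
      go : Dec (j ≡ suc m) → lookupRev (bernList (suc m)) j ≡ B j
      go (yes refl) = refl
      go (no j≢) = trans (lookup-tail _ (bernList m) j (subst (j ℕ.<_) (sym (length-bern m)) (ℕP.≤∧≢⇒< j≤ j≢))) (lookup-bern m j (ℕP.≤-pred (ℕP.≤∧≢⇒< j≤ j≢)))

    bin-pred : ∀ k → bin (suc k) k ≡ suc k
    bin-pred zero = refl
    bin-pred (suc k) = trans (cong₂ ℕ._+_ (bin-pred k) (bin-n (suc k))) (ℕP.+-comm (suc k) 1)

    lookup-last : ∀ m y → lookupRev (y ∷ bernList m) (suc m) ≡ y
    lookup-last m y = trans (cong (lookupRev (y ∷ bernList m)) (sym (length-bern m))) (lookup-head y (bernList m))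

  B-suc : ∀ m → B (suc m) ≡ - (inv (ℕ→ℚ (suc (suc m))) * Q.sum (suc m) (λ i → ℕ→ℚ (bin (suc (suc m)) i) * B i))
  B-suc m = trans (lookup-last m _) (cong (λ z → - (inv (ℕ→ℚ (suc (suc m))) * z)) (trans (sumFrom≡ 0 (suc m) _)
    (Q.sum-cong (suc m) (λ i i≤m → cong₂ (λ a b → ℕ→ℚ a * b) (sym (bin≡C (suc (suc m)) i)) (lookup-bern m i (ℕP.≤-pred i≤m))))))

  ℕ→ℚ-suc≢0 : ∀ n → ℕ→ℚ (suc n) ≢ 0ℚ
  ℕ→ℚ-suc≢0 n = ℤ→ℚ-≢0 (+ suc n) λ ()

  bernoulli-rec : ∀ m → Q.sum (suc (suc m)) (λ i → ℕ→ℚ (bin (suc (suc m)) i) * B i) ≡ 0ℚ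
  bernoulli-rec m = trans (cong (λ z → S + z) (cong₂ (λ a b → ℕ→ℚ a * b) (bin-pred (suc m)) (B-suc m)))
    (trans (Q.solve 3 (λ s n i → s Q.:+ n Q.:* (Q.:- (i Q.:* s)) Q.:= s Q.:+ (Q.:- ((i Q.:* n) Q.:* s))) refl S (ℕ→ℚ (suc (suc m))) (inv (ℕ→ℚ (suc (suc m)))))
      (trans (cong (λ z → S + - (z * S)) (inv-* (ℕ→ℚ (suc (suc m))) (ℕ→ℚ-suc≢0 (suc m)))) (trans (cong (λ z → S + - z) (ℚP.*-identityˡ S)) (ℚP.+-inverseʳ S))))
    where S = Q.sum (suc m) (λ i → ℕ→ℚ (bin (suc (suc m)) i) * B i)

  -- The deviation of a power sum from the leading term m B_k of Faulhaber's formula.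
  dev : ℕ → ℕ → ℚ
  dev k m = ℤ→ℚ (psum k m) - ℕ→ℚ m * B k

  dev-0 : ∀ m → dev 0 m ≡ 0ℚ
  dev-0 m = trans (cong (λ z → ℤ→ℚ z - ℕ→ℚ m * 1ℚ) (trans (Z.sum-const m (+ 1)) (ℤP.*-identityʳ (+ m)))) (trans (cong (λ z → ℕ→ℚ m - z) (ℚP.*-identityʳ (ℕ→ℚ m))) (ℚP.+-inverseʳ (ℕ→ℚ m)))

  private
    ℤsum≡ : ∀ n f → ℤsum n f ≡ Z.sum n f
    ℤsum≡ zero f = refl
    ℤsum≡ (suc n) f = cong (ℤ._+ f n) (ℤsum≡ n f)

  -- The power sums and the numbers m B_i enter recursions with the same binomial coefficients, and
  -- the one for m B_i adds up to zero.
  dev-rec : ∀ k m → ℕ→ℚ (suc (suc k)) * dev (suc k) m ≡ ℤ→ℚ ((+ m) Z.^ suc (suc k)) - Q.sum (suc k) (λ i → ℕ→ℚ (bin (suc (suc k)) i) * dev i m)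
  dev-rec k m = trans (cong (λ n → ℕ→ℚ n * dev (suc k) m) (sym (bin-pred (suc k)))) (trans (Q.solve 2 (λ s x → x Q.:= (s Q.:+ x) Q.:- s) refl S _) (cong (λ z → z - S) total))
    where
    b : ℕ → ℚ
    b i = ℕ→ℚ (bin (suc (suc k)) i)
    S = Q.sum (suc k) (λ i → b i * dev i m)
    total : Q.sum (suc (suc k)) (λ i → b i * dev i m) ≡ ℤ→ℚ ((+ m) Z.^ suc (suc k))
    total = trans (Q.sum-cong (suc (suc k)) (λ i _ → Q.solve 4 (λ b p m B → b Q.:* (p Q.:- m Q.:* B) Q.:= b Q.:* p Q.:+ (Q.:- m) Q.:* (b Q.:* B)) refl (b i) (ℤ→ℚ (psum i m)) (ℕ→ℚ m) (B i)))
      (trans (Q.sum-+ (suc (suc k)) _ _) (trans (cong₂ _+_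
        (trans (Q.sum-cong (suc (suc k)) (λ i _ → sym (ℤ→ℚ-* (+ bin (suc (suc k)) i) (psum i m)))) (trans (Q.sum-ι (suc (suc k)) (λ i → + bin (suc (suc k)) i ℤ.* psum i m)) (cong ℤ→ℚ (trans (ℤsum≡ (suc (suc k)) _) (psum-rec (suc k) m)))))
        (trans (Q.sum-* (suc (suc k)) (- ℕ→ℚ m) (λ i → b i * B i)) (trans (cong (- ℕ→ℚ m *_) (bernoulli-rec k)) (ℚP.*-zeroʳ (- ℕ→ℚ m)))))
        (ℚP.+-identityʳ _)))

  private
    Div : ℕ → ℚ → Set
    Div m x = ∃ λ D → x ≡ ℕ→ℚ m * ℕ→ℚ m * ℤ→ℚ D

    div-0 : ∀ m → Div m 0ℚ
    div-0 m = + 0 , sym (ℚP.*-zeroʳ (ℕ→ℚ m * ℕ→ℚ m))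

    div-+ : ∀ m x y → Div m x → Div m y → Div m (x + y)
    div-+ m x y (D , e) (D′ , e′) = D ℤ.+ D′ , trans (cong₂ _+_ e e′) (trans (sym (ℚP.*-distribˡ-+ (ℕ→ℚ m * ℕ→ℚ m) (ℤ→ℚ D) (ℤ→ℚ D′))) (cong (ℕ→ℚ m * ℕ→ℚ m *_) (sym (ℤ→ℚ-+ D D′))))

    div-sum : ∀ m n f → (∀ i → i ℕ.< n → Div m (f i)) → Div m (Q.sum n f)
    div-sum m zero f h = div-0 m
    div-sum m (suc n) f h = div-+ m (Q.sum n f) (f n) (div-sum m n f (λ i i<n → h i (ℕP.m<n⇒m<1+n i<n))) (h n ℕP.≤-refl)

    div-* : ∀ m z x → Div m x → Div m (ℤ→ℚ z * x)
    div-* m z x (D , e) = z ℤ.* D , trans (cong (ℤ→ℚ z *_) e) (trans (Q.solve 3 (λ z m D → z Q.:* (m Q.:* D) Q.:= m Q.:* (z Q.:* D)) refl (ℤ→ℚ z) (ℕ→ℚ m * ℕ→ℚ m) (ℤ→ℚ D))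
      (cong (ℕ→ℚ m * ℕ→ℚ m *_) (sym (ℤ→ℚ-* z D))))

    div-- : ∀ m x y → Div m x → Div m y → Div m (x - y)
    div-- m x y (D , e) (D′ , e′) = D ℤ.+ ℤ.- D′ , trans (cong₂ _-_ e e′) (trans (Q.solve 3 (λ m D D′ → m Q.:* D Q.:- m Q.:* D′ Q.:= m Q.:* (D Q.:+ (Q.:- D′))) refl (ℕ→ℚ m * ℕ→ℚ m) (ℤ→ℚ D) (ℤ→ℚ D′))
      (cong (ℕ→ℚ m * ℕ→ℚ m *_) (trans (cong (λ z → ℤ→ℚ D + z) (sym (ℤ→ℚ-neg D′))) (sym (ℤ→ℚ-+ D (ℤ.- D′))))))

  -- The remaining terms of Faulhaber's formula have the factor m^2. The recursion introduces the
  -- divisors 2, ..., k + 1, one at each stage, and (k+1)! clears them.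
  dev-divisible : ∀ m k → Div m (ℕ→ℚ (suc k !) * dev k m)
  dev-divisible m = <-rec (λ k → Div m (ℕ→ℚ (suc k !) * dev k m)) step
    where
    step : ∀ k → (∀ {i} → i ℕ.< k → Div m (ℕ→ℚ (suc i !) * dev i m)) → Div m (ℕ→ℚ (suc k !) * dev k m)
    step zero ih = subst (Div m) (sym (trans (cong (ℕ→ℚ 1 *_) (dev-0 m)) (ℚP.*-zeroʳ (ℕ→ℚ 1)))) (div-0 m)
    step (suc k) ih = subst (Div m) (sym eq) (div-- m _ _ (div-* m (+ (suc k !)) _ ((+ m) Z.^ k , power))
        (div-sum m (suc k) _ (λ i i≤k → subst (Div m) (rearrange i i≤k) (div-* m (+ bin (suc (suc k)) i) _ (div-* m (+ quot i i≤k) _ (ih i≤k))))))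
      where
      power : ℤ→ℚ ((+ m) Z.^ suc (suc k)) ≡ ℕ→ℚ m * ℕ→ℚ m * ℤ→ℚ ((+ m) Z.^ k)
      power = trans (ℤ→ℚ-* (+ m) ((+ m) Z.^ suc k)) (trans (cong (ℕ→ℚ m *_) (ℤ→ℚ-* (+ m) ((+ m) Z.^ k))) (sym (ℚP.*-assoc (ℕ→ℚ m) (ℕ→ℚ m) (ℤ→ℚ ((+ m) Z.^ k)))))
      quot : ∀ i → i ℕ.< suc k → ℕ
      quot i i≤k = ℕD._∣_.quotient (ℕD.m≤n⇒m!∣n! i≤k)
      rearrange : ∀ i i≤k → ℤ→ℚ (+ bin (suc (suc k)) i) * (ℤ→ℚ (+ quot i i≤k) * (ℕ→ℚ (suc i !) * dev i m)) ≡ ℕ→ℚ (suc k !) * (ℕ→ℚ (bin (suc (suc k)) i) * dev i m)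
      rearrange i i≤k = trans (Q.solve 4 (λ b c f x → b Q.:* (c Q.:* (f Q.:* x)) Q.:= (c Q.:* f) Q.:* (b Q.:* x)) refl (ℤ→ℚ (+ bin (suc (suc k)) i)) (ℤ→ℚ (+ quot i i≤k)) (ℕ→ℚ (suc i !)) (dev i m))
        (cong (_* (ℕ→ℚ (bin (suc (suc k)) i) * dev i m)) (trans (sym (Q.ιℕ* (quot i i≤k) (suc i !))) (cong ℕ→ℚ (sym (ℕD._∣_.equality (ℕD.m≤n⇒m!∣n! i≤k))))))
      eq : ℕ→ℚ (suc (suc k) !) * dev (suc k) m ≡ ℤ→ℚ (+ (suc k !)) * ℤ→ℚ ((+ m) Z.^ suc (suc k)) - Q.sum (suc k) (λ i → ℕ→ℚ (suc k !) * (ℕ→ℚ (bin (suc (suc k)) i) * dev i m))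
      eq = trans (cong (_* dev (suc k) m) (Q.ιℕ* (suc (suc k)) (suc k !))) (trans (Q.solve 3 (λ a f x → (a Q.:* f) Q.:* x Q.:= f Q.:* (a Q.:* x)) refl (ℕ→ℚ (suc (suc k))) (ℕ→ℚ (suc k !)) (dev (suc k) m))
        (trans (cong (ℕ→ℚ (suc k !) *_) (dev-rec k m)) (trans (Q.solve 3 (λ f a s → f Q.:* (a Q.:- s) Q.:= f Q.:* a Q.:- f Q.:* s) refl (ℕ→ℚ (suc k !)) (ℤ→ℚ ((+ m) Z.^ suc (suc k))) _)
          (cong (λ z → ℕ→ℚ (suc k !) * ℤ→ℚ ((+ m) Z.^ suc (suc k)) - z) (sym (Q.sum-* (suc k) (ℕ→ℚ (suc k !)) (λ i → ℕ→ℚ (bin (suc (suc k)) i) * dev i m)))))))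

-- Theory at a fixed odd prime p = d′ + 2 = 2h + 1.

module OddPrime (d′ h : ℕ) (pr : Prime (suc (suc d′))) (d≡h+h : suc d′ ≡ h ℕ.+ h) where

  -- The Stirling series for N = p^B s modulo p^B and for N = ps modulo p^2.

  module SeriesModPrimePowers where

    open GenericAlgebra
    open ShiftOperators
    open FleckQuotients
    open StirlingSeries
    open PrimeUnits
    open import Data.Integer using (ℤ; +_; -[1+_]; _+_; _*_; -_; _-_; 0ℤ; 1ℤ)

    cst-mod : ∀ {x y m} → x Z.≡ y mod m → cst x P.≡ cst y mod cst m
    cst-mod {x} {y} {m} (Z.by r e) = P.by (cst r) (P.trans (P.ι-cong e) (P.trans (P.ι+ y (m * r)) (P.+-congˡ (P.ι* m r))))

    act-diff : ∀ o f g i → act o (λ j → f j - g j) i ≡ act o f i - act o g i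
    act-diff o f g i = trans (act-cong o (λ j → cong (λ z → f j + z) (sym (ℤP.-1*i≡-i (g j)))) i)
      (trans (act-+ o f (λ j → -[1+ 0 ] * g j) i) (cong (λ z → act o f i + z) (trans (act-* o -[1+ 0 ] g i) (ℤP.-1*i≡-i (act o g i)))))

    module Vals where
      d = suc d′
      open Fleck d h pr d≡h+h public
      open Units d pr public
      open Coeffs d pr public
      open Spread d′ public

      0<d′ : 0 ℕ.< d′
      0<d′ = go d′ h d≡h+h
        where go : ∀ d′ h → suc d′ ≡ h ℕ.+ h → 0 ℕ.< d′
              go (suc d′) h _ = ℕ.z<s
              go zero (suc h) e = contradiction (ℕP.suc-injective e) (λ e′ → ℕP.<⇒≢ (ℕP.≤-trans (ℕ.z<s) (ℕP.m≤n+m (suc h) h)) e′)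

      1<d : 1 ℕ.< d
      1<d = ℕ.s≤s 0<d′

      cp : Op
      cp = cst 𝕡

      cp≡0 : cp P.≡ P.0# mod cp
      cp≡0 = cst-mod 𝕡≡0

      -- The deviation of `QQ d` from 1 - x^(p-1); all its coefficients are multiples of p.
      pw : Op
      pw = P.sum d′ (λ k → cst (q d (suc k)) ⊗ 𝕏 P.^ suc k) ⊕ cst (q d d + 1ℤ) ⊗ 𝕏 P.^ d

      QQ-d : QQ d ≋ R ⊕ pw
      QQ-d = P.trans (QQ-poly d) (P.trans (P.+-congʳ (P.trans (P.sum-first d′ _) (P.+-congʳ (P.*-congʳ (P.ι-cong (q-0 d))))))
        (P.trans (P.solve 3 (λ S c X → (con 1ℤ :* 𝟙 :+ S) :+ c :* X := (𝟙 :- con 1ℤ :* X) :+ (S :+ (c :+ con 1ℤ) :* X)) P.refl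
           (P.sum d′ (λ k → cst (q d (suc k)) ⊗ 𝕏 P.^ suc k)) (cst (q d d)) (𝕏 P.^ d))
          (P.+-congˡ (P.+-congˡ (P.*-congʳ (P.sym (P.ι+ (q d d) 1ℤ)))))))
        where open P using (𝟙; con; _:*_; _:-_; _:+_; _:=_)

      q-top+1 : q d d + 1ℤ Z.≡ 0ℤ mod 𝕡
      q-top+1 = Z.m+ʳ 1ℤ (q-top-mod-p (ℕ.z<s))

      pw≡0 : pw P.≡ P.0# mod cp
      pw≡0 = P.mtrans (P.m+ (P.sum-0m d′ (λ k k<d′ → P.m*0 (𝕏 P.^ suc k) (cst-mod (q-mod-p k (ℕ.s≤s k<d′))))) (P.m*0 (𝕏 P.^ d) (cst-mod q-top+1))) (P.meq (P.+-identityˡ P.0#))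

      linear-p : linear 𝕡 1 P.≡ P.1# mod cp
      linear-p = P.mtrans (P.m+ˡ P.1# (P.mneg {y = P.0#} (P.m*0 (𝕏 P.^ 1) cp≡0))) (P.meq (P.solve 0 (𝟙 :- con 0ℤ := 𝟙) P.refl))
        where open P using (𝟙; con; _:-_; _:=_)

      QQ-p-mod : QQ p P.≡ R mod cp
      QQ-p-mod = P.mtrans (P.m* linear-p (P.mtrans (P.meq QQ-d) (P.m+ˡ R pw≡0))) (P.meq (P.trans (P.*-identityˡ (R ⊕ P.0#)) (P.+-identityʳ R)))

      cp^ : ∀ n → cst (+ (p ℕ.^ n)) P.≈ cp P.^ n
      cp^ n = P.ιℕ^ p n

      -- Of p blocks of length c = p^(B+1), the linear correction has the factor c p(p-1)/2, hence
      -- pc as p is odd; the p-th power of the inductive congruence gains a factor p as well.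
      QQ-p^-mod : ∀ B → QQ (p ℕ.^ suc B) P.≡ R P.^ (p ℕ.^ B) mod (cp P.^ suc B)
      QQ-p^-mod zero = P.m^1⁻ cp (P.m≈ (P.reflexive (cong QQ (ℕP.*-identityʳ p))) (P.*-identityʳ R) QQ-p-mod)
      QQ-p^-mod (suc B) = P.mtrans (P.mtrans blocks drop) (P.m≈ P.refl (P.trans (P.^-congʳ R (ℕP.*-comm p (p ℕ.^ B))) (P.sym (P.^-assocʳ R (p ℕ.^ B) p))) (P.pow-lift p B (QQ-p^-mod B)))
        where
        c = p ℕ.^ suc B
        X = SS c ⊗ QQ c P.^ d
        blocks : QQ (p ℕ.* c) P.≡ QQ c P.^ p P.- cst (+ tri p) ⊗ (cst (+ c) ⊗ X) mod (cp P.^ suc (suc B))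
        blocks = P.m^-weaken cp (suc (suc B)) (suc B ℕ.+ suc B) (ℕ.s≤s (ℕP.m≤n+m (suc B) B))
          (P.m≈m (P.trans (P.*-cong (cp^ (suc B)) (cp^ (suc B))) (P.sym (P.^-homo-* cp (suc B) (suc B)))) (blocks-taylor c d))
        drop : QQ c P.^ p P.- cst (+ tri p) ⊗ (cst (+ c) ⊗ X) P.≡ QQ c P.^ p mod (cp P.^ suc (suc B))
        drop = P.mtrans (P.m+ˡ (QQ c P.^ p) (P.mneg {y = P.0#} (P.m^00 cp 1 (suc B)
            (P.m^1⁻ cp (P.by (cst (+ h)) (P.trans (P.ι-cong (cong +_ tri-odd)) (P.trans (P.ιℕ* p h) (P.sym (P.+-identityˡ (cp ⊗ cst (+ h))))))))
            (P.by X (P.trans (P.*-congʳ (cp^ (suc B))) (P.sym (P.+-identityˡ _)))))))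
          (P.meq (P.solve 1 (λ x → x :- con 0ℤ := x) P.refl (QQ c P.^ p)))
          where open P using (con; _:-_; _:=_)

      QQ-sp^-mod : ∀ s′ B → QQ (suc s′ ℕ.* p ℕ.^ suc B) P.≡ R P.^ (p ℕ.^ B ℕ.* suc s′) mod (cp P.^ suc B)
      QQ-sp^-mod s′ B = P.mtrans (P.m≈m (cp^ (suc B)) (P.mdrop (cst (+ c)) (cst (+ c)) (blocks-taylor c s′))) (P.mtrans
        (P.m+ (P.mpow (suc s′) (QQ-p^-mod B)) (P.mneg {y = P.0#} (P.m0* (cst (+ tri (suc s′))) (P.by (SS c ⊗ QQ c P.^ s′) (P.trans (P.*-congʳ (cp^ (suc B))) (P.sym (P.+-identityˡ _)))))))
        (P.meq (P.trans (P.solve 1 (λ x → x :- con 0ℤ := x) P.refl _) (P.^-assocʳ R (p ℕ.^ B) (suc s′)))))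
        where
        c = p ℕ.^ suc B
        open P using (con; _:-_; _:=_)

      -- Both series are inverses, of `QQ` and of R^M, and these agree modulo p^(B+1); R^M may be
      -- cancelled because it is invertible on power series.
      hs-mod : ∀ s′ B i → hs (suc s′ ℕ.* p ℕ.^ suc B) i Z.≡ Hn (p ℕ.^ B ℕ.* suc s′) i mod (𝕡 Z.^ suc B)
      hs-mod s′ B i = Z.mdiff (unipotent^ 1ℤ d′ M {λ j → ext (hs N) j - H M j} (λ n → refl) (λ j → Z.m≈ (act-diff (R P.^ M) (ext (hs N)) (H M) j) refl (Z.mdiff⁻
          (Z.mtrans (Z.msym (mod-act^ 𝕡 (suc B) (QQ-sp^-mod s′ B) (ext (hs N)) j)) (Z.meq (trans (QQ-hs N j) (trans (sym (H-0 j)) (trans (sym (R^-H M 0 j)) (cong (λ m → act (R P.^ M) (H m) j) (ℕP.+-identityʳ M)))))))))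
        (+ i))
        where
        N = suc s′ ℕ.* p ℕ.^ suc B
        M = p ℕ.^ B ℕ.* suc s′

      -- First-order deviation of `QQ p` = (1 - px) `QQ d` from R; the product of px with `pw` is
      -- already a multiple of p^2.
      zz : Op
      zz = pw P.- cp ⊗ (𝕏 ⊗ R)

      zz≡0 : zz P.≡ P.0# mod cp
      zz≡0 = P.mtrans (P.m- pw≡0 (P.m*0 (𝕏 ⊗ R) cp≡0)) (P.meq (P.-‿inverseʳ P.0#))

      QQ-p-mod² : QQ p P.≡ R ⊕ zz mod (cp P.^ 2)
      QQ-p-mod² = P.mtrans (P.meq (P.trans (P.*-congˡ QQ-d) (P.solve 4 (λ c x R w → (𝟙 :- c :* (x :* 𝟙)) :* (R :+ w) := (R :+ (w :- c :* (x :* R))) :+ (:- x) :* (c :* w)) P.refl cp 𝕏 R pw)))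
        (P.mtrans (P.m+ˡ (R ⊕ zz) (P.m0* (P.- 𝕏) (P.m^00 cp 1 1 (P.m^1⁻ cp cp≡0) (P.m^1⁻ cp pw≡0)))) (P.meq (P.+-identityʳ (R ⊕ zz))))
        where open P using (𝟙; con; _:*_; _:-_; :-_; _:+_; _:=_)

      θQ-d-mod : θQ d P.≡ 𝕏 P.^ d mod cp
      θQ-d-mod = P.mtrans (P.meq (θQ-poly d)) (P.mtrans (P.m+ (P.sum-0m d low) (P.m*ʳ (𝕏 P.^ d) (cst-mod top))) (P.meq (P.trans (P.+-identityˡ _) (P.*-identityˡ (𝕏 P.^ d)))))
        where
        low : ∀ k → k ℕ.< d → cst (+ k * q d k) ⊗ 𝕏 P.^ k P.≡ P.0# mod cp
        low zero _ = P.m*0 (𝕏 P.^ 0) (P.meq (P.ι-cong (ℤP.*-zeroˡ (q d 0))))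
        low (suc k) k<d = P.m*0 (𝕏 P.^ suc k) (cst-mod (Z.m0* (+ suc k) (q-mod-p k k<d)))
        top : + d * q d d Z.≡ 1ℤ mod 𝕡
        top = Z.m≈ (trans (cong (_* q d d) (lem (+ d))) (lem₂ (1ℤ + + d) (q d d))) refl
          (Z.m- {x = (1ℤ + + d) * q d d} {y = 0ℤ} {y′ = - 1ℤ} (Z.m*0 (q d d) (Z.m≈ (sym (ℤP.pos-+ 1 d)) refl 𝕡≡0)) (q-top-mod-p (ℕ.z<s)))
          where lem : ∀ d → d ≡ (1ℤ + d) - 1ℤ
                lem = solve-∀
                lem₂ : ∀ x y → (x - 1ℤ) * y ≡ x * y - y
                lem₂ = solve-∀

      -- In `SS-euler` the term with p disappears, and x d/dx of 1 - x^(p-1) is -(p-1) x^(p-1), that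
      -- is x^(p-1) modulo p.
      SS-p-mod : SS p P.≡ P.- (𝕏 P.^ p) mod cp
      SS-p-mod = P.mtrans (P.meq (SS-euler p)) (P.mtrans (P.m- (P.m*0 (𝕏 ⊗ QQ p) cp≡0) (P.m*ˡ 𝕏 (P.m- (P.m* linear-p θQ-d-mod) (P.m*0 (𝕏 ⊗ QQ d) cp≡0))))
        (P.meq (P.solve 2 (λ x X → con 0ℤ :- x :* (𝟙 :* X :- con 0ℤ) := :- (x :* X)) P.refl 𝕏 (𝕏 P.^ d))))
        where open P using (𝟙; con; _:*_; _:-_; :-_; _:+_; _:=_)

      module _ (s′ : ℕ) where
        private s₀ = suc s′
        -- `QQ (s p)` is R^s + R^(s-1) `vv` modulo p^2: s copies of the deviation of one block, and
        -- the effect of displacing the blocks by multiples of p.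
        vv : Op
        vv = cst (+ s₀) ⊗ zz ⊕ cst (+ tri s₀) ⊗ (cp ⊗ 𝕏 P.^ p)

        vv≡0 : vv P.≡ P.0# mod cp
        vv≡0 = P.mtrans (P.m+ (P.m0* (cst (+ s₀)) zz≡0) (P.m0* (cst (+ tri s₀)) (P.m*0 (𝕏 P.^ p) cp≡0))) (P.meq (P.+-identityˡ P.0#))

        QQ-sp-mod² : QQ (s₀ ℕ.* p) P.≡ R P.^ s₀ ⊕ R P.^ s′ ⊗ vv mod (cp P.^ 2)
        QQ-sp-mod² = P.mtrans (P.m≈m (P.*-congˡ (P.sym (P.*-identityʳ cp))) (blocks-taylor p s′)) (P.mtrans (P.m- first second)
          (P.meq (P.solve 7 (λ t₀ A S t B c X → (A :+ S :* B :* t) :- t₀ :* (c :* (:- X :* B)) := A :+ B :* (S :* t :+ t₀ :* (c :* X))) P.refl (cst (+ tri s₀)) (R P.^ s₀) (cst (+ s₀)) zz (R P.^ s′) cp (𝕏 P.^ p))))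
          where
          open P using (𝟙; con; _:*_; _:-_; :-_; _:+_; _:=_)
          first : QQ p P.^ s₀ P.≡ R P.^ s₀ ⊕ cst (+ s₀) ⊗ R P.^ s′ ⊗ zz mod (cp P.^ 2)
          first with P.pow-taylor₁ s′ R zz
          ... | w′ , e = P.mtrans (P.mpow s₀ QQ-p-mod²) (P.mtrans (P.meq e) (P.mtrans (P.m+ˡ (R P.^ s₀ ⊕ cst (+ s₀) ⊗ R P.^ s′ ⊗ zz) (P.m*0 w′ (P.m^00 cp 1 1 (P.m^1⁻ cp zz≡0) (P.m^1⁻ cp zz≡0)))) (P.meq (P.+-identityʳ _))))
          second : cst (+ tri s₀) ⊗ (cp ⊗ (SS p ⊗ QQ p P.^ s′)) P.≡ cst (+ tri s₀) ⊗ (cp ⊗ (P.- (𝕏 P.^ p) ⊗ R P.^ s′)) mod (cp P.^ 2)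
          second = P.m*ˡ (cst (+ tri s₀)) (P.m≈m (P.*-congˡ (P.sym (P.*-identityʳ cp))) (P.mscale cp (P.m* SS-p-mod (P.mpow s′ QQ-p-mod))))

        -- The inverse of R^s + R^(s-1) v is R^(-s) - R^(-s-1) v up to terms in v^2, and v is a
        -- multiple of p.
        hs-mod² : ∀ i → hs (s₀ ℕ.* p) i Z.≡ Hn s₀ i - act vv (H (suc s₀)) (+ i) mod (𝕡 Z.^ 2)
        hs-mod² i = Z.mdiff (QQ-unipotent N {λ j → ext (hs N) j - f j} causal (λ j → Z.m≈ (act-diff (QQ N) (ext (hs N)) f j) refl (Z.mdiff⁻
            (Z.mtrans (Z.meq (QQ-hs N j)) (Z.msym (Qf j))))) (+ i))
          where
          N = s₀ ℕ.* p
          f : ℤ → ℤ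
          f j = H s₀ j - act vv (H (suc s₀)) j
          causal : Causal (λ j → ext (hs N) j - f j)
          causal n = cong (λ z → 0ℤ - (0ℤ - z)) (act-causal vv {H (suc s₀)} (ext-causal (Hn (suc s₀))) n)
          R-down : ∀ k i → act (R P.^ k) (H (suc k)) i ≡ H 1 i
          R-down k i = trans (cong (λ m → act (R P.^ k) (H m) i) (sym (ℕP.+-comm k 1))) (R^-H k 1 i)
          E : Op
          E = R P.^ s₀ ⊕ R P.^ s′ ⊗ vv
          EH : ∀ j → act E (H s₀) j ≡ δ₀ j + act vv (H 1) j
          EH j = cong₂ _+_ (trans (cong (λ m → act (R P.^ s₀) (H m) j) (sym (ℕP.+-identityʳ s₀))) (trans (R^-H s₀ 0 j) (H-0 j)))
                           (trans (act-comm (R P.^ s′) vv (H s₀) j) (act-cong vv (R-down s′) j))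
          EvH : ∀ j → act E (act vv (H (suc s₀))) j Z.≡ act vv (H 1) j mod (𝕡 Z.^ 2)
          EvH j = Z.m≈ (cong₂ _+_ (trans (act-comm (R P.^ s₀) vv (H (suc s₀)) j) (act-cong vv (R-down s₀) j)) refl) (sym (ℤP.+-identityʳ (act vv (H 1) j)))
            (Z.m+ˡ (act vv (H 1) j) (mod-act^ 𝕡 2 (P.m0* (R P.^ s′) (P.m^00 cp 1 1 (P.m^1⁻ cp vv≡0) (P.m^1⁻ cp vv≡0))) (H (suc s₀)) j))
          Qf : ∀ j → act (QQ N) f j Z.≡ δ₀ j mod (𝕡 Z.^ 2)
          Qf j = Z.mtrans (mod-act^ 𝕡 2 QQ-sp-mod² f j) (Z.mtrans (Z.meq (act-diff E (H s₀) (act vv (H (suc s₀))) j))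
            (Z.mtrans (Z.m- (Z.meq (EH j)) (EvH j)) (Z.meq (lem (δ₀ j) (act vv (H 1) j)))))
            where lem : ∀ a b → (a + b) - b ≡ a
                  lem = solve-∀

  -- Coefficients of the series for N = ps, by exponent class modulo p - 1.

  module SeriesValues where

    open GenericAlgebra
    open ShiftOperators
    open FleckQuotients
    open StirlingSeries
    open PrimeUnits
    open SeriesModPrimePowers
    open import Data.Nat using (_!)
    open import Data.Nat.DivMod using (_/_; _%_; m<n⇒m%n≡m; [m+n]%n≡m%n; [m+kn]%n≡m%n; n%n≡0; m*n%n≡0; m≡m%n+[m/n]*n)
    open import Data.Integer using (ℤ; +_; _+_; _*_; -_; _-_; 0ℤ; 1ℤ; ∣_∣)

    act-sum : ∀ n (o : ℕ → Op) f i → act (P.sum n o) f i ≡ Z.sum n (λ k → act (o k) f i)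
    act-sum zero o f i = ℤP.*-zeroˡ (f i)
    act-sum (suc n) o f i = cong (_+ act (o n) f i) (act-sum n o f i)

    rf-div : ∀ M τ → suc τ ℕD.∣ rf (suc M) τ
    rf-div zero τ = ℕD.divides 1 (ℕP.*-comm (suc τ) 1)
    rf-div (suc M) τ = ℕD.∣n⇒∣m*n (suc (suc M) ℕ.+ τ) (rf-div M τ)

    tri-double : ∀ n → tri (suc n) ℕ.+ tri (suc n) ≡ suc n ℕ.* n
    tri-double zero = refl
    tri-double (suc n) = trans (lem (suc n) (tri (suc n))) (trans (cong (λ z → (suc n ℕ.+ suc n) ℕ.+ z) (tri-double n)) (lem₂ n))
      where
      lem : ∀ a b → (a ℕ.+ b) ℕ.+ (a ℕ.+ b) ≡ (a ℕ.+ a) ℕ.+ (b ℕ.+ b)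
      lem = ℕ-solve-∀
      lem₂ : ∀ n → (suc n ℕ.+ suc n) ℕ.+ suc n ℕ.* n ≡ suc (suc n) ℕ.* suc n
      lem₂ = ℕ-solve-∀

    q-1 : ∀ m → q m 1 ≡ - + tri (suc m)
    q-1 zero = refl
    q-1 (suc m) = trans (cong₂ (λ a b → a - + suc m * b) (q-1 m) (q-0 m)) (trans (lem (+ tri (suc m)) (+ suc m)) (cong -_ (sym (ℤP.pos-+ (suc m) (tri (suc m))))))
      where lem : ∀ a b → - a - b * 1ℤ ≡ - (b + a)
            lem = solve-∀

    module HVals where
      open Vals public

      H-shift-multiple : ∀ n M τ → act (𝕏 P.^ n) (H M) (+ (n ℕ.+ τ ℕ.* d)) ≡ + hc M τ
      H-shift-multiple n M τ = trans (act-𝕏^-ext n (Hn M) (τ ℕ.* d)) (Hn-multiple M τ)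

      H-shift-other : ∀ n M I → I % d ≢ n % d → act (𝕏 P.^ n) (H M) (+ I) ≡ 0ℤ
      H-shift-other n M I I≢n with I ℕP.<? n
      ... | yes I<n = act-𝕏^-ext-< n (Hn M) I I<n
      ... | no I≮n = trans (cong (λ m → act (𝕏 P.^ n) (H M) (+ m)) (sym n+j≡I)) (trans (act-𝕏^-ext n (Hn M) j)
          (if-no (j % d ℕ.≟ 0) (λ e → I≢n (trans (cong (_% d) (trans (sym n+j≡I) (cong (n ℕ.+_) (trans (m≡m%n+[m/n]*n j d) (cong (ℕ._+ (j / d) ℕ.* d) e))))) ([m+kn]%n≡m%n n (j / d) d)))))
        where
        j = I ℕ.∸ n
        n+j≡I : n ℕ.+ j ≡ I
        n+j≡I = ℕP.m+[n∸m]≡n (ℕP.≮⇒≥ I≮n)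

      module _ (s′ : ℕ) (s<d : suc s′ ℕ.< d) where
        private
          s₀ = suc s′
          X : ℕ → ℕ → ℤ
          X I n = act (𝕏 P.^ n) (H (suc s₀)) (+ I)
          Y : ℕ → ℤ
          Y I = act (𝕏 P.^ 1) (H s₀) (+ I)
          Σq : ℕ → ℤ
          Σq I = Z.sum d′ (λ k → q d (suc k) * X I (suc k))

          vvH : ∀ I → act (vv s′) (H (suc s₀)) (+ I) ≡ + s₀ * ((Σq I + (q d d + 1ℤ) * X I d) - 𝕡 * Y I) + + tri s₀ * (𝕡 * X I p)
          vvH I = cong (λ z → + s₀ * z + + tri s₀ * (𝕡 * X I p)) (cong₂ _+_
             (cong (_+ (q d d + 1ℤ) * X I d) (act-sum d′ (λ k → cst (q d (suc k)) ⊗ 𝕏 P.^ suc k) (H (suc s₀)) (+ I)))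
             (trans (act-neg (cp ⊗ (𝕏 ⊗ R)) (H (suc s₀)) (+ I)) (cong (λ z → - (𝕡 * z)) (trans (R-H s₀ (+ I - 1ℤ)) (sym (ℤP.*-identityˡ (H s₀ (+ I - 1ℤ))))))))

          1%d : 1 % d ≡ 1
          1%d = m<n⇒m%n≡m 1<d
          p%d : p % d ≡ 1
          p%d = trans ([m+n]%n≡m%n 1 d) 1%d

          s<p : s₀ ℕ.< p
          s<p = ℕP.m<n⇒m<1+n s<d

        -- Of `vv` only the x^(p-1) term reaches this class. Its coefficient is a multiple of p, and
        -- so is the value of `hc` it multiplies, since s! times that value contains the factor τ.
        hs-main : ∀ τ → 0 ℕ.< τ → p ℕD.∣ τ → hs (s₀ ℕ.* p) (τ ℕ.* d) Z.≡ + hc s₀ τ mod (𝕡 Z.^ 2)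
        hs-main (suc τ′) _ p∣τ = Z.mtrans (hs-mod² s′ I) (Z.mtrans (Z.m- (Z.meq (Hn-multiple s₀ (suc τ′))) small) (Z.meq (lem (+ hc s₀ (suc τ′)))))
          where
          I = suc τ′ ℕ.* d
          lem : ∀ a → a - 0ℤ ≡ a
          lem = solve-∀
          I%d : I % d ≡ 0
          I%d = m*n%n≡0 (suc τ′) d
          other : ∀ n M r → n % d ≡ suc r → act (𝕏 P.^ n) (H M) (+ I) ≡ 0ℤ
          other n M r e = H-shift-other n M I (λ e′ → contradiction (trans (sym I%d) (trans e′ e)) λ ())
          value : act (vv s′) (H (suc s₀)) (+ I) ≡ + s₀ * ((q d d + 1ℤ) * + hc (suc s₀) τ′)
          value = trans (vvH I) (trans (cong₂ (λ a b → + s₀ * a + + tri s₀ * (𝕡 * b))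
            (cong₂ _-_ (cong₂ (λ a b → a + (q d d + 1ℤ) * b) (Z.sum-0 d′ (λ k k<d′ → trans (cong (q d (suc k) *_) (other (suc k) (suc s₀) k (m<n⇒m%n≡m (ℕ.s≤s k<d′)))) (ℤP.*-zeroʳ (q d (suc k)))))
                                (H-shift-multiple d (suc s₀) τ′))
                       (cong (𝕡 *_) (other 1 s₀ 0 1%d)))
            (other p (suc s₀) 0 p%d)) (lem₂ (+ s₀) ((q d d + 1ℤ) * + hc (suc s₀) τ′) 𝕡 (+ tri s₀)))
            where lem₂ : ∀ s a p t → s * ((0ℤ + a) - p * 0ℤ) + t * (p * 0ℤ) ≡ s * a
                  lem₂ = solve-∀
          hc≡0 : + hc (suc s₀) τ′ Z.≡ 0ℤ mod 𝕡
          hc≡0 = unit-cancel₁ (+ (s₀ !)) (+ hc (suc s₀) τ′) (!-unit s₀ s<p)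
            (Z.m≈ (trans (ℤP.*-comm (+ (s₀ !)) (+ hc (suc s₀) τ′)) (trans (sym (ℤP.pos-* (hc (suc s₀) τ′) (s₀ !))) (cong +_ (hc-rf s₀ τ′)))) refl
              (∣⇒mod {p} {+ rf s₀ τ′} (ℕD.∣-trans p∣τ (rf-div s′ τ′))))
          small : act (vv s′) (H (suc s₀)) (+ I) Z.≡ 0ℤ mod (𝕡 Z.^ 2)
          small = Z.m≈ value refl (Z.m0* (+ s₀) (Z.m^00 𝕡 1 1 (Z.m^1⁻ 𝕡 q-top+1) (Z.m^1⁻ 𝕡 hc≡0)))

        private
          class-sum : ∀ k τ → suc k ℕ.< d → Σq (suc k ℕ.+ τ ℕ.* d) ≡ q d (suc k) * + hc (suc s₀) τ
          class-sum k τ k<d = trans (Z.sum-single d′ (λ k → q d (suc k) * X I (suc k)) k (ℕP.≤-pred k<d) (λ i i<d′ i≢k →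
              trans (cong (q d (suc i) *_) (H-shift-other (suc i) (suc s₀) I (λ e → i≢k (ℕP.suc-injective (trans (sym (m<n⇒m%n≡m (ℕ.s≤s i<d′))) (trans (sym e) I%d)))))) (ℤP.*-zeroʳ (q d (suc i)))))
            (cong (q d (suc k) *_) (H-shift-multiple (suc k) (suc s₀) τ))
            where
            I = suc k ℕ.+ τ ℕ.* d
            I%d : I % d ≡ suc k
            I%d = trans ([m+kn]%n≡m%n (suc k) τ d) (m<n⇒m%n≡m k<d)

        -- R^(-s) has no exponent in this class; the one term of `vv` that reaches it is that of
        -- x^(k+2) in `pw`.
        hs-other : ∀ k τ → suc (suc k) ℕ.< d → hs (s₀ ℕ.* p) (suc (suc k) ℕ.+ τ ℕ.* d) Z.≡ - (+ s₀ * (q d (suc (suc k)) * + hc (suc s₀) τ)) mod (𝕡 Z.^ 2)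
        hs-other k τ k<d = Z.mtrans (hs-mod² s′ I) (Z.meq (trans (cong₂ _-_ (Hn-other s₀ (suc (suc k)) τ (ℕ.z<s) k<d) value) (ℤP.+-identityˡ _)))
          where
          I = suc (suc k) ℕ.+ τ ℕ.* d
          I%d : I % d ≡ suc (suc k)
          I%d = trans ([m+kn]%n≡m%n (suc (suc k)) τ d) (m<n⇒m%n≡m k<d)
          value : act (vv s′) (H (suc s₀)) (+ I) ≡ + s₀ * (q d (suc (suc k)) * + hc (suc s₀) τ)
          value = trans (vvH I) (trans (cong₂ (λ a b → + s₀ * a + + tri s₀ * (𝕡 * b))
            (cong₂ _-_ (cong₂ (λ a b → a + (q d d + 1ℤ) * b) (class-sum (suc k) τ k<d)
                                (H-shift-other d (suc s₀) I (λ e → contradiction (trans (sym I%d) (trans e (n%n≡0 d))) λ ())))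
                       (cong (𝕡 *_) (H-shift-other 1 s₀ I (λ e → contradiction (trans (sym I%d) (trans e 1%d)) λ ()))))
            (H-shift-other p (suc s₀) I (λ e → contradiction (trans (sym I%d) (trans e p%d)) λ ()))) (lem₂ (+ s₀) (q d (suc (suc k)) * + hc (suc s₀) τ) (q d d + 1ℤ) 𝕡 (+ tri s₀)))
            where lem₂ : ∀ s a c p t → s * ((a + c * 0ℤ) - p * 0ℤ) + t * (p * 0ℤ) ≡ s * a
                  lem₂ = solve-∀

        -- Three terms of `vv` reach this class: that of x in `pw`, pxR, and px^p. For τ = 1 modulo
        -- p, twice their sum divided by -p is -s(s+1) + 2s^2 - s(s-1) = 0 modulo p.
        hs-one : ∀ τ → 0 ℕ.< τ → + τ Z.≡ 1ℤ mod 𝕡 → hs (s₀ ℕ.* p) (1 ℕ.+ τ ℕ.* d) Z.≡ 0ℤ mod (𝕡 Z.^ 2)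
        hs-one (suc τ′) _ τ≡1 = Z.mtrans (hs-mod² s′ I) (Z.mtrans (Z.m- (Z.meq (Hn-other s₀ 1 τ (ℕ.z<s) 1<d)) small) (Z.meq refl))
          where
          τ = suc τ′
          I = 1 ℕ.+ τ ℕ.* d
          a = + hc (suc s₀) τ
          b = + hc s₀ τ
          c = + hc (suc s₀) τ′
          I%d : I % d ≡ 1
          I%d = trans ([m+kn]%n≡m%n 1 τ d) 1%d
          value : act (vv s′) (H (suc s₀)) (+ I) ≡ + s₀ * (q d 1 * a - 𝕡 * b) + + tri s₀ * (𝕡 * c)
          value = trans (vvH I) (cong₂ (λ a b → + s₀ * a + + tri s₀ * (𝕡 * b))
            (cong₂ _-_ (trans (cong₂ (λ a b → a + (q d d + 1ℤ) * b) (class-sum 0 τ 1<d)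
                                (H-shift-other d (suc s₀) I (λ e → contradiction (trans (sym I%d) (trans e (n%n≡0 d))) λ ()))) (lem (q d 1 * a) (q d d + 1ℤ)))
                       (cong (𝕡 *_) (H-shift-multiple 1 s₀ τ)))
            (H-shift-multiple p (suc s₀) τ′))
            where lem : ∀ a b → a + b * 0ℤ ≡ a
                  lem = solve-∀
          factored : act (vv s′) (H (suc s₀)) (+ I) ≡ 𝕡 * - (+ s₀ * + h * a + + s₀ * b - + tri s₀ * c)
          factored = trans value (trans (cong (λ z → + s₀ * (z * a - 𝕡 * b) + + tri s₀ * (𝕡 * c)) (trans (q-1 d) (cong -_ (trans (cong +_ tri-odd) (ℤP.pos-* p h)))))
            (lem (+ s₀) 𝕡 (+ h) a b c (+ tri s₀)))
            where lem : ∀ s p h a b c t → s * (- (p * h) * a - p * b) + t * (p * c) ≡ p * - (s * h * a + s * b - t * c)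
                  lem = solve-∀
          f = + (s₀ !)
          f′ = + (s′ !)
          f≡ : f ≡ + s₀ * f′
          f≡ = ℤP.pos-* s₀ (s′ !)
          rf-0 : ∀ M → rf M 0 ≡ M !
          rf-0 M = trans (sym (ℕP.*-identityʳ (rf M 0))) (trans (rf-! M 0) (cong _! (ℕP.+-identityʳ M)))
          rf-1 : ∀ M → rf M 1 ≡ suc M !
          rf-1 M = trans (sym (ℕP.*-identityʳ (rf M 1))) (trans (rf-! M 1) (cong _! (ℕP.+-comm M 1)))
          τ′≡0 : + τ′ Z.≡ 0ℤ mod 𝕡
          τ′≡0 = Z.m≈ (trans (lem (+ τ′)) (cong (_- 1ℤ) (sym (ℤP.pos-+ 1 τ′)))) refl (Z.m- τ≡1 (Z.mrefl {1ℤ}))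
            where lem : ∀ a → a ≡ (1ℤ + a) - 1ℤ
                  lem = solve-∀
          hc! : ∀ M t t₀ v → + t Z.≡ + t₀ mod 𝕡 → rf M t₀ ≡ v → + hc (suc M) t * + (M !) Z.≡ + v mod 𝕡
          hc! M t t₀ v t≡ e = Z.m≈ (trans (sym (ℤP.pos-* (hc (suc M) t) (M !))) (cong +_ (hc-rf M t))) (cong +_ (sym e)) (rf-mod M t≡)
          af : a * f Z.≡ (1ℤ + + s₀) * f mod 𝕡
          af = Z.mtrans (hc! s₀ τ 1 (suc s₀ !) τ≡1 (rf-1 s₀)) (Z.meq (trans (ℤP.pos-* (suc s₀) (s₀ !)) (cong (_* f) (ℤP.pos-+ 1 s₀))))
          bf : b * f Z.≡ + s₀ * f mod 𝕡
          bf = Z.m≈ (trans (cong (b *_) f≡) (lem b (+ s₀) f′)) refl (Z.m*ˡ (+ s₀) (hc! s′ τ 1 (s₀ !) τ≡1 (rf-1 s′)))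
            where lem : ∀ b s f → b * (s * f) ≡ s * (b * f)
                  lem = solve-∀
          cf : c * f Z.≡ f mod 𝕡
          cf = hc! s₀ τ′ 0 (s₀ !) τ′≡0 (rf-0 s₀)
          e≡0 : + s₀ * + h * a + + s₀ * b - + tri s₀ * c Z.≡ 0ℤ mod 𝕡
          -- The factor 2 turns h and tri s into halves cleared, p - 1 and s(s-1); s! makes the
          -- three coefficients polynomials in τ.
          e≡0 = unit-cancel₁ (+ (2 ℕ.* s₀ !)) _ (*-unit {2} {s₀ !} (small-unit 2 (ℕ.z<s) (ℕ.s≤s 1<d)) (!-unit s₀ s<p))
            (Z.m≈ (trans (cong (_* (+ s₀ * + h * a + + s₀ * b - + tri s₀ * c)) (ℤP.pos-* 2 (s₀ !))) (trans (lem (+ s₀) (+ h) a b c (+ tri s₀) f)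
                  (cong₂ (λ x y → + s₀ * x * (a * f) + (1ℤ + 1ℤ) * (+ s₀ * (b * f)) - y * (c * f)) 2h 2tri))) refl
              (Z.mtrans (Z.m- (Z.m+ (Z.m* (Z.m*ˡ (+ s₀) d≡-1) af) (Z.m*ˡ (1ℤ + 1ℤ) (Z.m*ˡ (+ s₀) bf))) (Z.m*ˡ (+ s₀ * + s′) cf))
                (Z.meq (trans (cong (λ z → + s₀ * - 1ℤ * ((1ℤ + + s₀) * f) + (1ℤ + 1ℤ) * (+ s₀ * (+ s₀ * f)) - + s₀ * z * f) s′≡) (lem₂ (+ s₀) f)))))
            where
            lem : ∀ s h a b c t f → ((1ℤ + 1ℤ) * f) * (s * h * a + s * b - t * c) ≡ s * (h + h) * (a * f) + (1ℤ + 1ℤ) * (s * (b * f)) - (t + t) * (c * f)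
            lem = solve-∀
            lem₂ : ∀ s f → s * - 1ℤ * ((1ℤ + s) * f) + (1ℤ + 1ℤ) * (s * (s * f)) - s * (s - 1ℤ) * f ≡ 0ℤ
            lem₂ = solve-∀
            2h : + h + + h ≡ + d
            2h = trans (sym (ℤP.pos-+ h h)) (cong +_ (sym d≡h+h))
            2tri : + tri s₀ + + tri s₀ ≡ + s₀ * + s′
            2tri = trans (sym (ℤP.pos-+ (tri s₀) (tri s₀))) (trans (cong +_ (tri-double s′)) (ℤP.pos-* s₀ s′))
            s′≡ : + s′ ≡ + s₀ - 1ℤ
            s′≡ = trans (lem₃ (+ s′)) (cong (_- 1ℤ) (sym (ℤP.pos-+ 1 s′)))
              where lem₃ : ∀ a → a ≡ (1ℤ + a) - 1ℤ
                    lem₃ = solve-∀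
            d≡-1 : + d Z.≡ - 1ℤ mod 𝕡
            d≡-1 = Z.m≈ (trans (lem₃ (+ d)) (cong (_- 1ℤ) (sym (ℤP.pos-+ 1 d)))) refl (Z.m- 𝕡≡0 (Z.mrefl {1ℤ}))
              where lem₃ : ∀ a → a ≡ (1ℤ + a) - 1ℤ
                    lem₃ = solve-∀
          small : act (vv s′) (H (suc s₀)) (+ I) Z.≡ 0ℤ mod (𝕡 Z.^ 2)
          small = Z.m≈ factored (sym (ℤP.*-zeroʳ 𝕡)) (Z.m≈m (cong (𝕡 *_) (sym (ℤP.*-identityʳ 𝕡))) (Z.mscale 𝕡 (Z.mneg {y = 0ℤ} e≡0)))

  -- Products of integers prime to p, and the p-free parts of factorials.

  module FactorialProducts where

    open import Defs using (prodCoprimeTo)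
    open GenericAlgebra
    open ShiftOperators
    open FleckQuotients
    open StirlingSeries
    open PrimeUnits
    open SeriesValues
    open import Data.Nat using (_!)
    open import Data.Integer using (ℤ; +_; _+_; _*_; -_; _-_; 0ℤ; 1ℤ; ∣_∣)

    sgn : ℕ → ℤ
    sgn n = (- 1ℤ) Z.^ n

    sgn-+ : ∀ a b → sgn (a ℕ.+ b) ≡ sgn a * sgn b
    sgn-+ a b = Z.^-homo-* (- 1ℤ) a b

    sgn² : ∀ a → sgn a * sgn a ≡ 1ℤ
    sgn² a = trans (sym (Z.^-distrib-* (- 1ℤ) (- 1ℤ) a)) (Z.1^ a)

    sgn-even : ∀ h → sgn (h ℕ.+ h) ≡ 1ℤ
    sgn-even h = trans (sgn-+ h h) (sgn² h)

    sgn-cancel : ∀ a x → sgn a * (sgn a * x) ≡ x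
    sgn-cancel a x = trans (sym (ℤP.*-assoc (sgn a) (sgn a) x)) (trans (cong (_* x) (sgn² a)) (ℤP.*-identityˡ x))

    module Products where
      open HVals public

      V : ℕ → ℕ
      V = prodCoprimeTo p

      -- V m times the sum of 1/j over the j ≤ m prime to p, which is the linear coefficient in c of
      -- the product of the c + j.
      E : ℕ → ℕ
      E zero = 0
      E (suc m) = if does (p ∣? suc m) then E m else E m ℕ.* suc m ℕ.+ V m

      V-skip : ∀ {m} → p ℕD.∣ suc m → V (suc m) ≡ V m
      V-skip {m} p∣ = trans (cong (V m ℕ.*_) (if-yes (p ∣? suc m) p∣)) (ℕP.*-identityʳ (V m))

      V-suc : ∀ {m} → ¬ (p ℕD.∣ suc m) → V (suc m) ≡ V m ℕ.* suc m
      V-suc {m} p∤ = cong (V m ℕ.*_) (if-no (p ∣? suc m) p∤)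

      E-skip : ∀ {m} → p ℕD.∣ suc m → E (suc m) ≡ E m
      E-skip {m} p∣ = if-yes (p ∣? suc m) p∣

      E-suc : ∀ {m} → ¬ (p ℕD.∣ suc m) → E (suc m) ≡ E m ℕ.* suc m ℕ.+ V m
      E-suc {m} p∤ = if-no (p ∣? suc m) p∤

      V-unit : ∀ m → ¬ (p ℕD.∣ V m)
      V-unit zero = small-unit 1 (ℕ.z<s) (ℕ.s≤s (ℕ.z<s))
      V-unit (suc m) with p ∣? suc m
      ... | yes p∣ = subst (λ z → ¬ (p ℕD.∣ z)) (sym (V-skip p∣)) (V-unit m)
      ... | no p∤ = subst (λ z → ¬ (p ℕD.∣ z)) (sym (V-suc p∤)) (*-unit {V m} {suc m} (V-unit m) p∤)

      p∣p*m : ∀ m → p ℕD.∣ p ℕ.* m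
      p∣p*m m = ℕD.m∣m*n m

      shift-unit : ∀ {c} a → p ℕD.∣ c → ¬ (p ℕD.∣ a) → ¬ (p ℕD.∣ c ℕ.+ a)
      shift-unit {c} a p∣c p∤a p∣ = p∤a (ℕD.∣m+n∣m⇒∣n p∣ p∣c)

      fact-V : ∀ m a → a ℕ.< p → (p ℕ.* m ℕ.+ a) ! ≡ p ℕ.^ m ℕ.* (m ! ℕ.* V (p ℕ.* m ℕ.+ a))
      fact-V zero zero _ = trans (cong _! (trans (ℕP.+-identityʳ (p ℕ.* 0)) (ℕP.*-zeroʳ p))) (cong (λ z → 1 ℕ.* (1 ℕ.* V z)) (sym (trans (ℕP.+-identityʳ (p ℕ.* 0)) (ℕP.*-zeroʳ p))))
      fact-V (suc m) zero _ = trans (cong _! eq) (trans (cong (suc (p ℕ.* m ℕ.+ d) ℕ.*_) (fact-V m d ℕP.≤-refl))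
        (trans (cong (ℕ._* (p ℕ.^ m ℕ.* (m ! ℕ.* V (p ℕ.* m ℕ.+ d)))) (trans (sym eq) (ℕP.+-identityʳ (p ℕ.* suc m))))
         (trans (lem p (suc m) (p ℕ.^ m) (m !) (V (p ℕ.* m ℕ.+ d))) (cong (λ z → p ℕ.^ suc m ℕ.* (suc m ! ℕ.* z)) (trans (sym (V-skip (subst (p ℕD.∣_) eq (subst (p ℕD.∣_) (sym (ℕP.+-identityʳ (p ℕ.* suc m))) (p∣p*m (suc m)))))) (cong V (sym eq)))))))
        where
        eq : p ℕ.* suc m ℕ.+ 0 ≡ suc (p ℕ.* m ℕ.+ d)
        eq = trans (ℕP.+-identityʳ (p ℕ.* suc m)) (trans (ℕP.*-suc p m) (trans (ℕP.+-comm p (p ℕ.* m)) (ℕP.+-suc (p ℕ.* m) d)))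
        lem : ∀ p s P M v → (p ℕ.* s) ℕ.* (P ℕ.* (M ℕ.* v)) ≡ (p ℕ.* P) ℕ.* ((s ℕ.* M) ℕ.* v)
        lem = ℕ-solve-∀
      fact-V m (suc a) a<p = trans (cong _! (ℕP.+-suc (p ℕ.* m) a)) (trans (cong (suc (p ℕ.* m ℕ.+ a) ℕ.*_) (fact-V m a (ℕP.<-trans ℕP.≤-refl a<p)))
        (trans (lem (suc (p ℕ.* m ℕ.+ a)) (p ℕ.^ m) (m !) (V (p ℕ.* m ℕ.+ a))) (cong (λ z → p ℕ.^ m ℕ.* (m ! ℕ.* z)) (trans (sym (V-suc (subst (λ z → ¬ (p ℕD.∣ z)) (ℕP.+-suc (p ℕ.* m) a) (shift-unit (suc a) (p∣p*m m) (small-unit (suc a) (ℕ.z<s) a<p))))) (cong V (sym (ℕP.+-suc (p ℕ.* m) a)))))))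
        where
        lem : ∀ s P M v → s ℕ.* (P ℕ.* (M ℕ.* v)) ≡ P ℕ.* (M ℕ.* (v ℕ.* s))
        lem = ℕ-solve-∀

      -- As p divides c, the numbers j and c + j are prime to p together. So V(c + a) is V(c) times
      -- a product of factors c + j, expanded here to first order in c.
      V-taylor : ∀ c a → p ℕD.∣ c → + V (c ℕ.+ a) Z.≡ + V c * (+ V a + + c * + E a) mod (+ c * + c)
      V-taylor c zero _ = Z.meq (trans (cong (λ z → + V z) (ℕP.+-identityʳ c)) (lem (+ V c) (+ c)))
        where lem : ∀ v c → v ≡ v * (1ℤ + c * 0ℤ)
              lem = solve-∀
      V-taylor c (suc a) p∣c = go (p ∣? suc a)
        where
        c+a = sym (ℕP.+-suc c a)
        go : Dec (p ℕD.∣ suc a) → + V (c ℕ.+ suc a) Z.≡ + V c * (+ V (suc a) + + c * + E (suc a)) mod (+ c * + c)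
        go (yes p∣) = Z.m≈ (cong +_ (trans (cong V (sym c+a)) (V-skip (subst (p ℕD.∣_) (sym c+a) (ℕD.∣m∣n⇒∣m+n p∣c p∣)))))
          (cong₂ (λ x y → + V c * (+ x + + c * + y)) (V-skip p∣) (E-skip p∣)) (V-taylor c a p∣c)
        go (no p∤) = Z.m≈ (trans (cong +_ (trans (cong V (sym c+a)) (V-suc (subst (λ z → ¬ (p ℕD.∣ z)) (sym c+a) (shift-unit (suc a) p∣c p∤))))) (trans (ℤP.pos-* (V (c ℕ.+ a)) (suc (c ℕ.+ a))) (cong (λ z → + V (c ℕ.+ a) * + z) c+a)))
          refl (Z.mtrans (Z.m*ʳ (+ (c ℕ.+ suc a)) (V-taylor c a p∣c)) (Z.by (+ V c * + E a) (trans (cong (+ V c * (+ V a + + c * + E a) *_) (ℤP.pos-+ c (suc a)))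
            (trans (lem (+ V c) (+ V a) (+ c) (+ E a) (+ suc a)) (cong (_+ + c * + c * (+ V c * + E a)) (cong₂ (λ x y → + V c * (x + + c * y))
              (trans (sym (ℤP.pos-* (V a) (suc a))) (cong +_ (sym (V-suc p∤)))) (trans (trans (cong (_+ + V a) (sym (ℤP.pos-* (E a) (suc a)))) (sym (ℤP.pos-+ (E a ℕ.* suc a) (V a)))) (cong +_ (sym (E-suc p∤)))))))))) 
          where lem : ∀ v a c e s → v * (a + c * e) * (c + s) ≡ v * (a * s + c * (e * s + a)) + c * c * (v * e)
                lem = solve-∀

      c≡0 : ∀ {c} → p ℕD.∣ c → + c Z.≡ 0ℤ mod 𝕡
      c≡0 {c} p∣c = ∣⇒mod {p} {+ c} p∣c

      V-mul-mod : ∀ c a → p ℕD.∣ c → + V (c ℕ.+ a) Z.≡ + V c * + V a mod 𝕡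
      V-mul-mod c a p∣c = Z.mtrans (Z.m≈m (ℤP.*-identityʳ 𝕡) (Z.m^-weaken 𝕡 1 2 (ℕ.z<s) (weak (V-taylor c a p∣c))))
        (Z.mtrans (Z.m*ˡ (+ V c) (Z.m+ˡ (+ V a) (Z.m*0 (+ E a) (c≡0 p∣c)))) (Z.meq (cong (+ V c *_) (ℤP.+-identityʳ (+ V a)))))
        where
        weak : ∀ {x y} → x Z.≡ y mod (+ c * + c) → x Z.≡ y mod (𝕡 Z.^ 2)
        weak = Z.mcoarse (Z.m^00 𝕡 1 1 (Z.m^1⁻ 𝕡 (c≡0 p∣c)) (Z.m^1⁻ 𝕡 (c≡0 p∣c)))

      E-mul-mod : ∀ c a → p ℕD.∣ c → + E (c ℕ.+ a) Z.≡ + V c * + E a + + E c * + V a mod 𝕡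
      E-mul-mod c zero _ = Z.meq (trans (cong (λ z → + E z) (ℕP.+-identityʳ c)) (lem (+ V c) (+ E c)))
        where lem : ∀ v e → e ≡ v * 0ℤ + e * 1ℤ
              lem = solve-∀
      E-mul-mod c (suc a) p∣c = go (p ∣? suc a)
        where
        c+a = sym (ℕP.+-suc c a)
        go : Dec (p ℕD.∣ suc a) → + E (c ℕ.+ suc a) Z.≡ + V c * + E (suc a) + + E c * + V (suc a) mod 𝕡
        go (yes p∣) = Z.m≈ (cong +_ (trans (cong E (sym c+a)) (E-skip (subst (p ℕD.∣_) (sym c+a) (ℕD.∣m∣n⇒∣m+n p∣c p∣)))))
          (cong₂ (λ x y → + V c * + x + + E c * + y) (E-skip p∣) (V-skip p∣)) (E-mul-mod c a p∣c)
        go (no p∤) = Z.m≈ (trans (cong +_ (trans (cong E (sym c+a)) (E-suc (subst (λ z → ¬ (p ℕD.∣ z)) (sym c+a) (shift-unit (suc a) p∣c p∤)))))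
            (trans (ℤP.pos-+ (E (c ℕ.+ a) ℕ.* suc (c ℕ.+ a)) (V (c ℕ.+ a))) (cong (_+ + V (c ℕ.+ a)) (trans (ℤP.pos-* (E (c ℕ.+ a)) (suc (c ℕ.+ a))) (cong (+ E (c ℕ.+ a) *_) (trans (cong +_ c+a) (ℤP.pos-+ c (suc a))))))))
          (cong₂ (λ x y → + V c * x + + E c * y) (trans (cong +_ (E-suc p∤)) (trans (ℤP.pos-+ (E a ℕ.* suc a) (V a)) (cong (_+ + V a) (ℤP.pos-* (E a) (suc a))))) (trans (cong +_ (V-suc p∤)) (ℤP.pos-* (V a) (suc a))))
          (Z.mtrans (Z.m+ (Z.m* (E-mul-mod c a p∣c) (Z.m+ʳ (+ suc a) (c≡0 p∣c))) (V-mul-mod c a p∣c)) (Z.meq (lem (+ V c) (+ E a) (+ E c) (+ V a) (+ suc a))))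
          where lem : ∀ v ea ec va s → (v * ea + ec * va) * (0ℤ + s) + v * va ≡ v * (ea * s + va) + ec * (va * s)
                lem = solve-∀

      V-small : ∀ a → a ℕ.< p → V a ≡ a !
      V-small zero _ = refl
      V-small (suc a) a<p = trans (V-suc (small-unit (suc a) (ℕ.z<s) a<p)) (trans (cong (ℕ._* suc a) (V-small a (ℕP.<-trans ℕP.≤-refl a<p))) (ℕP.*-comm (a !) (suc a)))

      V-p : V p ≡ d !
      V-p = trans (V-skip ℕD.∣-refl) (V-small d ℕP.≤-refl)

      sgn-d : sgn d ≡ 1ℤ
      sgn-d = trans (cong sgn d≡h+h) (sgn-even h)

      wilson : + V p Z.≡ - 1ℤ mod 𝕡
      wilson = Z.m≈ (trans (cong +_ V-p) (sym (trans (q-top d) (trans (sf≡ d) (trans (cong (_* + (d !)) sgn-d) (ℤP.*-identityˡ (+ (d !)))))))) refl (q-top-mod-p (ℕ.z<s))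

      E-q : ∀ m → suc m ℕ.< p → q (suc m) m ≡ sgn m * + E (suc m)
      E-q zero m<p = trans (q-0 1) (trans (sym (ℤP.*-identityˡ 1ℤ)) (cong (1ℤ *_) (cong +_ (sym (E-suc (small-unit 1 (ℕ.z<s) m<p))))))
      E-q (suc m) m<p = trans (cong₂ (λ a b → a - + suc (suc m) * b) (trans (q-top (suc m)) (trans (sf≡ (suc m)) (cong (λ z → sgn (suc m) * + z) (sym (V-small (suc m) (ℕP.<-trans ℕP.≤-refl m<p)))))) (E-q m (ℕP.<-trans ℕP.≤-refl m<p)))
        (trans (lem (sgn m) (+ V (suc m)) (+ suc (suc m)) (+ E (suc m))) (cong (sgn (suc m) *_) (sym (trans (cong +_ (E-suc (small-unit (suc (suc m)) (ℕ.z<s) m<p))) (trans (ℤP.pos-+ (E (suc m) ℕ.* suc (suc m)) (V (suc m))) (cong (_+ + V (suc m)) (ℤP.pos-* (E (suc m)) (suc (suc m)))))))))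
        where lem : ∀ g v s e → (- 1ℤ * g) * v - s * (g * e) ≡ (- 1ℤ * g) * (e * s + v)
              lem = solve-∀

      -- Up to sign `E d` is the coefficient of x^(p-2) in `QQ d`, one of those divisible by p.
      E-p : + E p Z.≡ 0ℤ mod 𝕡
      E-p = Z.m≈ (trans (cong +_ (E-skip ℕD.∣-refl)) (sym (trans (cong (sgn d′ *_) (E-q d′ ℕP.≤-refl)) (sgn-cancel d′ (+ E d))))) refl (Z.m0* (sgn d′) (q-low d′ 0<d′ ℕP.≤-refl))
        where
        q-low : ∀ k → 0 ℕ.< k → k ℕ.< d → q d k Z.≡ 0ℤ mod 𝕡
        q-low (suc k) _ k<d = q-mod-p k k<d

      E-multiple : ∀ m → + E (p ℕ.* m) Z.≡ 0ℤ mod 𝕡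
      E-multiple zero = Z.meq (cong (λ z → + E z) (ℕP.*-zeroʳ p))
      E-multiple (suc m) = Z.m≈ (cong (λ z → + E z) (trans (ℕP.*-suc p m) (ℕP.+-comm p (p ℕ.* m)))) refl
        (Z.mtrans (E-mul-mod (p ℕ.* m) p (p∣p*m m)) (Z.mtrans (Z.m+ (Z.m0* (+ V (p ℕ.* m)) E-p) (Z.m*0 (+ V p) (E-multiple m))) (Z.meq refl)))

      module _ (j : ℕ) where
        private
          c = p ℕ.^ suc j
          p∣cw : ∀ w → p ℕD.∣ c ℕ.* w
          p∣cw w = ℕD.∣m⇒∣m*n w (ℕD.m∣m*n (p ℕ.^ j))
          cw≡0 : ∀ w → + (c ℕ.* w) Z.≡ 0ℤ mod (𝕡 Z.^ suc j)
          cw≡0 w = Z.by (+ w) (trans (ℤP.pos-* c w) (trans (cong (_* + w) (Z.ιℕ^ p (suc j))) (sym (ℤP.+-identityˡ (𝕡 Z.^ suc j * + w)))))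
          taylor : ∀ w a → + V (c ℕ.* w ℕ.+ a) Z.≡ + V (c ℕ.* w) * (+ V a + + (c ℕ.* w) * + E a) mod (𝕡 Z.^ suc (suc j))
          taylor w a = Z.m^-weaken 𝕡 (suc (suc j)) (suc j ℕ.+ suc j) (ℕ.s≤s (ℕP.m≤n+m (suc j) j))
                (Z.mcoarse (Z.m^00 𝕡 (suc j) (suc j) (cw≡0 w) (cw≡0 w)) (V-taylor (c ℕ.* w) a (p∣cw w)))

        -- The linear term carries E c, a multiple of p, so the modulus reaches one power of p
        -- beyond c itself.
        V-power : ∀ w → + V (c ℕ.* w) Z.≡ (+ V c) Z.^ w mod (𝕡 Z.^ suc (suc j))
        V-power zero = Z.meq (cong (λ z → + V z) (ℕP.*-zeroʳ c))
        V-power (suc w) = Z.m≈ (cong (λ z → + V z) (trans (ℕP.*-suc c w) (ℕP.+-comm c (c ℕ.* w)))) (ℤP.*-comm (+ V c) ((+ V c) Z.^ w))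
          (Z.mtrans (taylor w c) (Z.m* (V-power w) (Z.mtrans (Z.m+ˡ (+ V c) (Z.m≈m (cong (𝕡 Z.^_) (ℕP.+-comm (suc j) 1)) (Z.m^00 𝕡 (suc j) 1 (cw≡0 w) (Z.m^1⁻ 𝕡 (E-multiple (p ℕ.^ j)))))) (Z.meq (ℤP.+-identityʳ (+ V c))))))

        V-expand : ∀ w a → + V (c ℕ.* w ℕ.+ a) Z.≡ (+ V c) Z.^ w * (+ V a + + (c ℕ.* w) * + E a) mod (𝕡 Z.^ suc (suc j))
        V-expand w a = Z.mtrans (taylor w a) (Z.m*ʳ (+ V a + + (c ℕ.* w) * + E a) (V-power w))

      sgn-p : sgn p ≡ - 1ℤ
      sgn-p = trans (cong (- 1ℤ *_) sgn-d) refl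

      -- Wilson's theorem for prime powers: V(p^(j+2)) is the p-th power of V(p^(j+1)), which
      -- improves the congruence by one power, and the p-th power of -1 is -1.
      V-p^ : ∀ j → + V (p ℕ.^ suc j) Z.≡ - 1ℤ mod (𝕡 Z.^ suc j)
      V-p^ zero = Z.m^1⁻ 𝕡 (Z.m≈ (cong (λ z → + V z) (ℕP.*-identityʳ p)) refl wilson)
      V-p^ (suc j) = Z.m≈ (cong (λ z → + V z) (ℕP.*-comm p (p ℕ.^ suc j))) (sym sgn-p) (Z.mtrans (V-power j p) (Z.pow-lift p j (V-p^ j)))

      V-shift : ∀ j w a → + V (p ℕ.^ suc j ℕ.* w ℕ.+ a) Z.≡ sgn w * + V a mod (𝕡 Z.^ suc j)
      V-shift j w a = Z.mtrans (Z.m^-weaken 𝕡 (suc j) (suc (suc j)) (ℕP.n≤1+n (suc j)) (V-expand j w a))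
        (Z.m* (Z.mpow w (V-p^ j)) (Z.mtrans (Z.m+ˡ (+ V a) (Z.m*0 (+ E a) (Z.by (+ w) (trans (ℤP.pos-* (p ℕ.^ suc j) w) (trans (cong (_* + w) (Z.ιℕ^ p (suc j))) (sym (ℤP.+-identityˡ (𝕡 Z.^ suc j * + w)))))))) (Z.meq (ℤP.+-identityʳ (+ V a)))))

      -- The repunit (p^j - 1)/(p - 1), written b′ in the theorem; p-adically it tends to -1/(p-1).
      rep : ℕ → ℕ
      rep zero = 0
      rep (suc j) = rep j ℕ.+ p ℕ.^ j

      rep-suc : ∀ j → rep (suc j) ≡ suc (p ℕ.* rep j)
      rep-suc zero = cong suc (sym (ℕP.*-zeroʳ p))
      rep-suc (suc j) = trans (cong (ℕ._+ p ℕ.^ suc j) (rep-suc j)) (cong suc (sym (ℕP.*-distribˡ-+ p (rep j) (p ℕ.^ j))))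

      rep-geometric : ∀ j → p ℕ.^ j ≡ suc (rep j ℕ.* d)
      rep-geometric zero = refl
      rep-geometric (suc j) = trans (cong (λ z → z ℕ.+ d ℕ.* p ℕ.^ j) (rep-geometric j)) (cong suc (trans (cong (rep j ℕ.* d ℕ.+_) (ℕP.*-comm d (p ℕ.^ j))) (sym (ℕP.*-distribʳ-+ d (rep j) (p ℕ.^ j)))))

      -- The part of (p^B y)!/y! prime to p: each passage from a factorial to its multiples of p
      -- leaves behind one product of units.
      YY : ℕ → ℕ → ℕ
      YY zero y = 1
      YY (suc B) y = YY B y ℕ.* V (p ℕ.^ suc B ℕ.* y)

      fact-p^ : ∀ B y → (p ℕ.^ B ℕ.* y) ! ≡ p ℕ.^ (rep B ℕ.* y) ℕ.* (y ! ℕ.* YY B y)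
      fact-p^ zero y = trans (cong _! (ℕP.*-identityˡ y)) (lem (y !))
        where lem : ∀ a → a ≡ 1 ℕ.* (a ℕ.* 1)
              lem = ℕ-solve-∀
      fact-p^ (suc B) y = trans (cong _! (trans (ℕP.*-assoc p (p ℕ.^ B) y) (sym (ℕP.+-identityʳ (p ℕ.* (p ℕ.^ B ℕ.* y))))))
        (trans (fact-V (p ℕ.^ B ℕ.* y) 0 (ℕ.z<s)) (trans (cong₂ (λ a b → p ℕ.^ (p ℕ.^ B ℕ.* y) ℕ.* (a ℕ.* V b)) (fact-p^ B y) (trans (ℕP.+-identityʳ (p ℕ.* (p ℕ.^ B ℕ.* y))) (sym (ℕP.*-assoc p (p ℕ.^ B) y))))
         (trans (lem (p ℕ.^ (p ℕ.^ B ℕ.* y)) (p ℕ.^ (rep B ℕ.* y)) (y !) (YY B y) (V (p ℕ.^ suc B ℕ.* y)))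
           (cong (ℕ._* (y ! ℕ.* YY (suc B) y)) (trans (sym (ℕP.^-distribˡ-+-* p (rep B ℕ.* y) (p ℕ.^ B ℕ.* y))) (cong (p ℕ.^_) (sym (ℕP.*-distribʳ-+ y (rep B) (p ℕ.^ B)))))))))
        where lem : ∀ P Q f y v → P ℕ.* ((Q ℕ.* (f ℕ.* y)) ℕ.* v) ≡ (Q ℕ.* P) ℕ.* (f ℕ.* (y ℕ.* v))
              lem = ℕ-solve-∀

      YY-unit : ∀ B y → ¬ (p ℕD.∣ YY B y)
      YY-unit zero y = V-unit 0
      YY-unit (suc B) y = *-unit {YY B y} {V (p ℕ.^ suc B ℕ.* y)} (YY-unit B y) (V-unit (p ℕ.^ suc B ℕ.* y))

  -- The indicator of a residue class as a combination of high powers.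

  module ResidueFilter where

    open GenericAlgebra
    open ShiftOperators
    open FleckQuotients
    open StirlingSeries
    open PrimeUnits
    open SeriesValues
    open FactorialProducts
    open import Data.Nat using (_!)
    open import Data.Integer using (ℤ; +_; -[1+_]; _+_; _*_; -_; _-_; 0ℤ; 1ℤ; ∣_∣)

    -- The ratio of the two binomial coefficients is (M + t)/M = k.
    hc-ratio : ∀ M t k → 0 ℕ.< M → M ℕ.+ t ≡ M ℕ.* k → k ℕ.* hc M t ≡ hc (suc M) t
    hc-ratio (suc M) t k _ eq = ℕP.*-cancelʳ-≡ (k ℕ.* hc (suc M) t) (hc (suc (suc M)) t) (suc M ! ℕ.* t !) {{ℕP.m*n≢0 (suc M !) (t !) {{(suc M) ℕP.!≢0}} {{t ℕP.!≢0}}}}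
      (trans (lem k (hc (suc M) t) (suc M) (M !) (t !)) (trans (cong ((suc M ℕ.* k) ℕ.*_) (hc-! M t)) (trans (cong (ℕ._* (M ℕ.+ t) !) (sym eq)) (sym (hc-! (suc M) t)))))
      where lem : ∀ k h m M t → (k ℕ.* h) ℕ.* ((m ℕ.* M) ℕ.* t) ≡ (m ℕ.* k) ℕ.* (h ℕ.* (M ℕ.* t))
            lem = ℕ-solve-∀

    -- (α^n - β^n)/(α - β) without the division.
    geo : ℤ → ℤ → ℕ → ℤ
    geo α β zero = 0ℤ
    geo α β (suc n) = β * geo α β n + α Z.^ n

    geo-telescope : ∀ α β n → (α - β) * geo α β n ≡ α Z.^ n - β Z.^ n
    geo-telescope α β zero = ℤP.*-zeroʳ (α - β)
    geo-telescope α β (suc n) = trans (lem α β (geo α β n) (α Z.^ n)) (trans (cong (λ z → β * z + (α - β) * α Z.^ n) (geo-telescope α β n)) (lem₂ α β (α Z.^ n) (β Z.^ n)))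
      where lem : ∀ α β g x → (α - β) * (β * g + x) ≡ β * ((α - β) * g) + (α - β) * x
            lem = solve-∀
            lem₂ : ∀ α β x y → β * (x - y) + (α - β) * x ≡ α * x - β * y
            lem₂ = solve-∀

    geo-sum : ∀ α β n → geo α β (suc n) ≡ Z.sum (suc n) (λ i → α Z.^ i * β Z.^ (n ℕ.∸ i))
    geo-sum α β zero = lem β
      where lem : ∀ β → β * 0ℤ + 1ℤ ≡ 0ℤ + 1ℤ * 1ℤ
            lem = solve-∀
    geo-sum α β (suc n) = cong₂ _+_ (trans (cong (β *_) (geo-sum α β n)) (trans (sym (Z.sum-* (suc n) β (λ i → α Z.^ i * β Z.^ (n ℕ.∸ i))))
        (Z.sum-cong (suc n) (λ i i≤n → trans (lem β (α Z.^ i) (β Z.^ (n ℕ.∸ i))) (cong (λ m → α Z.^ i * β Z.^ m) (sym (ℕP.+-∸-assoc 1 (ℕP.≤-pred i≤n))))))))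
      (trans (sym (ℤP.*-identityʳ (α Z.^ suc n))) (cong (λ m → α Z.^ suc n * β Z.^ m) (sym (ℕP.n∸n≡0 n))))
      where lem : ∀ b x y → b * (x * y) ≡ x * (b * y)
            lem = solve-∀

    module Main where
      open Products public

      fermat-ℤ : ∀ x → ¬ (x Z.≡ 0ℤ mod 𝕡) → x Z.^ d Z.≡ 1ℤ mod 𝕡
      fermat-ℤ (+ n) p∤x = fermat′ n (λ p∣n → p∤x (∣⇒mod {p} {+ n} p∣n))
      fermat-ℤ x@(-[1+ n ]) p∤x = Z.m≈ (trans (cong (x Z.^_) d≡h+h) (trans (Z.neg-square h (+ suc n)) (cong ((+ suc n) Z.^_) (sym d≡h+h)))) refl
        (fermat′ (suc n) (λ p∣n → p∤x (∣⇒mod {p} {x} p∣n)))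

      pow-geometric : ∀ x K → x Z.^ (p ℕ.^ K) ≡ x * (x Z.^ d) Z.^ rep K
      pow-geometric x K = trans (cong (x Z.^_) (rep-geometric K)) (cong (x *_) (trans (cong (x Z.^_) (ℕP.*-comm (rep K) d)) (sym (Z.^-assocʳ x d (rep K)))))

      frobenius : ∀ x K → ¬ (x Z.≡ 0ℤ mod 𝕡) → x Z.^ (p ℕ.^ K) Z.≡ x mod 𝕡
      frobenius x K p∤x = Z.mtrans (Z.meq (pow-geometric x K)) (Z.mtrans (Z.m*ˡ x (Z.mpow (rep K) (fermat-ℤ x p∤x))) (Z.meq (trans (cong (x *_) (Z.1^ (rep K))) (ℤP.*-identityʳ x))))

      pow-p^-one : ∀ x K → ¬ (x Z.≡ 0ℤ mod 𝕡) → (x Z.^ (p ℕ.^ K)) Z.^ d Z.≡ 1ℤ mod (𝕡 Z.^ suc K)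
      pow-p^-one x K p∤x = Z.m≈ (trans (Z.^-assocʳ x (p ℕ.^ K) d) (trans (cong (x Z.^_) (ℕP.*-comm (p ℕ.^ K) d)) (sym (Z.^-assocʳ x d (p ℕ.^ K))))) (sym (Z.1^ (p ℕ.^ K)))
        (Z.pow-lifts p 0 K (Z.m^1⁻ 𝕡 (fermat-ℤ x p∤x)))

      module _ (r : ℤ) (p∤r : ¬ (r Z.≡ 0ℤ mod 𝕡)) (s′ s̄ : ℕ) (s+s̄ : suc s′ ℕ.+ s̄ ≡ d) where
        private s₀ = suc s′

        -- Chosen so that the exponent s + i of k and this exponent of r add up to 2(p-1); that of k
        -- starts at s so that k^(p^K (s+i)) has degree at least N.
        ex : ℕ → ℕ
        ex i = s̄ ℕ.+ suc (d′ ℕ.∸ i)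

        -- Raising to p^K brings units close to (p-1)-th roots of unity. If k and r agree modulo p,
        -- every term is 1; if they differ, the geometric sum vanishes; if p divides k, the positive
        -- exponent of k kills every term.
        indicator : ∀ K k → Z.sum d (λ i → ((+ k) Z.^ (p ℕ.^ K)) Z.^ (s₀ ℕ.+ i) * (r Z.^ (p ℕ.^ K)) Z.^ ex i) Z.≡ + d * c₀ (r - + k) mod (𝕡 Z.^ suc K)
        indicator K k = go (p ∣? k)
          where
          P = p ℕ.^ K
          α = (+ k) Z.^ P
          β = r Z.^ P
          β^d : β Z.^ d Z.≡ 1ℤ mod (𝕡 Z.^ suc K)
          β^d = pow-p^-one r K p∤r
          nonzero : ∀ K → ℕ.NonZero (p ℕ.^ K)
          nonzero K = ℕP.m^n≢0 p K
          lem₀ : ∀ r k → r ≡ (r - k) + k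
          lem₀ = solve-∀
          go : Dec (p ℕD.∣ k) → Z.sum d (λ i → α Z.^ (s₀ ℕ.+ i) * β Z.^ ex i) Z.≡ + d * c₀ (r - + k) mod (𝕡 Z.^ suc K)
          go (yes p∣k) = Z.mtrans (Z.sum-0m d (λ i _ → Z.m*0 (β Z.^ ex i) (Z.m*0 (α Z.^ (s′ ℕ.+ i)) α≡0)))
              (Z.meq (sym (trans (cong (+ d *_) (c₀-no (r - + k) (λ m → p∤r (Z.mtrans (Z.meq (lem₀ r (+ k))) (Z.m+ m k≡0))))) (ℤP.*-zeroʳ (+ d)))))
            where
            k≡0 : + k Z.≡ 0ℤ mod 𝕡
            k≡0 = ∣⇒mod {p} {+ k} p∣k
            α≡0 : α Z.≡ 0ℤ mod (𝕡 Z.^ suc K)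
            α≡0 = Z.mtrans (Z.pow-lifts p 0 K (Z.m^1⁻ 𝕡 k≡0)) (Z.meq (Z.0^ P {{nonzero K}}))
          go (no p∤k) = go′ (p ∣? ∣ r - + k ∣)
            where
            p∤k′ : ¬ (+ k Z.≡ 0ℤ mod 𝕡)
            p∤k′ m = p∤k (mod⇒∣ {p} {+ k} m)
            go′ : Dec (p ℕD.∣ ∣ r - + k ∣) → Z.sum d (λ i → α Z.^ (s₀ ℕ.+ i) * β Z.^ ex i) Z.≡ + d * c₀ (r - + k) mod (𝕡 Z.^ suc K)
            go′ (yes p∣) = Z.mtrans (Z.sum-mod d term) (Z.meq (trans (sum-one d) (sym (trans (cong (+ d *_) (c₀-yes (r - + k) r-k≡0)) (ℤP.*-identityʳ (+ d))))))
              where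
              r-k≡0 : r - + k Z.≡ 0ℤ mod 𝕡
              r-k≡0 = ∣⇒mod {p} {r - + k} p∣
              α≡β : α Z.≡ β mod (𝕡 Z.^ suc K)
              α≡β = Z.pow-lifts p 0 K (Z.m^1⁻ 𝕡 (Z.msym (Z.mdiff r-k≡0)))
              sum-one : ∀ n → Z.sum n (λ _ → 1ℤ) ≡ + n
              sum-one zero = refl
              sum-one (suc n) = trans (cong (_+ 1ℤ) (sum-one n)) (trans (ℤP.+-comm (+ n) 1ℤ) (sym (ℤP.pos-+ 1 n)))
              exps : ∀ i → i ℕ.< d → (s₀ ℕ.+ i) ℕ.+ ex i ≡ d ℕ.+ d
              exps i i<d = trans (lem s₀ i s̄ (d′ ℕ.∸ i)) (cong₂ ℕ._+_ s+s̄ (cong suc (ℕP.m+[n∸m]≡n (ℕP.≤-pred i<d))))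
                where lem : ∀ s i t e → (s ℕ.+ i) ℕ.+ (t ℕ.+ suc e) ≡ (s ℕ.+ t) ℕ.+ suc (i ℕ.+ e)
                      lem = ℕ-solve-∀
              term : ∀ i → i ℕ.< d → α Z.^ (s₀ ℕ.+ i) * β Z.^ ex i Z.≡ 1ℤ mod (𝕡 Z.^ suc K)
              term i i<d = Z.mtrans (Z.m*ʳ (β Z.^ ex i) (Z.mpow (s₀ ℕ.+ i) α≡β)) (Z.mtrans (Z.meq (trans (sym (Z.^-homo-* β (s₀ ℕ.+ i) (ex i))) (trans (cong (β Z.^_) (exps i i<d)) (Z.^-homo-* β d d)))) (Z.m* β^d β^d))
            go′ (no p∤) = Z.m≈ (trans factor refl) (trans (cong (+ d *_) (c₀-no (r - + k) (λ m → p∤ (mod⇒∣ {p} {r - + k} m)))) (ℤP.*-zeroʳ (+ d)))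
                (Z.m0* (α Z.^ s₀ * β Z.^ suc s̄) (unit-cancel (suc K) (α - β) (geo α β d) unit (Z.m≈ (geo-telescope α β d) (sym (ℤP.+-inverseʳ 1ℤ)) (Z.m- (pow-p^-one (+ k) K p∤k′) β^d))))
              where
              unit : ¬ (p ℕD.∣ ∣ α - β ∣)
              unit p∣ = p∤ (mod⇒∣ {p} {r - + k} (Z.mdiff⁻ (Z.mtrans (Z.msym (frobenius r K p∤r)) (Z.mtrans (Z.msym (Z.mdiff (∣⇒mod {p} {α - β} p∣))) (frobenius (+ k) K p∤k′)))))
              factor : Z.sum d (λ i → α Z.^ (s₀ ℕ.+ i) * β Z.^ ex i) ≡ α Z.^ s₀ * β Z.^ suc s̄ * geo α β d
              factor = trans (Z.sum-cong d (λ i _ → trans (cong₂ _*_ (Z.^-homo-* α s₀ i) (trans (cong (β Z.^_) (ℕP.+-suc s̄ (d′ ℕ.∸ i))) (Z.^-homo-* β (suc s̄) (d′ ℕ.∸ i)))) (lem (α Z.^ s₀) (α Z.^ i) (β Z.^ suc s̄) (β Z.^ (d′ ℕ.∸ i)))))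
                (trans (Z.sum-* d (α Z.^ s₀ * β Z.^ suc s̄) (λ i → α Z.^ i * β Z.^ (d′ ℕ.∸ i))) (cong (α Z.^ s₀ * β Z.^ suc s̄ *_) (sym (geo-sum α β d′))))
                where lem : ∀ a b c e → (a * b) * (c * e) ≡ (a * c) * (b * e)
                      lem = solve-∀

        module _ (B j : ℕ) where
          private
            K = B ℕ.+ j
            N = s₀ ℕ.* p ℕ.^ B
            e = rep B ℕ.* s₀
          -- As p^K is 1 modulo p - 1, the exponent p^K (s + i) exceeds N by a number of the form i
          -- + τ(p-1); its value is computed in `exponent`.
          τ : ℕ → ℕ
          τ i = s₀ ℕ.* (p ℕ.^ B ℕ.* rep j) ℕ.+ i ℕ.* rep K
          idx : ℕ → ℕ
          idx i = i ℕ.+ τ i ℕ.* d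

          exponent : ∀ i → p ℕ.^ K ℕ.* (s₀ ℕ.+ i) ≡ N ℕ.+ idx i
          exponent i = trans (ℕP.*-distribˡ-+ (p ℕ.^ K) s₀ i) (trans (cong₂ ℕ._+_ (trans (cong (ℕ._* s₀) (trans (ℕP.^-distribˡ-+-* p B j) (cong (p ℕ.^ B ℕ.*_) (rep-geometric j)))) refl) (cong (ℕ._* i) (rep-geometric K)))
            (lem (p ℕ.^ B) (rep j) d s₀ (rep K) i))
            where lem : ∀ b rj d s rk i → (b ℕ.* suc (rj ℕ.* d)) ℕ.* s ℕ.+ suc (rk ℕ.* d) ℕ.* i ≡ s ℕ.* b ℕ.+ (i ℕ.+ (s ℕ.* (b ℕ.* rj) ℕ.+ i ℕ.* rk) ℕ.* d)
                  lem = ℕ-solve-∀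

          N≡ : N ≡ s₀ ℕ.+ e ℕ.* d
          N≡ = trans (cong (s₀ ℕ.*_) (rep-geometric B)) (lem s₀ (rep B) d)
            where lem : ∀ s b d → s ℕ.* suc (b ℕ.* d) ≡ s ℕ.+ (b ℕ.* s) ℕ.* d
                  lem = ℕ-solve-∀

          sgn-N : sgn N ≡ sgn s₀
          sgn-N = trans (cong sgn N≡) (trans (sgn-+ s₀ (e ℕ.* d)) (trans (cong (sgn s₀ *_) (trans (cong sgn (ℕP.*-comm e d)) (trans (sym (Z.^-assocʳ (- 1ℤ) d e)) (trans (cong (Z._^ e) sgn-d) (Z.1^ e))))) (ℤP.*-identityʳ (sgn s₀))))

          u : ℕ
          u = s₀ ! ℕ.* YY B s₀

          sf-N : sf N ≡ 𝕡 Z.^ e * (sgn s₀ * + u)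
          sf-N = trans (sf≡ N) (trans (cong₂ (λ a b → a * + b) sgn-N (trans (cong _! (ℕP.*-comm s₀ (p ℕ.^ B))) (fact-p^ B s₀)))
            (trans (cong (sgn s₀ *_) (trans (ℤP.pos-* (p ℕ.^ e) u) (cong (_* + u) (Z.ιℕ^ p e)))) (lem (sgn s₀) (𝕡 Z.^ e) (+ u))))
            where lem : ∀ s p u → s * (p * u) ≡ p * (s * u)
                  lem = solve-∀

          fleck-stirling₀ : + d * cc N r Z.≡ Z.sum d (λ i → (r Z.^ (p ℕ.^ K)) Z.^ ex i * (sf N * hs N (idx i))) mod (𝕡 Z.^ suc K)
          fleck-stirling₀ = Z.m≈ (trans (cong (+ d *_) (D-δ^ N c₀ r)) (sym (D-* N (+ d) (λ k → c₀ (r - + k))))) sums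
            (D-mod N (λ k → Z.msym (indicator K k)))
            where
            sums : Z.sum d (λ i → (r Z.^ (p ℕ.^ K)) Z.^ ex i * (sf N * hs N (idx i))) ≡ D N (λ k → Z.sum d (λ i → ((+ k) Z.^ (p ℕ.^ K)) Z.^ (s₀ ℕ.+ i) * (r Z.^ (p ℕ.^ K)) Z.^ ex i))
            sums = sym (trans (D-sum N d (λ i k → ((+ k) Z.^ (p ℕ.^ K)) Z.^ (s₀ ℕ.+ i) * (r Z.^ (p ℕ.^ K)) Z.^ ex i))
              (Z.sum-cong d (λ i _ → trans (D-cong N (λ k → trans (ℤP.*-comm (((+ k) Z.^ (p ℕ.^ K)) Z.^ (s₀ ℕ.+ i)) ((r Z.^ (p ℕ.^ K)) Z.^ ex i)) (cong ((r Z.^ (p ℕ.^ K)) Z.^ ex i *_) (trans (Z.^-assocʳ (+ k) (p ℕ.^ K) (s₀ ℕ.+ i)) (cong ((+ k) Z.^_) (exponent i))))))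
                (trans (D-* N ((r Z.^ (p ℕ.^ K)) Z.^ ex i) (λ k → (+ k) Z.^ (N ℕ.+ idx i))) (cong ((r Z.^ (p ℕ.^ K)) Z.^ ex i *_) (D-pow N (idx i)))))))

          neg-pow : ∀ e → (- 𝕡) Z.^ e ≡ sgn e * 𝕡 Z.^ e
          neg-pow e = trans (cong (Z._^ e) (sym (ℤP.-1*i≡-i 𝕡))) (Z.^-distrib-* (- 1ℤ) 𝕡 e)

          -- N! contains p^e exactly, matching the (-p)^e of the Fleck quotient; after cancellation
          -- p^m is what remains of the modulus p^(K+1).
          fleck-stirling : ∀ m → suc K ≡ e ℕ.+ m → + d * (sgn e * F s′ e r) Z.≡ Z.sum d (λ i → (r Z.^ (p ℕ.^ K)) Z.^ ex i * (sgn s₀ * + u * hs N (idx i))) mod (𝕡 Z.^ m)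
          fleck-stirling m eq = p^-cancel≡ e m _ _ (Z.m≈m (cong (𝕡 Z.^_) eq) (Z.m≈
            (trans (lem (𝕡 Z.^ e) (+ d) (sgn e) (F s′ e r)) (cong (+ d *_) (trans (cong (_* F s′ e r) (sym (neg-pow e))) (trans (sym (cc≡F s′ e r)) (cong (λ m → cc m r) (sym N≡))))))
            (trans (sym (Z.sum-* d (𝕡 Z.^ e) (λ i → (r Z.^ (p ℕ.^ K)) Z.^ ex i * (sgn s₀ * + u * hs N (idx i))))) (Z.sum-cong d (λ i _ → trans (lem₂ (𝕡 Z.^ e) ((r Z.^ (p ℕ.^ K)) Z.^ ex i) (sgn s₀ * + u) (hs N (idx i))) (cong (λ z → (r Z.^ (p ℕ.^ K)) Z.^ ex i * (z * hs N (idx i))) (sym sf-N)))))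
            fleck-stirling₀))
            where lem : ∀ p d s f → p * (d * (s * f)) ≡ d * ((s * p) * f)
                  lem = solve-∀
                  lem₂ : ∀ p b u x → p * (b * (u * x)) ≡ b * ((p * u) * x)
                  lem₂ = solve-∀

  -- A telescoping form of the Gross-Koblitz formula.

  module GrossKoblitz where

    open GenericAlgebra
    open ShiftOperators
    open StirlingSeries
    open PrimeUnits
    open SeriesValues
    open FactorialProducts
    open ResidueFilter
    open import Data.Nat using (_!)
    open import Data.Integer using (ℤ; +_; _+_; _*_; -_; _-_; 0ℤ; 1ℤ)

    module Residues where
      open Main public

      sgn-p* : ∀ a → sgn (p ℕ.* a) ≡ sgn a
      sgn-p* a = trans (sym (Z.^-assocʳ (- 1ℤ) p a)) (cong (Z._^ a) sgn-p)

      sgn-rep : ∀ s j → sgn (s ℕ.* rep j) ≡ sgn (s ℕ.* j)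
      sgn-rep s zero = refl
      sgn-rep s (suc j) = trans (cong sgn (trans (cong (s ℕ.*_) (rep-suc j)) (lem s p (rep j)))) (trans (sgn-+ s (p ℕ.* (s ℕ.* rep j)))
        (trans (cong (sgn s *_) (trans (sgn-p* (s ℕ.* rep j)) (sgn-rep s j))) (trans (sym (sgn-+ s (s ℕ.* j))) (cong sgn (sym (ℕP.*-suc s j))))))
        where lem : ∀ s p r → s ℕ.* suc (p ℕ.* r) ≡ s ℕ.+ p ℕ.* (s ℕ.* r)
              lem = ℕ-solve-∀

      p^>0 : ∀ n → 0 ℕ.< p ℕ.^ n
      p^>0 n = ℕ.>-nonZero⁻¹ (p ℕ.^ n) {{ℕP.m^n≢0 p n}}

      p^≡0 : ∀ n → + (p ℕ.^ n) Z.≡ 0ℤ mod (𝕡 Z.^ n)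
      p^≡0 n = Z.by 1ℤ (trans (Z.ιℕ^ p n) (lem (𝕡 Z.^ n)))
        where lem : ∀ x → x ≡ 0ℤ + x * 1ℤ
              lem = solve-∀

      rep-unit : ∀ j → + rep (suc j) Z.≡ 1ℤ mod 𝕡
      rep-unit j = Z.by (+ rep j) (trans (cong +_ (rep-suc j)) (trans (ℤP.pos-+ 1 (p ℕ.* rep j)) (cong (λ z → 1ℤ + z) (ℤP.pos-* p (rep j)))))

      module _ (s : ℕ) (s<p : s ℕ.< p) (0<s : 0 ℕ.< s) where
        private
          -- (p^B y)! = (M + t)! is computed twice, once through y! and once through M! t! and a
          -- binomial coefficient; the powers of p on both sides are equal and cancel.
          factorial-ratio : ∀ B z → let B₁ = suc B; M = p ℕ.^ B ℕ.* s; t = p ℕ.^ B₁ ℕ.* z; y = p ℕ.* z ℕ.+ s in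
            V y ℕ.* YY B y ≡ hc (suc M) t ℕ.* (s ! ℕ.* (YY B s ℕ.* YY B₁ z))
          factorial-ratio B z = ℕP.*-cancelʳ-≡ (V y ℕ.* YY B y) _ (c₁ ℕ.* (c₂ ℕ.* z !)) {{nz}}
            (trans (lem₁ (V y) (YY B y) c₁ c₂ (z !)) (trans (cong (λ x → x ℕ.* ((z ! ℕ.* V y) ℕ.* YY B y)) powers)
              (trans (lem₂ (p ℕ.^ (rep B ℕ.* y)) (p ℕ.^ z) (z !) (V y) (YY B y)) (trans (cong (λ x → p ℕ.^ (rep B ℕ.* y) ℕ.* (x ℕ.* YY B y)) (sym (fact-V z s s<p)))
                (trans (sym (fact-p^ B y)) (trans (cong _! M+t) (trans (sym (hc-! M t)) (trans (cong₂ (λ a b → hc (suc M) t ℕ.* (a ℕ.* b)) (fact-p^ B s) (fact-p^ B₁ z))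
                  (lem₃ (hc (suc M) t) c₁ (s !) (YY B s) c₂ (z !) (YY B₁ z))))))))))
            where
            B₁ = suc B
            M = p ℕ.^ B ℕ.* s
            t = p ℕ.^ B₁ ℕ.* z
            y = p ℕ.* z ℕ.+ s
            c₁ = p ℕ.^ (rep B ℕ.* s)
            c₂ = p ℕ.^ (rep B₁ ℕ.* z)
            nz : ℕ.NonZero (c₁ ℕ.* (c₂ ℕ.* z !))
            nz = ℕP.m*n≢0 c₁ (c₂ ℕ.* z !) {{ℕP.m^n≢0 p (rep B ℕ.* s)}} {{ℕP.m*n≢0 c₂ (z !) {{ℕP.m^n≢0 p (rep B₁ ℕ.* z)}} {{z ℕP.!≢0}}}}
            M+t : p ℕ.^ B ℕ.* y ≡ M ℕ.+ t
            M+t = lem (p ℕ.^ B) p z s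
              where lem : ∀ b p z s → b ℕ.* (p ℕ.* z ℕ.+ s) ≡ b ℕ.* s ℕ.+ (p ℕ.* b) ℕ.* z
                    lem = ℕ-solve-∀
            powers : c₁ ℕ.* c₂ ≡ p ℕ.^ (rep B ℕ.* y) ℕ.* p ℕ.^ z
            powers = trans (sym (ℕP.^-distribˡ-+-* p (rep B ℕ.* s) (rep B₁ ℕ.* z))) (trans (cong (p ℕ.^_) (trans (cong (λ x → rep B ℕ.* s ℕ.+ x ℕ.* z) (rep-suc B)) (lem (rep B) s p z)))
              (ℕP.^-distribˡ-+-* p (rep B ℕ.* y) z))
              where lem : ∀ r s p z → r ℕ.* s ℕ.+ suc (p ℕ.* r) ℕ.* z ≡ r ℕ.* (p ℕ.* z ℕ.+ s) ℕ.+ z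
                    lem = ℕ-solve-∀
            lem₁ : ∀ v y a b z → (v ℕ.* y) ℕ.* (a ℕ.* (b ℕ.* z)) ≡ (a ℕ.* b) ℕ.* ((z ℕ.* v) ℕ.* y)
            lem₁ = ℕ-solve-∀
            lem₂ : ∀ a b z v y → (a ℕ.* b) ℕ.* ((z ℕ.* v) ℕ.* y) ≡ a ℕ.* ((b ℕ.* (z ℕ.* v)) ℕ.* y)
            lem₂ = ℕ-solve-∀
            lem₃ : ∀ h a s y b z w → h ℕ.* ((a ℕ.* (s ℕ.* y)) ℕ.* (b ℕ.* (z ℕ.* w))) ≡ (h ℕ.* (s ℕ.* (y ℕ.* w))) ℕ.* (a ℕ.* (b ℕ.* z))
            lem₃ = ℕ-solve-∀

        -- The unit part of N!, for N = s p^(B+1), times the binomial coefficient that `hc-ratio`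
        -- produces from the series.
        X : ℕ → ℕ → ℕ
        X B z = (s ! ℕ.* YY (suc B) s) ℕ.* hc (suc (p ℕ.^ B ℕ.* s)) (p ℕ.^ suc B ℕ.* z)

        X-identity : ∀ B z → X B z ℕ.* YY (suc B) z ≡ V (p ℕ.^ suc B ℕ.* s) ℕ.* (V (p ℕ.* z ℕ.+ s) ℕ.* YY B (p ℕ.* z ℕ.+ s))
        X-identity B z = trans (lem (s !) (YY B s) (V (p ℕ.^ suc B ℕ.* s)) (hc (suc (p ℕ.^ B ℕ.* s)) (p ℕ.^ suc B ℕ.* z)) (YY (suc B) z))
          (cong (V (p ℕ.^ suc B ℕ.* s) ℕ.*_) (sym (factorial-ratio B z)))
          where lem : ∀ f y v h w → ((f ℕ.* (y ℕ.* v)) ℕ.* h) ℕ.* w ≡ v ℕ.* (h ℕ.* (f ℕ.* (y ℕ.* w)))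
                lem = ℕ-solve-∀

        y≡₁ : ∀ j → p ℕ.* (s ℕ.* rep j) ℕ.+ s ≡ s ℕ.* rep (suc j)
        y≡₁ j = trans (lem p s (rep j)) (cong (s ℕ.*_) (sym (rep-suc j)))
          where lem : ∀ p s r → p ℕ.* (s ℕ.* r) ℕ.+ s ≡ s ℕ.* suc (p ℕ.* r)
                lem = ℕ-solve-∀

        y≡₂ : ∀ j → s ℕ.* rep (suc j) ≡ p ℕ.^ j ℕ.* s ℕ.+ s ℕ.* rep j
        y≡₂ j = trans (ℕP.*-distribˡ-+ s (rep j) (p ℕ.^ j)) (trans (ℕP.+-comm (s ℕ.* rep j) (s ℕ.* p ℕ.^ j)) (cong (ℕ._+ s ℕ.* rep j) (ℕP.*-comm s (p ℕ.^ j))))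

        -- The two arguments differ by p^j s, so each factor V has its argument moved by a multiple
        -- of a high power of p, which by `V-shift` changes only its sign.
        YY-shift : ∀ j B → + YY B (s ℕ.* rep (suc j)) Z.≡ sgn (s ℕ.* B) * + YY B (s ℕ.* rep j) mod (𝕡 Z.^ j)
        YY-shift j zero = Z.meq (trans (sym (ℤP.*-identityˡ 1ℤ)) (cong (λ k → sgn k * 1ℤ) (sym (ℕP.*-zeroʳ s))))
        YY-shift j (suc B) = Z.m≈ (ℤP.pos-* (YY B y) (V (p ℕ.^ suc B ℕ.* y)))
          (trans (cong₂ _*_ (trans (cong sgn (ℕP.*-suc s B)) (sgn-+ s (s ℕ.* B))) (ℤP.pos-* (YY B z) (V (p ℕ.^ suc B ℕ.* z)))) (lem (sgn s) (sgn (s ℕ.* B)) (+ YY B z) (+ V (p ℕ.^ suc B ℕ.* z))))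
          (Z.m* (YY-shift j B) (Z.m^-weaken 𝕡 j (suc (B ℕ.+ j)) (ℕP.m≤n+m j (suc B)) (Z.m≈ (cong (λ k → + V k) eq) refl (V-shift (B ℕ.+ j) s (p ℕ.^ suc B ℕ.* z)))))
          where
          y = s ℕ.* rep (suc j)
          z = s ℕ.* rep j
          eq : p ℕ.^ suc B ℕ.* y ≡ p ℕ.^ suc (B ℕ.+ j) ℕ.* s ℕ.+ p ℕ.^ suc B ℕ.* z
          eq = trans (cong (p ℕ.^ suc B ℕ.*_) (y≡₂ j)) (trans (lem₂ (p ℕ.^ suc B) (p ℕ.^ j) s z) (cong (λ k → k ℕ.* s ℕ.+ p ℕ.^ suc B ℕ.* z) (sym (ℕP.^-distribˡ-+-* p (suc B) j))))
            where lem₂ : ∀ b j s z → b ℕ.* (j ℕ.* s ℕ.+ z) ≡ (b ℕ.* j) ℕ.* s ℕ.+ b ℕ.* z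
                  lem₂ = ℕ-solve-∀
          lem : ∀ a b c e → (a * b) * (c * e) ≡ (b * c) * (a * e)
          lem = solve-∀

        private
          XYY : ∀ B j → + X B (s ℕ.* rep j) * (+ YY B (s ℕ.* rep j) * + V (p ℕ.^ suc B ℕ.* (s ℕ.* rep j)))
            ≡ + V (p ℕ.^ suc B ℕ.* s) * (+ V (s ℕ.* rep (suc j)) * + YY B (s ℕ.* rep (suc j)))
          XYY B j = trans (cong (+ X B z *_) (sym (ℤP.pos-* (YY B z) (V (p ℕ.^ suc B ℕ.* z))))) (trans (sym (ℤP.pos-* (X B z) (YY (suc B) z)))
            (trans (cong +_ (trans (X-identity B z) (cong (λ y → V (p ℕ.^ suc B ℕ.* s) ℕ.* (V y ℕ.* YY B y)) (y≡₁ j))))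
            (trans (ℤP.pos-* (V (p ℕ.^ suc B ℕ.* s)) (V y ℕ.* YY B y)) (cong (+ V (p ℕ.^ suc B ℕ.* s) *_) (ℤP.pos-* (V y) (YY B y))))))
            where z = s ℕ.* rep j
                  y = s ℕ.* rep (suc j)

          V-shift₀ : ∀ B w → + V (p ℕ.^ suc B ℕ.* w) Z.≡ sgn w mod (𝕡 Z.^ suc B)
          V-shift₀ B w = Z.m≈ (cong (λ k → + V k) (sym (ℕP.+-identityʳ (p ℕ.^ suc B ℕ.* w)))) (sym (ℤP.*-identityʳ (sgn w))) (V-shift B w 0)

        -- In `X-identity` the factors `YY` at neighbouring repunits cancel up to sign, and a single
        -- product of units remains.
        X-mod : ∀ B j m → m ℕ.≤ suc B → m ℕ.≤ j → + X B (s ℕ.* rep j) Z.≡ sgn (s ℕ.* rep j) * (sgn s * (sgn (s ℕ.* B) * + V (s ℕ.* rep (suc j)))) mod (𝕡 Z.^ m)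
        X-mod B j m m≤B m≤j = Z.m≈ (sym (sgn-cancel z (+ X B z))) refl (Z.m*ˡ (sgn z) (unit-cancel≡ m (+ YY B z) (sgn z * + X B z) _ (YY-unit B z)
            (Z.m≈ (lem₁ (+ YY B z) (sgn z) (+ X B z)) (lem₂ (+ YY B z) (sgn s) (sgn (s ℕ.* B)) (+ V y))
             (Z.mtrans (Z.m*ˡ (+ X B z) (Z.m*ˡ (+ YY B z) (Z.m^-weaken 𝕡 m (suc B) m≤B (Z.msym (V-shift₀ B z)))))
              (Z.mtrans (Z.meq (XYY B j)) (Z.m* (Z.m^-weaken 𝕡 m (suc B) m≤B (V-shift₀ B s)) (Z.m*ˡ (+ V y) (Z.m^-weaken 𝕡 m j m≤j (YY-shift j B)))))))))
          where
          z = s ℕ.* rep j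
          y = s ℕ.* rep (suc j)
          lem₁ : ∀ y g x → y * (g * x) ≡ x * (y * g)
          lem₁ = solve-∀
          lem₂ : ∀ y s b v → y * (s * (b * v)) ≡ s * (v * (b * y))
          lem₂ = solve-∀

        -- For B = 0 the two products V(p z) and V(p s) are compared with each other instead of with
        -- signs, which is accurate modulo p^2.
        X-mod² : ∀ j → + X 0 (s ℕ.* rep (suc j)) Z.≡ sgn (s ℕ.* rep (suc j)) * (sgn s * (sgn (s ℕ.* 0) * + V (s ℕ.* rep (suc (suc j))))) mod (𝕡 Z.^ 2)
        X-mod² j = Z.m≈ refl (trans (cong₂ (λ a b → a * (sgn s * (b * + V y))) sgn-z (cong sgn (ℕP.*-zeroʳ s))) (trans (lem₃ (sgn s) (sgn z₂) (+ V y)) (trans (cong (λ g → g * (sgn z₂ * + V y)) (sgn² s)) (ℤP.*-identityˡ _))))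
          (Z.m≈ (sym (sgn-cancel z₂ (+ X 0 z))) refl (Z.m*ˡ (sgn z₂) (unit-cancel≡ 2 (+ V (p ℕ.^ 1 ℕ.* s)) (sgn z₂ * + X 0 z) (+ V y) (V-unit (p ℕ.^ 1 ℕ.* s))
            (Z.m≈ (lem₁ (+ V (p ℕ.^ 1 ℕ.* s)) (sgn z₂) (+ X 0 z)) (cong (+ V (p ℕ.^ 1 ℕ.* s) *_) (sym (ℤP.*-identityʳ (+ V y))))
              (Z.mtrans (Z.m*ˡ (+ X 0 z) (Z.m*ˡ 1ℤ (Z.msym (Z.m≈ (cong (λ k → + V k) eq) refl (V-shift 1 z₂ (p ℕ.^ 1 ℕ.* s)))))) (Z.meq (XYY 0 (suc j))))))))
          where
          z = s ℕ.* rep (suc j)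
          z₂ = s ℕ.* rep j
          y = s ℕ.* rep (suc (suc j))
          sgn-z : sgn z ≡ sgn s * sgn z₂
          sgn-z = trans (sgn-rep s (suc j)) (trans (cong sgn (ℕP.*-suc s j)) (trans (sgn-+ s (s ℕ.* j)) (cong (sgn s *_) (sym (sgn-rep s j)))))
          eq : p ℕ.^ 1 ℕ.* z ≡ p ℕ.^ 2 ℕ.* z₂ ℕ.+ p ℕ.^ 1 ℕ.* s
          eq = trans (cong (λ k → p ℕ.^ 1 ℕ.* (s ℕ.* k)) (rep-suc j)) (lem p s (rep j))
            where lem : ∀ p s r → (p ℕ.* 1) ℕ.* (s ℕ.* suc (p ℕ.* r)) ≡ (p ℕ.* (p ℕ.* 1)) ℕ.* (s ℕ.* r) ℕ.+ (p ℕ.* 1) ℕ.* s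
                  lem = ℕ-solve-∀
          lem₁ : ∀ v g x → v * (g * x) ≡ x * (1ℤ * (g * v))
          lem₁ = solve-∀
          lem₃ : ∀ s z v → (s * z) * (s * (1ℤ * v)) ≡ (s * s) * (z * v)
          lem₃ = solve-∀

        -- This is -Γ_p(1 + s rep i) for Morita's p-adic gamma function Γ_p; it converges to -Γ_p(1
        -- - s/(p-1)).
        GG : ℕ → ℤ
        GG i = sgn (s ℕ.* i) * + V (s ℕ.* rep i)

        GG-stable : ∀ i k → GG (suc i ℕ.+ k) Z.≡ GG (suc i) mod (𝕡 Z.^ suc i)
        GG-stable i zero = Z.meq (cong GG (ℕP.+-identityʳ (suc i)))
        GG-stable i (suc k) = Z.mtrans (Z.m≈ (trans (cong GG (ℕP.+-suc (suc i) k)) (cong (λ a → sgn (s ℕ.* suc n) * + V a) (y≡₂ n))) refl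
            (Z.m*ˡ (sgn (s ℕ.* suc n)) (Z.m^-weaken 𝕡 (suc i) n (ℕP.m≤m+n (suc i) k) (V-shift (i ℕ.+ k) s (s ℕ.* rep n)))))
          (Z.mtrans (Z.meq (trans (cong (_* (sgn s * + V (s ℕ.* rep n))) (trans (cong sgn (ℕP.*-suc s n)) (sgn-+ s (s ℕ.* n)))) (trans (lem (sgn s) (sgn (s ℕ.* n)) (+ V (s ℕ.* rep n))) (trans (cong (_* GG n) (sgn² s)) (ℤP.*-identityˡ (GG n))))))
            (GG-stable i k))
          where
          n = suc i ℕ.+ k
          lem : ∀ a b c → (a * b) * (a * c) ≡ (a * a) * (b * c)
          lem = solve-∀

        X-GG : ∀ B j → sgn (rep (suc B) ℕ.* s) * (sgn s * (sgn (s ℕ.* rep j) * (sgn s * (sgn (s ℕ.* B) * + V (s ℕ.* rep (suc j)))))) ≡ GG (suc j)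
        X-GG B j = trans (cong₂ (λ a b → a * (sgn s * (b * (sgn s * (sgn (s ℕ.* B) * + V y)))))
            (trans (cong sgn (ℕP.*-comm (rep (suc B)) s)) (trans (sgn-rep s (suc B)) (trans (cong sgn (ℕP.*-suc s B)) (sgn-+ s (s ℕ.* B))))) (sgn-rep s j))
          (trans (lem (sgn s) (sgn (s ℕ.* B)) (sgn (s ℕ.* j)) (+ V y)) (trans (cong₂ (λ a b → a * b * (sgn s * sgn (s ℕ.* j) * + V y)) (sgn² s) (sgn² (s ℕ.* B)))
            (trans (ℤP.*-identityˡ _) (cong (_* + V y) (sym (trans (cong sgn (ℕP.*-suc s j)) (sgn-+ s (s ℕ.* j))))))))
          where
          y = s ℕ.* rep (suc j)
          lem : ∀ s b j v → (s * b) * (s * (j * (s * (b * v)))) ≡ (s * s) * (b * b) * (s * j * v)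
          lem = solve-∀

  -- Fleck quotients at N = p^B s modulo p^B and at N = ps modulo p^2.

  module FleckResidues where

    open GenericAlgebra
    open ShiftOperators
    open FleckQuotients
    open StirlingSeries
    open PrimeUnits
    open SeriesModPrimePowers
    open SeriesValues
    open FactorialProducts
    open ResidueFilter
    open GrossKoblitz
    open import Data.Nat using (_!)
    open import Data.Integer using (ℤ; +_; _+_; _*_; -_; _-_; 0ℤ; 1ℤ; ∣_∣)

    module Quotients where
      open Residues public

      module _ (r : ℤ) (p∤r : ¬ (r Z.≡ 0ℤ mod 𝕡)) (s′ s̄ : ℕ) (s+s̄ : suc s′ ℕ.+ s̄ ≡ d) (s<d : suc s′ ℕ.< d) where
        private
          s₀ = suc s′
          s<p : s₀ ℕ.< p
          s<p = ℕP.m<n⇒m<1+n s<d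
          0<s : 0 ℕ.< s₀
          0<s = ℕ.z<s
          exr = ex r p∤r s′ s̄ s+s̄
          𝔾 = GG s₀ s<p 0<s

        -- An approximation to ω(r)^(-s), with ω the Teichmüller character: s̄ + d is -s modulo p -
        -- 1.
        ρ : ℕ → ℤ
        ρ K = (r Z.^ (p ℕ.^ K)) Z.^ (s̄ ℕ.+ d)

        ρ-stable : ∀ B j → ρ (B ℕ.+ j) Z.≡ ρ B mod (𝕡 Z.^ suc B)
        ρ-stable B j = Z.mpow (s̄ ℕ.+ d) (Z.m≈ (trans (cong (r Z.^_) (trans (ℕP.^-distribˡ-+-* p B j) (ℕP.*-comm (p ℕ.^ B) (p ℕ.^ j)))) (sym (Z.^-assocʳ r (p ℕ.^ j) (p ℕ.^ B)))) refl
          (Z.pow-lifts p 0 B (Z.m^1⁻ 𝕡 (frobenius r j p∤r))))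

        private
          -- d times `rep (suc j)` is p^(j+1) - 1, so the repunit serves as the inverse of -d.
          unscale : ∀ e j m S → m ℕ.≤ suc j → + d * (sgn e * F s′ e r) Z.≡ S mod (𝕡 Z.^ m) → F s′ e r Z.≡ - (sgn e * (+ rep (suc j) * S)) mod (𝕡 Z.^ m)
          unscale e j m S m≤j c = Z.m≈ (sym (trans (cong -_ (trans (cong (_* (- 1ℤ * f)) (sgn² e)) (lem₂ f))) (ℤP.neg-involutive f))) refl
            (Z.mneg (Z.mtrans (Z.m≈ refl (lem (sgn e) (+ rep (suc j)) (+ d) f) (Z.m*ˡ (sgn e * sgn e) (Z.m*ʳ f (Z.msym d-rep)))) (Z.m*ˡ (sgn e) (Z.m*ˡ (+ rep (suc j)) c))))
            where
            f = F s′ e r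
            lem₂ : ∀ f → 1ℤ * (- 1ℤ * f) ≡ - f
            lem₂ = solve-∀
            lem : ∀ g k d f → g * (k * (d * (g * f))) ≡ (g * g) * ((k * d) * f)
            lem = solve-∀
            lem₃ : ∀ a → a ≡ (1ℤ + a) - 1ℤ
            lem₃ = solve-∀
            d-rep : + rep (suc j) * + d Z.≡ - 1ℤ mod (𝕡 Z.^ m)
            d-rep = Z.m≈ (trans (lem₃ (+ rep (suc j) * + d)) (cong (_- 1ℤ) (sym (trans (cong +_ (rep-geometric (suc j))) (trans (ℤP.pos-+ 1 (rep (suc j) ℕ.* d)) (cong (λ z → 1ℤ + z) (ℤP.pos-* (rep (suc j)) d))))))) refl
              (Z.m- (Z.m^-weaken 𝕡 m (suc j) m≤j (p^≡0 (suc j))) (Z.mrefl {1ℤ}))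

        module _ (B′ : ℕ) where
          private
            B = suc B′
            e = rep B ℕ.* s₀
            -- The summand e pays for the division by p^e; `suc K` then leaves the modulus p^(2B+1).
            j = e ℕ.+ B
            K = B ℕ.+ j
            N = s₀ ℕ.* p ℕ.^ B
            M = p ℕ.^ B′ ℕ.* s₀
            t = p ℕ.^ B ℕ.* (s₀ ℕ.* rep j)
            u₀ = s₀ ! ℕ.* YY B s₀
            τ₀ = τ r p∤r s′ s̄ s+s̄ B j
            idx₀ = idx r p∤r s′ s̄ s+s̄ B j
            β = r Z.^ (p ℕ.^ K)
            X₀ = X s₀ s<p 0<s B′ (s₀ ℕ.* rep j)

            f : ℕ → ℤ
            f i = β Z.^ exr i * (sgn s₀ * + u₀ * hs N (idx₀ i))

            eqK : suc K ≡ e ℕ.+ suc (B ℕ.+ B)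
            eqK = lem e B
              where lem : ∀ e B → suc (B ℕ.+ (e ℕ.+ B)) ≡ e ℕ.+ suc (B ℕ.+ B)
                    lem = ℕ-solve-∀

            τ₀≡t : τ₀ 0 ≡ t
            τ₀≡t = trans (ℕP.+-identityʳ (s₀ ℕ.* (p ℕ.^ B ℕ.* rep j))) (lem s₀ (p ℕ.^ B) (rep j))
              where lem : ∀ a b c → a ℕ.* (b ℕ.* c) ≡ b ℕ.* (a ℕ.* c)
                    lem = ℕ-solve-∀

          start : ∀ m → m ℕ.≤ suc (B ℕ.+ B) → + d * (sgn e * F s′ e r) Z.≡ Z.sum d f mod (𝕡 Z.^ m)
          start m m≤ = Z.m^-weaken 𝕡 m (suc (B ℕ.+ B)) m≤ (fleck-stirling r p∤r s′ s̄ s+s̄ B j (suc (B ℕ.+ B)) eqK)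

          -- The repunit brought in by `unscale` is just the factor that turns `hc M` into
          -- `hc (suc M)`.
          hc-X : + rep (suc j) * (β Z.^ exr 0 * (sgn s₀ * + u₀ * + hc M (τ₀ 0))) ≡ ρ K * (sgn s₀ * + X₀)
          hc-X = trans (lem (+ rep (suc j)) (ρ K) (sgn s₀) (+ u₀) (+ hc M (τ₀ 0))) (cong (λ z → ρ K * (sgn s₀ * z)) (trans (cong (+ u₀ *_) (trans (sym (ℤP.pos-* (rep (suc j)) (hc M (τ₀ 0)))) (cong +_
              (trans (cong (λ k → rep (suc j) ℕ.* hc M k) τ₀≡t) (hc-ratio M t (rep (suc j)) 0<M M+t))))) (sym (ℤP.pos-* u₀ (hc (suc M) t)))))
            where
            lem : ∀ k b s u h → k * (b * (s * u * h)) ≡ b * (s * (u * (k * h)))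
            lem = solve-∀
            0<M : 0 ℕ.< M
            0<M = ℕP.<-≤-trans (p^>0 B′) (ℕP.m≤m*n (p ℕ.^ B′) s₀)
            M+t : M ℕ.+ t ≡ M ℕ.* rep (suc j)
            M+t = trans (lem₂ (p ℕ.^ B′) s₀ p (rep j)) (cong (M ℕ.*_) (sym (rep-suc j)))
              where lem₂ : ∀ b s p k → b ℕ.* s ℕ.+ (p ℕ.* b) ℕ.* (s ℕ.* k) ≡ b ℕ.* s ℕ.* suc (p ℕ.* k)
                    lem₂ = ℕ-solve-∀

          finish : ∀ m n → n ℕ.≤ suc (suc n) → m ℕ.≤ suc n → suc n ℕ.≤ suc j → + X₀ Z.≡ sgn (s₀ ℕ.* rep j) * (sgn s₀ * (sgn (s₀ ℕ.* B′) * + V (s₀ ℕ.* rep (suc j)))) mod (𝕡 Z.^ m) →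
            - (sgn e * (ρ K * (sgn s₀ * + X₀))) Z.≡ - (𝔾 (suc n) * ρ (suc n)) mod (𝕡 Z.^ m)
          finish m n _ m≤n n≤j c = Z.mneg (Z.mtrans (Z.m*ˡ (sgn e) (Z.m*ˡ (ρ K) (Z.m*ˡ (sgn s₀) c)))
              (Z.mtrans (Z.meq (trans (lem (sgn e) (ρ K) _) (cong (_* ρ K) (X-GG s₀ s<p 0<s B′ j))))
                (Z.m* (Z.m^-weaken 𝕡 m (suc n) m≤n (Z.m≈ (cong 𝔾 (sym (ℕP.m+[n∸m]≡n n≤j))) refl (GG-stable s₀ s<p 0<s n (suc j ℕ.∸ suc n))))
                      (Z.m^-weaken 𝕡 m (suc (suc n)) (ℕP.m≤n⇒m≤1+n m≤n) (Z.m≈ (cong ρ (sym (ℕP.m+[n∸m]≡n n≤K))) refl (ρ-stable (suc n) (K ℕ.∸ suc n)))))))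
            where
            lem : ∀ a b c → a * (b * c) ≡ (a * c) * b
            lem = solve-∀
            n≤K : suc n ℕ.≤ K
            n≤K = ℕP.≤-trans n≤j (ℕ.s≤s (ℕP.m≤n+m j B′))

          -- Modulo p^B the series is (1 - x^(p-1))^(-M), supported on multiples of p - 1, so only
          -- the term i = 0 of the expanded indicator survives.
          fleck-gauss : F s′ (rep B ℕ.* s₀) r Z.≡ - (𝔾 B * ρ B) mod (𝕡 Z.^ B)
          fleck-gauss = Z.mtrans (unscale e j B _ (ℕP.≤-trans B≤j (ℕP.n≤1+n j)) (Z.mtrans (start B (ℕP.m≤n⇒m≤1+n (ℕP.m≤m+n B B))) collapse))
            (Z.mtrans (Z.meq (cong (λ z → - (sgn e * z)) hc-X)) (finish B B′ (ℕP.m≤n⇒m≤1+n (ℕP.n≤1+n B′)) ℕP.≤-refl (ℕP.≤-trans B≤j (ℕP.n≤1+n j)) (X-mod s₀ s<p 0<s B′ j B ℕP.≤-refl B≤j)))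
            where
            B≤j : B ℕ.≤ j
            B≤j = ℕP.m≤n+m B e
            collapse : Z.sum d f Z.≡ β Z.^ exr 0 * (sgn s₀ * + u₀ * + hc M (τ₀ 0)) mod (𝕡 Z.^ B)
            collapse = Z.mtrans (Z.meq (Z.sum-first d′ f)) (Z.mtrans (Z.m+
              (Z.m*ˡ (β Z.^ exr 0) (Z.m*ˡ (sgn s₀ * + u₀) (Z.mtrans (hs-mod s′ B′ (idx₀ 0)) (Z.meq (Hn-multiple M (τ₀ 0))))))
              (Z.sum-0m d′ (λ i i<d′ → Z.m0* (β Z.^ exr (suc i)) (Z.m0* (sgn s₀ * + u₀) (Z.mtrans (hs-mod s′ B′ (idx₀ (suc i))) (Z.meq (Hn-other M (suc i) (τ₀ (suc i)) (ℕ.z<s) (ℕ.s≤s i<d′))))))))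
              (Z.meq (ℤP.+-identityʳ _)))

        fleck-gauss-weak : ∀ c k → F s′ (rep (suc c ℕ.+ k) ℕ.* s₀) r Z.≡ - (𝔾 (suc c) * ρ (suc c)) mod (𝕡 Z.^ suc c)
        fleck-gauss-weak c k = Z.mtrans (Z.m^-weaken 𝕡 (suc c) (suc (c ℕ.+ k)) (ℕ.s≤s (ℕP.m≤m+n c k)) (fleck-gauss (c ℕ.+ k)))
          (Z.mneg (Z.m* (GG-stable s₀ s<p 0<s c k) (Z.m^-weaken 𝕡 (suc c) (suc (suc c)) (ℕP.n≤1+n (suc c)) (ρ-stable (suc c) k))))

        module _ (n₂ : ℕ) (d′≡ : d′ ≡ suc n₂) where
          -- The contribution of the exponent classes 2, ..., p - 2; class 1 contributes nothing, by
          -- `hs-one`.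
          noise : ℤ
          noise = Z.sum n₂ (λ k → q d (suc (suc k)) * (sgn s₀ * + (s₀ !) * (+ s₀ * + hc (suc s₀) (suc (suc k)) * r Z.^ exr (suc (suc k)))))

          fleck-gauss-p² : F s′ (rep 1 ℕ.* s₀) r Z.≡ - (𝔾 2 * ρ 2) + noise mod (𝕡 Z.^ 2)
          fleck-gauss-p² = Z.mtrans (unscale e j 2 _ (ℕ.s≤s 1≤j) (Z.mtrans (start 0 2 (ℕ.s≤s (ℕ.z<s))) collapse))
            (Z.mtrans (Z.meq (trans (cong (λ z → - (sgn e * z)) (ℤP.*-distribˡ-+ (+ rep (suc j)) (f₀) rest)) (lem₁ (sgn e) (+ rep (suc j) * f₀) (+ rep (suc j) * rest))))
             (Z.m+ (Z.mtrans (Z.meq (cong (λ z → - (sgn e * z)) (hc-X 0))) (finish 0 2 1 (ℕ.z<s) ℕP.≤-refl (ℕ.s≤s 1≤j) x-mod)) noise≡))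
            where
            B = 1
            B′ = 0
            e = rep B ℕ.* s₀
            j = e ℕ.+ B
            K = B ℕ.+ j
            N = s₀ ℕ.* p ℕ.^ B
            t = p ℕ.^ B ℕ.* (s₀ ℕ.* rep j)
            u₀ = s₀ ! ℕ.* YY B s₀
            τ₀ = τ r p∤r s′ s̄ s+s̄ B j
            idx₀ = idx r p∤r s′ s̄ s+s̄ B j
            β = r Z.^ (p ℕ.^ K)
            M′ = p ℕ.^ 0 ℕ.* s₀
            f : ℕ → ℤ
            f i = β Z.^ exr i * (sgn s₀ * + u₀ * hs N (idx₀ i))
            f₀ = β Z.^ exr 0 * (sgn s₀ * + u₀ * + hc (p ℕ.^ 0 ℕ.* s₀) (τ₀ 0))
            g : ℕ → ℤ
            g k = β Z.^ exr (suc (suc k)) * (sgn s₀ * + u₀ * - (+ s₀ * (q d (suc (suc k)) * + hc (suc s₀) (τ₀ (suc (suc k))))))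
            rest = Z.sum n₂ g
            1≤j : 1 ℕ.≤ j
            1≤j = ℕP.m≤n+m 1 e
            lem₁ : ∀ g a b → - (g * (a + b)) ≡ - (g * a) + - (g * b)
            lem₁ = solve-∀
            e≡ : e ≡ s₀
            e≡ = ℕP.+-identityʳ s₀
            N≡sp : N ≡ s₀ ℕ.* p
            N≡sp = cong (s₀ ℕ.*_) (ℕP.*-identityʳ p)
            x-mod : + X s₀ s<p 0<s 0 (s₀ ℕ.* rep j) Z.≡ sgn (s₀ ℕ.* rep j) * (sgn s₀ * (sgn (s₀ ℕ.* 0) * + V (s₀ ℕ.* rep (suc j)))) mod (𝕡 Z.^ 2)
            x-mod = subst (λ j → + X s₀ s<p 0<s 0 (s₀ ℕ.* rep j) Z.≡ sgn (s₀ ℕ.* rep j) * (sgn s₀ * (sgn (s₀ ℕ.* 0) * + V (s₀ ℕ.* rep (suc j)))) mod (𝕡 Z.^ 2)) (ℕP.+-comm 1 e) (X-mod² s₀ s<p 0<s e)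
            p^1 : + (s₀ ℕ.* (p ℕ.^ 1 ℕ.* rep j)) Z.≡ 0ℤ mod 𝕡
            p^1 = ∣⇒mod {p} {+ (s₀ ℕ.* (p ℕ.^ 1 ℕ.* rep j))} (ℕD.∣n⇒∣m*n s₀ (ℕD.∣m⇒∣m*n (rep j) (ℕD.m∣m*n 1)))
            τ-mod : ∀ i → + τ₀ i Z.≡ + i mod 𝕡
            τ-mod i = Z.mtrans (Z.meq (trans (ℤP.pos-+ (s₀ ℕ.* (p ℕ.^ 1 ℕ.* rep j)) (i ℕ.* rep K)) (cong (λ z → + (s₀ ℕ.* (p ℕ.^ 1 ℕ.* rep j)) + z) (ℤP.pos-* i (rep K)))))
              (Z.mtrans (Z.m+ p^1 (Z.m*ˡ (+ i) (rep-unit j))) (Z.meq (trans (ℤP.+-identityˡ (+ i * 1ℤ)) (ℤP.*-identityʳ (+ i)))))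
            τ₀>0 : 0 ℕ.< τ₀ 0
            τ₀>0 = subst (λ k → 0 ℕ.< s₀ ℕ.* (p ℕ.^ 1 ℕ.* k) ℕ.+ 0) (sym (trans (cong rep (ℕP.+-comm e 1)) (rep-suc e))) (ℕ.z<s)
            τ₁>0 : 0 ℕ.< τ₀ 1
            τ₁>0 = ℕP.<-≤-trans (subst (0 ℕ.<_) (sym (trans (ℕP.+-identityʳ (rep K)) (rep-suc j))) (ℕ.z<s)) (ℕP.m≤n+m (1 ℕ.* rep K) (s₀ ℕ.* (p ℕ.^ 1 ℕ.* rep j)))
            collapse : Z.sum d f Z.≡ f₀ + rest mod (𝕡 Z.^ 2)
            collapse = Z.mtrans (Z.meq (trans (Z.sum-first d′ f) (cong (λ z → f 0 + z) (trans (cong (λ n → Z.sum n (λ k → f (suc k))) d′≡) (Z.sum-first n₂ (λ k → f (suc k)))))))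
              (Z.m+ (Z.m*ˡ (β Z.^ exr 0) (Z.m*ˡ (sgn s₀ * + u₀) (Z.m≈ (cong (λ N → hs N (τ₀ 0 ℕ.* d)) N≡sp) (cong (λ M → + hc M (τ₀ 0)) (ℕP.+-identityʳ s₀)) (hs-main s′ s<d (τ₀ 0) τ₀>0 (mod⇒∣ {p} {+ τ₀ 0} (τ-mod 0))))))
                (Z.mtrans (Z.m+ (Z.m0* (β Z.^ exr 1) (Z.m0* (sgn s₀ * + u₀) (Z.m≈ (cong (λ N → hs N (1 ℕ.+ τ₀ 1 ℕ.* d)) N≡sp) refl (hs-one s′ s<d (τ₀ 1) τ₁>0 (τ-mod 1)))))
                  (Z.sum-mod n₂ (λ k k<n₂ → Z.m*ˡ (β Z.^ exr (suc (suc k))) (Z.m*ˡ (sgn s₀ * + u₀) (Z.m≈ (cong (λ N → hs N (idx₀ (suc (suc k)))) N≡sp) refl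
                    (hs-other s′ s<d k (τ₀ (suc (suc k))) (ℕ.s≤s (subst (suc (suc k) ℕ.≤_) (sym d′≡) (ℕ.s≤s k<n₂)))))))))
                  (Z.meq (ℤP.+-identityˡ rest))))
            u-mod : + u₀ Z.≡ + (s₀ !) * sgn s₀ mod 𝕡
            u-mod = Z.m≈ (trans (ℤP.pos-* (s₀ !) (YY 1 s₀)) (cong (λ k → + (s₀ !) * + k) (trans (ℕP.*-identityˡ (V (p ℕ.^ 1 ℕ.* s₀))) (cong V (sym (ℕP.+-identityʳ (p ℕ.^ 1 ℕ.* s₀))))))) (cong (+ (s₀ !) *_) (sym (ℤP.*-identityʳ (sgn s₀))))
              (Z.m*ˡ (+ (s₀ !)) (Z.m^1 𝕡 (V-shift 0 s₀ 0)))
            hc-mod : ∀ i → + hc (suc s₀) (τ₀ i) Z.≡ + hc (suc s₀) i mod 𝕡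
            hc-mod i = Z.m^1 𝕡 (unit-cancel≡ 1 (+ (s₀ !)) (+ hc (suc s₀) (τ₀ i)) (+ hc (suc s₀) i) (!-unit s₀ s<p) (Z.m^1⁻ 𝕡 (Z.m≈ (conv (τ₀ i)) (conv i) (rf-mod s₀ (τ-mod i)))))
              where conv : ∀ t → + (s₀ !) * + hc (suc s₀) t ≡ + rf s₀ t
                    conv t = trans (ℤP.*-comm (+ (s₀ !)) (+ hc (suc s₀) t)) (trans (sym (ℤP.pos-* (hc (suc s₀) t) (s₀ !))) (cong +_ (hc-rf s₀ t)))
            -- Each q is a multiple of p, so its cofactors matter modulo p only: r^(p^K) becomes r,
            -- τ becomes its index, and the unit part of N! becomes s! with a sign.
            noise≡ : - (sgn e * (+ rep (suc j) * rest)) Z.≡ noise mod (𝕡 Z.^ 2)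
            noise≡ = Z.m≈ (trans (trans (cong (λ k → - (sgn k * (+ rep (suc j) * rest))) e≡) (lem₂ (sgn s₀) (+ rep (suc j)) rest)) (sym (Z.sum-* n₂ (- (sgn s₀ * + rep (suc j))) g))) refl
              (Z.sum-mod n₂ (λ k k<n₂ → Z.m≈ (trans (lem₃ (sgn s₀) (+ rep (suc j)) (β Z.^ exr (suc (suc k))) (+ u₀) (+ s₀) (q d (suc (suc k))) (+ hc (suc s₀) (τ₀ (suc (suc k)))))
                   (cong (λ z → q d (suc (suc k)) * (z * (+ rep (suc j) * (+ u₀ * (+ s₀ * + hc (suc s₀) (τ₀ (suc (suc k))) * β Z.^ exr (suc (suc k))))))) (sgn² s₀)))
                   refl
                 (Z.m^mul 𝕡 1 1 (q d (suc (suc k))) (Z.m^1⁻ 𝕡 (q-mod-p (suc k) (ℕ.s≤s (subst (suc (suc k) ℕ.≤_) (sym d′≡) (ℕ.s≤s k<n₂)))))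
                   (Z.m^1⁻ 𝕡 (Z.mtrans (Z.m*ˡ 1ℤ (Z.m* (rep-unit j) (Z.m* u-mod (Z.m* (Z.m*ˡ (+ s₀) (hc-mod (suc (suc k)))) (Z.mpow (exr (suc (suc k))) (frobenius r K p∤r))))))
                     (Z.meq (lem₄ (+ (s₀ !)) (sgn s₀) (+ s₀ * + hc (suc s₀) (suc (suc k)) * r Z.^ exr (suc (suc k))))))))))
              where
              lem₂ : ∀ g k r → - (g * (k * r)) ≡ (- (g * k)) * r
              lem₂ = solve-∀
              lem₃ : ∀ g k b u s q h → (- (g * k)) * (b * (g * u * - (s * (q * h)))) ≡ q * ((g * g) * (k * (u * (s * h * b))))
              lem₃ = solve-∀
              lem₄ : ∀ f g x → 1ℤ * (1ℤ * ((f * g) * x)) ≡ g * f * x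
              lem₄ = solve-∀

  -- Euler's function at p^b and power sums with exponent φ(p^b).

  module PrimePowerSums where

    open import Defs using (φ)
    open GenericAlgebra
    open ShiftOperators
    open FleckQuotients
    open PrimeUnits
    open FactorialProducts
    open ResidueFilter
    open GrossKoblitz
    open FleckResidues
    open import Data.Nat.GCD using (gcd; gcd[m,n]∣m; gcd[m,n]∣n; gcd-greatest)
    open import Data.Nat.Primality using (euclidsLemma)
    open import Data.Integer using (ℤ; +_; _+_; _*_; -_; _-_; 0ℤ; 1ℤ; ∣_∣)

    -- The local counting function of Defs.φ has no name; the unsolved body of `coprimes` is
    -- identified with it when `φ-unfold` is checked.
    mutual
      coprimes : ℕ → ℕ → ℕ
      coprimes w n = _

      φ-unfold : ∀ m → φ (suc m) ≡ (if does (gcd (suc m) (suc m) ℕ.≟ 1) then 1 else 0) ℕ.+ coprimes (suc m) m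
      φ-unfold m with suc m | ℕP.<-cmp (suc m) (suc m)
      ... | w | t = refl

    φ≡coprimes : ∀ m → φ m ≡ coprimes m m
    φ≡coprimes m = refl

    module PowerSums where
      open Quotients public

      private
        divisor-p^ : ∀ b n → n ℕD.∣ p ℕ.^ b → ¬ (p ℕD.∣ n) → n ≡ 1
        divisor-p^ zero n n∣1 _ = ℕD.∣1⇒≡1 n∣1
        divisor-p^ (suc b) n (ℕD.divides k eq) p∤n with euclidsLemma k n pr (subst (p ℕD.∣_) eq (ℕD.m∣m*n (p ℕ.^ b)))
        ... | inj₂ p∣n = contradiction p∣n p∤n
        ... | inj₁ (ℕD.divides k′ eq′) = divisor-p^ b n (ℕD.divides k′ (ℕP.*-cancelˡ-≡ (p ℕ.^ b) (k′ ℕ.* n) p (trans eq (trans (cong (ℕ._* n) (trans eq′ (ℕP.*-comm k′ p))) (ℕP.*-assoc p k′ n))))) p∤n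

        gcd-p^ : ∀ b j → ¬ (p ℕD.∣ j) → gcd j (p ℕ.^ b) ≡ 1
        gcd-p^ b j p∤j = divisor-p^ b (gcd j (p ℕ.^ b)) (gcd[m,n]∣n j (p ℕ.^ b)) (λ p∣g → p∤j (ℕD.∣-trans p∣g (gcd[m,n]∣m j (p ℕ.^ b))))

        gcd-p^-no : ∀ b j → p ℕD.∣ j → gcd j (p ℕ.^ suc b) ≢ 1
        gcd-p^-no b j p∣j e = small-unit 1 (ℕ.z<s) (ℕ.s≤s (ℕ.z<s)) (subst (p ℕD.∣_) e (gcd-greatest p∣j (ℕD.m∣m*n (p ℕ.^ b))))

      units : ℕ → ℕ
      units zero = 0
      units (suc m) = if does (p ∣? suc m) then units m else suc (units m)

      coprimes≡units : ∀ b m → coprimes (p ℕ.^ suc b) m ≡ units m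
      coprimes≡units b zero = refl
      coprimes≡units b (suc m) = go (p ∣? suc m)
        where
        go : Dec (p ℕD.∣ suc m) → coprimes (p ℕ.^ suc b) (suc m) ≡ units (suc m)
        go (yes p∣) = trans (cong (ℕ._+ coprimes (p ℕ.^ suc b) m) (if-no (gcd (suc m) (p ℕ.^ suc b) ℕ.≟ 1) (gcd-p^-no b (suc m) p∣))) (trans (coprimes≡units b m) (sym (if-yes (p ∣? suc m) p∣)))
        go (no p∤) = trans (cong (ℕ._+ coprimes (p ℕ.^ suc b) m) (if-yes (gcd (suc m) (p ℕ.^ suc b) ℕ.≟ 1) (gcd-p^ (suc b) (suc m) p∤))) (trans (cong suc (coprimes≡units b m)) (sym (if-no (p ∣? suc m) p∤)))

      units-block : ∀ m a → a ℕ.< p → units (p ℕ.* m ℕ.+ a) ≡ d ℕ.* m ℕ.+ a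
      units-block zero zero _ = trans (cong units (trans (ℕP.+-identityʳ (p ℕ.* 0)) (ℕP.*-zeroʳ p))) (sym (trans (ℕP.+-identityʳ (d ℕ.* 0)) (ℕP.*-zeroʳ d)))
      units-block (suc m) zero _ = trans (cong units eq) (trans (if-yes (p ∣? suc (p ℕ.* m ℕ.+ d)) (subst (p ℕD.∣_) (trans (sym (ℕP.+-identityʳ (p ℕ.* suc m))) eq) (p∣p*m (suc m)))) (trans (units-block m d ℕP.≤-refl)
          (trans (ℕP.+-comm (d ℕ.* m) d) (trans (sym (ℕP.*-suc d m)) (sym (ℕP.+-identityʳ (d ℕ.* suc m)))))))
        where
        eq : p ℕ.* suc m ℕ.+ 0 ≡ suc (p ℕ.* m ℕ.+ d)
        eq = trans (ℕP.+-identityʳ (p ℕ.* suc m)) (trans (ℕP.*-suc p m) (trans (ℕP.+-comm p (p ℕ.* m)) (ℕP.+-suc (p ℕ.* m) d)))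
      units-block m (suc a) a<p = trans (cong units (ℕP.+-suc (p ℕ.* m) a)) (trans (if-no (p ∣? suc (p ℕ.* m ℕ.+ a)) (subst (λ z → ¬ (p ℕD.∣ z)) (ℕP.+-suc (p ℕ.* m) a) (shift-unit (suc a) (p∣p*m m) (small-unit (suc a) (ℕ.z<s) a<p))))
        (trans (cong suc (units-block m a (ℕP.<-trans ℕP.≤-refl a<p))) (sym (ℕP.+-suc (d ℕ.* m) a))))

      φ-p^ : ∀ b → φ (p ℕ.^ suc b) ≡ d ℕ.* p ℕ.^ b
      φ-p^ b = trans (φ≡coprimes (p ℕ.^ suc b)) (trans (coprimes≡units b (p ℕ.^ suc b)) (units-p^ b))
        where
        units-p^ : ∀ b → units (p ℕ.^ suc b) ≡ d ℕ.* p ℕ.^ b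
        units-p^ b = trans (cong units (sym (ℕP.+-identityʳ (p ℕ.* p ℕ.^ b)))) (trans (units-block (p ℕ.^ b) 0 (ℕ.z<s)) (ℕP.+-identityʳ (d ℕ.* p ℕ.^ b)))

      units-p^ : ∀ b → units (p ℕ.^ suc b) ≡ d ℕ.* p ℕ.^ b
      units-p^ b = trans (cong units (sym (ℕP.+-identityʳ (p ℕ.* p ℕ.^ b)))) (trans (units-block (p ℕ.^ b) 0 (ℕ.z<s)) (ℕP.+-identityʳ (d ℕ.* p ℕ.^ b)))

      suc≤p^ : ∀ b → suc b ℕ.≤ p ℕ.^ b
      suc≤p^ zero = ℕP.≤-refl
      suc≤p^ (suc b) = ℕP.≤-trans (ℕ.s≤s (suc≤p^ b)) (ℕP.≤-trans (ℕP.+-monoˡ-≤ (p ℕ.^ b) (p^>0 b)) (ℕP.+-monoʳ-≤ (p ℕ.^ b) (ℕP.m≤m+n (p ℕ.^ b) (d′ ℕ.* p ℕ.^ b))))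

      module _ (b′ : ℕ) where
        private
          b = suc b′
          ϕ = d ℕ.* p ℕ.^ b′
          2b = b ℕ.+ b

        -- Makes the ϕ-th powers of multiples of p vanish modulo p^(2b).
        2b≤ϕ : 2b ℕ.≤ ϕ
        2b≤ϕ = ℕP.≤-trans (ℕP.+-mono-≤ (suc≤p^ b′) (suc≤p^ b′)) (ℕP.≤-trans (ℕP.≤-reflexive (cong (p ℕ.^ b′ ℕ.+_) (sym (ℕP.+-identityʳ (p ℕ.^ b′))))) (ℕP.*-monoˡ-≤ (p ℕ.^ b′) 1<d))

        nonunit-pow : ∀ j → p ℕD.∣ j → (+ j) Z.^ ϕ Z.≡ 0ℤ mod (𝕡 Z.^ 2b)
        nonunit-pow j (ℕD.divides k eq) = Z.m^-weaken 𝕡 2b ϕ 2b≤ϕ (Z.by ((+ k) Z.^ ϕ) (trans (cong (Z._^ ϕ) (trans (cong +_ (trans eq (ℕP.*-comm k p))) (ℤP.pos-* p k))) (trans (Z.^-distrib-* 𝕡 (+ k) ϕ) (sym (ℤP.+-identityˡ (𝕡 Z.^ ϕ * (+ k) Z.^ ϕ))))))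

        euler : ∀ j → ¬ (p ℕD.∣ j) → (+ j) Z.^ ϕ Z.≡ 1ℤ mod (𝕡 Z.^ b)
        euler j p∤j = Z.m≈ (trans (cong ((+ j) Z.^_) (ℕP.*-comm d (p ℕ.^ b′))) (sym (Z.^-assocʳ (+ j) (p ℕ.^ b′) d))) refl (pow-p^-one (+ j) b′ (λ m → p∤j (mod⇒∣ {p} {+ j} m)))

        private
          t : ℕ → ℤ
          t j = if does (p ∣? j) then 0ℤ else (+ j) Z.^ ϕ - 1ℤ
          Tm : ℕ → ℤ
          Tm m = Z.sum m (λ j → t (suc j))

          t≡0 : ∀ j → t j Z.≡ 0ℤ mod (𝕡 Z.^ b)
          t≡0 j = go (p ∣? j)
            where
            go : Dec (p ℕD.∣ j) → t j Z.≡ 0ℤ mod (𝕡 Z.^ b)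
            go (yes p∣) = Z.meq (if-yes (p ∣? j) p∣)
            go (no p∤) = Z.m≈ (if-no (p ∣? j) p∤) (sym (ℤP.+-inverseʳ 1ℤ)) (Z.m+ʳ (- 1ℤ) (euler j p∤))

          -- Each j^ϕ - 1 is a multiple of p^b and a product of two of them vanishes, so the product
          -- over the units linearises.
          V-pow : ∀ m → (+ V m) Z.^ ϕ Z.≡ 1ℤ + Tm m mod (𝕡 Z.^ 2b)
          V-pow zero = Z.meq (Z.1^ ϕ)
          V-pow (suc m) = go (p ∣? suc m)
            where
            go : Dec (p ℕD.∣ suc m) → (+ V (suc m)) Z.^ ϕ Z.≡ 1ℤ + Tm (suc m) mod (𝕡 Z.^ 2b)
            go (yes p∣) = Z.m≈ (cong (λ v → (+ v) Z.^ ϕ) (V-skip p∣)) (cong (λ z → 1ℤ + z) (trans (cong (λ z → Tm m + z) (if-yes (p ∣? suc m) p∣)) (ℤP.+-identityʳ (Tm m)))) (V-pow m)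
            go (no p∤) = Z.m≈ (trans (cong (Z._^ ϕ) (trans (cong +_ (V-suc p∤)) (ℤP.pos-* (V m) (suc m)))) (Z.^-distrib-* (+ V m) (+ suc m) ϕ)) refl
              (Z.mtrans (Z.m* (V-pow m) (Z.meq (trans (lem₁ ((+ suc m) Z.^ ϕ)) (cong (λ z → 1ℤ + z) (sym (if-no (p ∣? suc m) p∤))))))
                (Z.mtrans (Z.meq (lem₂ (Tm m) (t (suc m)))) (Z.m+0 (1ℤ + (Tm m + t (suc m))) (Z.m^00 𝕡 b b (Z.sum-0m m (λ j _ → t≡0 (suc j))) (t≡0 (suc m))))))
              where lem₁ : ∀ x → x ≡ 1ℤ + (x - 1ℤ)
                    lem₁ = solve-∀
                    lem₂ : ∀ a b → (1ℤ + a) * (1ℤ + b) ≡ (1ℤ + (a + b)) + a * b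
                    lem₂ = solve-∀

          psum-T : ∀ m → Z.sum m (λ j → (+ suc j) Z.^ ϕ) Z.≡ Tm m + + units m mod (𝕡 Z.^ 2b)
          psum-T zero = Z.mrefl
          psum-T (suc m) = go (p ∣? suc m)
            where
            go : Dec (p ℕD.∣ suc m) → Z.sum (suc m) (λ j → (+ suc j) Z.^ ϕ) Z.≡ Tm (suc m) + + units (suc m) mod (𝕡 Z.^ 2b)
            go (yes p∣) = Z.m≈ refl (trans (cong₂ (λ a n → Tm m + a + + n) (if-yes (p ∣? suc m) p∣) (if-yes (p ∣? suc m) p∣)) (lem (Tm m) (+ units m))) (Z.m+ (psum-T m) (nonunit-pow (suc m) p∣))
              where lem : ∀ a n → a + 0ℤ + n ≡ a + n + 0ℤ
                    lem = solve-∀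
            go (no p∤) = Z.m≈ refl (trans (cong₂ (λ a n → Tm m + a + n) (if-no (p ∣? suc m) p∤) (trans (cong +_ (if-no (p ∣? suc m) p∤)) (ℤP.pos-+ 1 (units m)))) (lem (Tm m) (+ units m) ((+ suc m) Z.^ ϕ))) (Z.m+ʳ ((+ suc m) Z.^ ϕ) (psum-T m))
              where lem : ∀ a n x → a + (x - 1ℤ) + (1ℤ + n) ≡ a + n + x
                    lem = solve-∀

        V+1≡0 : - + V (p ℕ.^ b) - 1ℤ Z.≡ 0ℤ mod (𝕡 Z.^ b)
        V+1≡0 = Z.m≈ refl (sym (ℤP.+-inverseʳ 1ℤ)) (Z.m+ʳ (- 1ℤ) (Z.mneg {y = - 1ℤ} (V-p^ b′)))

        -- Comparing V^ϕ = (1 + (-V-1))^ϕ with the product of j^ϕ = 1 + (j^ϕ-1) over the units j.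
        psum-V : psum ϕ (p ℕ.^ b) Z.≡ + ϕ + + ϕ * (- + V (p ℕ.^ b) - 1ℤ) mod (𝕡 Z.^ 2b)
        psum-V = Z.mtrans (Z.meq (lem₁ (psum ϕ m) ((+ m) Z.^ ϕ))) (Z.mtrans (Z.m- (Z.m≈ eq refl (psum-T m)) (nonunit-pow m (ℕD.m∣m*n (p ℕ.^ b′))))
          (Z.mtrans (Z.meq (trans (lem₂ (Tm m) (+ units m)) (cong (λ n → + n + Tm m) (units-p^ b′)))) (Z.m+ˡ (+ ϕ) T≡)))
          where
          m = p ℕ.^ b
          x = - + V m - 1ℤ
          lem₁ : ∀ a b → a ≡ (a + b) - b
          lem₁ = solve-∀
          lem₂ : ∀ a b → a + b - 0ℤ ≡ b + a
          lem₂ = solve-∀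
          0^ϕ : ∀ n → 0 ℕ.< n → 0ℤ Z.^ n ≡ 0ℤ
          0^ϕ (suc n) _ = ℤP.*-zeroˡ (0ℤ Z.^ n)
          eq : psum ϕ m + (+ m) Z.^ ϕ ≡ Z.sum m (λ j → (+ suc j) Z.^ ϕ)
          eq = trans (Z.sum-first m (λ j → (+ j) Z.^ ϕ)) (trans (cong (_+ Z.sum m (λ j → (+ suc j) Z.^ ϕ)) (0^ϕ ϕ (ℕP.≤-trans (ℕ.z<s) 2b≤ϕ))) (ℤP.+-identityˡ _))
          ϕ-even : ϕ ≡ h ℕ.* p ℕ.^ b′ ℕ.+ h ℕ.* p ℕ.^ b′
          ϕ-even = trans (cong (ℕ._* p ℕ.^ b′) d≡h+h) (ℕP.*-distribʳ-+ (p ℕ.^ b′) h h)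
          taylor : ∀ n → 0 ℕ.< n → (1ℤ + x) Z.^ n Z.≡ 1ℤ + + n * x mod (𝕡 Z.^ 2b)
          taylor (suc n) _ with Z.pow-taylor₁ n 1ℤ x
          ... | w′ , e = Z.mtrans (Z.meq e) (Z.mtrans (Z.m+0 (1ℤ Z.^ suc n + + suc n * 1ℤ Z.^ n * x) (Z.m*0 w′ (Z.m^00 𝕡 b b V+1≡0 V+1≡0))) (Z.meq (trans (cong₂ (λ a c → a + + suc n * c * x) (Z.1^ (suc n)) (Z.1^ n)) (cong (λ c → 1ℤ + c * x) (ℤP.*-identityʳ (+ suc n))))))
          T≡ : Tm m Z.≡ + ϕ * x mod (𝕡 Z.^ 2b)
          T≡ = Z.m≈ (lem₃ (Tm m)) (lem₃ (+ ϕ * x)) (Z.m+ʳ (- 1ℤ) (Z.mtrans (Z.msym (V-pow m)) (Z.mtrans (Z.meq (trans (cong ((+ V m) Z.^_) ϕ-even) (trans (sym (Z.neg-square (h ℕ.* p ℕ.^ b′) (+ V m))) (trans (cong ((- + V m) Z.^_) (sym ϕ-even)) (cong (Z._^ ϕ) (lem₄ (+ V m))))))) (taylor ϕ (ℕP.≤-trans (ℕ.z<s) 2b≤ϕ)))))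
            where lem₃ : ∀ a → a ≡ (1ℤ + a) - 1ℤ
                  lem₃ = solve-∀
                  lem₄ : ∀ v → - v ≡ 1ℤ + (- v - 1ℤ)
                  lem₄ = solve-∀

        private
          psum-scale-m : ∀ k n m → psum k (n ℕ.* m) Z.≡ + n * psum k m mod (+ m)
          psum-scale-m k n m = Z.mtrans (Z.meq (Z.sum-blocks n m (λ j → (+ j) Z.^ k))) (Z.mtrans (Z.sum-mod n (λ i _ → Z.sum-mod m (λ j _ → Z.mpow k
              (Z.by (+ i) (trans (ℤP.pos-+ (i ℕ.* m) j) (trans (ℤP.+-comm (+ (i ℕ.* m)) (+ j)) (cong (λ z → + j + z) (trans (ℤP.pos-* i m) (ℤP.*-comm (+ i) (+ m))))))))))
            (Z.meq (Z.sum-const n (psum k m))))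

          -- For c = 0 the hypothesis forces b = 1 and k < p - 1; for larger c the sum consists of p
          -- blocks that agree modulo p.
          psum-div : ∀ c k → k ℕ.< ϕ → b ℕ.≤ suc c → psum k (p ℕ.^ suc c) Z.≡ 0ℤ mod 𝕡
          psum-div zero k k<ϕ b≤ = psum-mod-p (p^1≡0) k (ℕP.<-≤-trans k<ϕ (ℕP.≤-reflexive (trans (cong (λ e → d ℕ.* p ℕ.^ e) (ℕP.n≤0⇒n≡0 (ℕP.≤-pred b≤))) (ℕP.*-identityʳ d))))
            where p^1≡0 : + (p ℕ.^ 1) Z.≡ 0ℤ mod 𝕡
                  p^1≡0 = Z.m^1 𝕡 (p^≡0 1)
          psum-div (suc c) k _ _ = Z.mtrans (Z.mcoarse (Z.m^1 𝕡 (Z.m^-weaken 𝕡 1 (suc c) (ℕ.z<s) (p^≡0 (suc c)))) (psum-scale-m k p (p ℕ.^ suc c))) (Z.m*0 (psum k (p ℕ.^ suc c)) 𝕡≡0)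

        -- The range is cut into p blocks of length m and expanded about their starting points im.
        -- The linear terms give p(p-1)/2 · ϕ · m times the sum of exponent ϕ - 1, with factors p,
        -- p^(b-1), m and p; the quadratic ones have m^2 and a sum divisible by p.
        psum-scale : ∀ c → b ℕ.≤ suc c → psum ϕ (p ℕ.^ suc (suc c)) Z.≡ 𝕡 * psum ϕ (p ℕ.^ suc c) mod (𝕡 Z.^ (suc (suc c) ℕ.+ b))
        psum-scale c b≤ = go ϕ refl (ℕP.≤-trans (ℕP.+-mono-≤ (ℕ.z<s) (ℕ.z<s)) 2b≤ϕ)
          where
          m = p ℕ.^ suc c
          M = 𝕡 Z.^ (suc (suc c) ℕ.+ b)
          m≡0 : + m Z.≡ 0ℤ mod (𝕡 Z.^ suc c)
          m≡0 = p^≡0 (suc c)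
          2c≥ : suc (suc c) ℕ.+ b ℕ.≤ (suc c ℕ.+ suc c) ℕ.+ 1
          2c≥ = ℕP.≤-trans (ℕP.+-monoʳ-≤ (suc (suc c)) b≤) (ℕP.≤-reflexive (ℕP.+-comm 1 (suc c ℕ.+ suc c)))
          3c≥ : suc (suc c) ℕ.+ b ℕ.≤ (suc c ℕ.+ suc c) ℕ.+ suc c
          3c≥ = ℕP.≤-trans 2c≥ (ℕP.+-monoʳ-≤ (suc c ℕ.+ suc c) (ℕ.z<s))
          go : ∀ n → n ≡ ϕ → 2 ℕ.≤ n → psum n (p ℕ.* m) Z.≡ 𝕡 * psum n m mod M
          go (suc zero) _ (ℕ.s≤s ())
          go (suc (suc k)) eq _ = Z.mtrans (Z.meq (Z.sum-blocks p m (λ j → (+ j) Z.^ n))) (Z.mtrans (Z.sum-mod p (λ i _ → block i))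
              (Z.mtrans (Z.meq total) (Z.m+0 (𝕡 * psum n m) (Z.m+ first second))))
            where
            n = suc (suc k)
            s₁ = psum (suc k) m
            s₂ = psum k m
            A₁ = + n * + m * s₁
            A₂ = + tri n * (+ m * + m) * s₂
            block : ∀ i → Z.sum m (λ j → (+ (i ℕ.* m ℕ.+ j)) Z.^ n) Z.≡ psum n m + (+ i * A₁ + + i * + i * A₂) mod M
            block i = Z.mtrans (Z.sum-mod m (λ j _ → term j)) (Z.meq (trans (Z.sum-+ m (λ j → (+ j) Z.^ n) (λ j → + i * (+ n * + m) * (+ j) Z.^ suc k + + i * + i * (+ tri n * (+ m * + m)) * (+ j) Z.^ k))
                (cong (λ z → psum n m + z) (trans (Z.sum-+ m (λ j → + i * (+ n * + m) * (+ j) Z.^ suc k) (λ j → + i * + i * (+ tri n * (+ m * + m)) * (+ j) Z.^ k))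
                  (cong₂ _+_ (trans (Z.sum-* m (+ i * (+ n * + m)) (λ j → (+ j) Z.^ suc k)) (lem₁ (+ i) (+ n * + m) s₁)) (trans (Z.sum-* m (+ i * + i * (+ tri n * (+ m * + m))) (λ j → (+ j) Z.^ k)) (lem₁ (+ i * + i) (+ tri n * (+ m * + m)) s₂)))))))
              where
              lem₁ : ∀ a b c → a * b * c ≡ a * (b * c)
              lem₁ = solve-∀
              term : ∀ j → (+ (i ℕ.* m ℕ.+ j)) Z.^ n Z.≡ (+ j) Z.^ n + (+ i * (+ n * + m) * (+ j) Z.^ suc k + + i * + i * (+ tri n * (+ m * + m)) * (+ j) Z.^ k) mod M
              term j with Z.pow-taylor₂′ k (+ j) (+ i * + m)
              ... | w′ , e = Z.mtrans (Z.meq (trans (cong (Z._^ n) (trans (ℤP.pos-+ (i ℕ.* m) j) (trans (ℤP.+-comm (+ (i ℕ.* m)) (+ j)) (cong (λ z → + j + z) (ℤP.pos-* i m))))) (trans e (lem₂ ((+ j) Z.^ n) (+ n) ((+ j) Z.^ suc k) (+ i) (+ m) (+ tri n) ((+ j) Z.^ k) w′))))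
                  (Z.m+0 _ (Z.m*0 (+ i * (+ i * + i) * w′) (Z.m^-weaken 𝕡 (suc (suc c) ℕ.+ b) ((suc c ℕ.+ suc c) ℕ.+ suc c) 3c≥ (Z.m^00 𝕡 (suc c ℕ.+ suc c) (suc c) (Z.m^00 𝕡 (suc c) (suc c) m≡0 m≡0) m≡0))))
                where lem₂ : ∀ a n y₁ i m t y₀ w → a + n * y₁ * (i * m) + t * y₀ * (i * m * (i * m)) + i * m * (i * m) * (i * m) * w
                                ≡ (a + (i * (n * m) * y₁ + i * i * (t * (m * m)) * y₀)) + m * m * m * (i * (i * i) * w)
                      lem₂ = solve-∀
            Σi² = Z.sum p (λ i → + i * + i)
            total : Z.sum p (λ i → psum n m + (+ i * A₁ + + i * + i * A₂)) ≡ 𝕡 * psum n m + (+ tri p * A₁ + Σi² * A₂)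
            total = trans (Z.sum-+ p (λ _ → psum n m) (λ i → + i * A₁ + + i * + i * A₂)) (cong₂ _+_ (Z.sum-const p (psum n m)) (trans (Z.sum-+ p (λ i → + i * A₁) (λ i → + i * + i * A₂))
              (cong₂ _+_ (trans (Z.sum-cong p (λ i _ → ℤP.*-comm (+ i) A₁)) (trans (Z.sum-* p A₁ (λ i → + i)) (trans (ℤP.*-comm A₁ (Z.sum p (λ i → + i))) (cong (_* A₁) (Z.sum-id p)))))
                (trans (Z.sum-cong p (λ i _ → ℤP.*-comm (+ i * + i) A₂)) (trans (Z.sum-* p A₂ (λ i → + i * + i)) (ℤP.*-comm A₂ Σi²))))))
            k<ϕ : k ℕ.< ϕ
            k<ϕ = ℕP.≤-trans (ℕP.n≤1+n (suc k)) (ℕP.≤-reflexive eq)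
            n≡0 : + n Z.≡ 0ℤ mod (𝕡 Z.^ b′)
            n≡0 = Z.m≈ (trans (cong +_ eq) (ℤP.pos-* d (p ℕ.^ b′))) refl (Z.m0* (+ d) (p^≡0 b′))
            tri≡0 : + tri p Z.≡ 0ℤ mod 𝕡
            tri≡0 = Z.by (+ h) (trans (cong +_ tri-odd) (trans (ℤP.pos-* p h) (sym (ℤP.+-identityˡ (𝕡 * + h)))))
            first : + tri p * A₁ Z.≡ 0ℤ mod M
            first = Z.m≈m (cong (𝕡 Z.^_) (lem b′ c)) (Z.m^00 𝕡 1 ((b′ ℕ.+ suc c) ℕ.+ 1) (Z.m^1⁻ 𝕡 tri≡0) (Z.m^00 𝕡 (b′ ℕ.+ suc c) 1 (Z.m^00 𝕡 b′ (suc c) n≡0 m≡0) (Z.m^1⁻ 𝕡 (psum-div c (suc k) (ℕP.≤-reflexive eq) b≤))))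
              where lem : ∀ b c → 1 ℕ.+ ((b ℕ.+ suc c) ℕ.+ 1) ≡ suc (suc c) ℕ.+ suc b
                    lem = ℕ-solve-∀
            second : Σi² * A₂ Z.≡ 0ℤ mod M
            second = Z.m0* Σi² (Z.m≈ (lem (+ tri n) (+ m * + m) s₂) refl (Z.m0* (+ tri n) (Z.m^-weaken 𝕡 (suc (suc c) ℕ.+ b) ((suc c ℕ.+ suc c) ℕ.+ 1) 2c≥
                (Z.m^00 𝕡 (suc c ℕ.+ suc c) 1 (Z.m^00 𝕡 (suc c) (suc c) m≡0 m≡0) (Z.m^1⁻ 𝕡 (psum-div c k k<ϕ b≤))))))
              where lem : ∀ t m s → t * m * s ≡ t * (m * s)
                    lem = solve-∀

        psum-scales : ∀ w → psum ϕ (p ℕ.^ (b ℕ.+ w)) Z.≡ 𝕡 Z.^ w * psum ϕ (p ℕ.^ b) mod (𝕡 Z.^ ((b ℕ.+ w) ℕ.+ b))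
        psum-scales zero = Z.meq (trans (cong (λ k → psum ϕ (p ℕ.^ k)) (ℕP.+-identityʳ b)) (sym (ℤP.*-identityˡ (psum ϕ (p ℕ.^ b)))))
        psum-scales (suc w) = Z.m≈ (cong (λ k → psum ϕ (p ℕ.^ k)) (ℕP.+-suc b w)) (ℤP.*-assoc 𝕡 (𝕡 Z.^ w) (psum ϕ (p ℕ.^ b))) (Z.m≈m (cong (λ k → 𝕡 Z.^ (k ℕ.+ b)) (sym (ℕP.+-suc b w)))
          (Z.mtrans (psum-scale (b′ ℕ.+ w) (ℕ.s≤s (ℕP.m≤m+n b′ w))) (Z.mscale 𝕡 (psum-scales w))))

  -- Bernoulli numbers modulo powers of p.

  module BernoulliModPrimePowers where

    open import Defs
    open GenericAlgebra
    open ShiftOperators using (module Z)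
    open StirlingSeries using (q)
    open PrimeUnits
    open FactorialProducts
    open Localisation
    open PrimePowerSums
    open BernoulliNumbers
    open import Data.Nat using (_!)
    open import Data.Nat.Induction using (<-rec)
    open import Data.Integer as ℤ using (ℤ; +_; ∣_∣)
    open import Data.Rational as ℚ using (ℚ; 0ℚ; 1ℚ; _+_; _*_; -_; _-_)
    import Data.Rational.Properties as ℚP
    open import Data.Product using (∃₂; Σ; _×_)

    ℚ-cancel : ∀ n {x y} → n ≢ 0ℚ → n * x ≡ n * y → x ≡ y
    ℚ-cancel n {x} {y} n≢0 e = trans (sym (back x)) (trans (cong (inv n *_) e) (back y))
      where back : ∀ x → inv n * (n * x) ≡ x
            back x = trans (sym (ℚP.*-assoc (inv n) n x)) (trans (cong (_* x) (inv-* n n≢0)) (ℚP.*-identityˡ x))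

    ℚ-*-≢0 : ∀ {x y} → x ≢ 0ℚ → y ≢ 0ℚ → x * y ≢ 0ℚ
    ℚ-*-≢0 {x} {y} x≢0 y≢0 e = y≢0 (ℚ-cancel x x≢0 (trans e (sym (ℚP.*-zeroʳ x))))

    module BernP where
      open PowerSums public
      open Local d pr public

      π : ℤ₍ₚ₎
      π = int 𝕡

      π≡0 : π L.≡ L.0# mod (π L.^ 1)
      π≡0 = int-mod^ 1 (Z.m^1⁻ 𝕡 𝕡≡0)

      private
        PInt : ℚ → Set
        PInt x = Σ ℤ₍ₚ₎ (λ z → val z ≡ x)

        pint-+ : ∀ {x y} → PInt x → PInt y → PInt (x + y)
        pint-+ (z , e) (z′ , e′) = z ⊹ z′ , cong₂ _+_ e e′

        pint-sum : ∀ n f → (∀ i → i ℕ.< n → PInt (f i)) → PInt (Q.sum n f)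
        pint-sum zero f h = int (+ 0) , refl
        pint-sum (suc n) f h = pint-+ (pint-sum n f (λ i i<n → h i (ℕP.m<n⇒m<1+n i<n))) (h n ℕP.≤-refl)

        -- Below index p - 1 the recursion divides only by integers less than p.
        B-int : ∀ k → k ℕ.< d → PInt (B k)
        B-int = <-rec (λ k → k ℕ.< d → PInt (B k)) step
          where
          scale : ∀ m i → PInt (B i) → PInt (ℕ→ℚ (bin (suc (suc m)) i) * B i)
          scale m i (z , e) = int (+ bin (suc (suc m)) i) ∙ z , cong (ℕ→ℚ (bin (suc (suc m)) i) *_) e
          next : ∀ m → suc m ℕ.< d → PInt (Q.sum (suc m) (λ i → ℕ→ℚ (bin (suc (suc m)) i) * B i)) → PInt (B (suc m))
          next m m<d (z , e) = ⊖ (inverse (+ suc (suc m)) (small-unit (suc (suc m)) (ℕ.z<s) (ℕ.s≤s m<d)) ∙ z) , trans (cong (λ s → - (inv (ℕ→ℚ (suc (suc m))) * s)) e) (sym (B-suc m))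
          step : ∀ k → (∀ {i} → i ℕ.< k → i ℕ.< d → PInt (B i)) → k ℕ.< d → PInt (B k)
          step zero _ _ = int (+ 1) , refl
          step (suc m) ih m<d = next m m<d (pint-sum (suc m) (λ i → ℕ→ℚ (bin (suc (suc m)) i) * B i) (λ i i≤m → scale m i (ih i≤m (ℕP.<-trans i≤m m<d))))

        pick : ∀ k → Dec (k ℕ.< d) → ℤ₍ₚ₎
        pick k (yes k<d) = proj₁ (B-int k k<d)
        pick k (no _) = int (+ 0)

      -- From index p - 1 on the value 0 is a placeholder, since integrality is available only
      -- below.
      𝔹 : ℕ → ℤ₍ₚ₎
      𝔹 k = pick k (k ℕP.<? d)

      val-𝔹 : ∀ k → k ℕ.< d → val (𝔹 k) ≡ B k
      val-𝔹 k k<d with k ℕP.<? d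
      ... | yes k<d′ = proj₂ (B-int k k<d′)
      ... | no k≮d = contradiction k<d k≮d

      val-sum : ∀ n f → val (L.sum n f) ≡ Q.sum n (λ k → val (f k))
      val-sum zero f = refl
      val-sum (suc n) f = cong (_+ val (f n)) (val-sum n f)

      private
        Dz : ℕ → ℤ₍ₚ₎
        Dz k = int (psum k p) L.- π ∙ 𝔹 k

        val-Dz : ∀ k → k ℕ.< d → val (Dz k) ≡ dev k p
        val-Dz k k<d = cong (λ z → ℤ→ℚ (psum k p) - ℕ→ℚ p * z) (val-𝔹 k k<d)

        -- `dev-rec` divides by k + 1 < p, and for k > 0 its inhomogeneous term p^(k+1) is a
        -- multiple of p^2.
        Dz≡0 : ∀ k → k ℕ.< d → Dz k L.≡ L.0# mod (π L.^ 2)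
        Dz≡0 = <-rec (λ k → k ℕ.< d → Dz k L.≡ L.0# mod (π L.^ 2)) step
          where
          step : ∀ k → (∀ {i} → i ℕ.< k → i ℕ.< d → Dz i L.≡ L.0# mod (π L.^ 2)) → k ℕ.< d → Dz k L.≡ L.0# mod (π L.^ 2)
          step zero _ 0<d = L.meq (≐-by (trans (val-Dz 0 0<d) (dev-0 p)))
          step (suc k) ih k<d = unit-cancel-L (+ suc (suc k)) (small-unit (suc (suc k)) (ℕ.z<s) (ℕ.s≤s k<d))
            (L.m≈ eq (L.trans (L.zeroʳ (int (+ suc (suc k)))) (L.sym (L.-‿inverseʳ L.0#)))
              (L.m- (int-mod^ 2 power) (L.sum-0m (suc k) (λ i i≤k → L.m0* (int (+ bin (suc (suc k)) i)) (ih i≤k (ℕP.<-trans i≤k k<d))))))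
            where
            power : 𝕡 Z.^ suc (suc k) Z.≡ + 0 mod (𝕡 Z.^ 2)
            power = Z.m^0≤ 𝕡 2 (suc (suc k)) (ℕ.s≤s (ℕ.z<s))
            eq : int (+ suc (suc k)) ∙ Dz (suc k) ≐ int (𝕡 Z.^ suc (suc k)) L.- L.sum (suc k) (λ i → int (+ bin (suc (suc k)) i) ∙ Dz i)
            eq = ≐-by (trans (cong (ℕ→ℚ (suc (suc k)) *_) (val-Dz (suc k) k<d)) (trans (dev-rec k p) (cong (λ s → ℤ→ℚ (𝕡 Z.^ suc (suc k)) - s)
              (sym (trans (val-sum (suc k) _) (Q.sum-cong (suc k) (λ i i≤k → cong (ℕ→ℚ (bin (suc (suc k)) i) *_) (val-Dz i (ℕP.<-trans i≤k k<d)))))))))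

      psum-𝔹 : ∀ k → k ℕ.< d → int (psum k p) L.≡ π ∙ 𝔹 k mod (π L.^ 2)
      psum-𝔹 k k<d = L.mdiff (Dz≡0 k k<d)

      q-𝔹 : ∀ k → suc k ℕ.< d → int (+ suc k) ∙ int (q d (suc k)) L.≡ ⊖ (π ∙ 𝔹 (suc k)) mod (π L.^ 2)
      q-𝔹 k k<d = L.m≈ (L.sym (L.ι* (+ suc k) (q d (suc k)))) L.refl (L.mtrans (int-mod^ 2 (q-mod-p² k k<d)) (L.m≈ (L.ι- (psum (suc k) p)) L.refl (L.mneg (psum-𝔹 (suc k) k<d))))

      p-part : ∀ n → 0 ℕ.< n → ∃₂ λ w a → n ≡ p ℕ.^ w ℕ.* a × ¬ (p ℕD.∣ a)
      p-part = <-rec (λ n → 0 ℕ.< n → ∃₂ λ w a → n ≡ p ℕ.^ w ℕ.* a × ¬ (p ℕD.∣ a)) step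
        where
        step : ∀ n → (∀ {m} → m ℕ.< n → 0 ℕ.< m → ∃₂ λ w a → m ≡ p ℕ.^ w ℕ.* a × ¬ (p ℕD.∣ a)) → 0 ℕ.< n → ∃₂ λ w a → n ≡ p ℕ.^ w ℕ.* a × ¬ (p ℕD.∣ a)
        step n ih 0<n with p ∣? n
        ... | no p∤n = 0 , n , sym (ℕP.*-identityˡ n) , p∤n
        ... | yes (ℕD.divides zero eq) = contradiction (sym eq) (ℕP.<⇒≢ 0<n)
        ... | yes (ℕD.divides (suc k) eq) with ih {suc k} (ℕP.<-≤-trans (ℕP.m<m+n (suc k) (ℕ.z<s)) (ℕP.≤-reflexive (sym (trans eq (trans (ℕP.*-comm (suc k) p) refl))))) (ℕ.z<s)
        ... | w , a , e , u = suc w , a , trans eq (trans (ℕP.*-comm (suc k) p) (trans (cong (p ℕ.*_) e) (sym (ℕP.*-assoc p (p ℕ.^ w) a)))) , u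

      module _ (b′ : ℕ) where
        private
          b = suc b′
          ϕ = d ℕ.* p ℕ.^ b′
          xV = ℤ.- + V (p ℕ.^ b) ℤ.- + 1

        -- Modulo p^(b+1) the right side is p + V(p^b), because xV is a multiple of p^b.
        PBernoulli : Set
        PBernoulli = Σ ℤ₍ₚ₎ λ z → (val z ≡ ℕ→ℚ p * B ϕ) × (z L.≡ int (+ d) ⊹ int (+ d) ∙ int xV mod (π L.^ suc b))

        private
         -- All powers of p are cancelled in ℚ: dividing the identity for (ϕ+1)! dev by p^(2w)
         -- p^(b-1) leaves every error term with the factor p^(b+1), and only the unit a has to be
         -- inverted.
         core : ∀ w a D Y Y₂ → suc ϕ ! ≡ p ℕ.^ w ℕ.* a → ¬ (p ℕD.∣ a) →
          ℕ→ℚ (suc ϕ !) * dev ϕ (p ℕ.^ (b ℕ.+ w)) ≡ ℕ→ℚ (p ℕ.^ (b ℕ.+ w)) * ℕ→ℚ (p ℕ.^ (b ℕ.+ w)) * ℤ→ℚ D →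
          psum ϕ (p ℕ.^ (b ℕ.+ w)) ≡ 𝕡 Z.^ w ℤ.* psum ϕ (p ℕ.^ b) ℤ.+ 𝕡 Z.^ ((b ℕ.+ w) ℕ.+ b) ℤ.* Y →
          psum ϕ (p ℕ.^ b) ≡ (+ ϕ ℤ.+ + ϕ ℤ.* xV) ℤ.+ 𝕡 Z.^ (b ℕ.+ b) ℤ.* Y₂ → PBernoulli
         core w a D Y Y₂ fact≡ a-unit dev≡ scale≡ V≡ = z , val-z , L.by K (L.+-congˡ (L.*-congˡ L.refl))
          where
          K = (int Y₂ ⊹ int Y) L.- int D ∙ inverse (+ a) a-unit
          z = (int (+ d) ⊹ int (+ d) ∙ int xV) ⊹ (π L.^ suc b) ∙ K
          W = ℤ→ℚ (𝕡 Z.^ w)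
          Π = ℕ→ℚ p
          P′ = ℤ→ℚ (𝕡 Z.^ b′)
          A = ℕ→ℚ a
          x = ℤ→ℚ xV
          β = B ϕ
          ∂ = ℕ→ℚ d
          y y₂ δ : ℚ
          y = ℤ→ℚ Y
          y₂ = ℤ→ℚ Y₂
          δ = ℤ→ℚ D
          P-b : ℤ→ℚ (𝕡 Z.^ b) ≡ Π * P′
          P-b = ℤ→ℚ-* 𝕡 (𝕡 Z.^ b′)
          m≡ : ℕ→ℚ (p ℕ.^ (b ℕ.+ w)) ≡ Π * P′ * W
          m≡ = trans (cong ℤ→ℚ (trans (Z.ιℕ^ p (b ℕ.+ w)) (Z.^-homo-* 𝕡 b w))) (trans (ℤ→ℚ-* (𝕡 Z.^ b) (𝕡 Z.^ w)) (cong (_* W) P-b))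
          ϕ≡ : ℕ→ℚ ϕ ≡ ∂ * P′
          ϕ≡ = trans (Q.ιℕ* d (p ℕ.^ b′)) (cong (∂ *_) (cong ℤ→ℚ (Z.ιℕ^ p b′)))
          S≡ : ℤ→ℚ (psum ϕ (p ℕ.^ b)) ≡ (∂ * P′ + ∂ * P′ * x) + (Π * P′) * (Π * P′) * y₂
          S≡ = trans (cong ℤ→ℚ V≡) (trans (ℤ→ℚ-+ (+ ϕ ℤ.+ + ϕ ℤ.* xV) (𝕡 Z.^ (b ℕ.+ b) ℤ.* Y₂)) (cong₂ _+_
            (trans (ℤ→ℚ-+ (+ ϕ) (+ ϕ ℤ.* xV)) (cong₂ _+_ ϕ≡ (trans (ℤ→ℚ-* (+ ϕ) xV) (cong (_* x) ϕ≡))))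
            (trans (ℤ→ℚ-* (𝕡 Z.^ (b ℕ.+ b)) Y₂) (cong (_* y₂) (trans (cong ℤ→ℚ (Z.^-homo-* 𝕡 b b)) (trans (ℤ→ℚ-* (𝕡 Z.^ b) (𝕡 Z.^ b)) (cong₂ _*_ P-b P-b)))))))
          Sm≡ : ℤ→ℚ (psum ϕ (p ℕ.^ (b ℕ.+ w))) ≡ W * ((∂ * P′ + ∂ * P′ * x) + (Π * P′) * (Π * P′) * y₂) + (Π * P′ * W) * (Π * P′) * y
          Sm≡ = trans (cong ℤ→ℚ scale≡) (trans (ℤ→ℚ-+ (𝕡 Z.^ w ℤ.* psum ϕ (p ℕ.^ b)) (𝕡 Z.^ ((b ℕ.+ w) ℕ.+ b) ℤ.* Y)) (cong₂ _+_ (trans (ℤ→ℚ-* (𝕡 Z.^ w) (psum ϕ (p ℕ.^ b))) (cong (W *_) S≡))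
            (trans (ℤ→ℚ-* (𝕡 Z.^ ((b ℕ.+ w) ℕ.+ b)) Y) (cong (_* y) (trans (cong ℤ→ℚ (trans (Z.^-homo-* 𝕡 (b ℕ.+ w) b) (cong (ℤ._* 𝕡 Z.^ b) (sym (Z.ιℕ^ p (b ℕ.+ w)))))) (trans (ℤ→ℚ-* (+ (p ℕ.^ (b ℕ.+ w))) (𝕡 Z.^ b)) (cong₂ _*_ m≡ P-b)))))))
          f≡ : ℕ→ℚ (suc ϕ !) ≡ W * A
          f≡ = trans (cong ℕ→ℚ fact≡) (trans (Q.ιℕ* (p ℕ.^ w) a) (cong (_* A) (cong ℤ→ℚ (Z.ιℕ^ p w))))
          key : (W * A) * ((W * ((∂ * P′ + ∂ * P′ * x) + (Π * P′) * (Π * P′) * y₂) + (Π * P′ * W) * (Π * P′) * y) - (Π * P′ * W) * β) ≡ (Π * P′ * W) * (Π * P′ * W) * δ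
          key = trans (sym (cong₂ _*_ f≡ (cong₂ (λ s m → s - m * β) Sm≡ m≡))) (trans dev≡ (cong (λ m → m * m * δ) m≡))
          κ ω : ℚ
          κ = Π * (Π * P′)
          ω = ∂ + ∂ * x
          S-factor : (∂ * P′ + ∂ * P′ * x) + (Π * P′) * (Π * P′) * y₂ ≡ P′ * (ω + κ * y₂)
          S-factor = Q.solve 5 (λ ∂ P x Π y₂ → (∂ Q.:* P Q.:+ ∂ Q.:* P Q.:* x) Q.:+ (Π Q.:* P) Q.:* (Π Q.:* P) Q.:* y₂ Q.:= P Q.:* ((∂ Q.:+ ∂ Q.:* x) Q.:+ (Π Q.:* (Π Q.:* P)) Q.:* y₂)) refl ∂ P′ x Π y₂
          inner : (W * (P′ * (ω + κ * y₂)) + (Π * P′ * W) * (Π * P′) * y) - (Π * P′ * W) * β ≡ (W * P′) * ((ω + κ * y₂ + κ * y) - Π * β)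
          inner = Q.solve 6 (λ W P X Π y β → (W Q.:* (P Q.:* X) Q.:+ (Π Q.:* P Q.:* W) Q.:* (Π Q.:* P) Q.:* y) Q.:- (Π Q.:* P Q.:* W) Q.:* β Q.:= (W Q.:* P) Q.:* ((X Q.:+ (Π Q.:* (Π Q.:* P)) Q.:* y) Q.:- Π Q.:* β)) refl W P′ (ω + κ * y₂) Π y β
          reduced : A * ((ω + κ * y₂ + κ * y) - Π * β) ≡ κ * δ
          reduced = ℚ-cancel (W * W * P′) nz (trans (Q.solve 4 (λ W P A z → (W Q.:* W Q.:* P) Q.:* (A Q.:* z) Q.:= (W Q.:* A) Q.:* ((W Q.:* P) Q.:* z)) refl W P′ A ((ω + κ * y₂ + κ * y) - Π * β))
            (trans (cong ((W * A) *_) (trans (sym inner) (cong (λ k → (W * k + (Π * P′ * W) * (Π * P′) * y) - (Π * P′ * W) * β) (sym S-factor))))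
            (trans key (Q.solve 4 (λ W P Π δ → (Π Q.:* P Q.:* W) Q.:* (Π Q.:* P Q.:* W) Q.:* δ Q.:= (W Q.:* W Q.:* P) Q.:* ((Π Q.:* (Π Q.:* P)) Q.:* δ)) refl W P′ Π δ))))
            where
            p^≢0 : ∀ n → ℤ→ℚ (𝕡 Z.^ n) ≢ 0ℚ
            p^≢0 n e = ℤ→ℚ-≢0 (+ (p ℕ.^ n)) (λ z → contradiction (ℤP.+-injective z) (ℕ.≢-nonZero⁻¹ (p ℕ.^ n) {{ℕP.m^n≢0 p n}})) (trans (cong ℤ→ℚ (Z.ιℕ^ p n)) e)
            nz : W * W * P′ ≢ 0ℚ
            nz = ℚ-*-≢0 (ℚ-*-≢0 (p^≢0 w) (p^≢0 w)) (p^≢0 b′)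
          cancelled : A * (Π * β) ≡ A * (ω + κ * (y₂ + y)) - κ * δ
          cancelled = trans (Q.solve 5 (λ A ω κ Y t → A Q.:* t Q.:= A Q.:* (ω Q.:+ κ Q.:* Y) Q.:- A Q.:* ((ω Q.:+ κ Q.:* Y) Q.:- t)) refl A ω κ (y₂ + y) (Π * β))
            (cong (λ k → A * (ω + κ * (y₂ + y)) - k) (trans (cong (λ k → A * (k - Π * β)) (Q.solve 4 (λ ω κ y₂ y → ω Q.:+ κ Q.:* (y₂ Q.:+ y) Q.:= ω Q.:+ κ Q.:* y₂ Q.:+ κ Q.:* y) refl ω κ y₂ y)) reduced))
          invA : inv A * A ≡ 1ℚ
          invA = val≡ (inverse-* (+ a) a-unit)
          A≢0 : A ≢ 0ℚ
          A≢0 e = 1≢0 (trans (sym invA) (trans (cong (inv A *_) e) (ℚP.*-zeroʳ (inv A))))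
          val-z : val z ≡ Π * β
          val-z = ℚ-cancel A A≢0 (trans (cong (λ k → A * (ω + k * ((y₂ + y) - δ * inv A))) (trans (val≡ (int-^ 𝕡 (suc b))) (trans (ℤ→ℚ-* 𝕡 (𝕡 Z.^ b)) (cong (Π *_) P-b))))
            (trans (Q.solve 6 (λ A ω k Y δ i → A Q.:* (ω Q.:+ k Q.:* (Y Q.:- δ Q.:* i)) Q.:= A Q.:* (ω Q.:+ k Q.:* Y) Q.:- (i Q.:* A) Q.:* (k Q.:* δ)) refl A ω κ (y₂ + y) δ (inv A))
              (trans (cong (λ k → A * (ω + κ * (y₂ + y)) - k) (trans (cong (_* (κ * δ)) invA) (ℚP.*-identityˡ (κ * δ)))) (sym cancelled))))

        -- p B_ϕ is read off from the power sum over j < p^C with C large: dividing by (ϕ+1)!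
        -- costs only the bounded power p^w.
        pB : PBernoulli
        pB = let (w , a , fact≡ , a-unit) = p-part (suc ϕ !) (ℕ.>-nonZero⁻¹ (suc ϕ !) {{suc ϕ ℕP.!≢0}})
                 (D , dev≡) = dev-divisible (p ℕ.^ (b ℕ.+ w)) ϕ
                 scale = psum-scales b′ w
                 VV = psum-V b′
             in core w a D (Z.quo scale) (Z.quo VV) fact≡ a-unit dev≡ (Z.eq scale) (Z.eq VV)

  -- Comparison of the quotient at pn with those at p^B s and ps.

  module IntegerAssembly where

    open GenericAlgebra
    open ShiftOperators
    open FleckQuotients
    open StirlingSeries
    open PrimeUnits
    open SeriesValues
    open FactorialProducts
    open ResidueFilter
    open GrossKoblitz
    open BernoulliModPrimePowers
    open import Data.Nat using (_!; _∸_)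
    open import Data.Integer using (ℤ; +_; _+_; _*_; -_; _-_; 0ℤ; 1ℤ; ∣_∣)

    module Assembly where
      open BernP public

      rep-+ : ∀ b c → rep (b ℕ.+ c) ≡ rep b ℕ.+ p ℕ.^ b ℕ.* rep c
      rep-+ zero c = sym (ℕP.*-identityˡ (rep c))
      rep-+ (suc b) c = trans (rep-suc (b ℕ.+ c)) (trans (cong (λ z → suc (p ℕ.* z)) (rep-+ b c)) (trans (cong suc (lem p (rep b) (p ℕ.^ b) (rep c))) (cong (ℕ._+ p ℕ.^ suc b ℕ.* rep c) (sym (rep-suc b)))))
        where lem : ∀ p r q c → p ℕ.* (r ℕ.+ q ℕ.* c) ≡ p ℕ.* r ℕ.+ (p ℕ.* q) ℕ.* c
              lem = ℕ-solve-∀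

      ≤-rep : ∀ j → j ℕ.≤ rep j
      ≤-rep zero = ℕ.z≤n
      ≤-rep (suc j) = ℕP.≤-trans (ℕ.s≤s (≤-rep j)) (ℕP.≤-trans (ℕP.≤-reflexive (ℕP.+-comm 1 (rep j))) (ℕP.+-monoʳ-≤ (rep j) (p^>0 j)))

      module _ (r : ℤ) (p∤r : ¬ (r Z.≡ 0ℤ mod 𝕡)) (s′ s̄′ : ℕ) (s+s̄ : suc s′ ℕ.+ suc s̄′ ≡ d) (b′ n′ k : ℕ) (n′≡ : n′ ≡ suc s′ ℕ.+ k ℕ.* d) where
        s₀ = suc s′
        s̄ = suc s̄′
        b = suc b′
        n = p ℕ.^ b′ ℕ.* n′
        e₀ = k ℕ.+ rep b ℕ.* n′
        -- The step from pn to p^(B₁) s: q₁ solves e₀ + p q₁ = rep B₁ · s. Taking B₁ = b + k + 1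
        -- makes m₁ an exact difference, and q₁ keeps the factor p^(b-1).
        m₁ = rep (suc k) ℕ.* s₀ ∸ k
        q₁ = p ℕ.^ b′ ℕ.* m₁
        B₁ = b ℕ.+ suc k

        s<d : s₀ ℕ.< d
        s<d = ℕP.≤-trans (ℕP.m<m+n s₀ (ℕ.z<s)) (ℕP.≤-reflexive s+s̄)
        s<p : s₀ ℕ.< p
        s<p = ℕP.m<n⇒m<1+n s<d
        0<s : 0 ℕ.< s₀
        0<s = ℕ.z<s

        𝔾 : ℕ → ℤ
        𝔾 = GG s₀ s<p 0<s
        ρ₀ : ℕ → ℤ
        ρ₀ = ρ r p∤r s′ s̄ s+s̄ s<d
        exr : ℕ → ℕ
        exr = ex r p∤r s′ s̄ s+s̄

        n₂ = s̄′ ℕ.+ s′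
        d′≡n₂ : d′ ≡ suc n₂
        d′≡n₂ = trans (sym (ℕP.suc-injective s+s̄)) (trans (ℕP.+-suc s′ s̄′) (cong suc (ℕP.+-comm s′ s̄′)))

        pn≡ : p ℕ.* n ≡ s₀ ℕ.+ e₀ ℕ.* d
        pn≡ = trans (sym (ℕP.*-assoc p (p ℕ.^ b′) n′)) (trans (cong (ℕ._* n′) (rep-geometric b)) (trans (cong (ℕ._+ rep b ℕ.* d ℕ.* n′) n′≡) (lem s₀ k d (rep b) n′)))
          where lem : ∀ s k d r n → (s ℕ.+ k ℕ.* d) ℕ.+ r ℕ.* d ℕ.* n ≡ s ℕ.+ (k ℕ.+ r ℕ.* n) ℕ.* d
                lem = ℕ-solve-∀

        private
          m₁+k : m₁ ℕ.+ k ≡ rep (suc k) ℕ.* s₀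
          m₁+k = ℕP.m∸n+n≡m (ℕP.≤-trans (ℕP.≤-trans (ℕP.n≤1+n k) (≤-rep (suc k))) (ℕP.m≤m*n (rep (suc k)) s₀))

          e₁≡ : e₀ ℕ.+ p ℕ.* q₁ ≡ rep B₁ ℕ.* s₀
          e₁≡ = trans (cong (λ z → (k ℕ.+ rep b ℕ.* z) ℕ.+ p ℕ.* q₁) n′≡) (trans (lem k (rep b) s₀ d p (p ℕ.^ b′) m₁) (trans (cong₂ (λ x y → rep b ℕ.* s₀ ℕ.+ (m₁ ℕ.* y ℕ.+ k ℕ.* x)) (sym (rep-geometric b)) refl)
            (trans (cong (rep b ℕ.* s₀ ℕ.+_) (trans (sym (ℕP.*-distribʳ-+ (p ℕ.^ b) m₁ k)) (cong (ℕ._* p ℕ.^ b) m₁+k))) (trans (lem₂ (rep b) s₀ (rep (suc k)) (p ℕ.^ b)) (cong (ℕ._* s₀) (sym (rep-+ b (suc k))))))))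
            where
            lem : ∀ k r s d p P m → (k ℕ.+ r ℕ.* (s ℕ.+ k ℕ.* d)) ℕ.+ p ℕ.* (P ℕ.* m) ≡ r ℕ.* s ℕ.+ (m ℕ.* (p ℕ.* P) ℕ.+ k ℕ.* suc (r ℕ.* d))
            lem = ℕ-solve-∀
            lem₂ : ∀ r s t P → r ℕ.* s ℕ.+ (t ℕ.* s) ℕ.* P ≡ (r ℕ.+ P ℕ.* t) ℕ.* s
            lem₂ = ℕ-solve-∀

          -- The reference step, from ps to p^(B₁) s; it is s modulo p because positive repunits are
          -- 1 modulo p.
          q′ = rep (suc (b′ ℕ.+ k)) ℕ.* s₀

          e₂≡ : rep 1 ℕ.* s₀ ℕ.+ p ℕ.* q′ ≡ rep B₁ ℕ.* s₀
          e₂≡ = trans (lem s₀ p (rep (suc (b′ ℕ.+ k)))) (cong (ℕ._* s₀) (trans (sym (rep-suc (suc (b′ ℕ.+ k)))) (cong rep (cong suc (sym (ℕP.+-suc b′ k))))))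
            where lem : ∀ s p r → 1 ℕ.* s ℕ.+ p ℕ.* (r ℕ.* s) ≡ suc (p ℕ.* r) ℕ.* s
                  lem = ℕ-solve-∀

        Fₑ F₁ Fₚ : ℤ
        Fₑ = F s′ e₀ r
        F₁ = F s′ (rep B₁ ℕ.* s₀) r
        Fₚ = F s′ (rep 1 ℕ.* s₀) r

        private
          compare : + s₀ * (F₁ - Fₑ) Z.≡ + q₁ * (F₁ - Fₚ) mod (𝕡 Z.^ suc b)
          compare = Z.m≈ (cong (λ e → + s₀ * (F s′ e r - Fₑ)) (sym e₁≡)) (cong (λ e → + q₁ * (F s′ e r - Fₚ)) (sym e₁≡))
            (F-compare s′ e₀ (rep 1 ℕ.* s₀) b′ m₁ q′ (trans e₁≡ (sym e₂≡)) (Z.m≈ (ℤP.pos-* (rep (suc (b′ ℕ.+ k))) s₀) (sym (ℤP.*-identityˡ (+ s₀))) (Z.m*ʳ (+ s₀) (rep-unit (b′ ℕ.+ k)))) r)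

        F₁≡ : F₁ Z.≡ - (𝔾 (suc b) * ρ₀ (suc b)) mod (𝕡 Z.^ suc b)
        F₁≡ = Z.m≈ (cong (λ m → F s′ (rep m ℕ.* s₀) r) (cong suc (ℕP.+-suc b′ k))) refl (fleck-gauss-weak r p∤r s′ s̄ s+s̄ s<d b k)

        q₁≡0 : + q₁ Z.≡ 0ℤ mod (𝕡 Z.^ b′)
        q₁≡0 = Z.by (+ m₁) (trans (ℤP.pos-* (p ℕ.^ b′) m₁) (trans (cong (_* + m₁) (Z.ιℕ^ p b′)) (sym (ℤP.+-identityˡ (𝕡 Z.^ b′ * + m₁)))))

        noise-term : ℕ → ℤ
        noise-term j = q d (suc (suc j)) * (+ hc (suc s₀) (suc (suc j)) * r Z.^ exr (suc (suc j)))

        -- `noise` without its factor s, which cancels against the s on the left of `F-compare`.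
        noise₀ : ℤ
        noise₀ = sgn s₀ * + (s₀ !) * Z.sum n₂ noise-term

        private
          noise≡ : noise r p∤r s′ s̄ s+s̄ s<d n₂ d′≡n₂ ≡ + s₀ * noise₀
          noise≡ = trans (Z.sum-cong n₂ (λ j _ → lem (q d (suc (suc j))) (sgn s₀ * + (s₀ !)) (+ s₀) (+ hc (suc s₀) (suc (suc j))) (r Z.^ exr (suc (suc j)))))
            (trans (Z.sum-* n₂ (+ s₀ * (sgn s₀ * + (s₀ !))) noise-term) (ℤP.*-assoc (+ s₀) (sgn s₀ * + (s₀ !)) (Z.sum n₂ noise-term)))
            where lem : ∀ q g s h x → q * (g * (s * h * x)) ≡ s * g * (q * (h * x))
                  lem = solve-∀

        -- Next to q₁, divisible by p^(b-1), the difference F₁ - Fₚ is needed modulo p^2 only. There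
        -- the gamma products coincide and `noise` is left.
        F-expansion : Fₑ Z.≡ F₁ + + q₁ * noise₀ mod (𝕡 Z.^ suc b)
        F-expansion = unit-cancel≡ (suc b) (+ s₀) Fₑ (F₁ + + q₁ * noise₀) (small-unit s₀ 0<s s<p)
          (Z.m≈ (lem₁ (+ s₀) F₁ Fₑ) (lem₂ (+ s₀) F₁ (+ q₁) noise₀) (Z.m+ˡ (+ s₀ * F₁) (Z.mneg (Z.mtrans compare diff))))
          where
          lem₁ : ∀ s a b → s * b ≡ s * a + - (s * (a - b))
          lem₁ = solve-∀
          lem₂ : ∀ s a q n → s * (a + q * n) ≡ s * a + - (q * - (s * n))
          lem₂ = solve-∀
          diff : + q₁ * (F₁ - Fₚ) Z.≡ + q₁ * - (+ s₀ * noise₀) mod (𝕡 Z.^ suc b)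
          diff = Z.m≈m (cong (𝕡 Z.^_) (ℕP.+-comm b′ 2)) (Z.m^mul 𝕡 b′ 2 (+ q₁) q₁≡0
            (Z.mtrans (Z.m- (Z.m≈ (cong (λ m → F s′ (rep m ℕ.* s₀) r) (cong suc (ℕP.+-suc b′ k))) refl (fleck-gauss-weak r p∤r s′ s̄ s+s̄ s<d 1 (b′ ℕ.+ k))) (fleck-gauss-p² r p∤r s′ s̄ s+s̄ s<d n₂ d′≡n₂))
              (Z.meq (trans (lem₃ (- (𝔾 2 * ρ₀ 2)) (noise r p∤r s′ s̄ s+s̄ s<d n₂ d′≡n₂)) (cong -_ noise≡)))))
            where lem₃ : ∀ g n → g - (g + n) ≡ - n
                  lem₃ = solve-∀

        -- Exactly pn + (p-1) p q₁ = p^(B₁) s, and both p^(B₁) and p^2 q₁ vanish modulo p^(b+1).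
        pq₁≡pn : 𝕡 * + q₁ Z.≡ 𝕡 * + n mod (𝕡 Z.^ suc b)
        pq₁≡pn = Z.m≈ refl (solved (𝕡 * + n) (+ d) (𝕡 * + q₁) (+ (p ℕ.^ B₁ ℕ.* s₀)) total)
          (Z.msym (Z.m+0 (𝕡 * + q₁) (Z.m- {y = 0ℤ} {y′ = 0ℤ} big≡0 pp≡0)))
          where
          solved : ∀ N d Q P → N + d * Q ≡ P → N ≡ Q + (P - (1ℤ + d) * Q)
          solved N d Q P e = trans (lem N d Q) (cong (λ z → Q + (z - (1ℤ + d) * Q)) e)
            where lem : ∀ N d Q → N ≡ Q + ((N + d * Q) - (1ℤ + d) * Q)
                  lem = solve-∀
          total : 𝕡 * + n + + d * (𝕡 * + q₁) ≡ + (p ℕ.^ B₁ ℕ.* s₀)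
          total = trans (cong₂ _+_ (sym (ℤP.pos-* p n)) (trans (cong (+ d *_) (sym (ℤP.pos-* p q₁))) (sym (ℤP.pos-* d (p ℕ.* q₁))))) (trans (sym (ℤP.pos-+ (p ℕ.* n) (d ℕ.* (p ℕ.* q₁)))) (cong +_
            (trans (cong (ℕ._+ d ℕ.* (p ℕ.* q₁)) pn≡) (trans (lem s₀ e₀ d (p ℕ.* q₁)) (trans (cong (λ z → s₀ ℕ.+ z ℕ.* d) e₁≡) (trans (lem₂ s₀ (rep B₁) d) (cong (ℕ._* s₀) (sym (rep-geometric B₁)))))))))
            where
            lem : ∀ s e d q → (s ℕ.+ e ℕ.* d) ℕ.+ d ℕ.* q ≡ s ℕ.+ (e ℕ.+ q) ℕ.* d
            lem = ℕ-solve-∀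
            lem₂ : ∀ s r d → s ℕ.+ r ℕ.* s ℕ.* d ≡ suc (r ℕ.* d) ℕ.* s
            lem₂ = ℕ-solve-∀
          big≡0 : + (p ℕ.^ B₁ ℕ.* s₀) Z.≡ 0ℤ mod (𝕡 Z.^ suc b)
          big≡0 = Z.m^-weaken 𝕡 (suc b) B₁ (ℕP.≤-trans (ℕP.≤-reflexive (ℕP.+-comm 1 b)) (ℕP.+-monoʳ-≤ b (ℕ.z<s))) (Z.m≈ (ℤP.pos-* (p ℕ.^ B₁) s₀) refl (Z.m*0 (+ s₀) (p^≡0 B₁)))
          pp≡0 : (1ℤ + + d) * (𝕡 * + q₁) Z.≡ 0ℤ mod (𝕡 Z.^ suc b)
          pp≡0 = Z.m≈ (cong (_* (𝕡 * + q₁)) (sym (ℤP.pos-+ 1 d))) refl (Z.m^00 𝕡 1 (1 ℕ.+ b′) (Z.m^1⁻ 𝕡 𝕡≡0) (Z.m^00 𝕡 1 b′ (Z.m^1⁻ 𝕡 𝕡≡0) q₁≡0))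

        -- `v₀` is the product of the theorem with its sign; (-1)^(s(b-1)) equals (-1)^((b-1)n) by
        -- `sgn-exponent`.
        x₀ Y₀ v₀ : ℤ
        x₀ = - + V (p ℕ.^ b) - 1ℤ
        Y₀ = r Z.^ d - 1ℤ
        v₀ = sgn (s₀ ℕ.* b′) * + V (s₀ ℕ.* rep b)

        x₀≡0 : x₀ Z.≡ 0ℤ mod (𝕡 Z.^ b)
        x₀≡0 = V+1≡0 b′

        Y₀≡0 : Y₀ Z.≡ 0ℤ mod 𝕡
        Y₀≡0 = Z.mdiff⁻ (fermat-ℤ r p∤r)

        n≡0 : + n Z.≡ 0ℤ mod (𝕡 Z.^ b′)
        n≡0 = Z.m≈ (ℤP.pos-* (p ℕ.^ b′) n′) refl (Z.m*0 (+ n′) (p^≡0 b′))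

        nY≡0 : + n * Y₀ Z.≡ 0ℤ mod (𝕡 Z.^ b)
        nY≡0 = Z.m≈m (cong (𝕡 Z.^_) (ℕP.+-comm b′ 1)) (Z.m^00 𝕡 b′ 1 n≡0 (Z.m^1⁻ 𝕡 Y₀≡0))

        -- The total exponent of r is d p^(b-1) w₁, so the power is one of r^d = 1 + pt. As d w₁ is
        -- n′ modulo p^2, w₁ acts as -n′.
        r^n-ρ : r Z.^ n * ρ₀ (suc b) Z.≡ 1ℤ - + n * Y₀ mod (𝕡 Z.^ suc b)
        r^n-ρ with Y₀≡0
        ... | Z.by t Y≡ = Z.mtrans (Z.meq power) (Z.mtrans (Z.m≈ (cong (λ z → z Z.^ (p ℕ.^ b′ ℕ.* w₁)) r^d≡) refl (Z.one-plus-pow* p h tri-odd t b′ w₁)) (Z.m+ˡ 1ℤ main))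
          where
          w₁ = 1 ℕ.+ k ℕ.+ rep 2 ℕ.* s̄ ℕ.+ p ℕ.^ 2
          r^d≡ : r Z.^ d ≡ 1ℤ + 𝕡 * t
          r^d≡ = trans (lem (r Z.^ d)) (cong (λ z → 1ℤ + z) (trans Y≡ (ℤP.+-identityˡ (𝕡 * t))))
            where lem : ∀ a → a ≡ 1ℤ + (a - 1ℤ)
                  lem = solve-∀
          dw : d ℕ.* w₁ ≡ n′ ℕ.+ p ℕ.^ 2 ℕ.* (s̄ ℕ.+ d)
          dw = sym (trans (cong₂ ℕ._+_ n′≡ (trans (ℕP.*-distribˡ-+ (p ℕ.^ 2) s̄ d) (cong (λ z → z ℕ.* s̄ ℕ.+ p ℕ.^ 2 ℕ.* d) (rep-geometric 2))))
            (trans (lem s₀ k d (rep 2) s̄ (p ℕ.^ 2)) (trans (cong (ℕ._+ (k ℕ.+ rep 2 ℕ.* s̄ ℕ.+ p ℕ.^ 2) ℕ.* d) s+s̄) (lem₂ d k (rep 2 ℕ.* s̄) (p ℕ.^ 2)))))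
            where lem : ∀ s k d r t P → (s ℕ.+ k ℕ.* d) ℕ.+ (suc (r ℕ.* d) ℕ.* t ℕ.+ P ℕ.* d) ≡ (s ℕ.+ t) ℕ.+ (k ℕ.+ r ℕ.* t ℕ.+ P) ℕ.* d
                  lem = ℕ-solve-∀
                  lem₂ : ∀ d k r P → d ℕ.+ (k ℕ.+ r ℕ.+ P) ℕ.* d ≡ d ℕ.* (1 ℕ.+ k ℕ.+ r ℕ.+ P)
                  lem₂ = ℕ-solve-∀
          total : n ℕ.+ p ℕ.^ suc b ℕ.* (s̄ ℕ.+ d) ≡ d ℕ.* (p ℕ.^ b′ ℕ.* w₁)
          total = trans (lem (p ℕ.^ b′) n′ p (s̄ ℕ.+ d)) (trans (cong (p ℕ.^ b′ ℕ.*_) (sym dw)) (lem₂ (p ℕ.^ b′) d w₁))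
            where lem : ∀ P n p s → P ℕ.* n ℕ.+ (p ℕ.* (p ℕ.* P)) ℕ.* s ≡ P ℕ.* (n ℕ.+ (p ℕ.* (p ℕ.* 1)) ℕ.* s)
                  lem = ℕ-solve-∀
                  lem₂ : ∀ P d w → P ℕ.* (d ℕ.* w) ≡ d ℕ.* (P ℕ.* w)
                  lem₂ = ℕ-solve-∀
          power : r Z.^ n * ρ₀ (suc b) ≡ (r Z.^ d) Z.^ (p ℕ.^ b′ ℕ.* w₁)
          power = trans (cong (r Z.^ n *_) (Z.^-assocʳ r (p ℕ.^ suc b) (s̄ ℕ.+ d))) (trans (sym (Z.^-homo-* r n (p ℕ.^ suc b ℕ.* (s̄ ℕ.+ d)))) (trans (cong (r Z.^_) total) (sym (Z.^-assocʳ r d (p ℕ.^ b′ ℕ.* w₁)))))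
          Xw = + w₁ * (𝕡 Z.^ b′ * Y₀)
          Xw≡0 : 𝕡 Z.^ b′ * Y₀ Z.≡ 0ℤ mod (𝕡 Z.^ b)
          Xw≡0 = Z.m≈m (cong (𝕡 Z.^_) (ℕP.+-comm b′ 1)) (Z.m^00 𝕡 b′ 1 (Z.m^0≤ 𝕡 b′ b′ ℕP.≤-refl) (Z.m^1⁻ 𝕡 Y₀≡0))
          dX : + d * Xw ≡ + n * Y₀ + + (p ℕ.^ 2 ℕ.* (s̄ ℕ.+ d)) * (𝕡 Z.^ b′ * Y₀)
          dX = trans (lem (+ d) (+ w₁) (𝕡 Z.^ b′ * Y₀)) (trans (cong (_* (𝕡 Z.^ b′ * Y₀)) (trans (sym (ℤP.pos-* d w₁)) (trans (cong +_ dw) (ℤP.pos-+ n′ (p ℕ.^ 2 ℕ.* (s̄ ℕ.+ d))))))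
            (trans (lem₂ (+ n′) (+ (p ℕ.^ 2 ℕ.* (s̄ ℕ.+ d))) (𝕡 Z.^ b′) Y₀) (cong (λ z → z * Y₀ + + (p ℕ.^ 2 ℕ.* (s̄ ℕ.+ d)) * (𝕡 Z.^ b′ * Y₀)) (trans (cong (_* + n′) (sym (Z.ιℕ^ p b′))) (sym (ℤP.pos-* (p ℕ.^ b′) n′))))))
            where lem : ∀ d w x → d * (w * x) ≡ (d * w) * x
                  lem = solve-∀
                  lem₂ : ∀ n a P Y → (n + a) * (P * Y) ≡ (P * n) * Y + a * (P * Y)
                  lem₂ = solve-∀
          split : ∀ d Xw N A → d * Xw ≡ N + A → Xw ≡ - N + (- A + (1ℤ + d) * Xw)
          split d Xw N A e = trans (lem d Xw) (trans (cong (λ z → - z + (1ℤ + d) * Xw) e) (lem₂ N A ((1ℤ + d) * Xw)))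
            where lem : ∀ d Xw → Xw ≡ - (d * Xw) + (1ℤ + d) * Xw
                  lem = solve-∀
                  lem₂ : ∀ N A B → - (N + A) + B ≡ - N + (- A + B)
                  lem₂ = solve-∀
          main : + w₁ * (𝕡 Z.^ suc b′ * t) Z.≡ - (+ n * Y₀) mod (𝕡 Z.^ suc b)
          main = Z.m≈ (cong (+ w₁ *_) (trans (lem 𝕡 (𝕡 Z.^ b′) t) (cong (𝕡 Z.^ b′ *_) (sym (trans Y≡ (ℤP.+-identityˡ (𝕡 * t))))))) refl
            (Z.mtrans (Z.meq (split (+ d) Xw (+ n * Y₀) (+ (p ℕ.^ 2 ℕ.* (s̄ ℕ.+ d)) * (𝕡 Z.^ b′ * Y₀)) dX)) (Z.m+0 (- (+ n * Y₀)) (Z.m+ {y = 0ℤ} {y′ = 0ℤ}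
              (Z.mneg {y = 0ℤ} (Z.m^-weaken 𝕡 (suc b) (2 ℕ.+ b) (ℕP.n≤1+n (suc b)) (Z.m^00 𝕡 2 b (Z.m≈ (ℤP.pos-* (p ℕ.^ 2) (s̄ ℕ.+ d)) refl (Z.m*0 (+ (s̄ ℕ.+ d)) (p^≡0 2))) Xw≡0)))
              (Z.m^00 𝕡 1 b (Z.m^1⁻ 𝕡 (Z.m≈ (sym (ℤP.pos-+ 1 d)) refl 𝕡≡0)) (Z.m0* (+ w₁) Xw≡0)))))
            where lem : ∀ p P t → p * P * t ≡ P * (p * t)
                  lem = solve-∀

        private
          g₀ = sgn (s₀ ℕ.* b′)
          E₀ = + E s₀
          c₁ = + (p ℕ.^ b ℕ.* s₀)

          pw₁ : s₀ ℕ.* rep b ≡ p ℕ.* (s₀ ℕ.* rep b′) ℕ.+ s₀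
          pw₁ = sym (y≡₁ s₀ s<p 0<s b′)

          V-pw : + V (p ℕ.* (s₀ ℕ.* rep b′)) Z.≡ g₀ mod 𝕡
          V-pw = Z.m^1 𝕡 (Z.m≈ (cong (λ z → + V z) (trans (cong (ℕ._* (s₀ ℕ.* rep b′)) (sym (ℕP.*-identityʳ p))) (sym (ℕP.+-identityʳ _)))) (trans (sym (sgn-rep s₀ b′)) (sym (ℤP.*-identityʳ (sgn (s₀ ℕ.* rep b′))))) (V-shift 0 (s₀ ℕ.* rep b′) 0))

          v₀≡ : v₀ Z.≡ + (s₀ !) mod 𝕡
          v₀≡ = Z.m≈ (cong (λ z → g₀ * + V z) pw₁) (sym (sgn-cancel (s₀ ℕ.* b′) (+ (s₀ !)))) (Z.m*ˡ g₀ (Z.mtrans (V-mul-mod (p ℕ.* (s₀ ℕ.* rep b′)) s₀ (p∣p*m (s₀ ℕ.* rep b′)))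
            (Z.m* V-pw (Z.meq (cong +_ (V-small s₀ s<p))))))

          E₀≡ : g₀ * + E (s₀ ℕ.* rep b) Z.≡ E₀ mod 𝕡
          E₀≡ = Z.m≈ (cong (λ z → g₀ * + E z) pw₁) (sym (sgn-cancel (s₀ ℕ.* b′) E₀)) (Z.m*ˡ g₀ (Z.mtrans (E-mul-mod (p ℕ.* (s₀ ℕ.* rep b′)) s₀ (p∣p*m (s₀ ℕ.* rep b′)))
            (Z.mtrans (Z.m+ (Z.m*ʳ E₀ V-pw) (Z.m*0 (+ V s₀) (E-multiple (s₀ ℕ.* rep b′)))) (Z.meq (ℤP.+-identityʳ (g₀ * E₀))))))

          c₁≡0 : c₁ Z.≡ 0ℤ mod (𝕡 Z.^ b)
          c₁≡0 = Z.m≈ (ℤP.pos-* (p ℕ.^ b) s₀) refl (Z.m*0 (+ s₀) (p^≡0 b))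

          V-c^s : (+ V (p ℕ.^ b)) Z.^ s₀ Z.≡ sgn s₀ * (1ℤ + + s₀ * x₀) mod (𝕡 Z.^ suc b)
          V-c^s with Z.pow-taylor₁ s′ 1ℤ x₀
          ... | w′ , e = Z.m≈ (trans (cong (Z._^ s₀) (lem (+ V (p ℕ.^ b)))) (Z.^-distrib-* (- 1ℤ) (1ℤ + x₀) s₀)) refl (Z.m*ˡ (sgn s₀)
              (Z.mtrans (Z.meq e) (Z.mtrans (Z.m+0 (1ℤ Z.^ s₀ + + s₀ * 1ℤ Z.^ s′ * x₀) (Z.m*0 w′ (Z.m^-weaken 𝕡 (suc b) (b ℕ.+ b) (ℕ.s≤s (ℕP.m≤n+m b b′)) (Z.m^00 𝕡 b b x₀≡0 x₀≡0))))
                (Z.meq (trans (cong₂ (λ a c → a + + s₀ * c * x₀) (Z.1^ s₀) (Z.1^ s′)) (cong (λ c → 1ℤ + c * x₀) (ℤP.*-identityʳ (+ s₀))))))))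
            where lem : ∀ v → v ≡ - 1ℤ * (1ℤ + (- v - 1ℤ))
                  lem = solve-∀

          -- Expansion of V at p^b s + s rep b: it separates from `v₀` the first-order effects of
          -- V(p^b) + 1 and of the harmonic quantity `E`.
          𝔾≡ : sgn s₀ * 𝔾 (suc b) Z.≡ (1ℤ + + s₀ * x₀) * (v₀ + c₁ * E₀) mod (𝕡 Z.^ suc b)
          𝔾≡ = Z.mtrans (Z.meq (cong₂ (λ a z → sgn s₀ * (a * + V z)) signs (y≡₂ s₀ s<p 0<s b))) (Z.mtrans (Z.m*ˡ (sgn s₀) (Z.m*ˡ (sgn s₀ * (sgn s₀ * g₀)) (Z.mtrans (V-expand b′ s₀ (s₀ ℕ.* rep b)) (Z.m*ʳ _ V-c^s))))
            (Z.mtrans (Z.meq (trans (lem (sgn s₀) g₀ (1ℤ + + s₀ * x₀) (+ V (s₀ ℕ.* rep b)) c₁ (+ E (s₀ ℕ.* rep b))) (cong (λ z → z * ((1ℤ + + s₀ * x₀) * (v₀ + c₁ * (g₀ * + E (s₀ ℕ.* rep b))))) (trans (cong₂ _*_ (sgn² s₀) (sgn² s₀)) refl))))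
              (Z.m≈ (ℤP.*-identityˡ _) refl (Z.m*ˡ (1ℤ + + s₀ * x₀) (Z.m+ˡ v₀ (Z.m≈m (cong (𝕡 Z.^_) (ℕP.+-comm b 1)) (Z.m^mul 𝕡 b 1 c₁ c₁≡0 (Z.m^1⁻ 𝕡 E₀≡))))))))
            where
            signs : sgn (s₀ ℕ.* suc b) ≡ sgn s₀ * (sgn s₀ * g₀)
            signs = trans (cong sgn (trans (ℕP.*-suc s₀ b) (cong (s₀ ℕ.+_) (ℕP.*-suc s₀ b′)))) (trans (sgn-+ s₀ (s₀ ℕ.+ s₀ ℕ.* b′)) (cong (sgn s₀ *_) (sgn-+ s₀ (s₀ ℕ.* b′))))
            lem : ∀ s g x v c e → s * ((s * (s * g)) * ((s * x) * (v + c * e))) ≡ ((s * s) * (s * s)) * (x * (g * v + c * (g * e)))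
            lem = solve-∀

        -- Product of the expansions of `𝔾` and r^n `ρ₀`. Products of two quantities divisible by
        -- p^b drop out, and next to one of them `v₀` may be replaced by s!.
        main-part : sgn s₀ * (r Z.^ n * F₁) + v₀ Z.≡ + (s₀ !) * (- (+ s₀ * x₀) + + n * Y₀) - c₁ * E₀ mod (𝕡 Z.^ suc b)
        main-part = Z.mtrans (Z.m+ʳ v₀ (Z.mtrans (Z.m*ˡ (sgn s₀) (Z.m*ˡ (r Z.^ n) F₁≡)) (Z.mtrans (Z.meq (lem₁ (sgn s₀) (r Z.^ n) (𝔾 (suc b)) (ρ₀ (suc b)))) (Z.mneg (Z.m* 𝔾≡ r^n-ρ)))))
          (Z.mtrans (Z.meq (lem₂ (+ s₀ * x₀) v₀ (c₁ * E₀) (+ n * Y₀))) (Z.mtrans (Z.m+0 (v₀ * (- (+ s₀ * x₀) + + n * Y₀) - c₁ * E₀) (small sx≡0 cE≡0 nY≡0))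
            (Z.m+ʳ (- (c₁ * E₀)) (Z.m≈ (ℤP.*-comm v₀ main) (ℤP.*-comm (+ (s₀ !)) main) (Z.m≈m (cong (𝕡 Z.^_) (ℕP.+-comm b 1)) (Z.m^mul 𝕡 b 1 main (Z.m+ {y = 0ℤ} {y′ = 0ℤ} (Z.mneg {y = 0ℤ} sx≡0) nY≡0) (Z.m^1⁻ 𝕡 v₀≡)))))))
          where
          main = - (+ s₀ * x₀) + + n * Y₀
          lem₁ : ∀ s r g p → s * (r * - (g * p)) ≡ - ((s * g) * (r * p))
          lem₁ = solve-∀
          lem₂ : ∀ x v c y → - ((1ℤ + x) * (v + c) * (1ℤ - y)) + v ≡ (v * (- x + y) - c) + (y * c + (x * y) * (v + c) - x * c)
          lem₂ = solve-∀
          sx≡0 : + s₀ * x₀ Z.≡ 0ℤ mod (𝕡 Z.^ b)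
          sx≡0 = Z.m0* (+ s₀) x₀≡0
          cE≡0 : c₁ * E₀ Z.≡ 0ℤ mod (𝕡 Z.^ b)
          cE≡0 = Z.m*0 E₀ c₁≡0
          small : ∀ {x c y} → x Z.≡ 0ℤ mod (𝕡 Z.^ b) → c Z.≡ 0ℤ mod (𝕡 Z.^ b) → y Z.≡ 0ℤ mod (𝕡 Z.^ b) → y * c + (x * y) * (v₀ + c) - x * c Z.≡ 0ℤ mod (𝕡 Z.^ suc b)
          small {x} {c} {y} x≡0 c≡0 y≡0 = Z.m- {y = 0ℤ} {y′ = 0ℤ} (Z.m+ {y = 0ℤ} {y′ = 0ℤ} (pr₂ y≡0 c≡0) (Z.m*0 (v₀ + c) (pr₂ x≡0 y≡0))) (pr₂ x≡0 c≡0)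
            where
            pr₂ : ∀ {u w} → u Z.≡ 0ℤ mod (𝕡 Z.^ b) → w Z.≡ 0ℤ mod (𝕡 Z.^ b) → u * w Z.≡ 0ℤ mod (𝕡 Z.^ suc b)
            pr₂ u≡0 w≡0 = Z.m^-weaken 𝕡 (suc b) (b ℕ.+ b) (ℕ.s≤s (ℕP.m≤n+m b b′)) (Z.m^00 𝕡 b b u≡0 w≡0)

  -- Division by s! and the Bernoulli sum over the p-adic integers.

  module LocalAssembly where

    open import Defs using (B; ℤ→ℚ; inv)
    open GenericAlgebra
    open ShiftOperators using (module Z)
    open FleckQuotients using (∣⇒mod)
    open StirlingSeries
    open PrimeUnits
    open SeriesValues
    open FactorialProducts
    open ResidueFilter
    open Localisation
    open BernoulliNumbers
    open BernoulliModPrimePowers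
    open IntegerAssembly
    open import Data.Nat using (_!; _∸_)
    open import Data.Integer using (ℤ; +_; 0ℤ; 1ℤ; ∣_∣) renaming (_+_ to _+ℤ_; _*_ to _*ℤ_; -_ to -ℤ_; _-_ to _-ℤ_)

    rf-range : ∀ M τ x → τ ℕ.< x → x ℕ.≤ M ℕ.+ τ → x ℕD.∣ rf M τ
    rf-range zero τ x τ<x x≤ = contradiction τ<x (ℕP.≤⇒≯ x≤)
    rf-range (suc M) τ x τ<x x≤ with x ℕ.≟ suc M ℕ.+ τ
    ... | yes refl = ℕD.m∣m*n (rf M τ)
    ... | no x≢ = ℕD.∣n⇒∣m*n (suc M ℕ.+ τ) (rf-range M τ x τ<x (ℕP.≤-pred (ℕP.≤∧≢⇒< x≤ x≢)))

    module Localised where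
      open Assembly public

      private
        recip-dec : ∀ z → Dec (p ℕD.∣ ∣ z ∣) → ℤ₍ₚ₎
        recip-dec z (yes _) = int 0ℤ
        recip-dec z (no u) = inverse z u

      -- Inversion made total by the value 0, so that summands carry no unit proofs.
      recip : ℤ → ℤ₍ₚ₎
      recip z = recip-dec z (p ∣? ∣ z ∣)

      private
        recip-dec-* : ∀ z D → ¬ (p ℕD.∣ ∣ z ∣) → recip-dec z D ∙ int z ≐ int 1ℤ
        recip-dec-* z (yes p∣) u = contradiction p∣ u
        recip-dec-* z (no u′) _ = inverse-* z u′

        val-recip-dec : ∀ z D → ¬ (p ℕD.∣ ∣ z ∣) → val (recip-dec z D) ≡ inv (ℤ→ℚ z)
        val-recip-dec z (yes p∣) u = contradiction p∣ u
        val-recip-dec z (no _) _ = refl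

      recip-* : ∀ z → ¬ (p ℕD.∣ ∣ z ∣) → recip z ∙ int z ≐ int 1ℤ
      recip-* z u = recip-dec-* z (p ∣? ∣ z ∣) u

      val-recip : ∀ z → ¬ (p ℕD.∣ ∣ z ∣) → val (recip z) ≡ inv (ℤ→ℚ z)
      val-recip z u = val-recip-dec z (p ∣? ∣ z ∣) u

      int-sum : ∀ n f → int (Z.sum n f) ≐ L.sum n (λ k → int (f k))
      int-sum zero f = L.refl
      int-sum (suc n) f = L.trans (L.ι+ (Z.sum n f) (f n)) (L.+-congʳ (int-sum n f))

      pow-unit : ∀ x → ¬ (x Z.≡ 0ℤ mod 𝕡) → ∀ n → ¬ (p ℕD.∣ ∣ x Z.^ n ∣)
      pow-unit x u zero = 1-unit
      pow-unit x u (suc n) p∣ = *-unit {∣ x ∣} {∣ x Z.^ n ∣} (λ p∣x → u (∣⇒mod {p} {x} p∣x)) (pow-unit x u n) (subst (p ℕD.∣_) (ℤP.abs-* x (x Z.^ n)) p∣)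

      module _ (r : ℤ) (p∤r : ¬ (r Z.≡ 0ℤ mod 𝕡)) (s′ s̄′ : ℕ) (s+s̄ : suc s′ ℕ.+ suc s̄′ ≡ d) (b′ n′ k : ℕ) (n′≡ : n′ ≡ suc s′ ℕ.+ k ℕ.* d) where
        private
          s₁ = suc s′
          b₁ = suc b′
          n₁ = p ℕ.^ b′ ℕ.* n′
          𝔮 = q₁ r p∤r s′ s̄′ s+s̄ b′ n′ k n′≡
          exq = exr r p∤r s′ s̄′ s+s̄ b′ n′ k n′≡
          Fe = Fₑ r p∤r s′ s̄′ s+s̄ b′ n′ k n′≡
          FN = F₁ r p∤r s′ s̄′ s+s̄ b′ n′ k n′≡
          n₃ = s̄′ ℕ.+ s′
          V₀ = v₀ r p∤r s′ s̄′ s+s̄ b′ n′ k n′≡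
          X₁ = x₀ r p∤r s′ s̄′ s+s̄ b′ n′ k n′≡
          Y₁ = Y₀ r p∤r s′ s̄′ s+s̄ b′ n′ k n′≡
          s₁<p : s₁ ℕ.< p
          s₁<p = s<p r p∤r s′ s̄′ s+s̄ b′ n′ k n′≡
          d′≡ : d′ ≡ suc n₃
          d′≡ = d′≡n₂ r p∤r s′ s̄′ s+s̄ b′ n′ k n′≡
          mod-b : ℤ₍ₚ₎
          mod-b = π L.^ suc b₁

        zr : ℕ → ℤ
        zr j = + j *ℤ r Z.^ j

        zr-unit : ∀ j → 0 ℕ.< j → j ℕ.< p → ¬ (p ℕD.∣ ∣ zr j ∣)
        zr-unit j 0<j j<p p∣ = *-unit {j} {∣ r Z.^ j ∣} (small-unit j 0<j j<p) (pow-unit r p∤r j) (subst (p ℕD.∣_) (ℤP.abs-* (+ j) (r Z.^ j)) p∣)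

        summand : ℕ → ℤ₍ₚ₎
        summand i = int (+ hc (suc s₁) (suc (suc i))) ∙ 𝔹 (suc (suc i)) ∙ recip (zr (suc (suc i)))

        𝕊 : ℤ₍ₚ₎
        𝕊 = L.sum s̄′ summand

        private
          πn≡0 : π ∙ int (+ n₁) L.≡ L.0# mod (π L.^ b₁)
          πn≡0 = L.m^00 π 1 b′ π≡0 (int-mod^ b′ (n≡0 r p∤r s′ s̄′ s+s̄ b′ n′ k n′≡))

          𝔮≡0 : int (+ 𝔮) L.≡ L.0# mod (π L.^ b′)
          𝔮≡0 = int-mod^ b′ (q₁≡0 r p∤r s′ s̄′ s+s̄ b′ n′ k n′≡)

          𝔮π≡ : int (+ 𝔮) ∙ π L.≡ π ∙ int (+ n₁) mod mod-b
          𝔮π≡ = L.m≈ (L.trans (L.*-comm (int (+ 𝔮)) π) (L.sym (L.ι* 𝕡 (+ 𝔮)))) (L.sym (L.ι* 𝕡 (+ n₁))) (int-mod^ (suc b₁) (pq₁≡pn r p∤r s′ s̄′ s+s̄ b′ n′ k n′≡))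

          -- The exponents add up to a multiple of p - 1, so r^n times the power in `noise` is 1/r^J
          -- modulo p; this is the origin of r^k in the denominator.
          r-one : ∀ J → J ℕ.≤ d′ → (r Z.^ n₁ *ℤ r Z.^ exq J) *ℤ r Z.^ J Z.≡ 1ℤ mod 𝕡
          r-one J J≤ = Z.m≈ (trans (cong (_*ℤ r Z.^ J) (sym (Z.^-homo-* r n₁ (exq J)))) (trans (sym (Z.^-homo-* r (n₁ ℕ.+ exq J) J)) (trans (cong (r Z.^_) exps) (sym (Z.^-assocʳ r d w₀))))) (sym (Z.1^ w₀)) (Z.mpow w₀ (fermat-ℤ r p∤r))
            where
            w₀ = 2 ℕ.+ k ℕ.+ rep b′ ℕ.* n′
            exps : n₁ ℕ.+ exq J ℕ.+ J ≡ d ℕ.* w₀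
            exps = trans (lem₁ n₁ (suc s̄′) (d′ ∸ J) J) (trans (cong (λ z → n₁ ℕ.+ suc s̄′ ℕ.+ suc z) (ℕP.m∸n+n≡m J≤)) (trans (cong (λ z → z ℕ.+ suc s̄′ ℕ.+ d) (trans (cong (ℕ._* n′) (rep-geometric b′)) (cong (ℕ._+ rep b′ ℕ.* d ℕ.* n′) n′≡)))
              (trans (lem₂ s₁ (k) d (rep b′) n′ (suc s̄′)) (trans (cong (λ z → z ℕ.+ (k ℕ.+ rep b′ ℕ.* n′ ℕ.+ 1) ℕ.* d) s+s̄) (lem₃ d k (rep b′ ℕ.* n′))))))
              where
              lem₁ : ∀ n s e J → n ℕ.+ (s ℕ.+ suc e) ℕ.+ J ≡ n ℕ.+ s ℕ.+ suc (e ℕ.+ J)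
              lem₁ = ℕ-solve-∀
              lem₂ : ∀ s k d r n t → (s ℕ.+ k ℕ.* d) ℕ.+ r ℕ.* d ℕ.* n ℕ.+ t ℕ.+ d ≡ (s ℕ.+ t) ℕ.+ (k ℕ.+ r ℕ.* n ℕ.+ 1) ℕ.* d
              lem₂ = ℕ-solve-∀
              lem₃ : ∀ d k r → d ℕ.+ (k ℕ.+ r ℕ.+ 1) ℕ.* d ≡ d ℕ.* (2 ℕ.+ k ℕ.+ r)
              lem₃ = ℕ-solve-∀

          -- After multiplication by J r^J: J q_J is -p B_J modulo p^2, q₁ p becomes pn, and the
          -- powers of r matter modulo p only because q₁ q_J is a multiple of p^b.
          term : ∀ j → suc (suc j) ℕ.≤ d′ → int (+ 𝔮) ∙ int (q d (suc (suc j))) ∙ (int (+ hc (suc s₁) (suc (suc j))) ∙ int (r Z.^ n₁ *ℤ r Z.^ exq (suc (suc j))))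
            L.≡ ⊖ (π ∙ int (+ n₁) ∙ summand j) mod mod-b
          term j J≤ = unit-cancel-L (zr J) unit (L.m≈ (L.trans (L.*-congʳ (L.ι* (+ J) (r Z.^ J))) (L.trans (L.solve 6 (λ J r q z h x → (J L.:* r) L.:* (q L.:* z L.:* (h L.:* x)) L.:= q L.:* (J L.:* z) L.:* (h L.:* (x L.:* r))) L.refl (int (+ J)) (int (r Z.^ J)) (int (+ 𝔮)) (int (q d J)) hJ (int (r Z.^ n₁ *ℤ r Z.^ exq J))) (L.*-congˡ (L.*-congˡ (L.sym (L.ι* (r Z.^ n₁ *ℤ r Z.^ exq J) (r Z.^ J))))))) right
              (L.mtrans (L.m≈m (L.^-congʳ π (ℕP.+-comm b₁ 1)) (L.m^mul π b₁ 1 (int (+ 𝔮) ∙ (int (+ J) ∙ int (q d J))) small (L.m*ˡ hJ (int-mod^ 1 (Z.m^1⁻ 𝕡 (r-one J J≤))))))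
                (L.m*ʳ (hJ ∙ int 1ℤ) core)))
            where
            J = suc (suc j)
            hJ = int (+ hc (suc s₁) J)
            unit : ¬ (p ℕD.∣ ∣ zr J ∣)
            unit = zr-unit J (ℕ.z<s) (ℕ.s≤s (ℕP.m≤n⇒m≤1+n J≤))
            q𝔹 : int (+ J) ∙ int (q d J) L.≡ ⊖ (π ∙ 𝔹 J) mod (π L.^ 2)
            q𝔹 = q-𝔹 (suc j) (ℕ.s≤s J≤)
            small : int (+ 𝔮) ∙ (int (+ J) ∙ int (q d J)) L.≡ L.0# mod (π L.^ b₁)
            small = L.m≈m (L.^-congʳ π (ℕP.+-comm b′ 1)) (L.m^00 π b′ 1 𝔮≡0 (L.m0* (int (+ J)) (int-mod^ 1 (Z.m^1⁻ 𝕡 (q-mod-p (suc j) (ℕ.s≤s J≤))))))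
            core : int (+ 𝔮) ∙ (int (+ J) ∙ int (q d J)) L.≡ ⊖ (π ∙ int (+ n₁) ∙ 𝔹 J) mod mod-b
            core = L.mtrans (L.m≈m (L.^-congʳ π (ℕP.+-comm b′ 2)) (L.m^mul π b′ 2 (int (+ 𝔮)) 𝔮≡0 q𝔹))
              (L.m≈ (L.solve 3 (λ q p B → q L.:* (L.:- (p L.:* B)) L.:= L.:- ((q L.:* p) L.:* B)) L.refl (int (+ 𝔮)) π (𝔹 J)) L.refl (L.mneg (L.m*ʳ (𝔹 J) 𝔮π≡)))
            right : int (zr J) ∙ ⊖ (π ∙ int (+ n₁) ∙ summand j) L.≈ ⊖ (π ∙ int (+ n₁) ∙ 𝔹 J) ∙ (hJ ∙ int 1ℤ)
            right = L.trans (L.solve 5 (λ z N h B i → z L.:* (L.:- (N L.:* (h L.:* B L.:* i))) L.:= L.:- (N L.:* B) L.:* (h L.:* (i L.:* z))) L.refl (int (zr J)) (π ∙ int (+ n₁)) hJ (𝔹 J) (recip (zr J)))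
              (L.*-congˡ (L.*-congˡ (recip-* (zr J) unit)))

          -- For k ≥ p - s the coefficient binom(s + k, s) is a multiple of p, which shortens the
          -- range from k < p - 1 to k < p - s.
          tail : ∀ i → i ℕ.< s′ → π ∙ int (+ n₁) ∙ summand (s̄′ ℕ.+ i) L.≡ L.0# mod mod-b
          tail i i<s = L.m≈m (L.^-congʳ π (ℕP.+-comm b₁ 1)) (L.m^00 π b₁ 1 πn≡0 (L.m*0 (recip (zr J)) (L.m*0 (𝔹 J) (int-mod^ 1 (Z.m^1⁻ 𝕡 hc≡0)))))
            where
            J = suc (suc (s̄′ ℕ.+ i))
            J<p : J ℕ.< p
            J<p = ℕ.s≤s (ℕ.s≤s (ℕP.≤-trans (ℕP.+-monoʳ-< s̄′ i<s) (ℕP.≤-trans (ℕP.n≤1+n n₃) (ℕP.≤-reflexive (sym d′≡)))))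
            p≤ : p ℕ.≤ s₁ ℕ.+ J
            p≤ = ℕP.≤-trans (ℕP.≤-reflexive (cong suc (trans (sym s+s̄) refl))) (ℕP.≤-trans (ℕP.≤-reflexive (sym (ℕP.+-suc s₁ (suc s̄′)))) (ℕP.+-monoʳ-≤ s₁ (ℕ.s≤s (ℕ.s≤s (ℕP.m≤m+n s̄′ i)))))
            hc≡0 : + hc (suc s₁) J Z.≡ 0ℤ mod 𝕡
            hc≡0 = unit-cancel₁ (+ (s₁ !)) (+ hc (suc s₁) J) (!-unit s₁ s₁<p)
              (Z.m≈ (trans (ℤP.*-comm (+ (s₁ !)) (+ hc (suc s₁) J)) (trans (sym (ℤP.pos-* (hc (suc s₁) J) (s₁ !))) (cong +_ (hc-rf s₁ J)))) refl
                (∣⇒mod {p} {+ rf s₁ J} (rf-range s₁ J p J<p p≤)))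

          noise-L : int (sgn s₁ *ℤ (r Z.^ n₁ *ℤ (+ 𝔮 *ℤ noise₀ r p∤r s′ s̄′ s+s̄ b′ n′ k n′≡))) L.≡ int (+ (s₁ !)) ∙ ⊖ (π ∙ int (+ n₁) ∙ 𝕊) mod mod-b
          noise-L = L.mtrans (L.meq (L.trans (L.ι-cong rearrange) (L.trans (L.ι* (+ (s₁ !)) _) (L.*-congˡ (int-sum n₃ t)))))
            (L.m*ˡ (int (+ (s₁ !))) (L.mtrans (L.sum-mod n₃ (λ j j<n₃ → L.mtrans (L.meq (split j)) (term j (ℕP.≤-trans (ℕ.s≤s j<n₃) (ℕP.≤-reflexive (sym d′≡))))))
              (L.mtrans (L.meq (L.trans (L.sum-neg n₃ _) (L.-‿cong (L.sum-split s̄′ s′ (λ j → π ∙ int (+ n₁) ∙ summand j))))) (L.mneg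
                (L.mtrans (L.m+0 (L.sum s̄′ (λ j → π ∙ int (+ n₁) ∙ summand j)) (L.sum-0m s′ tail)) (L.meq (L.sum-* s̄′ (π ∙ int (+ n₁)) summand)))))))
            where
            t : ℕ → ℤ
            t j = (+ 𝔮 *ℤ q d (suc (suc j))) *ℤ (+ hc (suc s₁) (suc (suc j)) *ℤ (r Z.^ n₁ *ℤ r Z.^ exq (suc (suc j))))
            nt = noise-term r p∤r s′ s̄′ s+s̄ b′ n′ k n′≡
            rearrange : sgn s₁ *ℤ (r Z.^ n₁ *ℤ (+ 𝔮 *ℤ (sgn s₁ *ℤ + (s₁ !) *ℤ Z.sum n₃ nt))) ≡ + (s₁ !) *ℤ Z.sum n₃ t
            rearrange = trans (lem (sgn s₁) (r Z.^ n₁) (+ 𝔮) (+ (s₁ !)) (Z.sum n₃ nt)) (trans (cong (_*ℤ (+ (s₁ !) *ℤ ((+ 𝔮 *ℤ r Z.^ n₁) *ℤ Z.sum n₃ nt))) (sgn² s₁)) (trans (ℤP.*-identityˡ _) (cong (+ (s₁ !) *ℤ_)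
                (trans (sym (Z.sum-* n₃ (+ 𝔮 *ℤ r Z.^ n₁) nt)) (Z.sum-cong n₃ (λ j _ → lem₂ (+ 𝔮) (r Z.^ n₁) (q d (suc (suc j))) (+ hc (suc s₁) (suc (suc j))) (r Z.^ exq (suc (suc j)))))))))
              where
              lem : ∀ s r q f S → s *ℤ (r *ℤ (q *ℤ (s *ℤ f *ℤ S))) ≡ (s *ℤ s) *ℤ (f *ℤ ((q *ℤ r) *ℤ S))
              lem = solve-∀
              lem₂ : ∀ q r z h x → (q *ℤ r) *ℤ (z *ℤ (h *ℤ x)) ≡ (q *ℤ z) *ℤ (h *ℤ (r *ℤ x))
              lem₂ = solve-∀
            split : ∀ j → int (t j) ≐ int (+ 𝔮) ∙ int (q d (suc (suc j))) ∙ (int (+ hc (suc s₁) (suc (suc j))) ∙ int (r Z.^ n₁ *ℤ r Z.^ exq (suc (suc j))))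
            split j = L.trans (L.ι* (+ 𝔮 *ℤ q d (suc (suc j))) (+ hc (suc s₁) (suc (suc j)) *ℤ (r Z.^ n₁ *ℤ r Z.^ exq (suc (suc j)))))
              (L.*-cong (L.ι* (+ 𝔮) (q d (suc (suc j)))) (L.ι* (+ hc (suc s₁) (suc (suc j))) (r Z.^ n₁ *ℤ r Z.^ exq (suc (suc j)))))

          sgn-n : sgn n₁ ≡ sgn s₁
          sgn-n = trans (cong sgn (trans (cong (ℕ._* n′) (rep-geometric b′)) (trans (cong (ℕ._+ rep b′ ℕ.* d ℕ.* n′) n′≡) (lem s₁ k d (rep b′) n′)))) (trans (sgn-+ s₁ (d ℕ.* (k ℕ.+ rep b′ ℕ.* n′)))
              (trans (cong (sgn s₁ *ℤ_) (trans (sym (Z.^-assocʳ (-ℤ 1ℤ) d (k ℕ.+ rep b′ ℕ.* n′))) (trans (cong (Z._^ (k ℕ.+ rep b′ ℕ.* n′)) sgn-d) (Z.1^ (k ℕ.+ rep b′ ℕ.* n′))))) (ℤP.*-identityʳ (sgn s₁))))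
            where lem : ∀ s k d r n → (s ℕ.+ k ℕ.* d) ℕ.+ r ℕ.* d ℕ.* n ≡ s ℕ.+ d ℕ.* (k ℕ.+ r ℕ.* n)
                  lem = ℕ-solve-∀

        sgn-exponent : sgn (b′ ℕ.* n₁) ≡ sgn (s₁ ℕ.* b′)
        sgn-exponent = trans (cong sgn (ℕP.*-comm b′ n₁)) (trans (sym (Z.^-assocʳ (-ℤ 1ℤ) n₁ b′)) (trans (cong (Z._^ b′) sgn-n) (Z.^-assocʳ (-ℤ 1ℤ) s₁ b′)))

        private
          c₂ = int (+ (p ℕ.^ b₁ ℕ.* s₁))
          fact = int (+ (s₁ !))
          u-x u-y : ℤ₍ₚ₎
          u-x = int (+ s₁) ∙ int X₁
          u-y = int (+ n₁) ∙ int Y₁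

          numerator : int ((-ℤ r) Z.^ n₁ *ℤ Fe) ⊹ int V₀ L.≡ fact ∙ (⊖ u-x ⊹ u-y) L.- c₂ ∙ int (+ E s₁) ⊹ fact ∙ ⊖ (π ∙ int (+ n₁) ∙ 𝕊) mod mod-b
          numerator = L.mtrans (L.m+ʳ (int V₀) (L.mtrans (int-mod^ (suc b₁) (Z.m*ˡ ((-ℤ r) Z.^ n₁) (F-expansion r p∤r s′ s̄′ s+s̄ b′ n′ k n′≡))) (L.meq (L.trans (L.ι-cong expand) (L.ι+ A₁ A₂)))))
            (L.mtrans (L.meq (L.solve 3 (λ a b v → a L.:+ b L.:+ v L.:= (a L.:+ v) L.:+ b) L.refl (int A₁) (int A₂) (int V₀))) (L.m+ (L.mtrans (L.meq (L.sym (L.ι+ A₁ V₀))) (L.mtrans (int-mod^ (suc b₁) (main-part r p∤r s′ s̄′ s+s̄ b′ n′ k n′≡)) (L.meq to-L))) noise-L))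
            where
            A₁ = sgn s₁ *ℤ (r Z.^ n₁ *ℤ FN)
            noise′ = noise₀ r p∤r s′ s̄′ s+s̄ b′ n′ k n′≡
            A₂ = sgn s₁ *ℤ (r Z.^ n₁ *ℤ (+ 𝔮 *ℤ noise′))
            neg-r : (-ℤ r) Z.^ n₁ ≡ sgn s₁ *ℤ r Z.^ n₁
            neg-r = trans (cong (Z._^ n₁) (sym (ℤP.-1*i≡-i r))) (trans (Z.^-distrib-* (-ℤ 1ℤ) r n₁) (cong (_*ℤ r Z.^ n₁) sgn-n))
            expand : (-ℤ r) Z.^ n₁ *ℤ (FN +ℤ + 𝔮 *ℤ noise′) ≡ A₁ +ℤ A₂
            expand = trans (cong (_*ℤ (FN +ℤ + 𝔮 *ℤ noise′)) neg-r) (lem (sgn s₁) (r Z.^ n₁) FN (+ 𝔮 *ℤ noise′))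
              where lem : ∀ s r a b → (s *ℤ r) *ℤ (a +ℤ b) ≡ s *ℤ (r *ℤ a) +ℤ s *ℤ (r *ℤ b)
                    lem = solve-∀
            to-L : int (+ (s₁ !) *ℤ (-ℤ (+ s₁ *ℤ X₁) +ℤ + n₁ *ℤ Y₁) -ℤ + (p ℕ.^ b₁ ℕ.* s₁) *ℤ + E s₁) ≐ fact ∙ (⊖ u-x ⊹ u-y) L.- c₂ ∙ int (+ E s₁)
            to-L = L.trans (L.ι+ (+ (s₁ !) *ℤ (-ℤ (+ s₁ *ℤ X₁) +ℤ + n₁ *ℤ Y₁)) (-ℤ (+ (p ℕ.^ b₁ ℕ.* s₁) *ℤ + E s₁))) (L.+-cong
              (L.trans (L.ι* (+ (s₁ !)) (-ℤ (+ s₁ *ℤ X₁) +ℤ + n₁ *ℤ Y₁)) (L.*-congˡ (L.trans (L.ι+ (-ℤ (+ s₁ *ℤ X₁)) (+ n₁ *ℤ Y₁)) (L.+-cong (L.trans (L.ι- (+ s₁ *ℤ X₁)) (L.-‿cong (L.ι* (+ s₁) X₁))) (L.ι* (+ n₁) Y₁)))))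
              (L.trans (L.ι- (+ (p ℕ.^ b₁ ℕ.* s₁) *ℤ + E s₁)) (L.-‿cong (L.ι* (+ (p ℕ.^ b₁ ℕ.* s₁)) (+ E s₁)))))

        -- The harmonic number H_s, integral at p because s < p.
        ℍ : ℤ₍ₚ₎
        ℍ = int (+ E s₁) ∙ recip (+ (s₁ !))

        pB₀ : ℤ₍ₚ₎
        pB₀ = proj₁ (pB b′)

        private
          -- With d = p - 1, the sum d + dx - p + 1 is dx = -x + px, and px vanishes modulo p^(b+1).
          bernoulli-part : int (+ s₁) ∙ (pB₀ L.- π ⊹ L.1#) L.≡ ⊖ u-x mod mod-b
          bernoulli-part = L.mtrans (L.m*ˡ (int (+ s₁)) (L.m+ʳ L.1# (L.m+ʳ (⊖ π) (proj₂ (proj₂ (pB b′)))))) (L.mtrans (L.meq (L.trans (L.*-congˡ (L.+-congʳ (L.+-congˡ (L.-‿cong π≡1+d))))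
              (L.trans (L.solve 3 (λ s d x → s L.:* ((d L.:+ d L.:* x) L.:- (L.𝟙 L.:+ d) L.:+ L.𝟙) L.:= L.:- (s L.:* x) L.:+ s L.:* ((L.𝟙 L.:+ d) L.:* x)) L.refl (int (+ s₁)) (int (+ d)) (int X₁))
                (L.+-congˡ (L.*-congˡ (L.*-congʳ (L.sym π≡1+d)))))))
            (L.m+0 (⊖ u-x) (L.m0* (int (+ s₁)) (L.m^00 π 1 b₁ π≡0 (int-mod^ b₁ (x₀≡0 r p∤r s′ s̄′ s+s̄ b′ n′ k n′≡))))))
            where
            π≡1+d : π ≐ L.1# ⊹ int (+ d)
            π≡1+d = L.ιℕ-suc d

        LHS RHS : ℤ₍ₚ₎
        LHS = (int (-ℤ r) L.^ n₁ ∙ int Fe ⊹ int V₀) ∙ recip (+ (s₁ !))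
        RHS = int (+ s₁) ∙ (pB₀ L.- π ⊹ L.1#) L.- int (+ (p ℕ.^ b₁)) ∙ int (+ s₁) ∙ ℍ ⊹ int (+ n₁) ∙ (int r L.^ d L.- L.1#) L.- π ∙ int (+ n₁) ∙ 𝕊

        LHS≡RHS : LHS L.≡ RHS mod (π L.^ suc b₁)
        LHS≡RHS = L.mtrans (L.m*ʳ i (L.m≈ (L.+-congʳ (L.trans (L.*-congʳ (int-^ (-ℤ r) n₁)) (L.sym (L.ι* ((-ℤ r) Z.^ n₁) Fe)))) L.refl numerator))
          (L.mtrans (L.meq (L.trans (L.solve 6 (λ f a c e g i → (f L.:* a L.:- c L.:* e L.:+ f L.:* (L.:- g)) L.:* i L.:= (i L.:* f) L.:* (a L.:- g) L.:- c L.:* (e L.:* i)) L.refl fact (⊖ u-x ⊹ u-y) c₂ (int (+ E s₁)) (π ∙ int (+ n₁) ∙ 𝕊) i)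
              (L.trans (L.+-cong (L.trans (L.*-congʳ (recip-* (+ (s₁ !)) (!-unit s₁ s₁<p))) (L.*-identityˡ _)) (L.-‿cong (L.*-congʳ (L.trans (L.ιℕ* (p ℕ.^ b₁) s₁) L.refl))))
               (L.solve 4 (λ x y g c → ((x L.:+ y) L.:- g) L.:- c L.:= (x L.:- c) L.:+ y L.:- g) L.refl (⊖ u-x) u-y (π ∙ int (+ n₁) ∙ 𝕊) (int (+ (p ℕ.^ b₁)) ∙ int (+ s₁) ∙ ℍ)))))
            (L.m+ʳ (⊖ (π ∙ int (+ n₁) ∙ 𝕊)) (L.m+ (L.m+ʳ (⊖ (int (+ (p ℕ.^ b₁)) ∙ int (+ s₁) ∙ ℍ)) (L.msym bernoulli-part)) (L.meq (L.*-congˡ Y≐)))))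
          where
          i = recip (+ (s₁ !))
          Y≐ : int Y₁ ≐ int r L.^ d L.- L.1#
          Y≐ = L.trans (L.ι+ (r Z.^ d) (-ℤ 1ℤ)) (L.+-cong (L.sym (int-^ r d)) (L.ι- 1ℤ))

  -- Matching the p-adic congruence with the rational expressions of the theorem.

  module StatementSides where

    open import Defs
    open GenericAlgebra
    open ShiftOperators
    open FleckQuotients
    open StirlingSeries
    open PrimeUnits
    open SeriesValues
    open FactorialProducts
    open ResidueFilter
    open Localisation
    open BernoulliNumbers
    open BernoulliModPrimePowers
    open LocalAssembly
    open import Data.Nat using (_!; _∸_; _≤_; _<_) renaming (_*_ to _*ₙ_; _^_ to _^ₙ_; _+_ to _+ₙ_)
    open import Data.Nat.DivMod using (_/_; _%_; m*n/n≡m; m≡m%n+[m/n]*n; m%n<n; [m+kn]%n≡m%n; +-distrib-/-∣ʳ; m<n⇒m/n≡0)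
    open import Data.Nat.Combinatorics using (_C_; nCk≡nC[n∸k])
    open import Data.Integer using (ℤ; +_; 0ℤ; 1ℤ; ∣_∣) renaming (_+_ to _+ℤ_; _*_ to _*ℤ_; -_ to -ℤ_; _-_ to _-ℤ_)
    open import Data.Rational using (0ℚ; 1ℚ; _+_; _-_; _*_; -_)
    import Data.Rational.Properties as ℚP

    D-binomial : ∀ n g → D n g ≡ Z.sum (suc n) (λ k → + bin n k *ℤ (sgn k *ℤ g k))
    D-binomial zero g = lem (g 0)
      where lem : ∀ x → x ≡ 0ℤ +ℤ 1ℤ *ℤ (1ℤ *ℤ x)
            lem = solve-∀
    D-binomial (suc n) g = trans (cong₂ _-ℤ_ (D-binomial n g) (D-binomial n (λ k → g (suc k)))) (sym (trans (Z.sum-first (suc n) (λ k → + bin (suc n) k *ℤ (sgn k *ℤ g k)))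
      (trans (cong₂ _+ℤ_ (cong (λ z → + z *ℤ (1ℤ *ℤ g 0)) (sym (bin-0 n))) (trans (Z.sum-cong (suc n) (λ k _ → trans (cong (_*ℤ (sgn (suc k) *ℤ g (suc k))) (ℤP.pos-+ (bin n k) (bin n (suc k)))) (lem (+ bin n k) (+ bin n (suc k)) (sgn k) (g (suc k)))))
          (trans (Z.sum-+ (suc n) _ _) (cong₂ _+ℤ_ (Z.sum-neg (suc n) (λ k → + bin n k *ℤ (sgn k *ℤ g (suc k)))) (trans (cong (λ z → Z.sum n (λ k → + bin n (suc k) *ℤ (sgn (suc k) *ℤ g (suc k))) +ℤ + z *ℤ (sgn (suc n) *ℤ g (suc n))) (bin-> n (suc n) ℕP.≤-refl)) (ℤP.+-identityʳ _))))))
        (trans (lem₂ (+ bin n 0 *ℤ (1ℤ *ℤ g 0)) _ _) (cong (_-ℤ Z.sum (suc n) (λ k → + bin n k *ℤ (sgn k *ℤ g (suc k)))) (sym (Z.sum-first n (λ k → + bin n k *ℤ (sgn k *ℤ g k)))))))))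
      where
      lem : ∀ a b s x → (a +ℤ b) *ℤ ((-ℤ 1ℤ *ℤ s) *ℤ x) ≡ -ℤ (a *ℤ (s *ℤ x)) +ℤ b *ℤ ((-ℤ 1ℤ *ℤ s) *ℤ x)
      lem = solve-∀
      lem₂ : ∀ a b c → a +ℤ (-ℤ b +ℤ c) ≡ (a +ℤ c) -ℤ b
      lem₂ = solve-∀

    hc-bin : ∀ M τ → hc (suc M) τ ≡ bin (M +ₙ τ) τ
    hc-bin M zero = sym (bin-0 (M +ₙ 0))
    hc-bin zero (suc τ) = trans (hc-bin 0 τ) (sym (trans (cong (bin τ τ +ₙ_) (bin-> τ (suc τ) ℕP.≤-refl)) (ℕP.+-identityʳ (bin τ τ))))
    hc-bin (suc M) (suc τ) = trans (cong₂ _+ₙ_ (hc-bin M (suc τ)) (hc-bin (suc M) τ)) (trans (ℕP.+-comm (bin (M +ₙ suc τ) (suc τ)) (bin (suc M +ₙ τ) τ)) (cong (λ m → bin m τ +ₙ bin (M +ₙ suc τ) (suc τ)) (sym (ℕP.+-suc M τ))))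

    hc-C : ∀ M τ → hc (suc M) τ ≡ (M +ₙ τ) C M
    hc-C M τ = trans (hc-bin M τ) (trans (bin≡C (M +ₙ τ) τ) (sym (trans (nCk≡nC[n∸k] (ℕP.m≤m+n M τ)) (cong ((M +ₙ τ) C_) (ℕP.m+n∸m≡n M τ)))))

    ordAux-divides : ∀ f p m → p ^ₙ ordAux f p m ℕD.∣ m
    ordAux-divides zero p m = ℕD.1∣ m
    ordAux-divides (suc f) p m with p ∣? m
    ... | yes (ℕD.divides q refl) = subst (ℕD._∣ q *ₙ p) (ℕP.*-comm (p ^ₙ ordAux f p q) p) (ℕD.*-monoˡ-∣ p (ordAux-divides f p q))
    ... | no _ = ℕD.1∣ m

    ord-divides : ∀ p m b → b ≤ ord p m → p ^ₙ b ℕD.∣ m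
    ord-divides p m b b≤ = ℕD.∣-trans (subst (λ o → p ^ₙ b ℕD.∣ p ^ₙ o) (ℕP.m+[n∸m]≡n b≤) (subst (p ^ₙ b ℕD.∣_) (sym (ℕP.^-distribˡ-+-* p b (ord p m ∸ b))) (ℕD.m∣m*n (p ^ₙ (ord p m ∸ b))))) (ordAux-divides m p m)

    nStar≡ : ∀ d′ n s′ → n % suc d′ ≡ suc s′ → nStar (suc (suc d′)) n ≡ suc s′
    nStar≡ d′ n s′ eq with n % suc d′ | eq
    ... | .(suc s′) | refl = refl

    module Values where
      open Localised public hiding (H)

      Cp≡cc : ∀ n r → Cp p n r ≡ ℤ→ℚ (cc n r)
      Cp≡cc n r = trans (sumFrom≡ 0 (suc n) _) (trans (Q.sum-cong (suc n) (λ k _ → body k (p ∣? ∣ + k -ℤ r ∣))) (trans (ℤ→ℚ-sum (suc n) _)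
        (cong ℤ→ℚ (sym (trans (D-δ^ n c₀ r) (D-binomial n (λ k → c₀ (r -ℤ + k))))))))
        where
        ℤ→ℚ-sum : ∀ n f → Q.sum n (λ k → ℤ→ℚ (f k)) ≡ ℤ→ℚ (Z.sum n f)
        ℤ→ℚ-sum zero f = refl
        ℤ→ℚ-sum (suc n) f = trans (cong (_+ ℤ→ℚ (f n)) (ℤ→ℚ-sum n f)) (sym (ℤ→ℚ-+ (Z.sum n f) (f n)))
        body : ∀ k → Dec (p ℕD.∣ ∣ + k -ℤ r ∣) → (if does (p ∣? ∣ + k -ℤ r ∣) then ℕ→ℚ (n C k) * ((- 1ℚ) ^ℚ k) else 0ℚ) ≡ ℤ→ℚ (+ bin n k *ℤ (sgn k *ℤ c₀ (r -ℤ + k)))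
        body k (yes p∣) = trans (if-yes (p ∣? ∣ + k -ℤ r ∣) p∣) (trans (cong₂ _*_ (cong ℕ→ℚ (sym (bin≡C n k))) (ℤ→ℚ-^ (-ℤ 1ℤ) k)) (trans (sym (ℤ→ℚ-* (+ bin n k) (sgn k)))
          (cong (λ z → ℤ→ℚ (+ bin n k *ℤ z)) (sym (trans (cong (sgn k *ℤ_) (c₀-yes (r -ℤ + k) (∣⇒mod {p} {r -ℤ + k} (subst (p ℕD.∣_) (ℤP.∣i-j∣≡∣j-i∣ (+ k) r) p∣)))) (ℤP.*-identityʳ (sgn k)))))))
        body k (no p∤) = trans (if-no (p ∣? ∣ + k -ℤ r ∣) p∤) (cong ℤ→ℚ (sym (trans (cong (λ z → + bin n k *ℤ (sgn k *ℤ z)) (c₀-no (r -ℤ + k) (λ m → p∤ (subst (p ℕD.∣_) (ℤP.∣i-j∣≡∣j-i∣ r (+ k)) (mod⇒∣ {p} {r -ℤ + k} m)))))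
          (trans (cong (+ bin n k *ℤ_) (ℤP.*-zeroʳ (sgn k))) (ℤP.*-zeroʳ (+ bin n k))))))

      -- From N - 1 = (s - 1) + e(p-1) with s - 1 < p - 1, the floor in the definition of F_p is e.
      Fp≡F : ∀ s′ e r → suc s′ < d → ∀ N → N ≡ suc s′ +ₙ e *ₙ d → Fp p N r ≡ ℤ→ℚ (F s′ e r)
      Fp≡F s′ e r s<d (suc m) N≡ = trans (cong₂ (λ a b → inv a * b) denominator≡ (trans (Cp≡cc (suc m) r) (trans (cong ℤ→ℚ (trans (cong (λ n → cc n r) N≡) (cc≡F s′ e r))) (ℤ→ℚ-* ((-ℤ 𝕡) Z.^ e) (F s′ e r)))))
        (trans (sym (ℚP.*-assoc (inv D₀) D₀ (ℤ→ℚ (F s′ e r)))) (trans (cong (_* ℤ→ℚ (F s′ e r)) (inv-* D₀ (pow≢0 e))) (ℚP.*-identityˡ (ℤ→ℚ (F s′ e r)))))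
        where
        D₀ = ℤ→ℚ ((-ℤ 𝕡) Z.^ e)
        e≡ : m / d ≡ e
        e≡ = trans (cong (_/ d) (ℕP.suc-injective N≡)) (trans (+-distrib-/-∣ʳ s′ (ℕD.n∣m*n e)) (trans (cong₂ _+ₙ_ (m<n⇒m/n≡0 (ℕP.<-trans ℕP.≤-refl s<d)) (m*n/n≡m e d)) refl))
        denominator≡ : (- ℕ→ℚ p) ^ℚ divT m (p ∸ 1) ≡ D₀
        denominator≡ = trans (cong₂ _^ℚ_ (sym (ℤ→ℚ-neg 𝕡)) e≡) (ℤ→ℚ-^ (-ℤ 𝕡) e)
        pow≢0 : ∀ e → ℤ→ℚ ((-ℤ 𝕡) Z.^ e) ≢ 0ℚ
        pow≢0 zero = 1≢0
        pow≢0 (suc e) z = ℚ-*-≢0 (ℤ→ℚ-≢0 (-ℤ 𝕡) λ ()) (pow≢0 e) (trans (sym (ℤ→ℚ-* (-ℤ 𝕡) ((-ℤ 𝕡) Z.^ e))) z)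

      E-harmonic : ∀ a → a < p → ℕ→ℚ (E a) ≡ ℕ→ℚ (a !) * Q.sum a (λ k → inv (ℕ→ℚ (suc k)))
      E-harmonic zero _ = refl
      E-harmonic (suc a) a<p = trans (cong ℕ→ℚ (trans (E-suc (small-unit (suc a) (ℕ.z<s) a<p)) (cong (E a *ₙ suc a +ₙ_) (V-small a (ℕP.<-trans ℕP.≤-refl a<p)))))
        (trans (Q.ιℕ+ (E a *ₙ suc a) (a !)) (trans (cong (_+ ℕ→ℚ (a !)) (trans (Q.ιℕ* (E a) (suc a)) (cong (_* ℕ→ℚ (suc a)) (E-harmonic a (ℕP.<-trans ℕP.≤-refl a<p)))))
          (trans (cong (λ z → ℕ→ℚ (a !) * S₀ * ℕ→ℚ (suc a) + z) (sym (trans (cong (_* ℕ→ℚ (a !)) (inv-* (ℕ→ℚ (suc a)) (ℕ→ℚ-suc≢0 a))) (ℚP.*-identityˡ (ℕ→ℚ (a !))))))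
            (trans (Q.solve 4 (λ f s n i → f Q.:* s Q.:* n Q.:+ (i Q.:* n) Q.:* f Q.:= (n Q.:* f) Q.:* (s Q.:+ i)) refl (ℕ→ℚ (a !)) S₀ (ℕ→ℚ (suc a)) (inv (ℕ→ℚ (suc a))))
              (cong (_* (S₀ + inv (ℕ→ℚ (suc a)))) (sym (Q.ιℕ* (suc a) (a !))))))))
        where S₀ = Q.sum a (λ k → inv (ℕ→ℚ (suc k)))

      Statement : ℕ → ℕ → ℤ → ℕ → Set
      Statement n σ r b = CongModPow p (suc b)
        ((((ℤ→ℚ (-ℤ r)) ^ℚ n) * Fp p (p *ₙ n) r
            + ((- 1ℚ) ^ℚ ((b ∸ 1) *ₙ n))
              * ℕ→ℚ (prodCoprimeTo p (divT ((p ^ₙ b) ∸ 1) (p ∸ 1) *ₙ σ)))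
          * inv (ℕ→ℚ (σ !)))
        (ℕ→ℚ σ * (ℕ→ℚ p * B (φ (p ^ₙ b)) - ℕ→ℚ p + 1ℚ)
          - ℕ→ℚ (p ^ₙ b) * ℕ→ℚ σ * H σ
          + ℕ→ℚ n * ((ℤ→ℚ r) ^ℚ (p ∸ 1) - 1ℚ)
          - ℕ→ℚ p * ℕ→ℚ n
            * sumRange 2 (p ∸ σ ∸ 1)
                (λ k → ℕ→ℚ (((σ +ₙ k) C σ))
                  * B k * inv (ℕ→ℚ k * (ℤ→ℚ r) ^ℚ k)))

      module _ (r : ℤ) (p∤r : ¬ (r Z.≡ 0ℤ mod 𝕡)) (s′ s̄′ : ℕ) (s+s̄ : suc s′ +ₙ suc s̄′ ≡ d) (b′ n′ k : ℕ) (n′≡ : n′ ≡ suc s′ +ₙ k *ₙ d) where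
        private
          σ = suc s′
          b₃ = suc b′
          n₄ = p ^ₙ b′ *ₙ n′
          σ<d : σ < d
          σ<d = s<d r p∤r s′ s̄′ s+s̄ b′ n′ k n′≡
          σ<p : σ < p
          σ<p = s<p r p∤r s′ s̄′ s+s̄ b′ n′ k n′≡
          eₙ = e₀ r p∤r s′ s̄′ s+s̄ b′ n′ k n′≡

          val-LHS : val (LHS r p∤r s′ s̄′ s+s̄ b′ n′ k n′≡) ≡
            (((ℤ→ℚ (-ℤ r)) ^ℚ n₄) * Fp p (p *ₙ n₄) r + ((- 1ℚ) ^ℚ (b′ *ₙ n₄)) * ℕ→ℚ (prodCoprimeTo p (divT ((p ^ₙ b₃) ∸ 1) (p ∸ 1) *ₙ σ))) * inv (ℕ→ℚ (σ !))
          val-LHS = cong₂ _*_ (cong₂ _+_ (cong₂ _*_ (val-^ (int (-ℤ r)) n₄) (sym (Fp≡F s′ eₙ r σ<d (p *ₙ n₄) (pn≡ r p∤r s′ s̄′ s+s̄ b′ n′ k n′≡)))) prod) (val-recip (+ (σ !)) (!-unit σ σ<p))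
            where
            index : σ *ₙ rep b₃ ≡ divT ((p ^ₙ b₃) ∸ 1) (p ∸ 1) *ₙ σ
            index = trans (ℕP.*-comm σ (rep b₃)) (cong (_*ₙ σ) (sym (trans (cong (λ z → (z ∸ 1) / d) (rep-geometric b₃)) (m*n/n≡m (rep b₃) d))))
            prod : ℤ→ℚ (v₀ r p∤r s′ s̄′ s+s̄ b′ n′ k n′≡) ≡ ((- 1ℚ) ^ℚ (b′ *ₙ n₄)) * ℕ→ℚ (prodCoprimeTo p (divT ((p ^ₙ b₃) ∸ 1) (p ∸ 1) *ₙ σ))
            prod = trans (ℤ→ℚ-* (sgn (σ *ₙ b′)) (+ V (σ *ₙ rep b₃))) (cong₂ _*_ (trans (cong ℤ→ℚ (sym (sgn-exponent r p∤r s′ s̄′ s+s̄ b′ n′ k n′≡))) (sym (ℤ→ℚ-^ (-ℤ 1ℤ) (b′ *ₙ n₄)))) (cong (λ z → ℕ→ℚ (V z)) index))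

          val-ℍ : val (ℍ r p∤r s′ s̄′ s+s̄ b′ n′ k n′≡) ≡ H σ
          val-ℍ = trans (cong₂ _*_ (E-harmonic σ σ<p) (val-recip (+ (σ !)) (!-unit σ σ<p))) (trans (Q.solve 3 (λ f s i → (f Q.:* s) Q.:* i Q.:= (i Q.:* f) Q.:* s) refl (ℕ→ℚ (σ !)) S₀ (inv (ℕ→ℚ (σ !))))
            (trans (cong (_* S₀) (inv-* (ℕ→ℚ (σ !)) (ℤ→ℚ-≢0 (+ (σ !)) (λ z → contradiction (ℤP.+-injective z) (ℕ.≢-nonZero⁻¹ (σ !) {{σ ℕP.!≢0}}))))) (trans (ℚP.*-identityˡ S₀) (sym (sumFrom≡ 1 σ (λ k → inv (ℕ→ℚ k)))))))
            where S₀ = Q.sum σ (λ k → inv (ℕ→ℚ (suc k)))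

          val-𝕊 : val (𝕊 r p∤r s′ s̄′ s+s̄ b′ n′ k n′≡) ≡ sumRange 2 (p ∸ σ ∸ 1) (λ k → ℕ→ℚ (((σ +ₙ k) C σ)) * B k * inv (ℕ→ℚ k * (ℤ→ℚ r) ^ℚ k))
          val-𝕊 = trans (val-sum s̄′ _) (trans (Q.sum-cong s̄′ (λ i i<s̄′ → cong₂ _*_ (cong₂ _*_ (cong ℕ→ℚ (hc-C σ (suc (suc i)))) (val-𝔹 (suc (suc i)) (J<d i i<s̄′)))
              (trans (val-recip (zr r p∤r s′ s̄′ s+s̄ b′ n′ k n′≡ (suc (suc i))) (zr-unit r p∤r s′ s̄′ s+s̄ b′ n′ k n′≡ (suc (suc i)) (ℕ.z<s) (ℕP.m<n⇒m<1+n (J<d i i<s̄′))))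
                (cong inv (trans (ℤ→ℚ-* (+ suc (suc i)) (r Z.^ suc (suc i))) (cong (ℕ→ℚ (suc (suc i)) *_) (sym (ℤ→ℚ-^ r (suc (suc i))))))))))
            (trans (sym (sumFrom≡ 2 s̄′ (λ k → ℕ→ℚ (((σ +ₙ k) C σ)) * B k * inv (ℕ→ℚ k * (ℤ→ℚ r) ^ℚ k)))) (cong (λ m → sumFrom 2 (suc m ∸ 2) (λ k → ℕ→ℚ (((σ +ₙ k) C σ)) * B k * inv (ℕ→ℚ k * (ℤ→ℚ r) ^ℚ k))) (sym range))))
            where
            J<d : ∀ i → i < s̄′ → suc (suc i) < d
            J<d i i<s̄′ = ℕP.≤-trans (ℕ.s≤s (ℕ.s≤s i<s̄′)) (ℕP.≤-trans (ℕ.s≤s (ℕP.m≤n+m (suc s̄′) s′)) (ℕP.≤-reflexive s+s̄))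
            range : p ∸ σ ∸ 1 ≡ suc s̄′
            range = trans (ℕP.∸-+-assoc p σ 1) (trans (cong₂ _∸_ (cong suc (sym s+s̄)) (ℕP.+-comm σ 1)) (ℕP.m+n∸m≡n (suc σ) (suc s̄′)))

          val-RHS : val (RHS r p∤r s′ s̄′ s+s̄ b′ n′ k n′≡) ≡
            ℕ→ℚ σ * (ℕ→ℚ p * B (φ (p ^ₙ b₃)) - ℕ→ℚ p + 1ℚ) - ℕ→ℚ (p ^ₙ b₃) * ℕ→ℚ σ * H σ + ℕ→ℚ n₄ * ((ℤ→ℚ r) ^ℚ (p ∸ 1) - 1ℚ)
              - ℕ→ℚ p * ℕ→ℚ n₄ * sumRange 2 (p ∸ σ ∸ 1) (λ k → ℕ→ℚ (((σ +ₙ k) C σ)) * B k * inv (ℕ→ℚ k * (ℤ→ℚ r) ^ℚ k))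
          val-RHS = cong₂ _-_ (cong₂ _+_ (cong₂ _-_ (cong (λ z → ℕ→ℚ σ * (z - ℕ→ℚ p + 1ℚ)) (trans (proj₁ (proj₂ (pB b′))) (cong (λ m → ℕ→ℚ p * B m) (sym (φ-p^ b′))))) (cong (ℕ→ℚ (p ^ₙ b₃) * ℕ→ℚ σ *_) val-ℍ))
              (cong (λ z → ℕ→ℚ n₄ * (z - 1ℚ)) (val-^ (int r) d))) (cong (ℕ→ℚ p * ℕ→ℚ n₄ *_) val-𝕊)

        statement : Statement n₄ σ r b₃
        statement = subst₂ (CongModPow p (suc b₃)) val-LHS val-RHS (congruence (suc b₃) (LHS≡RHS r p∤r s′ s̄′ s+s̄ b′ n′ k n′≡))

      residue-pos : ∀ n → ¬ (d ℕD.∣ n) → ∃ λ s′ → n % d ≡ suc s′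
      residue-pos n d∤n = go (n % d) refl
        where go : ∀ m → n % d ≡ m → ∃ λ s′ → n % d ≡ suc s′
              go zero e = contradiction (ℕD.m%n≡0⇒n∣m n d e) d∤n
              go (suc s′) e = s′ , e

      general : ∀ n r → ¬ (d ℕD.∣ n) → ¬ (p ℕD.∣ ∣ r ∣) → ∀ b → 1 ≤ b → b ≤ ord p (p *ₙ n) → Statement n (nStar p n) r b
      -- The bound on b gives p^b | pn, hence n = p^(b-1) n′, where n′ may again be divisible by p.
      general n r d∤n p∤r (suc b′) _ b≤ = go (ℕD.*-cancelˡ-∣ p (ord-divides p (p *ₙ n) (suc b′) b≤))
        where
        go : p ^ₙ b′ ℕD.∣ n → Statement n (nStar p n) r (suc b′)
        go (ℕD.divides n′ eq) = subst (λ σ → Statement n σ r (suc b′)) (sym (nStar≡ d′ n s′ n%d)) (subst (λ n → Statement n (suc s′) r (suc b′)) (sym n≡)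
            (statement r (λ m → p∤r (mod⇒∣ {p} {r} m)) s′ s̄′ s+s̄ b′ n′ (n′ / d) (trans (m≡m%n+[m/n]*n n′ d) (cong (_+ₙ (n′ / d) *ₙ d) n′%d))))
          where
          n≡ : n ≡ p ^ₙ b′ *ₙ n′
          n≡ = trans eq (ℕP.*-comm n′ (p ^ₙ b′))
          s′ = proj₁ (residue-pos n d∤n)
          n%d : n % d ≡ suc s′
          n%d = proj₂ (residue-pos n d∤n)
          s̄′ = d ∸ suc (suc s′)
          s+s̄ : suc s′ +ₙ suc s̄′ ≡ d
          s+s̄ = trans (ℕP.+-suc (suc s′) s̄′) (ℕP.m+[n∸m]≡n (subst (_< d) n%d (m%n<n n d)))
          n′%d : n′ % d ≡ suc s′
          -- p^(b-1) is 1 modulo p - 1, so n and n′ have the same residue.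
          n′%d = trans (sym ([m+kn]%n≡m%n n′ (rep b′ *ₙ n′) d)) (trans (cong (_% d) (sym (trans n≡ (trans (cong (_*ₙ n′) (rep-geometric b′)) (cong (n′ +ₙ_) (lem (rep b′) d n′)))))) n%d)
            where lem : ∀ r d n → r *ₙ d *ₙ n ≡ r *ₙ n *ₙ d
                  lem = ℕ-solve-∀

open import Defs
open import Data.Nat using (ℕ; suc; _∸_; _≤_; _<_; _!) renaming (_*_ to _*ₙ_; _^_ to _^ₙ_; _+_ to _+ₙ_)
open import Data.Nat.Combinatorics using (_C_)
open import Data.Nat.Primality using (Prime; ¬prime[0]; ¬prime[1])
open import Data.Nat.Divisibility using (_∣_)
open import Data.Integer using (ℤ; +_) renaming (-_ to -ℤ_)
open import Data.Integer.Divisibility renaming (_∣_ to _∣ℤ_)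
open import Data.Rational using (ℚ; 1ℚ; _+_; _-_; _*_; -_)
open import Relation.Nullary using (¬_; contradiction)

theorem1p3 : (p : ℕ) → Prime p → p ≢ 2 →
    (n : ℕ) → 0 < n → (r : ℤ) →
    ¬ ((p ∸ 1) ∣ n) → ¬ ((+ p) ∣ℤ r) →
    (b : ℕ) → 1 ≤ b → b ≤ ord p (p *ₙ n) →
    CongModPow p (suc b)
    ((((ℤ→ℚ (-ℤ r)) ^ℚ n) * Fp p (p *ₙ n) r
    + ((- 1ℚ) ^ℚ ((b ∸ 1) *ₙ n))
    * ℕ→ℚ (prodCoprimeTo p (divT ((p ^ₙ b) ∸ 1) (p ∸ 1) *ₙ nStar p n)))
    * inv (ℕ→ℚ (nStar p n !)))
    (ℕ→ℚ (nStar p n) * (ℕ→ℚ p * B (φ (p ^ₙ b)) - ℕ→ℚ p + 1ℚ)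
    - ℕ→ℚ (p ^ₙ b) * ℕ→ℚ (nStar p n) * H (nStar p n)
    + ℕ→ℚ n * ((ℤ→ℚ r) ^ℚ (p ∸ 1) - 1ℚ)
    - ℕ→ℚ p * ℕ→ℚ n
    * sumRange 2 (p ∸ nStar p n ∸ 1)
    (λ k → ℕ→ℚ (((nStar p n +ₙ k) C nStar p n))
    * B k * inv (ℕ→ℚ k * (ℤ→ℚ r) ^ℚ k)))
theorem1p3 zero pr = contradiction pr ¬prime[0]
theorem1p3 (suc zero) pr = contradiction pr ¬prime[1]
theorem1p3 (suc (suc d′)) pr p≢2 n 0<n r d∤n p∤r b 1≤b b≤ with PrimeUnits.prime-odd d′ pr p≢2
... | h , d≡h+h = OddPrime.StatementSides.Values.general d′ h pr d≡h+h n r d∤n p∤r b 1≤b b≤
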